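{- Let $r_1,r_2,s_1,s_2\ge 0$ be integers with $r:=r_1+2r_2\ge 1$ and $s:=s_1+2s_2\ge 1$, and put $n=r+s$. Consider cluster-tilted algebras of type $\tilde A_{n-1}$ over an algebraically closed field $K$, up to isomorphism. The number of such algebras in the derived equivalence class with parameters $(r_1,r_2,s_1,s_2)$ (equivalently, the number of quivers in $\mathcal{Q}_{n-1}$ having a realization with parameters $(r_1,r_2,s_1,s_2)$) equals $$\sum_{k|r,\,k|r_2,\,k|s,\,k|s_2}\frac{\phi(k)}k(-1)^{(r+r_2+s+s_2)/k}\sum_{\substack{i,j\geq0\\ (i,j)\neq(0,0)}}\frac{(-1)^{i+j}}{2(i+j)}\binom{2i}{i,\,2i-r/k,\,r_2/k,\,(r-r_2)/k-i}\binom{2j}{j,\,2j-s/k,\,s_2/k,\,(s-s_2)/k-j}$$ if $r_1\neq s_1$ or $r_2\neq s_2$, and equals $$2^{r-2r_2-2}\binom{r}{r_2,\,r_2,\,r-2r_2}+\sum_{\substack{k|r,\,k|r_2\\ i,j\geq0,\ (i,j)\neq(0,0)}}\frac{\phi(k)}k\frac{(-1)^{i+j}}{4(i+j)}\binom{2i}{i,\,2i-r/k,\,r_2/k,\,(r-r_2)/k-i}\binom{2j}{j,\,2j-r/k,\,r_2/k,\,(r-r_2)/k-j}$$ if $r_1=s_1$ and $r_2=s_2$. Moreover, for integers $r,s\ge1$, the number $\tilde a(r,s)$ of quivers mutation equivalent to a non-oriented $(r+s)$-cycle with $r$ arrows oriented in one direction and $s$ arrows in the other is $$\tilde a(r,s)=\begin{cases}\frac12\sum_{k|r,\,k|s}\frac{\phi(k)}{r+s}\binom{2r/k}{r/k}\binom{2s/k}{s/k}&\text{if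 } r\neq s,\\[4pt] \frac12\Big(\frac12\binom{2r}{r}+\sum_{k|r}\frac{\phi(k)}{4r}\binom{2r/k}{r/k}^2\Big)&\text{if } r=s.\end{cases}$$
   Context: $\phi$ is Euler's totient function: $\phi(k)$ is the number of $1\le d\le k$ with $\gcd(d,k)=1$. Multinomial coefficients $\binom{m}{a_1,\dots,a_t}$ with $a_1+\dots+a_t=m$ equal $m!/(a_1!\cdots a_t!)$ when all $a_i\ge0$ and are $0$ if some $a_i<0$; in the sums, $k$ runs over positive integers. All quivers are finite, connected, without loops and without oriented 2-cycles, considered up to isomorphism. A rooted quiver of type $A$ is a quiver with a distinguished vertex (the root), defined recursively as one of: (i) a single vertex, which is the root; (ii) a root $\rho$, a rooted quiver of type $A$ with root $v\neq\rho$, and one arrow between $\rho$ and $v$ (either direction); (iii) a root $\rho$, an oriented 3-cycle $\rho\to u\to w\to\rho$, and two (vertex-disjoint) rooted quivers of type $A$ with roots $u$ and $w$. For $n\ge2$, $\mathcal{Q}_{n-1}$ is the class of quivers with $n$ vertices such that: (1) there is exactly one full subquiver which is a non-oriented cycle (underlying graph a cycle, arrows not all oriented the same way) of length $\ge2$ (length 2 means a double arrow); its arrows are called base arrows; (2) for each base arrow $\alpha:x\to y$ there may or may not be a vertex $z_\alpha$ not on the cycle with arrows $y\to z_\alpha\to x$ (an oriented 3-cycle; for a double arrow only one of the two arrows is regarded as part of such a 3-cycle), and apart from these there are no other arrows incident to vertices on the cycle; (3) removing the cycle vertices and their incident arrows yields a disjoint union of rooted quivers of type $A$, one with root $z_\alpha$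 for each existing $z_\alpha$, said to be attached to $\alpha$. It is known that $\mathcal{Q}_{n-1}$ is exactly the set of quivers mutation equivalent to a non-oriented $n$-cycle (quivers of type $\tilde A_{n-1}$). A realization of $Q\in\mathcal{Q}_{n-1}$ is $Q$ together with an embedding of its non-oriented cycle into the plane (i.e. a choice of which cyclic direction is clockwise); realizations are identified if an isomorphism of quivers maps one to the other preserving the clockwise direction, so a quiver has one or two realizations. For a realization, $r_1$ is the number of arrows lying in no oriented 3-cycle that are either anti-clockwise base arrows or arrows in a rooted quiver of type $A$ attached to an anti-clockwise base arrow; $r_2$ is the number of oriented 3-cycles that either contain an anti-clockwise base arrow or lie in a rooted quiver of type $A$ attached to an anti-clockwise base arrow; $s_1,s_2$ are defined likewise with "clockwise". Then $r_1+2r_2+s_1+2s_2=n$. Known facts (setting): every cluster-tilted algebra of type $\tilde A_{n-1}$ over $K$ is isomorphic to $KQ/I$ for a quiver $Q\in\mathcal{Q}_{n-1}$, and is determined up to isomorphism by its quiver; two such algebras are derived equivalent iff their quivers have realizations with the same parameters $(r_1,r_2,s_1,s_2)$, up to interchanging $(r_1,r_2)$ with $(s_1,s_2)$. Two quivers in $\mathcal{Q}_{n-1}$ are mutation equivalent iff they have realizations with the same $(r_1+2r_2,\,s_1+2s_2)$ up to swapping. -}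

module Defs where

open import Data.Bool using (Bool; true; false; if_then_else_)
open import Data.Maybe using (Maybe; just; nothing)
open import Data.Empty using (⊥)
open import Data.Unit using (⊤; tt)
open import Data.Sum using (_⊎_; inj₁; inj₂)
open import Data.Product using (Σ; _×_; _,_; proj₁; proj₂; ∃-syntax)
open import Data.Nat as ℕ using (ℕ; zero; suc; _∸_; _≟_; _<?_; NonZero)
open import Data.Nat.DivMod using (_mod_)
open import Data.Nat.Divisibility using (_∣?_)
open import Data.Nat.GCD using (gcd)
open import Data.Nat.Combinatorics using (_C_)
open import Data.Integer as ℤ using (ℤ; +_; -[1+_])
open import Data.Rational as ℚ using (ℚ; 0ℚ; 1ℚ)
open import Data.Fin using (Fin; toℕ)
open import Data.List using (List; []; _∷_; map; filter; length; upTo; allFin; concatMap; foldr; _++_; all)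
open import Data.List.Relation.Unary.All using (All)
open import Data.List.Relation.Unary.Any using (Any)
open import Data.List.Relation.Unary.AllPairs using (AllPairs)
open import Data.List.Relation.Binary.Permutation.Propositional using (_↭_)
open import Data.Fin.Permutation using (Permutation′; _⟨$⟩ʳ_)
open import Function.Bundles using (_↔_; Inverse)
open import Relation.Binary.PropositionalEquality using (_≡_; _≢_)
open import Relation.Binary.Construct.Closure.ReflexiveTransitive using (Star)
open import Relation.Nullary using (¬_; yes; no)
open import Relation.Nullary.Decidable using (⌊_⌋; _×-dec_)

NumClasses : {A : Set} → (P : A → Set) → (_≈_ : A → A → Set) → ℚ → Set
NumClasses {A} P _≈_ q =
  Σ (List A) λ L →
    All P L × AllPairs (λ x y → ¬ (x ≈ y)) L ×
    (∀ x → P x → Any (λ y → x ≈ y) L) ×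
    ((+ length L) ℚ./ 1 ≡ q)

record Quiver : Set₁ where
  field
    V   : Set
    arr : List (V × V)      -- arrows (source , target), with multiplicity
open Quiver public

mapArr : {V W : Set} → (V → W) → List (V × V) → List (W × W)
mapArr f = map (λ (a , b) → (f a , f b))

QIso : Quiver → Quiver → Set
QIso Q Q' = Σ (V Q ↔ V Q') λ f → mapArr (Inverse.to f) (arr Q) ↭ arr Q'

nextFin : ∀ {n} → Fin n → Fin n
nextFin {suc m} i = suc (toℕ i) mod suc m

data RA : Set where
  single : RA
  ext    : Bool → RA → RA          -- (ii) new root ρ, arrow ρ→v (true) or v→ρ (false)
  tri    : RA → RA → RA            -- (iii) new root ρ, 3-cycle ρ→u→w→ρ, u,w roots of the two parts

VA : RA → Set
VA single     = ⊤
VA (ext _ t)  = Maybe (VA t)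
VA (tri t u)  = Maybe (VA t ⊎ VA u)

root : (t : RA) → VA t
root single    = tt
root (ext _ t) = nothing
root (tri t u) = nothing

arrA : (t : RA) → List (VA t × VA t)
arrA single        = []
arrA (ext true t)  = (nothing , just (root t)) ∷ mapArr just (arrA t)
arrA (ext false t) = (just (root t) , nothing) ∷ mapArr just (arrA t)
arrA (tri t u)     =
  (nothing , just (inj₁ (root t))) ∷ (just (inj₁ (root t)) , just (inj₂ (root u))) ∷
  (just (inj₂ (root u)) , nothing) ∷
  (mapArr (λ v → just (inj₁ v)) (arrA t) ++ mapArr (λ v → just (inj₂ v)) (arrA u))

-- number of arrows lying in no oriented 3-cycle, and number of oriented 3-cycles
nonTriA : RA → ℕ
nonTriA single    = 0
nonTriA (ext _ t) = suc (nonTriA t)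
nonTriA (tri t u) = nonTriA t ℕ.+ nonTriA u

trisA : RA → ℕ
trisA single    = 0
trisA (ext _ t) = trisA t
trisA (tri t u) = suc (trisA t ℕ.+ trisA u)

-- Cycle vertices c_0,…,c_{m-1} (m = k+2 ≥ 2) in clockwise order; base arrow i
-- joins c_i and c_{i+1 mod m}; ori i = true means c_i → c_{i+1} (clockwise),
-- false means c_{i+1} → c_i (anti-clockwise).  att i = just t means a vertex
-- z_i with y → z_i → x (x → y the base arrow), z_i the root of the attached
-- rooted quiver t of type A.
record Real : Set where
  field
    k     : ℕ
    ori   : Fin (suc (suc k)) → Bool
    nonOr : Σ (Fin (suc (suc k))) λ i → Σ (Fin (suc (suc k))) λ j → ori i ≢ ori j
    att   : Fin (suc (suc k)) → Maybe RA

AV : Maybe RA → Set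
AV nothing  = ⊥
AV (just t) = VA t

attArrows : {W : Set} → W → W → (a : Maybe RA) → (AV a → W) → List (W × W)
attArrows x y nothing  e = []
attArrows x y (just t) e = (y , e (root t)) ∷ (e (root t) , x) ∷ mapArr e (arrA t)

module _ (R : Real) where
  open Real R

  RV : Set
  RV = Fin (suc (suc k)) ⊎ Σ (Fin (suc (suc k))) (λ i → AV (att i))

  baseArrow : Fin (suc (suc k)) → RV × RV
  baseArrow i = if ori i then (inj₁ i , inj₁ (nextFin i)) else (inj₁ (nextFin i) , inj₁ i)

  arrowsAt : Fin (suc (suc k)) → List (RV × RV)
  arrowsAt i = baseArrow i ∷
    attArrows (proj₁ (baseArrow i)) (proj₂ (baseArrow i)) (att i) (λ v → inj₂ (i , v))

  quiverOf : Quiver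
  quiverOf = record { V = RV ; arr = concatMap arrowsAt (allFin (suc (suc k))) }

  -- contribution of base arrow i together with its attached quiver:
  -- (arrows in no oriented 3-cycle , oriented 3-cycles)
  contrib : Maybe RA → ℕ × ℕ
  contrib nothing  = (1 , 0)
  contrib (just t) = (nonTriA t , suc (trisA t))

  sumOver : Bool → (ℕ × ℕ → ℕ) → ℕ
  sumOver b f = foldr ℕ._+_ 0
    (map (λ i → if ori i then (if b then f (contrib (att i)) else 0)
                         else (if b then 0 else f (contrib (att i))))
         (allFin (suc (suc k))))

  -- parameters (r₁ , r₂ , s₁ , s₂): r anti-clockwise, s clockwise
  params : ℕ × ℕ × ℕ × ℕ
  params = (sumOver false proj₁ , sumOver false proj₂ , sumOver true proj₁ , sumOver true proj₂)

RealIso : Real → Real → Set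
RealIso R R' = QIso (quiverOf R) (quiverOf R')

-- Quivers as skew-symmetric integer matrices, mutation

Mat : ℕ → Set
Mat n = Fin n → Fin n → ℤ

-- sgn(b_ik) [b_ik b_kj]_+  (nonzero only if both have the same sign)
mutEntry : ℤ → ℤ → ℤ
mutEntry (+ suc a) (+ suc b) = + (suc a ℕ.* suc b)
mutEntry -[1+ a ] -[1+ b ]   = ℤ.- (+ (suc a ℕ.* suc b))
mutEntry _ _ = + 0

μ : ∀ {n} → Fin n → Mat n → Mat n
μ k B i j with i Data.Fin.≟ k | j Data.Fin.≟ k
... | no _  | no _  = B i j ℤ.+ mutEntry (B i k) (B k j)
... | _     | _     = ℤ.- B i j

MutStep : ∀ {n} → Mat n → Mat n → Set
MutStep {n} B B' = Σ (Fin n) λ k → ∀ i j → B' i j ≡ μ k B i j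

MatIso : ∀ {n} → Mat n → Mat n → Set
MatIso {n} B B' = Σ (Permutation′ n) λ σ → ∀ i j → B' i j ≡ B (σ ⟨$⟩ʳ i) (σ ⟨$⟩ʳ j)

MutEq : ∀ {n} → Mat n → Mat n → Set
MutEq = Star (λ B B' → MutStep B B' ⊎ MatIso B B')

cycleEdge : (r s : ℕ) → Fin (r ℕ.+ s) → Fin (r ℕ.+ s) × Fin (r ℕ.+ s)
cycleEdge r s e = if ⌊ toℕ e <? r ⌋ then (e , nextFin e) else (nextFin e , e)

countB : ℕ → (List Bool) → ℕ
countB acc [] = acc
countB acc (true ∷ bs) = countB (suc acc) bs
countB acc (false ∷ bs) = countB acc bs

cycleMat : (r s : ℕ) → Mat (r ℕ.+ s)
cycleMat r s i j =
  (+ countB 0 (map (λ e → ⌊ (proj₁ (cycleEdge r s e) Data.Fin.≟ i) ×-dec (proj₂ (cycleEdge r s e) Data.Fin.≟ j) ⌋) (allFin _)))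
  ℤ.- (+ countB 0 (map (λ e → ⌊ (proj₁ (cycleEdge r s e) Data.Fin.≟ j) ×-dec (proj₂ (cycleEdge r s e) Data.Fin.≟ i) ⌋) (allFin _)))

-- total versions of division (only ever used with nonzero denominators)
_/ℕ_ : ℕ → ℕ → ℕ
m /ℕ zero  = 0
m /ℕ suc d = m ℕ./ suc d

frac : ℤ → ℕ → ℚ
frac a zero    = 0ℚ
frac a (suc d) = a ℚ./ suc d

fromℕ : ℕ → ℚ
fromℕ m = (+ m) ℚ./ 1

ΣQ : {A : Set} → List A → (A → ℚ) → ℚ
ΣQ xs f = foldr (λ x acc → f x ℚ.+ acc) 0ℚ (map (λ x → x) xs)

pm1 : ℕ → ℚ
pm1 zero    = 1ℚ
pm1 (suc n) = ℚ.- pm1 n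

pow2 : ℤ → ℚ
pow2 (+ n)     = fromℕ (2 ℕ.^ n)
pow2 -[1+ n ]  = frac (+ 1) (2 ℕ.^ suc n)

φ : ℕ → ℕ
φ k = length (filter (λ d → gcd d k ≟ 1) (map suc (upTo k)))

isNeg : ℤ → Bool
isNeg (+ _)    = false
isNeg -[1+ _ ] = true

prodFact : List ℤ → ℕ
prodFact []       = 1
prodFact (a ∷ as) = (ℤ.∣ a ∣ ℕ.!) ℕ.* prodFact as

anyNeg : List ℤ → Bool
anyNeg []       = false
anyNeg (a ∷ as) = if isNeg a then true else anyNeg as

multinom : ℕ → List ℤ → ℚ
multinom m as = if anyNeg as then 0ℚ else frac (+ (m ℕ.!)) (prodFact as)

range1 : ℕ → List ℕ
range1 b = map suc (upTo b)

range0 : ℕ → List ℕ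
range0 b = upTo (suc b)

-- q if m ≠ 0, else 0  (used to exclude (i,j) = (0,0))
nz : ℕ → ℚ → ℚ
nz zero    q = 0ℚ
nz (suc _) q = q

T : (r r₂ k i : ℕ) → ℚ
T r r₂ k i = multinom (2 ℕ.* i)
  ( + i ∷ (+ (2 ℕ.* i) ℤ.- + (r /ℕ k)) ∷ + (r₂ /ℕ k) ∷ (+ ((r ∸ r₂) /ℕ k) ℤ.- + i) ∷ [])

-- Σ over i,j ≥ 0, (i,j) ≠ (0,0); all terms with i > a or j > b vanish
-- in our uses, so the (finitely supported) sum is taken over 0 ≤ i ≤ a, 0 ≤ j ≤ b.
ΣIJ : ℕ → ℕ → (ℕ → ℕ → ℚ) → ℚ
ΣIJ a b f = ΣQ (range0 a) λ i → ΣQ (range0 b) λ j → nz (i ℕ.+ j) (f i j)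

formulaGen : (r₁ r₂ s₁ s₂ : ℕ) → ℚ
formulaGen r₁ r₂ s₁ s₂ =
  let r = r₁ ℕ.+ 2 ℕ.* r₂ ; s = s₁ ℕ.+ 2 ℕ.* s₂ in
  ΣQ (filter (λ k → ((k ∣? r) ×-dec (k ∣? r₂)) ×-dec ((k ∣? s) ×-dec (k ∣? s₂))) (range1 r)) λ k →
    frac (+ φ k) k ℚ.* pm1 ((r ℕ.+ r₂ ℕ.+ s ℕ.+ s₂) /ℕ k) ℚ.*
    ΣIJ r s (λ i j → pm1 (i ℕ.+ j) ℚ.* frac (+ 1) (2 ℕ.* (i ℕ.+ j)) ℚ.* T r r₂ k i ℚ.* T s s₂ k j)

formulaSym : (r₁ r₂ : ℕ) → ℚ
formulaSym r₁ r₂ =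
  let r = r₁ ℕ.+ 2 ℕ.* r₂ in
  pow2 ((+ r ℤ.- + (2 ℕ.* r₂)) ℤ.- + 2) ℚ.* multinom r (+ r₂ ∷ + r₂ ∷ (+ r ℤ.- + (2 ℕ.* r₂)) ∷ [])
  ℚ.+ ΣQ (filter (λ k → (k ∣? r) ×-dec (k ∣? r₂)) (range1 r)) λ k →
    ΣIJ r r (λ i j → frac (+ φ k) k ℚ.* (pm1 (i ℕ.+ j) ℚ.* frac (+ 1) (4 ℕ.* (i ℕ.+ j))) ℚ.*
                      T r r₂ k i ℚ.* T r r₂ k j)

half : ℚ
half = frac (+ 1) 2

aTildeNeq : ℕ → ℕ → ℚ
aTildeNeq r s = half ℚ.* ΣQ (filter (λ k → (k ∣? r) ×-dec (k ∣? s)) (range1 r)) λ k →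
  frac (+ φ k) (r ℕ.+ s) ℚ.* fromℕ ((((2 ℕ.* r) /ℕ k) C (r /ℕ k)) ℕ.* (((2 ℕ.* s) /ℕ k) C (s /ℕ k)))

aTildeEq : ℕ → ℚ
aTildeEq r = half ℚ.* (half ℚ.* fromℕ ((2 ℕ.* r) C r) ℚ.+
  ΣQ (filter (λ k → k ∣? r) (range1 r)) λ k →
    frac (+ φ k) (4 ℕ.* r) ℚ.* fromℕ ((((2 ℕ.* r) /ℕ k) C (r /ℕ k)) ℕ.^ 2))

-- A quiver of type Ã is drawn as a triangulation of an annulus: a cyclic word of base arrows, each with an
-- orientation and a binary tree, whose leaves are the boundary segments on its side. Mutation at a vertex is the
-- flip of a diagonal, and flips connect any two triangulations with equally many segments on either boundary.
-- Conversely the quiver determines the word up to rotation and reflection: flipping the roots of the trees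
-- reduces this to bare cycles. So both parts count orbits of words, under rotations and, when the two sides
-- agree, also under the reflection that exchanges the orientations.
--
-- Let u and v be the generating functions of the trees on either side, where a node with two leaves (a cherry)
-- has weight y and any other leaf weight x, so u = p + u² with p = x + y - x². By Burnside's lemma
-- the rotation classes are given by the coefficients of -log(1 - u - v) = Σ C(2i,i) C(2j,j) pⁱ qʲ / (2(i + j)).
-- Words fixed by a reflection are palindromes, counted by 1/(1 - 2u) = Σ C(2i,i) pⁱ, whose coefficients are
-- numbers of bicoloured Motzkin paths.
module Submission where

open import Defs
open import Data.Bool as Bool using (Bool; true; false; if_then_else_; not; _∧_)
open import Data.Bool.Properties using (not-involutive; ∧-comm)
open import Data.Maybe as Maybe using (Maybe; just; nothing)
open import Data.Maybe.Properties using (just-injective)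
open import Data.Empty using (⊥; ⊥-elim)
open import Data.Unit using (⊤; tt)
open import Data.Sum using (_⊎_; inj₁; inj₂; [_,_]′)
open import Data.Product using (Σ; ∃; _×_; _,_; proj₁; proj₂)
open import Data.Product.Properties using (,-injectiveʳ) renaming (≡-dec to ×-≡-dec)
open import Data.Nat using (ℕ; zero; suc; _+_; _*_; _∸_; _^_; _!; _≤_; _<_; _≥_; z≤n; s≤s; NonZero; >-nonZero; >-nonZero⁻¹)
import Data.Nat as ℕ
open import Data.Nat.Properties hiding (_≟_)
import Data.Nat.Tactic.RingSolver as ℕ-Ring
open import Data.Nat.Induction using (<-wellFounded)
open import Data.Nat.DivMod using (m/n*n≡m; _/_; _%_; m*n/n≡m; m<n⇒m%n≡m; n%n≡0; m%n<n)
open import Data.Nat.Divisibility using (_∣_; _∣?_; divides; ∣⇒≤)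
open import Data.Nat.GCD using (gcd; gcd[m,n]∣m; gcd[m,n]∣n; gcd-GCD; c*gcd[m,n]≡gcd[cm,cn]; module Bézout)
open import Data.Nat.Combinatorics using (_C_; nCn≡1; nCk≡nC[n∸k]; nCk≡n!/k![n-k]!; k![n∸k]!∣n!; nCk+nC[k+1]≡[n+1]C[k+1])
open import Data.Integer as ℤ using (ℤ) renaming (_+_ to _⊞_; _*_ to _⊠_; _-_ to _⊟_)
import Data.Integer.Properties as ℤₚ
import Data.Integer.Tactic.RingSolver as ℤ-Ring
open import Data.Rational as ℚ using (ℚ; 0ℚ; 1ℚ) renaming (_*_ to _·_; _+_ to _⊕_; _-_ to _⊖_)
import Data.Rational.Properties as ℚₚ
open ℚₚ using () renaming (*-zeroˡ to ·-zeroˡ; *-identityˡ to ·-identityˡ; *-zeroʳ to ·-zeroʳ; +-identityˡ to ⊕-identityˡ; +-identityʳ to ⊕-identityʳ; *-comm to ·-comm; *-assoc to ·-assoc; *-identityʳ to ·-identityʳ)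
import Data.Rational.Unnormalised as ℚᵘ
import Data.Rational.Unnormalised.Properties as ℚᵘₚ
open import Data.Fin as Fin using (Fin; toℕ)
import Data.Fin.Properties as Finₚ
open import Data.Fin.Permutation using (_⟨$⟩ʳ_; _⟨$⟩ˡ_; inverseʳ; inverseˡ)
open import Data.List using (List; []; _∷_; [_]; map; filter; length; upTo; allFin; tabulate; lookup; concatMap; foldr; _++_; reverse; replicate; take; drop; cartesianProduct)
open import Data.List.Properties
open import Data.List.Membership.Propositional using (_∈_; _∉_; find; lose)
open import Data.List.Membership.Propositional.Properties
import Data.List.Membership.Propositional.Properties.WithK as ∈ₚK
open import Data.List.Relation.Binary.BagAndSetEquality using (∼bag⇒↭)
open import Data.List.Relation.Unary.All as All using (All; []; _∷_)
import Data.List.Relation.Unary.All.Properties as Allₚ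
open import Data.List.Relation.Unary.Any as Any using (Any; here; there)
import Data.List.Relation.Unary.Any.Properties as Anyₚ
open import Data.List.Relation.Unary.AllPairs as AllPairs using (AllPairs; []; _∷_)
import Data.List.Relation.Unary.AllPairs.Properties as AllPairsₚ
open import Data.List.Relation.Unary.Unique.Propositional using (Unique)
import Data.List.Relation.Unary.Unique.Propositional.Properties as Uniqueₚ
open Uniqueₚ using () renaming (Unique[x∷xs]⇒x∉xs to head∉tail)
open import Data.List.Relation.Binary.Pointwise using (Pointwise; []; _∷_; Pointwise-length)
open import Data.List.Relation.Binary.Permutation.Propositional using (_↭_; ↭-refl; ↭-sym; ↭-trans; ↭-prep; ↭-reflexive)
import Data.List.Relation.Binary.Permutation.Propositional as Perm
import Data.List.Relation.Binary.Permutation.Propositional.Properties as Permₚ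
open Permₚ using (∈-resp-↭; All-resp-↭; ↭-length; ↭-reverse)
open import Function using (_∘_; id)
open import Function.Bundles using (_↔_; Inverse; mk↔ₛ′; mk⇔)
open import Function.Properties.Inverse using (↔-sym)
open import Function.Construct.Identity using (↔-id)
open import Induction.WellFounded using (Acc; acc)
open import Relation.Binary.Definitions using (DecidableEquality)
open import Relation.Binary.Construct.Closure.ReflexiveTransitive using (ε; _◅_; _◅◅_) renaming (reverse to reverse⋆)
open import Relation.Binary.PropositionalEquality using (_≡_; _≢_; refl; sym; trans; cong; cong₂; subst; subst₂; module ≡-Reasoning)
open import Relation.Nullary using (¬_; ¬?; Dec; yes; no; does; contradiction)
open import Relation.Nullary.Decidable using (⌊_⌋; _×-dec_; dec-true; dec-false; isYes≗does)
open import Relation.Unary using (Pred; Decidable)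
open import Tactic.RingSolver using (solve-∀)
open import Tactic.RingSolver.Core.AlmostCommutativeRing using (AlmostCommutativeRing; fromCommutativeRing)
open import Level using (0ℓ)

-- The series of trees do not see cherries: with x + y - x² as the weight of a leaf, the counts
-- refined by cherries follow from the unrefined ones by substitution. Expanding a power i of this
-- weight gives trinomial coefficients, and C(2i, i) times such a coefficient is one of the
-- multinomials of the statement; the signs are those of -x². The proof keeps coefficients instead
-- of power series, each family being fixed by a recurrence in the number of trees and the excess of
-- leaves over trees. Burnside's lemma divides words of length L by L. This 1/L is the source of the
-- logarithm, and grouping the rotations by their order k gives φ(k)/k. For the quivers the obstacle
-- is to recognise cycle and trees in a bare matrix, where small cases have double arrows. Mutation
-- circumvents it: two drawings with equal matrices have equal matrices again after flipping the
-- same vertex in both, so the trees are dismantled in parallel and only bare cycles are compared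
-- entry by entry.

ℚ-ring : AlmostCommutativeRing 0ℓ 0ℓ
ℚ-ring = fromCommutativeRing ℚₚ.+-*-commutativeRing λ x → isZero x (x ℚₚ.≟ 0ℚ)
  where
  isZero : ∀ x → Dec (x ≡ 0ℚ) → Maybe (0ℚ ≡ x)
  isZero x (yes p) = just (sym p)
  isZero x (no _) = nothing

-- Rational arithmetic

fromℕ-+ : ∀ m n → fromℕ (m + n) ≡ fromℕ m ⊕ fromℕ n
fromℕ-+ m n = ℚₚ.toℚᵘ-injective (begin
  ℚ.toℚᵘ (fromℕ (m + n)) ≈⟨ ℚₚ.toℚᵘ-fromℚᵘ (ℚᵘ.mkℚᵘ (ℤ.+ (m + n)) 0) ⟩
  ℚᵘ.mkℚᵘ (ℤ.+ (m + n)) 0 ≈⟨ ℚᵘ.*≡* (cong (_⊠ ℤ.+ 1) (cong₂ _⊞_ (sym (ℤₚ.*-identityʳ (ℤ.+ m))) (sym (ℤₚ.*-identityʳ (ℤ.+ n))))) ⟩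
  ℚᵘ.mkℚᵘ (ℤ.+ m) 0 ℚᵘ.+ ℚᵘ.mkℚᵘ (ℤ.+ n) 0 ≈⟨ ℚᵘₚ.+-cong (ℚₚ.toℚᵘ-fromℚᵘ (ℚᵘ.mkℚᵘ (ℤ.+ m) 0)) (ℚₚ.toℚᵘ-fromℚᵘ (ℚᵘ.mkℚᵘ (ℤ.+ n) 0)) ⟨
  ℚ.toℚᵘ (fromℕ m) ℚᵘ.+ ℚ.toℚᵘ (fromℕ n) ≈⟨ ℚₚ.toℚᵘ-homo-+ (fromℕ m) (fromℕ n) ⟨
  ℚ.toℚᵘ (fromℕ m ⊕ fromℕ n) ∎)
  where open ℚᵘₚ.≃-Reasoning

1/ : ℕ → ℚ
1/ n = frac (ℤ.+ 1) n

2^ : ℕ → ℚ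
2^ m = fromℕ (2 ^ m)

φ/ : ℕ → ℚ
φ/ k = frac (ℤ.+ φ k) k

frac-mul : ∀ a n → frac a (suc n) · fromℕ (suc n) ≡ a ℚ./ 1
frac-mul a n = ℚₚ.toℚᵘ-injective (begin
  ℚ.toℚᵘ (a ℚ./ suc n · fromℕ (suc n)) ≈⟨ ℚₚ.toℚᵘ-homo-* (a ℚ./ suc n) (fromℕ (suc n)) ⟩
  ℚ.toℚᵘ (a ℚ./ suc n) ℚᵘ.* ℚ.toℚᵘ (fromℕ (suc n)) ≈⟨ ℚᵘₚ.*-cong (ℚₚ.toℚᵘ-fromℚᵘ (ℚᵘ.mkℚᵘ a n)) (ℚₚ.toℚᵘ-fromℚᵘ (ℚᵘ.mkℚᵘ (ℤ.+ suc n) 0)) ⟩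
  ℚᵘ.mkℚᵘ a n ℚᵘ.* ℚᵘ.mkℚᵘ (ℤ.+ suc n) 0 ≈⟨ ℚᵘ.*≡* (trans (ℤₚ.*-identityʳ _) (cong (a ⊠_) (cong (ℤ.+_) (sym (*-identityʳ (suc n)))))) ⟩
  ℚᵘ.mkℚᵘ a 0 ≈⟨ ℚₚ.toℚᵘ-fromℚᵘ (ℚᵘ.mkℚᵘ a 0) ⟨
  ℚ.toℚᵘ (a ℚ./ 1) ∎)
  where open ℚᵘₚ.≃-Reasoning

open ≡-Reasoning

fromℕ-* : ∀ m n → fromℕ (m * n) ≡ fromℕ m · fromℕ n
fromℕ-* zero n = sym (·-zeroˡ (fromℕ n))
fromℕ-* (suc m) n = begin
  fromℕ (n + m * n) ≡⟨ fromℕ-+ n (m * n) ⟩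
  fromℕ n ⊕ fromℕ (m * n) ≡⟨ cong (fromℕ n ⊕_) (fromℕ-* m n) ⟩
  fromℕ n ⊕ fromℕ m · fromℕ n ≡⟨ dist (fromℕ n) (fromℕ m) ⟩
  (1ℚ ⊕ fromℕ m) · fromℕ n ≡⟨ cong (_· fromℕ n) (fromℕ-+ 1 m) ⟨
  fromℕ (suc m) · fromℕ n ∎
  where
  dist : ∀ x y → x ⊕ y · x ≡ (1ℚ ⊕ y) · x
  dist = solve-∀ ℚ-ring

1/-inverse : ∀ n .{{_ : NonZero n}} → 1/ n · fromℕ n ≡ 1ℚ
1/-inverse (suc n) = frac-mul (ℤ.+ 1) n

*-cancelʳ-fromℕ : ∀ n .{{_ : NonZero n}} {p q} → p · fromℕ n ≡ q · fromℕ n → p ≡ q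
*-cancelʳ-fromℕ n {p} {q} eq = begin
  p ≡⟨ expand p ⟩
  p · fromℕ n · 1/ n ≡⟨ cong (_· 1/ n) eq ⟩
  q · fromℕ n · 1/ n ≡⟨ expand q ⟨
  q ∎
  where
  swap : ∀ x y z → x · y · z ≡ x · (z · y)
  swap = solve-∀ ℚ-ring
  expand : ∀ x → x ≡ x · fromℕ n · 1/ n
  expand x = trans (sym (·-identityʳ x)) (trans (cong (x ·_) (sym (1/-inverse n))) (sym (swap x (fromℕ n) (1/ n))))

frac≡*1/ : ∀ m n → frac (ℤ.+ m) n ≡ fromℕ m · 1/ n
frac≡*1/ m zero = sym (·-zeroʳ (fromℕ m))
frac≡*1/ m (suc n) = *-cancelʳ-fromℕ (suc n) (trans (frac-mul (ℤ.+ m) n)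
  (sym (trans (·-assoc (fromℕ m) _ _) (trans (cong (fromℕ m ·_) (frac-mul (ℤ.+ 1) n)) (·-identityʳ _)))))

1/-* : ∀ m n .{{_ : NonZero m}} .{{_ : NonZero n}} → 1/ (m * n) ≡ 1/ m · 1/ n
1/-* m n = *-cancelʳ-fromℕ (m * n) {{m*n≢0 m n}} (begin
  1/ (m * n) · fromℕ (m * n) ≡⟨ 1/-inverse (m * n) {{m*n≢0 m n}} ⟩
  1ℚ ≡⟨ cong₂ _·_ (1/-inverse m) (1/-inverse n) ⟨
  (1/ m · fromℕ m) · (1/ n · fromℕ n) ≡⟨ mid4 (1/ m) (fromℕ m) (1/ n) (fromℕ n) ⟩
  (1/ m · 1/ n) · (fromℕ m · fromℕ n) ≡⟨ cong ((1/ m · 1/ n) ·_) (fromℕ-* m n) ⟨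
  (1/ m · 1/ n) · fromℕ (m * n) ∎)
  where
  mid4 : ∀ a b c d → (a · b) · (c · d) ≡ (a · c) · (b · d)
  mid4 = solve-∀ ℚ-ring

𝟙 : Bool → ℚ
𝟙 true = 1ℚ
𝟙 false = 0ℚ

𝟙-∧ : ∀ a b → 𝟙 (a ∧ b) ≡ 𝟙 a · 𝟙 b
𝟙-∧ true b = sym (·-identityˡ (𝟙 b))
𝟙-∧ false b = sym (·-zeroˡ (𝟙 b))

-- Finite sums over lists

module _ {A : Set} where

  ∑ : List A → (A → ℚ) → ℚ
  ∑ [] f = 0ℚ
  ∑ (x ∷ xs) f = f x ⊕ ∑ xs f

  ΣQ≡∑ : ∀ xs (f : A → ℚ) → ΣQ xs f ≡ ∑ xs f
  ΣQ≡∑ [] f = refl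
  ΣQ≡∑ (x ∷ xs) f = cong (f x ⊕_) (ΣQ≡∑ xs f)

  ∑-cong : ∀ xs {f g : A → ℚ} → (∀ {x} → x ∈ xs → f x ≡ g x) → ∑ xs f ≡ ∑ xs g
  ∑-cong [] eq = refl
  ∑-cong (x ∷ xs) eq = cong₂ _⊕_ (eq (here refl)) (∑-cong xs (eq ∘ there))

  ∑-ext : ∀ xs {f g : A → ℚ} → (∀ x → f x ≡ g x) → ∑ xs f ≡ ∑ xs g
  ∑-ext xs eq = ∑-cong xs (λ {x} _ → eq x)

  ∑-zero : ∀ xs {f : A → ℚ} → (∀ {x} → x ∈ xs → f x ≡ 0ℚ) → ∑ xs f ≡ 0ℚ
  ∑-zero [] eq = refl
  ∑-zero (x ∷ xs) eq = trans (cong₂ _⊕_ (eq (here refl)) (∑-zero xs (eq ∘ there))) (⊕-identityˡ 0ℚ)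

  ∑-++ : ∀ xs ys (f : A → ℚ) → ∑ (xs ++ ys) f ≡ ∑ xs f ⊕ ∑ ys f
  ∑-++ [] ys f = sym (⊕-identityˡ _)
  ∑-++ (x ∷ xs) ys f = trans (cong (f x ⊕_) (∑-++ xs ys f)) (sym (ℚₚ.+-assoc (f x) _ _))

  ∑-+ : ∀ xs (f g : A → ℚ) → ∑ xs (λ x → f x ⊕ g x) ≡ ∑ xs f ⊕ ∑ xs g
  ∑-+ [] f g = sym (⊕-identityˡ 0ℚ)
  ∑-+ (x ∷ xs) f g = trans (cong ((f x ⊕ g x) ⊕_) (∑-+ xs f g)) (mid4 (f x) (g x) (∑ xs f) (∑ xs g))
    where
    mid4 : ∀ a b c d → (a ⊕ b) ⊕ (c ⊕ d) ≡ (a ⊕ c) ⊕ (b ⊕ d)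
    mid4 = solve-∀ ℚ-ring

  ∑-*ˡ : ∀ xs c (f : A → ℚ) → ∑ xs (λ x → c · f x) ≡ c · ∑ xs f
  ∑-*ˡ [] c f = sym (·-zeroʳ c)
  ∑-*ˡ (x ∷ xs) c f = trans (cong (c · f x ⊕_) (∑-*ˡ xs c f)) (sym (ℚₚ.*-distribˡ-+ c (f x) _))

  ∑-*ʳ : ∀ xs c (f : A → ℚ) → ∑ xs (λ x → f x · c) ≡ ∑ xs f · c
  ∑-*ʳ xs c f = trans (∑-ext xs (λ x → ·-comm (f x) c)) (trans (∑-*ˡ xs c f) (·-comm c _))

  ∑-↭ : ∀ {xs ys} (f : A → ℚ) → xs ↭ ys → ∑ xs f ≡ ∑ ys f
  ∑-↭ f Perm.refl = refl
  ∑-↭ f (Perm.prep x p) = cong (f x ⊕_) (∑-↭ f p)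
  ∑-↭ {_ ∷ _ ∷ xs} {_ ∷ _ ∷ ys} f (Perm.swap x y p) =
    trans (cong (λ z → f x ⊕ (f y ⊕ z)) (∑-↭ f p)) (exch (f x) (f y) (∑ ys f))
    where
    exch : ∀ a b c → a ⊕ (b ⊕ c) ≡ b ⊕ (a ⊕ c)
    exch = solve-∀ ℚ-ring
  ∑-↭ f (Perm.trans p q) = trans (∑-↭ f p) (∑-↭ f q)

  ∑-const1 : ∀ (xs : List A) → ∑ xs (λ _ → 1ℚ) ≡ fromℕ (length xs)
  ∑-const1 [] = refl
  ∑-const1 (x ∷ xs) = trans (cong (1ℚ ⊕_) (∑-const1 xs)) (sym (fromℕ-+ 1 (length xs)))

  ∑-filter : ∀ {P : Pred A 0ℓ} (P? : Decidable P) xs (f : A → ℚ) →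
    ∑ (filter P? xs) f ≡ ∑ xs (λ x → 𝟙 (does (P? x)) · f x)
  ∑-filter P? [] f = refl
  ∑-filter P? (x ∷ xs) f with P? x
  ... | yes _ = cong₂ _⊕_ (sym (·-identityˡ (f x))) (∑-filter P? xs f)
  ... | no _ = trans (∑-filter P? xs f) (trans (sym (⊕-identityˡ _)) (cong (_⊕ _) (sym (·-zeroˡ (f x)))))

∑₁ ∑< : ℕ → (ℕ → ℚ) → ℚ
∑₁ n = ∑ (range1 n)
∑< n = ∑ (upTo n)

∑-map : ∀ {A B : Set} (g : A → B) xs (f : B → ℚ) → ∑ (map g xs) f ≡ ∑ xs (f ∘ g)
∑-map g [] f = refl
∑-map g (x ∷ xs) f = cong (f (g x) ⊕_) (∑-map g xs f)

∑-concatMap : ∀ {A B : Set} (g : A → List B) xs (f : B → ℚ) → ∑ (concatMap g xs) f ≡ ∑ xs (λ x → ∑ (g x) f)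
∑-concatMap g [] f = refl
∑-concatMap g (x ∷ xs) f = trans (∑-++ (g x) _ f) (cong (∑ (g x) f ⊕_) (∑-concatMap g xs f))

∑-swap : ∀ {A B : Set} xs ys (f : A → B → ℚ) →
  ∑ xs (λ x → ∑ ys (f x)) ≡ ∑ ys (λ y → ∑ xs (λ x → f x y))
∑-swap [] ys f = sym (∑-zero ys (λ _ → refl))
∑-swap (x ∷ xs) ys f = trans (cong (∑ ys (f x) ⊕_) (∑-swap xs ys f)) (sym (∑-+ ys (f x) _))

∑-product : ∀ {A B : Set} xs ys (f : A → ℚ) (g : B → ℚ) →
  ∑ (cartesianProduct xs ys) (λ (x , y) → f x · g y) ≡ ∑ xs f · ∑ ys g
∑-product [] ys f g = sym (·-zeroˡ (∑ ys g))
∑-product (x ∷ xs) ys f g = begin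
  ∑ (map (x ,_) ys ++ cartesianProduct xs ys) _ ≡⟨ ∑-++ (map (x ,_) ys) _ _ ⟩
  ∑ (map (x ,_) ys) _ ⊕ _ ≡⟨ cong₂ _⊕_ (trans (∑-map (x ,_) ys _) (∑-*ˡ ys (f x) g)) (∑-product xs ys f g) ⟩
  f x · ∑ ys g ⊕ ∑ xs f · ∑ ys g ≡⟨ ℚₚ.*-distribʳ-+ (∑ ys g) (f x) (∑ xs f) ⟨
  (f x ⊕ ∑ xs f) · ∑ ys g ∎

Unique-set⇒↭ : ∀ {A : Set} {xs ys : List A} → Unique xs → Unique ys →
  (∀ {x} → x ∈ xs → x ∈ ys) → (∀ {x} → x ∈ ys → x ∈ xs) → xs ↭ ys
Unique-set⇒↭ ux uy to from = ∼bag⇒↭ (∈ₚK.unique∧set⇒bag ux uy (mk⇔ to from))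

module _ {A : Set} (_≟_ : DecidableEquality A) where

  δ : A → A → ℚ
  δ x y = 𝟙 (does (x ≟ y))

  δ-refl : ∀ x → δ x x ≡ 1ℚ
  δ-refl x = cong 𝟙 (dec-true (x ≟ x) refl)

  δ-≢ : ∀ {x y} → x ≢ y → δ x y ≡ 0ℚ
  δ-≢ {x} {y} x≢y = cong 𝟙 (dec-false (x ≟ y) x≢y)

  ∑-δ-∉ : ∀ {xs} z (f : A → ℚ) → z ∉ xs → ∑ xs (λ x → δ x z · f x) ≡ 0ℚ
  ∑-δ-∉ {xs} z f z∉ = ∑-zero xs λ {x} x∈ → trans (cong (_· f x) (δ-≢ λ { refl → z∉ x∈ })) (·-zeroˡ (f x))

  ∑-δ : ∀ {xs} z (f : A → ℚ) → Unique xs → z ∈ xs → ∑ xs (λ x → δ x z · f x) ≡ f z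
  ∑-δ {x ∷ xs} z f u@(_ ∷ _) (here refl) =
    trans (cong₂ _⊕_ (trans (cong (_· f x) (δ-refl x)) (·-identityˡ (f x)))
                       (∑-δ-∉ z f (head∉tail u)))
          (⊕-identityʳ (f x))
  ∑-δ {x ∷ xs} z f u@(_ ∷ u') (there z∈) =
    trans (cong₂ _⊕_ (trans (cong (_· f x) (δ-≢ λ { refl → head∉tail u z∈ })) (·-zeroˡ (f x)))
                       (∑-δ z f u' z∈))
          (⊕-identityˡ (f z))

range1⇒≤ : ∀ {n k} → k ∈ range1 n → 1 ≤ k × k ≤ n
range1⇒≤ k∈ with ∈-map⁻ suc k∈
... | j , j∈ , refl = s≤s z≤n , ∈-upTo⁻ j∈

≤⇒range1 : ∀ {n k} → 1 ≤ k → k ≤ n → k ∈ range1 n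
≤⇒range1 {k = suc k} _ k≤n = ∈-map⁺ suc (∈-upTo⁺ k≤n)

range1-Unique : ∀ n → Unique (range1 n)
range1-Unique n = Uniqueₚ.map⁺ suc-injective (Uniqueₚ.upTo⁺ n)

-- Burnside's lemma for an action presented by the list orb x of all images of x,
-- each repeated as often as there are group elements producing it.
module Burnside {A : Set} (_≟_ : DecidableEquality A) (orb : A → List A)
  (self : ∀ x → x ∈ orb x) (orb-↭ : ∀ x y → y ∈ orb x → orb y ↭ orb x) where

  multiplicity : A → List A → ℚ
  multiplicity x ys = ∑ ys (λ y → δ _≟_ x y)

  -- If `orb x` lists the images of x under a group, `multiplicity x (orb x)` is the order of the
  -- stabiliser, so the weight is 1 over the number of distinct images.
  weight : A → ℚ
  weight x = multiplicity x (orb x) · 1/ (length (orb x))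

  private
    orb-sym : ∀ {x y} → y ∈ orb x → x ∈ orb y
    orb-sym {x} y∈ = ∈-resp-↭ (↭-sym (orb-↭ _ _ y∈)) (self x)

    orb-trans : ∀ {x y z} → y ∈ orb x → z ∈ orb y → z ∈ orb x
    orb-trans y∈ z∈ = ∈-resp-↭ (orb-↭ _ _ y∈) z∈

    _∈orb?_ : ∀ y x → Dec (y ∈ orb x)
    y ∈orb? x = Any.any? (y ≟_) (orb x)

    nonEmpty : ∀ {x} (ys : List A) → x ∈ ys → NonZero (length ys)
    nonEmpty (_ ∷ _) _ = _

    multiplicity-∉ : ∀ {x} ys → x ∉ ys → multiplicity x ys ≡ 0ℚ
    multiplicity-∉ ys x∉ = ∑-zero ys λ {y} y∈ → δ-≢ _≟_ λ { refl → x∉ y∈ }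

    -- All members y of the class have the same list of images up to order, so their weights add up
    -- their multiplicities in one list. Every entry of that list is exactly one member of X, hence
    -- the total is the length, which the denominator cancels.
    class-weight : ∀ X x → Unique X → (∀ {y} → y ∈ orb x → y ∈ X) →
      ∑ X (λ y → 𝟙 (does (y ∈orb? x)) · weight y) ≡ 1ℚ
    class-weight X x uX closed = begin
      ∑ X (λ y → 𝟙 (does (y ∈orb? x)) · weight y) ≡⟨ ∑-ext X step ⟩
      ∑ X (λ y → multiplicity y (orb x) · 1/N) ≡⟨ ∑-*ʳ X 1/N _ ⟩
      ∑ X (λ y → ∑ (orb x) (δ _≟_ y)) · 1/N ≡⟨ cong (_· 1/N) (∑-swap X (orb x) (δ _≟_)) ⟩
      ∑ (orb x) (λ z → ∑ X (λ y → δ _≟_ y z)) · 1/N ≡⟨ cong (_· 1/N) (∑-cong (orb x) one) ⟩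
      ∑ (orb x) (λ _ → 1ℚ) · 1/N ≡⟨ cong (_· 1/N) (∑-const1 (orb x)) ⟩
      fromℕ (length (orb x)) · 1/N ≡⟨ ·-comm (fromℕ (length (orb x))) 1/N ⟩
      1/N · fromℕ (length (orb x)) ≡⟨ 1/-inverse (length (orb x)) {{nonEmpty (orb x) (self x)}} ⟩
      1ℚ ∎
      where
      1/N = 1/ (length (orb x))
      step : ∀ y → 𝟙 (does (y ∈orb? x)) · weight y ≡ multiplicity y (orb x) · 1/N
      step y with y ∈orb? x
      ... | yes y∈ = trans (·-identityˡ (weight y))
              (cong₂ _·_ (∑-↭ _ (orb-↭ _ _ y∈)) (cong 1/ (↭-length (orb-↭ _ _ y∈))))
      ... | no y∉ = trans (·-zeroˡ (weight y))
              (sym (trans (cong (_· 1/N) (multiplicity-∉ (orb x) y∉)) (·-zeroˡ 1/N)))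
      one : ∀ {z} → z ∈ orb x → ∑ X (λ y → δ _≟_ y z) ≡ 1ℚ
      one {z} z∈ = trans (∑-ext X (λ y → sym (·-identityʳ (δ _≟_ y z)))) (∑-δ _≟_ z (λ _ → 1ℚ) uX (closed z∈))

    split : ∀ X x (f : A → ℚ) → ∑ X f ≡ ∑ X (λ y → 𝟙 (does (y ∈orb? x)) · f y) ⊕ ∑ (filter (λ y → ¬? (y ∈orb? x)) X) f
    split X x f = sym (trans (cong (∑ X _ ⊕_) (∑-filter _ X f)) (trans (sym (∑-+ X _ _)) (∑-ext X part)))
      where
      part : ∀ y → 𝟙 (does (y ∈orb? x)) · f y ⊕ 𝟙 (not (does (y ∈orb? x))) · f y ≡ f y
      part y with does (y ∈orb? x)
      ... | true = trans (cong₂ _⊕_ (·-identityˡ (f y)) (·-zeroˡ (f y))) (⊕-identityʳ (f y))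
      ... | false = trans (cong₂ _⊕_ (·-zeroˡ (f y)) (·-identityˡ (f y))) (⊕-identityˡ (f y))

  Classes : List A → Set
  Classes X = Σ (List A) λ L →
    All (_∈ X) L × AllPairs (λ x y → y ∉ orb x) L ×
    (∀ {x} → x ∈ X → Any (λ y → y ∈ orb x) L) × fromℕ (length L) ≡ ∑ X weight

  -- The first element of X represents its class, which is then filtered out; the list gets shorter
  -- because x occurs among its own images.
  classes : ∀ X → Unique X → (∀ {x y} → x ∈ X → y ∈ orb x → y ∈ X) → Classes X
  classes X = go X (<-wellFounded (length X))
    where
    go : ∀ X → Acc _<_ (length X) → Unique X → (∀ {x y} → x ∈ X → y ∈ orb x → y ∈ X) → Classes X
    go [] _ _ _ = [] , [] , [] , (λ ()) , refl
    go X@(x ∷ X₀) (acc rs) uX closed =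
      let X' = filter ∉? X
          L , all , pairs , any , sum = go X' (rs shorter) (Uniqueₚ.filter⁺ ∉? uX) closed'
      in x ∷ L ,
         here refl ∷ All.map (λ y∈ → proj₁ (∈-filter⁻ ∉? y∈)) all ,
         All.map (λ y∈ → proj₂ (∈-filter⁻ ∉? {xs = X} y∈)) all ∷ pairs ,
         covered L any ,
         trans (fromℕ-+ 1 (length L)) (trans (cong₂ _⊕_ (sym (class-weight X x uX (closed (here refl)))) sum) (sym (split X x weight)))
      where
      ∉? = λ y → ¬? (y ∈orb? x)
      shorter : length (filter ∉? X) < length X
      shorter = filter-notAll ∉? X (here (λ x∉ → x∉ (self x)))
      closed' : ∀ {y z} → y ∈ filter ∉? X → z ∈ orb y → z ∈ filter ∉? X
      closed' y∈ z∈ with ∈-filter⁻ ∉? {xs = X} y∈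
      ... | y∈X , y∉ = ∈-filter⁺ ∉? (closed y∈X z∈) (λ z∈x → y∉ (orb-trans z∈x (orb-sym z∈)))
      covered : ∀ L → (∀ {y} → y ∈ filter ∉? X → Any (λ z → z ∈ orb y) L) → ∀ {y} → y ∈ X → Any (λ z → z ∈ orb y) (x ∷ L)
      covered L any {y} y∈ with y ∈orb? x
      ... | yes y∈x = here (orb-sym y∈x)
      ... | no y∉x = there (any (∈-filter⁺ ∉? y∈ y∉x))

-- Rotations, periods and reflections of cyclic words

module _ {A : Set} where

  rot1 : List A → List A
  rot1 [] = []
  rot1 (x ∷ xs) = xs ++ [ x ]

  rot : ℕ → List A → List A
  rot zero w = w
  rot (suc d) w = rot d (rot1 w)

  length-rot1 : ∀ w → length (rot1 w) ≡ length w
  length-rot1 [] = refl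
  length-rot1 (x ∷ xs) = trans (length-++ xs) (+-comm (length xs) 1)

  length-rot : ∀ d w → length (rot d w) ≡ length w
  length-rot zero w = refl
  length-rot (suc d) w = trans (length-rot d (rot1 w)) (length-rot1 w)

  rot-+ : ∀ m n w → rot (m + n) w ≡ rot n (rot m w)
  rot-+ zero n w = refl
  rot-+ (suc m) n w = rot-+ m n (rot1 w)

  rot-++ : ∀ xs ys → rot (length xs) (xs ++ ys) ≡ ys ++ xs
  rot-++ [] ys = sym (++-identityʳ ys)
  rot-++ (x ∷ xs) ys = begin
    rot (length xs) ((xs ++ ys) ++ [ x ]) ≡⟨ cong (rot (length xs)) (++-assoc xs ys [ x ]) ⟩
    rot (length xs) (xs ++ ys ++ [ x ]) ≡⟨ rot-++ xs (ys ++ [ x ]) ⟩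
    (ys ++ [ x ]) ++ xs ≡⟨ ++-assoc ys [ x ] xs ⟩
    ys ++ x ∷ xs ∎

  rot-length : ∀ w → rot (length w) w ≡ w
  rot-length w = trans (cong (rot (length w)) (sym (++-identityʳ w))) (rot-++ w [])

  rot-fixed-* : ∀ d w → rot d w ≡ w → ∀ k → rot (k * d) w ≡ w
  rot-fixed-* d w eq zero = refl
  rot-fixed-* d w eq (suc k) = trans (rot-+ d (k * d) w) (trans (cong (rot (k * d)) eq) (rot-fixed-* d w eq k))

  -- Bézout: the gcd is an integral combination of d and the length, and rotation by either of them
  -- fixes w. Over natural numbers the two signs of the combination are separate cases.
  rot-gcd : ∀ d w → rot d w ≡ w → rot (gcd d (length w)) w ≡ w
  rot-gcd d w eq with Bézout.identity (gcd-GCD d (length w))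
  ... | Bézout.+- x y e = begin
    rot g w ≡⟨ cong (rot g) (rot-fixed-* (length w) w (rot-length w) y) ⟨
    rot g (rot (y * length w) w) ≡⟨ rot-+ (y * length w) g w ⟨
    rot (y * length w + g) w ≡⟨ cong (λ m → rot m w) (trans (+-comm (y * length w) g) e) ⟩
    rot (x * d) w ≡⟨ rot-fixed-* d w eq x ⟩
    w ∎
    where
    g = gcd d (length w)
  ... | Bézout.-+ x y e = begin
    rot g w ≡⟨ cong (rot g) (rot-fixed-* d w eq x) ⟨
    rot g (rot (x * d) w) ≡⟨ rot-+ (x * d) g w ⟨
    rot (x * d + g) w ≡⟨ cong (λ m → rot m w) (trans (+-comm (x * d) g) e) ⟩
    rot (y * length w) w ≡⟨ rot-fixed-* (length w) w (rot-length w) y ⟩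
    w ∎
    where
    g = gcd d (length w)

  rot-∣ : ∀ {g d} w → g ∣ d → rot g w ≡ w → rot d w ≡ w
  rot-∣ {g} w (divides q refl) eq = rot-fixed-* g w eq q

  pow : ℕ → List A → List A
  pow zero v = []
  pow (suc k) v = v ++ pow k v

  length-pow : ∀ k v → length (pow k v) ≡ k * length v
  length-pow zero v = refl
  length-pow (suc k) v = trans (length-++ v) (cong (length v +_) (length-pow k v))

  pow-comm : ∀ k v → pow k v ++ v ≡ v ++ pow k v
  pow-comm zero v = sym (++-identityʳ v)
  pow-comm (suc k) v = trans (++-assoc v (pow k v) v) (cong (v ++_) (pow-comm k v))

  rot-pow : ∀ k v → rot (length v) (pow k v) ≡ pow k v
  rot-pow zero v = rot-[] (length v)
    where
    rot-[] : ∀ d → rot d [] ≡ []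
    rot-[] zero = refl
    rot-[] (suc d) = rot-[] d
  rot-pow (suc k) v = trans (rot-++ v (pow k v)) (pow-comm k v)

  ++-cancel-length : ∀ (xs ys : List A) {us vs} → length xs ≡ length ys → xs ++ us ≡ ys ++ vs → xs ≡ ys × us ≡ vs
  ++-cancel-length [] [] _ eq = refl , eq
  ++-cancel-length (x ∷ xs) (y ∷ ys) le eq =
    let h , t = ∷-injective eq
        p , q = ++-cancel-length xs ys (suc-injective le) t
    in cong₂ _∷_ h p , q

  -- Since u is at least as long as v, comparing prefixes in u v = v u shows that u begins with v;
  -- what remains commutes with v again.
  commute⇒pow : ∀ k u v → length u ≡ k * length v → u ++ v ≡ v ++ u → u ≡ pow k v
  commute⇒pow zero [] v le eq = refl
  commute⇒pow (suc k) u v le eq = trans (sym u≡) (cong₂ _++_ head≡ (commute⇒pow k u' v length-u' comm'))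
    where
    g = length v
    u₀ = take g u
    u' = drop g u
    u≡ : u₀ ++ u' ≡ u
    u≡ = take++drop≡id g u
    g≤ : g ≤ length u
    g≤ = ≤-trans (m≤m+n g (k * g)) (≤-reflexive (sym le))
    length-u₀ : length u₀ ≡ g
    length-u₀ = trans (length-take g u) (m≤n⇒m⊓n≡m g≤)
    parts : u₀ ≡ v × (u' ++ v) ≡ u
    parts = ++-cancel-length u₀ v length-u₀
      (trans (sym (++-assoc u₀ u' v)) (trans (cong (_++ v) u≡) eq))
    head≡ = proj₁ parts
    comm' : u' ++ v ≡ v ++ u'
    comm' = trans (proj₂ parts) (trans (sym u≡) (cong (_++ u') head≡))
    length-u' : length u' ≡ k * g
    length-u' = trans (length-drop g u) (trans (cong (_∸ g) le) (m+n∸m≡n g (k * g)))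

  -- Cut w into a prefix v of length g and a rest u. Rotation by g turns v u into u v, so being
  -- fixed means that u and v commute.
  rot-fixed⇒pow : ∀ k g w → length w ≡ suc k * g → rot g w ≡ w →
    Σ (List A) λ v → length v ≡ g × w ≡ pow (suc k) v
  rot-fixed⇒pow k g w le eq = v , length-v ,
      trans (sym w≡) (cong (v ++_) (commute⇒pow k u v length-u comm))
    where
    v = take g w
    u = drop g w
    w≡ : v ++ u ≡ w
    w≡ = take++drop≡id g w
    length-v : length v ≡ g
    length-v = trans (length-take g w)
      (m≤n⇒m⊓n≡m (≤-trans (m≤m+n g (k * g)) (≤-reflexive (sym le))))
    length-u : length u ≡ k * length v
    length-u = trans (length-drop g w) (trans (cong (_∸ g) le)
      (trans (m+n∸m≡n g (k * g)) (cong (k *_) (sym length-v))))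
    comm : u ++ v ≡ v ++ u
    comm = begin
      u ++ v ≡⟨ rot-++ v u ⟨
      rot (length v) (v ++ u) ≡⟨ cong₂ rot length-v w≡ ⟩
      rot g w ≡⟨ eq ⟩
      w ≡⟨ w≡ ⟨
      v ++ u ∎

  rot1-injective : ∀ {v w : List A} → rot1 v ≡ rot1 w → v ≡ w
  rot1-injective {[]} {[]} eq = refl
  rot1-injective {[]} {x ∷ xs} eq = contradiction (sym eq) (∷ʳ-≢[] xs)
    where
    ∷ʳ-≢[] : ∀ (xs : List A) {x} → xs ++ [ x ] ≢ []
    ∷ʳ-≢[] [] ()
    ∷ʳ-≢[] (_ ∷ _) ()
  rot1-injective {x ∷ xs} {[]} eq = sym (rot1-injective {[]} {x ∷ xs} (sym eq))
  rot1-injective {x ∷ xs} {y ∷ ys} eq = let a , b = ∷ʳ-injective xs ys eq in cong₂ _∷_ b a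

  -- The inverse of `rot1` is again a rotation, so rotations need no separate inverses.
  unrot : List A → List A
  unrot w = rot (length w ∸ 1) w

  rot1-unrot : ∀ w → rot1 (unrot w) ≡ w
  rot1-unrot [] = refl
  rot1-unrot w@(x ∷ xs) = trans (sym (rot-+ (length xs) 1 w)) (trans (cong (λ n → rot n w) (+-comm (length xs) 1)) (rot-length w))

  rot-rot1 : ∀ d w → rot d (rot1 w) ≡ rot1 (rot d w)
  rot-rot1 d w = trans (cong (λ n → rot n w) (+-comm 1 d)) (rot-+ d 1 w)

  rot-inverse : ∀ d w → ∃ λ e → rot e (rot d w) ≡ w
  rot-inverse zero w = 0 , refl
  rot-inverse (suc d) w = let e , eq = rot-inverse d (rot1 w) in e + (length w ∸ 1) ,
    trans (rot-+ e (length w ∸ 1) (rot (suc d) w)) (trans (cong (rot (length w ∸ 1)) eq)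
    (rot1-injective (trans (sym (rot-rot1 (length w ∸ 1) (rot1 w))) (trans (rot-rot1 (length w ∸ 1) (rot1 w)) (cong rot1 (back w))))))
    where
    back : ∀ w → rot (length w ∸ 1) (rot1 w) ≡ w
    back w = trans (rot-rot1 (length w ∸ 1) w) (rot1-unrot w)

  -- The steps run over 1, ..., L rather than 0, ..., L - 1, to fit the sums over `range1` that
  -- produce totients. The empty word gets one entry so that it still lies in its own list.
  rots : List A → List (List A)
  rots [] = [ [] ]
  rots w@(_ ∷ _) = map (λ d → rot d w) (range1 (length w))

  self∈rots : ∀ w → w ∈ rots w
  self∈rots [] = here refl
  self∈rots w@(_ ∷ xs) = subst (_∈ rots w) (rot-length w)
    (∈-map⁺ (λ d → rot d w) (≤⇒range1 {length w} (s≤s z≤n) ≤-refl))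

  rots⇒rot : ∀ {w y} → y ∈ rots w → ∃ λ d → y ≡ rot d w
  rots⇒rot {[]} (here refl) = 0 , refl
  rots⇒rot {x ∷ xs} y∈ with ∈-map⁻ (λ d → rot d (x ∷ xs)) {xs = range1 (length (x ∷ xs))} y∈
  ... | d , _ , eq = d , eq

  rots-rot1 : ∀ w → rots (rot1 w) ↭ rots w
  rots-rot1 [] = ↭-refl
  rots-rot1 w@(x ∷ xs) = ↭-trans (↭-reflexive lhs) (Permₚ.drop-∷ shifted)
    where
    f : ℕ → List A
    f d = rot (suc d) w
    n = length w
    lhs : rots (rot1 w) ≡ map (f ∘ suc) (upTo n)
    lhs = trans (unfold (rot1 w) (length-rot1 w)) (cong (λ k → map (λ d → rot (suc d) (rot1 w)) (upTo k)) (length-rot1 w))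
      where
      unfold : ∀ w' {m} → length w' ≡ suc m → rots w' ≡ map (λ d → rot (suc d) w') (upTo (length w'))
      unfold w'@(_ ∷ _) _ = sym (map-∘ (upTo (length w')))
    rhs : rots w ≡ map f (upTo n)
    rhs = sym (map-∘ (upTo n))
    fn≡f0 : f n ≡ f 0
    fn≡f0 = trans (cong (λ k → rot k (rot1 w)) (sym (length-rot1 w))) (rot-length (rot1 w))
    -- Putting f 0 in front of f 1, ..., f n gives f 0, ..., f n, whose last entry is f 0 once more;
    -- one copy of f 0 is cancelled afterwards.
    shifted : f 0 ∷ map (f ∘ suc) (upTo n) ↭ f 0 ∷ rots w
    shifted = ↭-trans (↭-reflexive (trans (cong (f 0 ∷_) (map-upTo (f ∘ suc) n)) (trans (sym (applyUpTo-∷ʳ f n)) (cong₂ (λ l z → l ++ [ z ]) (sym (map-upTo f n)) fn≡f0))))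
      (↭-trans (Permₚ.++-comm (map f (upTo n)) [ f 0 ]) (↭-reflexive (cong (f 0 ∷_) (sym rhs))))

  rots-rot : ∀ d w → rots (rot d w) ↭ rots w
  rots-rot zero w = ↭-refl
  rots-rot (suc d) w = ↭-trans (rots-rot d (rot1 w)) (rots-rot1 w)

  rot∈rots : ∀ d w → rot d w ∈ rots w
  rot∈rots d w = ∈-resp-↭ (rots-rot d w) (self∈rots (rot d w))

  rots-↭ : ∀ {x y} → y ∈ rots x → rots y ↭ rots x
  rots-↭ {x} y∈ with rots⇒rot {x} y∈
  ... | d , refl = rots-rot d x

  length-rots : ∀ x xs → length (rots (x ∷ xs)) ≡ length (x ∷ xs)
  length-rots x xs = trans (length-map _ (range1 (length (x ∷ xs))))
    (trans (length-map suc (upTo (length (x ∷ xs)))) (length-upTo (length (x ∷ xs))))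

module Mirror {A : Set} (flip : A → A) (flip-flip : ∀ x → flip (flip x) ≡ x) where

  mirror : List A → List A
  mirror w = reverse (map flip w)

  mirror-++ : ∀ xs ys → mirror (xs ++ ys) ≡ mirror ys ++ mirror xs
  mirror-++ xs ys = trans (cong reverse (map-++ flip xs ys)) (reverse-++ (map flip xs) (map flip ys))

  mirror-mirror : ∀ w → mirror (mirror w) ≡ w
  mirror-mirror w = begin
    reverse (map flip (reverse (map flip w))) ≡⟨ cong reverse (reverse-map flip (map flip w)) ⟩
    reverse (reverse (map flip (map flip w))) ≡⟨ reverse-involutive (map flip (map flip w)) ⟩
    map flip (map flip w) ≡⟨ map-∘ w ⟨
    map (flip ∘ flip) w ≡⟨ map-cong flip-flip w ⟩
    map id w ≡⟨ map-id w ⟩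
    w ∎

  length-mirror : ∀ w → length (mirror w) ≡ length w
  length-mirror w = trans (length-reverse (map flip w)) (length-map flip w)

  -- The defining relation of the dihedral group; through it `mirror` carries rotation classes to
  -- rotation classes.
  rot1-mirror-rot1 : ∀ w → rot1 (mirror (rot1 w)) ≡ mirror w
  rot1-mirror-rot1 [] = refl
  rot1-mirror-rot1 (x ∷ xs) = trans (cong rot1 (mirror-++ xs [ x ])) (sym (mirror-++ [ x ] xs))

  rots-mirror-rot : ∀ d w → rots (mirror (rot d w)) ↭ rots (mirror w)
  rots-mirror-rot zero w = ↭-refl
  rots-mirror-rot (suc d) w = ↭-trans (rots-mirror-rot d (rot1 w))
    (↭-trans (↭-sym (rots-rot1 (mirror (rot1 w)))) (↭-reflexive (cong rots (rot1-mirror-rot1 w))))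

  -- A nonempty word of length L gets 2L entries, with repetitions: one for each element of the
  -- dihedral group, as the count of orbits requires.
  dihedral : List A → List (List A)
  dihedral w = rots w ++ rots (mirror w)

  self∈dihedral : ∀ w → w ∈ dihedral w
  self∈dihedral w = ∈-++⁺ˡ (self∈rots w)

  dihedral⇒ : ∀ {w y} → y ∈ dihedral w → ∃ λ d → y ≡ rot d w ⊎ y ≡ rot d (mirror w)
  dihedral⇒ {w} y∈ with ∈-++⁻ (rots w) y∈
  ... | inj₁ p = let d , e = rots⇒rot {w = w} p in d , inj₁ e
  ... | inj₂ p = let d , e = rots⇒rot {w = mirror w} p in d , inj₂ e

  dihedral-↭ : ∀ {x y} → y ∈ dihedral x → dihedral y ↭ dihedral x
  dihedral-↭ {x} y∈ with dihedral⇒ {x} y∈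
  ... | d , inj₁ refl = Permₚ.++⁺ (rots-rot d x) (rots-mirror-rot d x)
  ... | d , inj₂ refl = ↭-trans (Permₚ.++⁺ (rots-rot d (mirror x)) (rots-mirror-rot d (mirror x)))
    (↭-trans (Permₚ.++-comm (rots (mirror x)) _) (↭-reflexive (cong (λ z → rots z ++ rots (mirror x)) (mirror-mirror x))))

-- Totients and sums over greatest common divisors

/ℕ-* : ∀ q k .{{_ : NonZero k}} → (q * k) /ℕ k ≡ q
/ℕ-* q (suc k) = m*n/n≡m q (suc k)

-- Grouping 1 ≤ d ≤ L by gcd d L = L/k: there are φ k such d for every k ∣ L.
totient-fibre : ∀ g k .{{_ : NonZero g}} .{{_ : NonZero k}} →
  ∑₁ (g * k) (λ d → δ ℕ._≟_ (gcd d (g * k)) g) ≡ fromℕ (φ k)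
totient-fibre g k = begin
  ∑₁ (g * k) (λ d → δ ℕ._≟_ (gcd d (g * k)) g) ≡⟨ ∑-ext (range1 (g * k)) (λ d → sym (·-identityʳ _)) ⟩
  ∑₁ (g * k) (λ d → 𝟙 (does (big? d)) · 1ℚ) ≡⟨ ∑-filter big? (range1 (g * k)) (λ _ → 1ℚ) ⟨
  ∑ (filter big? (range1 (g * k))) (λ _ → 1ℚ) ≡⟨ ∑-const1 (filter big? (range1 (g * k))) ⟩
  fromℕ (length (filter big? (range1 (g * k)))) ≡⟨ cong fromℕ (↭-length perm) ⟩
  fromℕ (length (map (g *_) (filter small? (range1 k)))) ≡⟨ cong fromℕ (length-map (g *_) (filter small? (range1 k))) ⟩
  fromℕ (φ k) ∎
  where
  big? : ∀ d → Dec (gcd d (g * k) ≡ g)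
  big? d = gcd d (g * k) ℕ.≟ g
  small? : ∀ d → Dec (gcd d k ≡ 1)
  small? d = gcd d k ℕ.≟ 1
  to : ∀ {d} → d ∈ filter big? (range1 (g * k)) → d ∈ map (g *_) (filter small? (range1 k))
  to {d} d∈ with ∈-filter⁻ big? {xs = range1 (g * k)} d∈
  ... | d∈r , gcd≡ with subst (_∣ d) gcd≡ (gcd[m,n]∣m d (g * k))
  ... | divides e refl = subst (_∈ map (g *_) (filter small? (range1 k))) (*-comm g e)
      (∈-map⁺ (g *_) (∈-filter⁺ small? (≤⇒range1 1≤e e≤k) gcd1))
    where
    1≤e : 1 ≤ e
    1≤e = n≢0⇒n>0 λ { refl → 1+n≰n (proj₁ (range1⇒≤ d∈r)) }
    e≤k : e ≤ k
    e≤k = *-cancelˡ-≤ g (≤-trans (≤-reflexive (*-comm g e)) (proj₂ (range1⇒≤ d∈r)))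
    gcd1 : gcd e k ≡ 1
    gcd1 = *-cancelˡ-≡ (gcd e k) 1 g (trans (c*gcd[m,n]≡gcd[cm,cn] g e k)
      (trans (cong (λ z → gcd z (g * k)) (*-comm g e)) (trans gcd≡ (sym (*-identityʳ g)))))
  from : ∀ {d} → d ∈ map (g *_) (filter small? (range1 k)) → d ∈ filter big? (range1 (g * k))
  from d∈ with ∈-map⁻ (g *_) d∈
  ... | e , e∈ , refl with ∈-filter⁻ small? {xs = range1 k} e∈
  ... | e∈r , gcd≡ = ∈-filter⁺ big?
      (≤⇒range1 (*-mono-≤ (>-nonZero⁻¹ g) (proj₁ (range1⇒≤ e∈r))) (*-monoʳ-≤ g (proj₂ (range1⇒≤ e∈r))))
      (trans (sym (c*gcd[m,n]≡gcd[cm,cn] g e k)) (trans (cong (g *_) gcd≡) (*-identityʳ g)))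
  perm : filter big? (range1 (g * k)) ↭ map (g *_) (filter small? (range1 k))
  perm = Unique-set⇒↭ (Uniqueₚ.filter⁺ big? (range1-Unique (g * k)))
    (Uniqueₚ.map⁺ (λ {x} {y} → *-cancelˡ-≡ x y g) (Uniqueₚ.filter⁺ small? (range1-Unique k))) to from

-- The divisors g are sought up to a bound n independent of L, so that the sum over g can later be
-- exchanged with a sum over L.
∑-gcd : ∀ n L .{{_ : NonZero L}} → L ≤ n → (f : ℕ → ℚ) →
  ∑₁ L (λ d → f (gcd d L)) ≡ ∑₁ n (λ g → 𝟙 (does (g ∣? L)) · (fromℕ (φ (L /ℕ g)) · f g))
∑-gcd n L L≤n f = begin
  ∑₁ L (λ d → f (gcd d L))
    ≡⟨ ∑-cong (range1 L) (λ {d} d∈ → sym (∑-δ ℕ._≟_ (gcd d L) f (range1-Unique n) (gcd∈ d))) ⟩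
  ∑₁ L (λ d → ∑₁ n (λ g → δ ℕ._≟_ g (gcd d L) · f g))
    ≡⟨ ∑-swap (range1 L) (range1 n) (λ d g → δ ℕ._≟_ g (gcd d L) · f g) ⟩
  ∑₁ n (λ g → ∑₁ L (λ d → δ ℕ._≟_ g (gcd d L) · f g))
    ≡⟨ ∑-cong (range1 n) (λ {g} g∈ → trans (∑-*ʳ (range1 L) (f g) _) (trans (cong (_· f g) (fibre g g∈)) (·-assoc (𝟙 (does (g ∣? L))) (fromℕ (φ (L /ℕ g))) (f g)))) ⟩
  ∑₁ n (λ g → 𝟙 (does (g ∣? L)) · (fromℕ (φ (L /ℕ g)) · f g)) ∎
  where
  gcd∈ : ∀ d → gcd d L ∈ range1 n
  gcd∈ d = ≤⇒range1 (n≢0⇒n>0 λ e → ℕ.≢-nonZero⁻¹ L (0∣⇒0 (subst (_∣ L) e (gcd[m,n]∣n d L)))) (≤-trans (∣⇒≤ (gcd[m,n]∣n d L)) L≤n)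
    where
    0∣⇒0 : ∀ {n} → 0 ∣ n → n ≡ 0
    0∣⇒0 (divides q e) = trans e (*-zeroʳ q)
  sym-δ : ∀ x y → δ ℕ._≟_ x y ≡ δ ℕ._≟_ y x
  sym-δ x y with x ℕ.≟ y
  ... | yes refl = refl
  ... | no x≢y = trans (δ-≢ ℕ._≟_ x≢y) (sym (δ-≢ ℕ._≟_ (x≢y ∘ sym)))
  fibre′ : ∀ g k .{{_ : NonZero g}} .{{_ : NonZero k}} →
    ∑₁ (k * g) (λ d → δ ℕ._≟_ g (gcd d (k * g))) ≡ fromℕ (φ ((k * g) /ℕ g))
  fibre′ g k = trans (∑-ext (range1 (k * g)) (λ d → sym-δ g (gcd d (k * g))))
    (trans (cong (λ n → ∑₁ n (λ d → δ ℕ._≟_ (gcd d n) g)) (*-comm k g))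
    (trans (totient-fibre g k) (cong (λ n → fromℕ (φ n)) (sym (/ℕ-* k g)))))
  fibre″ : ∀ g k L .{{_ : NonZero g}} .{{_ : NonZero L}} → L ≡ k * g →
    ∑₁ L (λ d → δ ℕ._≟_ g (gcd d L)) ≡ fromℕ (φ (L /ℕ g))
  fibre″ g k _ {{g≢0}} refl = fibre′ g k {{g≢0}} {{m*n≢0⇒m≢0 k}}
  fibre-dec : ∀ g → g ∈ range1 n → (g∣?L : Dec (g ∣ L)) →
    ∑₁ L (λ d → δ ℕ._≟_ g (gcd d L)) ≡ 𝟙 (does g∣?L) · fromℕ (φ (L /ℕ g))
  fibre-dec g g∈ (no ∤L) =
    trans (∑-zero (range1 L) λ {d} _ → δ-≢ ℕ._≟_ {g} {gcd d L} λ e → ∤L (subst (_∣ L) (sym e) (gcd[m,n]∣n d L)))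
          (sym (·-zeroˡ (fromℕ (φ (L /ℕ g)))))
  fibre-dec g g∈ (yes (divides k e)) =
    trans (fibre″ g k L {{>-nonZero (proj₁ (range1⇒≤ g∈))}} e) (sym (·-identityˡ (fromℕ (φ (L /ℕ g)))))
  fibre : ∀ g → g ∈ range1 n → ∑₁ L (λ d → δ ℕ._≟_ g (gcd d L)) ≡ 𝟙 (does (g ∣? L)) · fromℕ (φ (L /ℕ g))
  fibre g g∈ = fibre-dec g g∈ (g ∣? L)

-- Enumeration of forests and of words by leaves

data Tree (X : Set) : Set where
  leaf : Tree X
  node : X → Tree X → Tree X → Tree X

leaves : ∀ {X} → Tree X → ℕ
leaves leaf = 1
leaves (node _ l r) = leaves l + leaves r

cherries : ∀ {X} → Tree X → ℕ
cherries leaf = 0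
cherries (node _ leaf leaf) = 1
cherries (node _ l@leaf r@(node _ _ _)) = cherries l + cherries r
cherries (node _ l@(node _ _ _) r) = cherries l + cherries r

-- A shape encodes an attachment Maybe RA: leaf is nothing, and the two children of a node are the
-- parts on the arrow out of and into its vertex. Leaves count r₁ + 2 r₂ and cherries count r₂.
Shape : Set
Shape = Tree ⊤

Letter : Set
Letter = Bool × Shape

Word : Set
Word = List Letter

Forest : Set
Forest = List Shape

1≤leaves : ∀ {X} (t : Tree X) → 1 ≤ leaves t
1≤leaves leaf = ≤-refl
1≤leaves (node _ l r) = ≤-trans (1≤leaves l) (m≤m+n (leaves l) (leaves r))

_≟ˢ_ : DecidableEquality Shape
leaf ≟ˢ leaf = yes refl
leaf ≟ˢ node _ _ _ = no λ ()
node _ _ _ ≟ˢ leaf = no λ ()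
node tt l r ≟ˢ node tt l' r' with l ≟ˢ l' | r ≟ˢ r'
... | yes refl | yes refl = yes refl
... | no l≢ | _ = no λ { refl → l≢ refl }
... | _ | no r≢ = no λ { refl → r≢ refl }

_≟ᵂ_ : DecidableEquality Word
_≟ᵂ_ = ≡-dec (×-≡-dec Bool._≟_ _≟ˢ_)

-- Spelled like the summand of `sumOver`, so that counts along a word agree with the parameters of a
-- realization by computation.
pick : Bool → Bool → ℕ → ℕ
pick b c n = if c then (if b then n else 0) else (if b then 0 else n)

sumAt : Bool → (Shape → ℕ) → Word → ℕ
sumAt b f [] = 0
sumAt b f ((c , t) ∷ w) = pick b c (f t) + sumAt b f w

sumᶠ : (Shape → ℕ) → Forest → ℕ
sumᶠ f [] = 0
sumᶠ f (t ∷ F) = f t + sumᶠ f F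

length≤leaves : ∀ F → length F ≤ sumᶠ leaves F
length≤leaves [] = z≤n
length≤leaves (t ∷ F) = +-mono-≤ (1≤leaves t) (length≤leaves F)

Unique-map-∈ : ∀ {A B : Set} (f : A → B) {xs} →
  (∀ {x y} → x ∈ xs → y ∈ xs → f x ≡ f y → x ≡ y) → Unique xs → Unique (map f xs)
Unique-map-∈ f inj [] = []
Unique-map-∈ f {x ∷ xs} inj (px ∷ u) =
  Allₚ.map⁺ (All.tabulate λ y∈ eq → All.lookup px y∈ (inj (here refl) (there y∈) eq)) ∷
  Unique-map-∈ f (λ a b → inj (there a) (there b)) u

-- The inverse of removing the root of the first tree, which adds one tree and keeps all leaves.
-- `forests` recurses along this removal, whereby the excess of leaves over trees drops by one.
joinTop : Forest → Forest
joinTop (l ∷ r ∷ F) = node tt l r ∷ F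
joinTop F = F

-- forests ℓ e lists the forests of ℓ trees with ℓ + e leaves in total.
forests : ℕ → ℕ → List Forest
forests zero zero = [ [] ]
forests zero (suc e) = []
forests (suc ℓ) zero = map (leaf ∷_) (forests ℓ zero)
forests (suc ℓ) (suc e) = map (leaf ∷_) (forests ℓ (suc e)) ++ map joinTop (forests (suc (suc ℓ)) e)

Sound : ℕ → ℕ → List Forest → Set
Sound ℓ e Fs = ∀ {F} → F ∈ Fs → length F ≡ ℓ × sumᶠ leaves F ≡ ℓ + e

leaf-sound : ∀ {ℓ e Fs} → Sound ℓ e Fs → Sound (suc ℓ) e (map (leaf ∷_) Fs)
leaf-sound sound F∈ with ∈-map⁻ (leaf ∷_) F∈
... | F' , F'∈ , refl = let p , q = sound F'∈ in cong suc p , cong suc q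

join-sound : ∀ {ℓ e Fs} → Sound (suc (suc ℓ)) e Fs → Sound (suc ℓ) (suc e) (map joinTop Fs)
join-sound {ℓ} {e} sound F∈ with ∈-map⁻ joinTop F∈
... | l ∷ r ∷ F' , F'∈ , refl = let p , q = sound F'∈ in
  suc-injective p , trans (+-assoc (leaves l) (leaves r) _) (trans q (cong suc (sym (+-suc ℓ e))))
... | [] , F'∈ , refl with () ← proj₁ (sound F'∈)
... | _ ∷ [] , F'∈ , refl with () ← proj₁ (sound F'∈)

forests-sound : ∀ ℓ e {F} → F ∈ forests ℓ e → length F ≡ ℓ × sumᶠ leaves F ≡ ℓ + e
forests-sound zero zero (here refl) = refl , refl
forests-sound (suc ℓ) zero F∈ = leaf-sound (forests-sound ℓ zero) F∈
forests-sound (suc ℓ) (suc e) F∈ =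
  [ leaf-sound (forests-sound ℓ (suc e)) , join-sound (forests-sound (suc (suc ℓ)) e) ]′
    (∈-++⁻ (map (leaf ∷_) (forests ℓ (suc e))) F∈)

forests-complete : ∀ ℓ e F → length F ≡ ℓ → sumᶠ leaves F ≡ ℓ + e → F ∈ forests ℓ e
forests-complete zero zero [] refl q = here refl
forests-complete (suc ℓ) zero (leaf ∷ F) p q =
  ∈-map⁺ (leaf ∷_) (forests-complete ℓ zero F (suc-injective p) (suc-injective q))
forests-complete (suc ℓ) zero (node tt l r ∷ F) p q = contradiction
  (≤-trans (length≤leaves (l ∷ r ∷ F)) (≤-reflexive (trans (sym (+-assoc (leaves l) (leaves r) _))
    (trans q (trans (+-identityʳ (suc ℓ)) (sym p)))))) 1+n≰n
forests-complete (suc ℓ) (suc e) (leaf ∷ F) p q =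
  ∈-++⁺ˡ (∈-map⁺ (leaf ∷_) (forests-complete ℓ (suc e) F (suc-injective p) (suc-injective q)))
forests-complete (suc ℓ) (suc e) (node tt l r ∷ F) p q =
  ∈-++⁺ʳ (map (leaf ∷_) (forests ℓ (suc e))) (∈-map⁺ joinTop (forests-complete (suc (suc ℓ)) e (l ∷ r ∷ F) (cong suc p)
    (trans (sym (+-assoc (leaves l) (leaves r) _)) (trans q (cong suc (+-suc ℓ e))))))

forests-Unique : ∀ ℓ e → Unique (forests ℓ e)
forests-Unique zero zero = [] ∷ []
forests-Unique zero (suc e) = []
forests-Unique (suc ℓ) zero = Uniqueₚ.map⁺ ∷-injectiveʳ (forests-Unique ℓ zero)
forests-Unique (suc ℓ) (suc e) = Uniqueₚ.++⁺
  (Uniqueₚ.map⁺ ∷-injectiveʳ (forests-Unique ℓ (suc e)))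
  (Unique-map-∈ joinTop inj (forests-Unique (suc (suc ℓ)) e))
  disjoint
  where
  two : ∀ {F} → F ∈ forests (suc (suc ℓ)) e → Σ Shape λ l → Σ Shape λ r → Σ Forest λ F' → F ≡ l ∷ r ∷ F'
  two {l ∷ r ∷ F} _ = l , r , F , refl
  two {[]} F∈ with () ← proj₁ (forests-sound (suc (suc ℓ)) e F∈)
  two {_ ∷ []} F∈ with () ← proj₁ (forests-sound (suc (suc ℓ)) e F∈)
  inj : ∀ {F F'} → F ∈ forests (suc (suc ℓ)) e → F' ∈ forests (suc (suc ℓ)) e → joinTop F ≡ joinTop F' → F ≡ F'
  inj F∈ F'∈ eq with two F∈ | two F'∈
  inj F∈ F'∈ refl | l , r , F , refl | _ , _ , _ , refl = refl
  disjoint : ∀ {F} → ¬ (F ∈ map (leaf ∷_) (forests ℓ (suc e)) × F ∈ map joinTop (forests (suc (suc ℓ)) e))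
  disjoint (p , q) with ∈-map⁻ (leaf ∷_) p | ∈-map⁻ joinTop q
  ... | _ , _ , refl | _ , F'∈ , eq with two F'∈
  disjoint (p , q) | _ , _ , refl | _ , F'∈ , () | _ , _ , _ , refl

-- excess ℓ r is r - ℓ, undefined when negative.
excess : ℕ → ℕ → Maybe ℕ
excess zero r = just r
excess (suc ℓ) zero = nothing
excess (suc ℓ) (suc r) = excess ℓ r

excess-just : ∀ ℓ r {e} → excess ℓ r ≡ just e → ℓ + e ≡ r
excess-just zero r refl = refl
excess-just (suc ℓ) (suc r) eq = cong suc (excess-just ℓ r eq)

excess-+ : ∀ ℓ e → excess ℓ (ℓ + e) ≡ just e
excess-+ zero e = refl
excess-+ (suc ℓ) e = excess-+ ℓ e

excess-> : ∀ {ℓ r} → r < ℓ → excess ℓ r ≡ nothing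
excess-> {suc ℓ} {zero} _ = refl
excess-> {suc ℓ} {suc r} (s≤s r<ℓ) = excess-> r<ℓ

forestsOf : ℕ → ℕ → List Forest
forestsOf ℓ r with excess ℓ r
... | just e = forests ℓ e
... | nothing = []

forestsOf-sound : ∀ ℓ r {F} → F ∈ forestsOf ℓ r → length F ≡ ℓ × sumᶠ leaves F ≡ r
forestsOf-sound ℓ r F∈ with excess ℓ r in eq
... | just e = let p , q = forests-sound ℓ e F∈ in p , trans q (excess-just ℓ r eq)

forestsOf-complete : ∀ F → F ∈ forestsOf (length F) (sumᶠ leaves F)
forestsOf-complete F with excess (length F) (sumᶠ leaves F) in eq
... | just e = forests-complete (length F) e F refl (sym (excess-just (length F) _ eq))
... | nothing with m≤n⇒∃[o]m+o≡n (length≤leaves F)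
... | o , e with () ← trans (sym eq) (trans (cong (excess (length F)) (sym e)) (excess-+ (length F) o))

forestsOf-Unique : ∀ ℓ r → Unique (forestsOf ℓ r)
forestsOf-Unique ℓ r with excess ℓ r
... | just e = forests-Unique ℓ e
... | nothing = []

module _ (r s : ℕ) where

  State : Set
  State = Word × Forest × Forest

  -- A spare tree becomes the next letter. Orientations are thus chosen one at a time while the
  -- trees are still kept as two forests, and the number of words becomes a sum of products of
  -- forest counts.
  takeᶠ takeᵗ : State → State
  takeᶠ (w , t ∷ F , G) = (false , t) ∷ w , F , G
  takeᶠ (w , [] , G) = w , [] , G
  takeᵗ (w , F , t ∷ G) = (true , t) ∷ w , F , G
  takeᵗ (w , F , []) = w , F , []

  -- states L ℓ m lists the words of length L together with ℓ and m spare trees for the anti-clockwise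
  -- and the clockwise letters, r and s leaves in total.
  states : ℕ → ℕ → ℕ → List (Word × Forest × Forest)
  states zero ℓ m = map ([] ,_) (cartesianProduct (forestsOf ℓ r) (forestsOf m s))
  states (suc L) ℓ m = map takeᶠ (states L (suc ℓ) m) ++ map takeᵗ (states L ℓ (suc m))

  IsState : ℕ → ℕ → ℕ → Word × Forest × Forest → Set
  IsState L ℓ m (w , F , G) = length w ≡ L × length F ≡ ℓ × length G ≡ m ×
    sumAt false leaves w + sumᶠ leaves F ≡ r × sumAt true leaves w + sumᶠ leaves G ≡ s

  private
    move : ∀ a b c → (b + a) + c ≡ a + (b + c)
    move = ℕ-Ring.solve-∀

  states-sound : ∀ L ℓ m {x} → x ∈ states L ℓ m → IsState L ℓ m x
  states-sound zero ℓ m x∈ with ∈-map⁻ ([] ,_) x∈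
  ... | (F , G) , FG∈ , refl with ∈-cartesianProduct⁻ (forestsOf ℓ r) (forestsOf m s) FG∈
  ... | F∈ , G∈ = let p , q = forestsOf-sound ℓ r F∈ ; p' , q' = forestsOf-sound m s G∈ in refl , p , p' , q , q'
  states-sound (suc L) ℓ m x∈ with ∈-++⁻ (map takeᶠ (states L (suc ℓ) m)) x∈
  ... | inj₁ x∈₁ with ∈-map⁻ takeᶠ x∈₁
  ... | (w , t ∷ F , G) , y∈ , refl = let a , b , c , d , e = states-sound L (suc ℓ) m y∈ in
            cong suc a , suc-injective b , c , trans (move (sumAt false leaves w) (leaves t) (sumᶠ leaves F)) d , e
  ... | (w , [] , G) , y∈ , refl with () ← proj₁ (proj₂ (states-sound L (suc ℓ) m y∈))
  states-sound (suc L) ℓ m x∈ | inj₂ x∈₂ with ∈-map⁻ takeᵗ x∈₂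
  ... | (w , F , t ∷ G) , y∈ , refl = let a , b , c , d , e = states-sound L ℓ (suc m) y∈ in
            cong suc a , b , suc-injective c , d , trans (move (sumAt true leaves w) (leaves t) (sumᶠ leaves G)) e
  ... | (w , F , []) , y∈ , refl with () ← proj₁ (proj₂ (proj₂ (states-sound L ℓ (suc m) y∈)))

  states-complete : ∀ L ℓ m {x} → IsState L ℓ m x → x ∈ states L ℓ m
  states-complete zero ℓ m {[] , F , G} (refl , refl , refl , refl , refl) =
    ∈-map⁺ ([] ,_) (∈-cartesianProduct⁺ (forestsOf-complete F) (forestsOf-complete G))
  states-complete (suc L) ℓ m {(false , t) ∷ w , F , G} (a , b , c , d , e) =
    ∈-++⁺ˡ (∈-map⁺ takeᶠ (states-complete L (suc ℓ) m {w , t ∷ F , G}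
      (suc-injective a , cong suc b , c , trans (sym (move (sumAt false leaves w) (leaves t) (sumᶠ leaves F))) d , e)))
  states-complete (suc L) ℓ m {(true , t) ∷ w , F , G} (a , b , c , d , e) =
    ∈-++⁺ʳ (map takeᶠ (states L (suc ℓ) m)) (∈-map⁺ takeᵗ (states-complete L ℓ (suc m) {w , F , t ∷ G}
      (suc-injective a , b , cong suc c , d , trans (sym (move (sumAt true leaves w) (leaves t) (sumᶠ leaves G))) e)))

  states-Unique : ∀ L ℓ m → Unique (states L ℓ m)
  states-Unique zero ℓ m = Uniqueₚ.map⁺ ,-injectiveʳ (Uniqueₚ.cartesianProduct⁺ (forestsOf-Unique ℓ r) (forestsOf-Unique m s))
  states-Unique (suc L) ℓ m = Uniqueₚ.++⁺
    (Unique-map-∈ takeᶠ injᶠ (states-Unique L (suc ℓ) m)) (Unique-map-∈ takeᵗ injᵗ (states-Unique L ℓ (suc m))) disjoint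
    where
    consᶠ : ∀ {x} → x ∈ states L (suc ℓ) m → ∃ λ t → ∃ λ F → proj₁ (proj₂ x) ≡ t ∷ F
    consᶠ {_ , t ∷ F , _} _ = t , F , refl
    consᶠ {_ , [] , _} x∈ with () ← proj₁ (proj₂ (states-sound L (suc ℓ) m x∈))
    consᵗ : ∀ {x} → x ∈ states L ℓ (suc m) → ∃ λ t → ∃ λ F → proj₂ (proj₂ x) ≡ t ∷ F
    consᵗ {_ , _ , t ∷ F} _ = t , F , refl
    consᵗ {_ , _ , []} x∈ with () ← proj₁ (proj₂ (proj₂ (states-sound L ℓ (suc m) x∈)))
    injᶠ : ∀ {x y} → x ∈ states L (suc ℓ) m → y ∈ states L (suc ℓ) m → takeᶠ x ≡ takeᶠ y → x ≡ y
    injᶠ x∈ y∈ eq with consᶠ x∈ | consᶠ y∈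
    injᶠ {w , t ∷ F , G} {_ , _ ∷ _ , _} x∈ y∈ refl | _ | _ = refl
    injᵗ : ∀ {x y} → x ∈ states L ℓ (suc m) → y ∈ states L ℓ (suc m) → takeᵗ x ≡ takeᵗ y → x ≡ y
    injᵗ x∈ y∈ eq with consᵗ x∈ | consᵗ y∈
    injᵗ {w , F , t ∷ G} {_ , _ , _ ∷ _} x∈ y∈ refl | _ | _ = refl
    disjoint : ∀ {x} → ¬ (x ∈ map takeᶠ (states L (suc ℓ) m) × x ∈ map takeᵗ (states L ℓ (suc m)))
    disjoint (p , q) with ∈-map⁻ takeᶠ p | ∈-map⁻ takeᵗ q
    ... | y , y∈ , refl | z , z∈ , eq with consᶠ y∈ | consᵗ z∈
    disjoint (p , q) | (_ , _ ∷ _ , _) , y∈ , refl | (_ , _ , _ ∷ _) , z∈ , () | _ | _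

  words : ℕ → List Word
  words L = map proj₁ (states L 0 0)

  IsWord : ℕ → Word → Set
  IsWord L w = length w ≡ L × sumAt false leaves w ≡ r × sumAt true leaves w ≡ s

  words-sound : ∀ L {w} → w ∈ words L → IsWord L w
  words-sound L w∈ with ∈-map⁻ proj₁ w∈
  ... | (w , F , G) , x∈ , refl with states-sound L 0 0 x∈
  words-sound L w∈ | (w , [] , []) , x∈ , refl | a , _ , _ , d , e =
    a , trans (sym (+-identityʳ _)) d , trans (sym (+-identityʳ _)) e

  words-complete : ∀ L {w} → IsWord L w → w ∈ words L
  words-complete L {w} (a , d , e) = ∈-map⁺ proj₁ (states-complete L 0 0 {w , [] , []}
    (a , refl , refl , trans (+-identityʳ _) d , trans (+-identityʳ _) e))

  words-Unique : ∀ L → Unique (words L)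
  words-Unique L = Unique-map-∈ proj₁ inj (states-Unique L 0 0)
    where
    inj : ∀ {x y} → x ∈ states L 0 0 → y ∈ states L 0 0 → proj₁ x ≡ proj₁ y → x ≡ y
    inj {_ , F , G} {_ , F' , G'} x∈ y∈ refl with states-sound L 0 0 x∈ | states-sound L 0 0 y∈
    inj {_ , [] , []} {_ , [] , []} x∈ y∈ refl | _ | _ = refl

  -- Conditions on cherries enter as predicates for the two sides: equality with prescribed numbers
  -- for the derived equivalence classes, `always` for the mutation classes.
  test : (p q : ℕ → Bool) → Word × Forest × Forest → ℚ
  test p q (w , F , G) = 𝟙 (p (sumAt false cherries w + sumᶠ cherries F)) · 𝟙 (q (sumAt true cherries w + sumᶠ cherries G))

  test-takeᶠ : ∀ p q {w t F G} → test p q (takeᶠ (w , t ∷ F , G)) ≡ test p q (w , t ∷ F , G)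
  test-takeᶠ p q {w} {t} {F} {G} =
    cong (λ z → 𝟙 (p z) · 𝟙 (q (sumAt true cherries w + sumᶠ cherries G))) (move (sumAt false cherries w) (cherries t) (sumᶠ cherries F))
  test-takeᵗ : ∀ p q {w t F G} → test p q (takeᵗ (w , F , t ∷ G)) ≡ test p q (w , F , t ∷ G)
  test-takeᵗ p q {w} {t} {F} {G} =
    cong (λ z → 𝟙 (p (sumAt false cherries w + sumᶠ cherries F)) · 𝟙 (q z)) (move (sumAt true cherries w) (cherries t) (sumᶠ cherries G))

  ∑-states-suc : ∀ p q L ℓ m →
    ∑ (states (suc L) ℓ m) (test p q) ≡ ∑ (states L (suc ℓ) m) (test p q) ⊕ ∑ (states L ℓ (suc m)) (test p q)
  ∑-states-suc p q L ℓ m = trans (∑-++ (map takeᶠ (states L (suc ℓ) m)) (map takeᵗ (states L ℓ (suc m))) (test p q))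
    (cong₂ _⊕_ (trans (∑-map takeᶠ (states L (suc ℓ) m) (test p q)) (∑-cong (states L (suc ℓ) m) stepᶠ))
                 (trans (∑-map takeᵗ (states L ℓ (suc m)) (test p q)) (∑-cong (states L ℓ (suc m)) stepᵗ)))
    where
    stepᶠ : ∀ {x} → x ∈ states L (suc ℓ) m → test p q (takeᶠ x) ≡ test p q x
    stepᶠ {w , t ∷ F , G} _ = test-takeᶠ p q {w} {t} {F} {G}
    stepᶠ {w , [] , G} x∈ with () ← proj₁ (proj₂ (states-sound L (suc ℓ) m x∈))
    stepᵗ : ∀ {x} → x ∈ states L ℓ (suc m) → test p q (takeᵗ x) ≡ test p q x
    stepᵗ {w , F , t ∷ G} _ = test-takeᵗ p q {w} {t} {F} {G}
    stepᵗ {w , F , []} x∈ with () ← proj₁ (proj₂ (proj₂ (states-sound L ℓ (suc m) x∈)))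

-- Coefficients of the tree series

at : Maybe ℕ → (ℕ → ℚ) → ℚ
at (just e) f = f e
at nothing f = 0ℚ

-- The sum over i + j = n, as in the coefficient of a Cauchy product.
anti : ℕ → (ℕ → ℕ → ℚ) → ℚ
anti zero f = f 0 0
anti (suc n) f = f 0 (suc n) ⊕ anti n (λ i j → f (suc i) j)

anti-ext : ∀ n {f g : ℕ → ℕ → ℚ} → (∀ i j → f i j ≡ g i j) → anti n f ≡ anti n g
anti-ext zero eq = eq 0 0
anti-ext (suc n) eq = cong₂ _⊕_ (eq 0 (suc n)) (anti-ext n (λ i j → eq (suc i) j))

anti-+ : ∀ n (f g : ℕ → ℕ → ℚ) → anti n (λ i j → f i j ⊕ g i j) ≡ anti n f ⊕ anti n g
anti-+ zero f g = refl
anti-+ (suc n) f g = trans (cong ((f 0 (suc n) ⊕ g 0 (suc n)) ⊕_) (anti-+ n _ _))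
  (mid4 (f 0 (suc n)) (g 0 (suc n)) (anti n (λ i j → f (suc i) j)) (anti n (λ i j → g (suc i) j)))
  where
  mid4 : ∀ a b c d → (a ⊕ b) ⊕ (c ⊕ d) ≡ (a ⊕ c) ⊕ (b ⊕ d)
  mid4 = solve-∀ ℚ-ring

anti-neg : ∀ n (f : ℕ → ℕ → ℚ) → anti n (λ i j → ℚ.- f i j) ≡ ℚ.- anti n f
anti-neg zero f = refl
anti-neg (suc n) f = trans (cong (ℚ.- f 0 (suc n) ⊕_) (anti-neg n _)) (sym (ℚₚ.neg-distrib-+ (f 0 (suc n)) _))

sucˡ sucʳ : (ℕ → ℕ → ℚ) → ℕ → ℕ → ℚ
sucˡ h zero j = 0ℚ
sucˡ h (suc i) j = h i j
sucʳ h i zero = 0ℚ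
sucʳ h i (suc j) = h i j

anti-sucˡ : ∀ n h → anti (suc n) (sucˡ h) ≡ anti n h
anti-sucˡ n h = ⊕-identityˡ (anti n h)

anti-sucʳ : ∀ n h → anti (suc n) (sucʳ h) ≡ anti n h
anti-sucʳ zero h = ⊕-identityʳ (h 0 0)
anti-sucʳ (suc n) h = cong (h 0 (suc n) ⊕_) (trans (anti-ext (suc n) shift) (anti-sucʳ n (λ i j → h (suc i) j)))
  where
  shift : ∀ i j → sucʳ h (suc i) j ≡ sucʳ (λ i' j' → h (suc i') j') i j
  shift i zero = refl
  shift i (suc j) = refl

-- excessPoly p i d is the coefficient, with the cherries filtered by p, of the terms of total excess d in
-- (x + y - x²)ⁱ, where x, y and x² stand for a leaf, a cherry and two leaves.
excessPoly : (ℕ → Bool) → ℕ → ℕ → ℚ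
excessPoly p zero zero = 𝟙 (p 0)
excessPoly p zero (suc d) = 0ℚ
excessPoly p (suc i) zero = excessPoly p i zero
excessPoly p (suc i) (suc d) = excessPoly p i (suc d) ⊕ (excessPoly (p ∘ suc) i d ⊖ excessPoly p i d)

-- With u = x + u², these are the coefficients of x^(l+e) in u^l/(1-2u) and in u^l.
central ballot : ℕ → ℕ → ℚ
central l e = fromℕ ((l + 2 * e) C e)
ballot l zero = central l zero
ballot l (suc e) = central l (suc e) ⊖ fromℕ 2 · central (suc l) e

central-zero : ∀ l → central l 0 ≡ 1ℚ
central-zero l = cong fromℕ (nC0≡1 (l + 0))
  where
  nC0≡1 : ∀ n → n C 0 ≡ 1
  nC0≡1 n = trans (nCk≡nC[n∸k] {0} {n} z≤n) (nCn≡1 n)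

-- Pascal's rule, which for the series reads u^(l+1) = x u^l + u^(l+2), divided by 1 - 2u.
central-suc : ∀ l e → central (suc l) (suc e) ≡ central l (suc e) ⊕ central (suc (suc l)) e
central-suc l e = trans (cong fromℕ pascal) (fromℕ-+ ((l + 2 * suc e) C suc e) ((2 + l + 2 * e) C e))
  where
  shift : ∀ l e → l + 2 * suc e ≡ 2 + l + 2 * e
  shift = ℕ-Ring.solve-∀
  pascal : (suc l + 2 * suc e) C suc e ≡ (l + 2 * suc e) C suc e + (2 + l + 2 * e) C e
  pascal = trans (sym (nCk+nC[k+1]≡[n+1]C[k+1] (l + 2 * suc e) e))
    (trans (+-comm ((l + 2 * suc e) C e) ((l + 2 * suc e) C suc e))
           (cong (λ n → (l + 2 * suc e) C suc e + n C e) (shift l e)))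

ballot-suc : ∀ l e → ballot (suc l) (suc e) ≡ ballot l (suc e) ⊕ ballot (suc (suc l)) e
ballot-suc l zero = begin
  central (suc l) 1 ⊖ two · central (suc (suc l)) 0
    ≡⟨ cong₂ (λ x y → x ⊖ two · y) (central-suc l 0) (trans (central-zero (suc (suc l))) (sym (central-zero (suc l)))) ⟩
  (central l 1 ⊕ central (suc (suc l)) 0) ⊖ two · central (suc l) 0
    ≡⟨ comm3 (central l 1) (central (suc (suc l)) 0) (two · central (suc l) 0) ⟩
  (central l 1 ⊖ two · central (suc l) 0) ⊕ central (suc (suc l)) 0 ∎
  where
  two = fromℕ 2
  comm3 : ∀ a b c → (a ⊕ b) ⊖ c ≡ (a ⊖ c) ⊕ b
  comm3 = solve-∀ ℚ-ring
ballot-suc l (suc e) = begin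
  central (suc l) (suc (suc e)) ⊖ two · central (suc (suc l)) (suc e)
    ≡⟨ cong₂ (λ x y → x ⊖ two · y) (central-suc l (suc e)) (central-suc (suc l) e) ⟩
  (central l (suc (suc e)) ⊕ central (suc (suc l)) (suc e)) ⊖ two · (central (suc l) (suc e) ⊕ central (suc (suc (suc l))) e)
    ≡⟨ rearrange (central l (suc (suc e))) (central (suc (suc l)) (suc e)) two (central (suc l) (suc e)) (central (suc (suc (suc l))) e) ⟩
  (central l (suc (suc e)) ⊖ two · central (suc l) (suc e)) ⊕ (central (suc (suc l)) (suc e) ⊖ two · central (suc (suc (suc l))) e) ∎
  where
  two = fromℕ 2
  rearrange : ∀ a b t c d → (a ⊕ b) ⊖ t · (c ⊕ d) ≡ (a ⊖ t · c) ⊕ (b ⊖ t · d)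
  rearrange = solve-∀ ℚ-ring

-- The relation u = x + u² turned into a recurrence that determines such a family up to its values at l = 0.
record IsTreeLike (f : (ℕ → Bool) → ℕ → ℕ → ℚ) : Set where
  field
    at-00 : ∀ p → f p 0 0 ≡ 𝟙 (p 0)
    at-s0 : ∀ p l → f p (suc l) 0 ≡ f p l 0
    at-ss : ∀ p l e → f p (suc l) (suc e) ≡
      (f p l (suc e) ⊕ f p (suc (suc l)) e) ⊕ (f (p ∘ suc) l e ⊖ f p l e)

-- Substitution: `κ l e'` is the coefficient of the power l + e' of a variable that is replaced by x
-- + y - x², and that power contributes its terms of the remaining excess d = e - e'.
combine : (ℕ → ℕ → ℚ) → (ℕ → Bool) → ℕ → ℕ → ℚ
combine κ p l e = anti e (λ e' d → κ l e' · excessPoly p (l + e') d)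

-- Both factors are unfolded at once: κ by its own recurrence, the power by splitting off one factor
-- x + y - x². Some of the resulting terms are missing where e' or d is 0; `sucˡ` and `sucʳ` pad
-- them by 0 so that all four sums run over the same antidiagonal.
combine-treeLike : ∀ κ → (∀ l → κ l 0 ≡ 1ℚ) → (∀ l e → κ (suc l) (suc e) ≡ κ l (suc e) ⊕ κ (suc (suc l)) e) →
  IsTreeLike (combine κ)
combine-treeLike κ κ0 κs = record { at-00 = at-00 ; at-s0 = at-s0 ; at-ss = at-ss }
  where
  at-00 : ∀ p → κ 0 0 · 𝟙 (p 0) ≡ 𝟙 (p 0)
  at-00 p = trans (cong (_· 𝟙 (p 0)) (κ0 0)) (·-identityˡ (𝟙 (p 0)))
  at-s0 : ∀ p l → combine κ p (suc l) 0 ≡ combine κ p l 0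
  at-s0 p l = cong (_· excessPoly p (l + 0) 0) (trans (κ0 (suc l)) (sym (κ0 l)))
  at-ss : ∀ p l e → combine κ p (suc l) (suc e) ≡
    (combine κ p l (suc e) ⊕ combine κ p (suc (suc l)) e) ⊕ (combine κ (p ∘ suc) l e ⊖ combine κ p l e)
  at-ss p l e = begin
    anti (suc e) (λ e' d → κ (suc l) e' · excessPoly p (suc l + e') d)
      ≡⟨ anti-ext (suc e) pointwise ⟩
    anti (suc e) (λ e' d → (f₁ e' d ⊕ sucˡ f₂ e' d) ⊕ (sucʳ f₃ e' d ⊕ ℚ.- sucʳ f₄ e' d))
      ≡⟨ anti-+ (suc e) (λ e' d → f₁ e' d ⊕ sucˡ f₂ e' d) (λ e' d → sucʳ f₃ e' d ⊕ ℚ.- sucʳ f₄ e' d) ⟩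
    anti (suc e) (λ e' d → f₁ e' d ⊕ sucˡ f₂ e' d) ⊕ anti (suc e) (λ e' d → sucʳ f₃ e' d ⊕ ℚ.- sucʳ f₄ e' d)
      ≡⟨ cong₂ _⊕_ (trans (anti-+ (suc e) f₁ (sucˡ f₂)) (cong (anti (suc e) f₁ ⊕_) (anti-sucˡ e f₂)))
           (trans (anti-+ (suc e) (sucʳ f₃) (λ e' d → ℚ.- sucʳ f₄ e' d))
                  (cong₂ _⊕_ (anti-sucʳ e f₃) (trans (anti-neg (suc e) (sucʳ f₄)) (cong ℚ.-_ (anti-sucʳ e f₄))))) ⟩
    (anti (suc e) f₁ ⊕ anti e f₂) ⊕ (anti e f₃ ⊖ anti e f₄)
      ≡⟨ cong (λ z → (anti (suc e) f₁ ⊕ z) ⊕ (anti e f₃ ⊖ anti e f₄)) (anti-ext e index) ⟩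
    (combine κ p l (suc e) ⊕ combine κ p (suc (suc l)) e) ⊕ (combine κ (p ∘ suc) l e ⊖ combine κ p l e) ∎
    where
    f₁ f₂ f₃ f₄ : ℕ → ℕ → ℚ
    f₁ e' d = κ l e' · excessPoly p (l + e') d
    f₂ e' d = κ (suc (suc l)) e' · excessPoly p (suc l + suc e') d
    f₃ e' d = κ l e' · excessPoly (p ∘ suc) (l + e') d
    f₄ e' d = κ l e' · excessPoly p (l + e') d
    index : ∀ e' d → f₂ e' d ≡ κ (suc (suc l)) e' · excessPoly p (suc (suc l) + e') d
    index e' d = cong (λ n → κ (suc (suc l)) e' · excessPoly p n d) (+-suc (suc l) e')
    expand : ∀ k a b c → k · (a ⊕ (b ⊖ c)) ≡ (k · a ⊕ 0ℚ) ⊕ (k · b ⊕ ℚ.- (k · c))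
    expand = solve-∀ ℚ-ring
    low : ∀ k a → k · a ≡ (k · a ⊕ 0ℚ) ⊕ (0ℚ ⊕ ℚ.- 0ℚ)
    low = solve-∀ ℚ-ring
    expand′ : ∀ k k' a b c → (k ⊕ k') · (a ⊕ (b ⊖ c)) ≡ (k · a ⊕ k' · (a ⊕ (b ⊖ c))) ⊕ (k · b ⊕ ℚ.- (k · c))
    expand′ = solve-∀ ℚ-ring
    low′ : ∀ k k' a → (k ⊕ k') · a ≡ (k · a ⊕ k' · a) ⊕ (0ℚ ⊕ ℚ.- 0ℚ)
    low′ = solve-∀ ℚ-ring
    down : ∀ d → κ (suc l) 0 · d ≡ κ l 0 · d
    down d = cong (_· d) (trans (κ0 (suc l)) (sym (κ0 l)))
    lift : ∀ e' d → excessPoly p (l + suc e') d ≡ excessPoly p (suc (l + e')) d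
    lift e' d = cong (λ n → excessPoly p n d) (+-suc l e')
    pointwise : ∀ e' d → κ (suc l) e' · excessPoly p (suc l + e') d ≡
      (f₁ e' d ⊕ sucˡ f₂ e' d) ⊕ (sucʳ f₃ e' d ⊕ ℚ.- sucʳ f₄ e' d)
    pointwise zero zero = trans (down (excessPoly p (l + 0) 0)) (low (κ l 0) (excessPoly p (l + 0) 0))
    pointwise zero (suc d) = trans (down (excessPoly p (suc l + 0) (suc d)))
      (expand (κ l 0) (excessPoly p (l + 0) (suc d)) (excessPoly (p ∘ suc) (l + 0) d) (excessPoly p (l + 0) d))
    pointwise (suc e') zero = trans (cong (_· excessPoly p (l + suc e') 0) (κs l e'))
      (low′ (κ l (suc e')) (κ (suc (suc l)) e') (excessPoly p (l + suc e') 0))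
    pointwise (suc e') (suc d) = trans (cong (_· excessPoly p (suc l + suc e') (suc d)) (κs l e'))
      (expand′ (κ l (suc e')) (κ (suc (suc l)) e') (excessPoly p (l + suc e') (suc d)) (excessPoly (p ∘ suc) (l + suc e') d) (excessPoly p (l + suc e') d))

-- The recurrence leads from (l + 1, e + 1) to the same excess with smaller l and to smaller excess
-- with arbitrary l. The induction on l therefore takes all smaller excesses as given, through
-- `below`.
treeLike-unique : ∀ {f g} → IsTreeLike f → IsTreeLike g →
  ∀ p e → (∀ q e' → e' < e → ∀ l → f q l e' ≡ g q l e') → f p 0 e ≡ g p 0 e → ∀ l → f p l e ≡ g p l e
treeLike-unique F G p e below base zero = base
treeLike-unique F G p zero below base (suc l) =
  trans (IsTreeLike.at-s0 F p l) (trans (treeLike-unique F G p zero below base l) (sym (IsTreeLike.at-s0 G p l)))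
treeLike-unique {f} {g} F G p (suc e) below base (suc l) = begin
  f p (suc l) (suc e)
    ≡⟨ IsTreeLike.at-ss F p l e ⟩
  (f p l (suc e) ⊕ f p (suc (suc l)) e) ⊕ (f (p ∘ suc) l e ⊖ f p l e)
    ≡⟨ cong₂ _⊕_ (cong₂ _⊕_ (treeLike-unique F G p (suc e) below base l) (below p e ≤-refl (suc (suc l))))
                   (cong₂ _⊖_ (below (p ∘ suc) e ≤-refl l) (below p e ≤-refl l)) ⟩
  (g p l (suc e) ⊕ g p (suc (suc l)) e) ⊕ (g (p ∘ suc) l e ⊖ g p l e)
    ≡⟨ IsTreeLike.at-ss G p l e ⟨
  g p (suc l) (suc e) ∎

forestCount : (ℕ → Bool) → ℕ → ℕ → ℚ
forestCount p l e = ∑ (forests l e) (λ F → 𝟙 (p (sumᶠ cherries F)))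

-- Joining the first two trees changes the number of cherries exactly when both are leaves. Hence a
-- test taken after joining, g, and one taken before, h, differ only on forests that begin with two
-- leaves; these forests account for the correction y - x².
∑-forests-exchange : ∀ l e (g h : Forest → ℚ) →
  (∀ F → g (leaf ∷ joinTop F) ≡ h (leaf ∷ joinTop F) ⊎ length F < 2) →
  (∀ F → g (joinTop F) ≡ h (joinTop F) ⊎ length F < 2) →
  ∑ (forests (suc (suc l)) e) g ≡ ∑ (forests (suc (suc l)) e) h ⊕
    (∑ (forests l e) (λ F → g (leaf ∷ leaf ∷ F)) ⊖ ∑ (forests l e) (λ F → h (leaf ∷ leaf ∷ F)))
∑-forests-exchange l e g h eq₁ eq₂ = begin
  ∑ (forests (suc (suc l)) e) g ≡⟨ expand e g ⟩
  LL g ⊕ rest e g ≡⟨ cong (LL g ⊕_) (rest-eq e) ⟩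
  LL g ⊕ rest e h ≡⟨ swap3 (LL g) (rest e h) (LL h) ⟩
  (LL h ⊕ rest e h) ⊕ (LL g ⊖ LL h) ≡⟨ cong (_⊕ (LL g ⊖ LL h)) (expand e h) ⟨
  ∑ (forests (suc (suc l)) e) h ⊕ (LL g ⊖ LL h) ∎
  where
  LL : (Forest → ℚ) → ℚ
  LL k = ∑ (forests l e) (λ F → k (leaf ∷ leaf ∷ F))
  rest : ℕ → (Forest → ℚ) → ℚ
  rest zero k = 0ℚ
  rest (suc e) k = ∑ (forests (suc (suc l)) e) (λ F → k (leaf ∷ joinTop F)) ⊕ ∑ (forests (suc (suc (suc l))) e) (λ F → k (joinTop F))
  swap3 : ∀ a b c → a ⊕ b ≡ (c ⊕ b) ⊕ (a ⊖ c)
  swap3 = solve-∀ ℚ-ring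
  expand : ∀ e k → ∑ (forests (suc (suc l)) e) k ≡ ∑ (forests l e) (λ F → k (leaf ∷ leaf ∷ F)) ⊕ rest e k
  expand zero k = trans (∑-map (leaf ∷_) (map (leaf ∷_) (forests l 0)) k)
    (trans (∑-map (leaf ∷_) (forests l 0) (λ F → k (leaf ∷ F))) (sym (⊕-identityʳ (∑ (forests l 0) (λ F → k (leaf ∷ leaf ∷ F))))))
  expand (suc e) k = trans (∑-++ (map (leaf ∷_) (forests (suc l) (suc e))) (map joinTop (forests (suc (suc (suc l))) e)) k)
    (trans (cong₂ _⊕_
      (trans (∑-map (leaf ∷_) (forests (suc l) (suc e)) k)
      (trans (∑-++ (map (leaf ∷_) (forests l (suc e))) (map joinTop (forests (suc (suc l)) e)) (λ F → k (leaf ∷ F)))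
        (cong₂ _⊕_ (∑-map (leaf ∷_) (forests l (suc e)) (λ F → k (leaf ∷ F))) (∑-map joinTop (forests (suc (suc l)) e) (λ F → k (leaf ∷ F))))))
      (∑-map joinTop (forests (suc (suc (suc l))) e) k))
    (ℚₚ.+-assoc (∑ (forests l (suc e)) (λ F → k (leaf ∷ leaf ∷ F))) _ _))
  agree : ∀ n e (g' h' : Forest → ℚ) → (∀ F → g' F ≡ h' F ⊎ length F < 2) → ∑ (forests (suc (suc n)) e) g' ≡ ∑ (forests (suc (suc n)) e) h'
  agree n e g' h' eq = ∑-cong (forests (suc (suc n)) e) λ {F} F∈ →
    [ id , (λ short → contradiction (≤-trans short (≤-trans (s≤s (s≤s z≤n)) (≤-reflexive (sym (proj₁ (forests-sound (suc (suc n)) e F∈)))))) 1+n≰n) ]′ (eq F)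
  rest-eq : ∀ e → rest e g ≡ rest e h
  rest-eq zero = refl
  rest-eq (suc e) = cong₂ _⊕_ (agree l e _ _ eq₁) (agree (suc l) e _ _ eq₂)

forestCount-treeLike : IsTreeLike forestCount
forestCount-treeLike = record { at-00 = λ p → ⊕-identityʳ (𝟙 (p 0)) ; at-s0 = λ p l → ∑-map (leaf ∷_) (forests l 0) _ ; at-ss = at-ss }
  where
  at-ss : ∀ p l e → forestCount p (suc l) (suc e) ≡
    (forestCount p l (suc e) ⊕ forestCount p (suc (suc l)) e) ⊕ (forestCount (p ∘ suc) l e ⊖ forestCount p l e)
  at-ss p l e = trans (∑-++ (map (leaf ∷_) (forests l (suc e))) (map joinTop (forests (suc (suc l)) e)) k)
    (trans (cong₂ _⊕_ (∑-map (leaf ∷_) (forests l (suc e)) k)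
      (trans (∑-map joinTop (forests (suc (suc l)) e) k) (∑-forests-exchange l e (k ∘ joinTop) k eq₁ eq₂)))
    (sym (ℚₚ.+-assoc (forestCount p l (suc e)) (forestCount p (suc (suc l)) e) (forestCount (p ∘ suc) l e ⊖ forestCount p l e))))
    where
    k : Forest → ℚ
    k F = 𝟙 (p (sumᶠ cherries F))
    eq₁ : ∀ F → k (joinTop (leaf ∷ joinTop F)) ≡ k (leaf ∷ joinTop F) ⊎ length F < 2
    eq₁ (_ ∷ _ ∷ F) = inj₁ refl
    eq₁ (_ ∷ []) = inj₂ (s≤s (s≤s z≤n))
    eq₁ [] = inj₂ (s≤s z≤n)
    eq₂ : ∀ F → k (joinTop (joinTop F)) ≡ k (joinTop F) ⊎ length F < 2
    eq₂ (l ∷ r ∷ []) = inj₁ refl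
    eq₂ (l ∷ r ∷ t ∷ F) = inj₁ (cong (𝟙 ∘ p) (+-assoc (cherries (node tt l r)) (cherries t) (sumᶠ cherries F)))
    eq₂ (_ ∷ []) = inj₂ (s≤s (s≤s z≤n))
    eq₂ [] = inj₂ (s≤s z≤n)

C-factorials : ∀ a b → ((a + b) C a) * (a ! * b !) ≡ (a + b) !
C-factorials a b = trans (cong₂ _*_ (nCk≡n!/k![n-k]! (m≤m+n a b)) (cong (λ c → a ! * c !) (sym (m+n∸m≡n a b))))
  (m/n*n≡m {{_!*_!≢0 a (a + b ∸ a)}} (k![n∸k]!∣n! (m≤m+n a b)))

absorption : ∀ n k → suc k * ((suc k + n) C suc k) ≡ (suc k + n) * ((k + n) C k)
absorption n k = *-cancelʳ-≡ _ _ (k ! * n !) {{_!*_!≢0 k n}} (begin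
  suc k * c₁ * (k ! * n !) ≡⟨ regroup (suc k) c₁ (k !) (n !) ⟩
  c₁ * (suc k ! * n !) ≡⟨ C-factorials (suc k) n ⟩
  (suc k + n) * (k + n) ! ≡⟨ cong ((suc k + n) *_) (C-factorials k n) ⟨
  (suc k + n) * (c₀ * (k ! * n !)) ≡⟨ *-assoc (suc k + n) c₀ (k ! * n !) ⟨
  (suc k + n) * c₀ * (k ! * n !) ∎)
  where
  c₁ = (suc k + n) C suc k
  c₀ = (k + n) C k
  regroup : ∀ a b c d → a * b * (c * d) ≡ b * (a * c * d)
  regroup = ℕ-Ring.solve-∀

fromℕ-suc : ∀ n → fromℕ (suc n) ≡ 1ℚ ⊕ fromℕ n
fromℕ-suc n = fromℕ-+ 1 n

central-absorption : ∀ l e → fromℕ (suc e) · central l (suc e) ≡ fromℕ (l + 2 * suc e) · central (suc l) e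
central-absorption l e = trans (sym (fromℕ-* (suc e) ((l + 2 * suc e) C suc e)))
  (trans (cong fromℕ nat) (fromℕ-* (l + 2 * suc e) ((suc l + 2 * e) C e)))
  where
  split : ∀ l e → l + 2 * suc e ≡ suc e + (l + suc e)
  split = ℕ-Ring.solve-∀
  split′ : ∀ l e → suc l + 2 * e ≡ e + (l + suc e)
  split′ = ℕ-Ring.solve-∀
  nat : suc e * ((l + 2 * suc e) C suc e) ≡ (l + 2 * suc e) * ((suc l + 2 * e) C e)
  nat = subst₂ (λ a b → suc e * (a C suc e) ≡ a * (b C e)) (sym (split l e)) (sym (split′ l e)) (absorption (l + suc e) e)

-- The coefficient form of x u' = u(1-u)/(1-2u).
ballot-central : ∀ l e → fromℕ (l + suc e) · ballot l (suc e) ≡ fromℕ l · (central l (suc e) ⊖ central (suc l) e)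
ballot-central l e = begin
  fromℕ (l + suc e) · (c ⊖ two · c')
    ≡⟨ cong (_· (c ⊖ two · c')) (fromℕ-+ l (suc e)) ⟩
  (L ⊕ E) · (c ⊖ two · c')
    ≡⟨ expand L E c two c' ⟩
  L · c ⊖ (two · (L ⊕ E)) · c' ⊕ E · c
    ≡⟨ cong (L · c ⊖ (two · (L ⊕ E)) · c' ⊕_) (trans (central-absorption l e) (cong (_· c') (trans (fromℕ-+ l (2 * suc e)) (cong (L ⊕_) (fromℕ-* 2 (suc e)))))) ⟩
  L · c ⊖ (two · (L ⊕ E)) · c' ⊕ (L ⊕ two · E) · c'
    ≡⟨ cong (λ t → L · c ⊖ (t · (L ⊕ E)) · c' ⊕ (L ⊕ t · E) · c') (fromℕ-suc 1) ⟩
  L · c ⊖ ((1ℚ ⊕ 1ℚ) · (L ⊕ E)) · c' ⊕ (L ⊕ (1ℚ ⊕ 1ℚ) · E) · c'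
    ≡⟨ collect L E c c' ⟩
  L · (c ⊖ c') ∎
  where
  L = fromℕ l
  E = fromℕ (suc e)
  two = fromℕ 2
  c = central l (suc e)
  c' = central (suc l) e
  expand : ∀ L E c t c' → (L ⊕ E) · (c ⊖ t · c') ≡ L · c ⊖ (t · (L ⊕ E)) · c' ⊕ E · c
  expand = solve-∀ ℚ-ring
  collect : ∀ L E c c' → L · c ⊖ ((1ℚ ⊕ 1ℚ) · (L ⊕ E)) · c' ⊕ (L ⊕ (1ℚ ⊕ 1ℚ) · E) · c' ≡ L · (c ⊖ c')
  collect = solve-∀ ℚ-ring

-- [x^i] of u^l/(1-2u) and of u^l.
centralAt ballotAt : ℕ → ℕ → ℚ
centralAt i l = at (excess l i) (central l)
ballotAt i l = at (excess l i) (ballot l)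

excess-suc : ∀ l i {e} → excess l i ≡ just (suc e) → excess (suc l) i ≡ just e
excess-suc l i {e} eq = trans (cong (excess (suc l)) (trans (sym (excess-just l i eq)) (+-suc l e))) (excess-+ (suc l) e)

excess-suc0 : ∀ l i → excess l i ≡ just 0 → excess (suc l) i ≡ nothing
excess-suc0 l i eq = excess-> (s≤s (≤-reflexive (trans (sym (excess-just l i eq)) (+-identityʳ l))))

excess-suc∅ : ∀ l i → excess l i ≡ nothing → excess (suc l) i ≡ nothing
excess-suc∅ (suc l) zero eq = refl
excess-suc∅ (suc l) (suc i) eq = excess-suc∅ l i eq

centralAt-suc : ∀ {i l m} → excess (suc l) i ≡ m → at m (central (suc l)) ≡ centralAt i (suc l)
centralAt-suc {l = l} eq = cong (λ m → at m (central (suc l))) (sym eq)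

ballotAt-central : ∀ i l → ballotAt i l ≡ centralAt i l ⊖ fromℕ 2 · centralAt i (suc l)
ballotAt-central i l = go (excess l i) refl
  where
  minus0 : ∀ t c → c ≡ c ⊖ t · 0ℚ
  minus0 = solve-∀ ℚ-ring
  go : ∀ m → excess l i ≡ m → at m (ballot l) ≡ at m (central l) ⊖ fromℕ 2 · centralAt i (suc l)
  go nothing eq = trans (minus0 (fromℕ 2) 0ℚ) (cong (λ z → 0ℚ ⊖ fromℕ 2 · z) (centralAt-suc {i} {l} (excess-suc∅ l i eq)))
  go (just zero) eq = trans (minus0 (fromℕ 2) (central l 0)) (cong (λ z → central l 0 ⊖ fromℕ 2 · z) (centralAt-suc {i} {l} (excess-suc0 l i eq)))
  go (just (suc e)) eq = cong (λ z → central l (suc e) ⊖ fromℕ 2 · z) (centralAt-suc {i} {l} (excess-suc l i eq))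

ballotAt-euler : ∀ i l → fromℕ i · ballotAt i l ≡ fromℕ l · (centralAt i l ⊖ centralAt i (suc l))
ballotAt-euler i l = go (excess l i) refl
  where
  zeros : ∀ t t' → t · 0ℚ ≡ t' · (0ℚ ⊖ 0ℚ)
  zeros = solve-∀ ℚ-ring
  minus0 : ∀ t c → t · c ≡ t · (c ⊖ 0ℚ)
  minus0 = solve-∀ ℚ-ring
  go : ∀ m → excess l i ≡ m → fromℕ i · at m (ballot l) ≡ fromℕ l · (at m (central l) ⊖ centralAt i (suc l))
  go nothing eq = trans (zeros (fromℕ i) (fromℕ l)) (cong (λ z → fromℕ l · (0ℚ ⊖ z)) (centralAt-suc {i} {l} (excess-suc∅ l i eq)))
  go (just zero) eq = trans (cong (λ n → fromℕ n · central l 0) (trans (sym (excess-just l i eq)) (+-identityʳ l)))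
    (trans (minus0 (fromℕ l) (central l 0)) (cong (λ z → fromℕ l · (central l 0 ⊖ z)) (centralAt-suc {i} {l} (excess-suc0 l i eq))))
  go (just (suc e)) eq = trans (cong (λ n → fromℕ n · ballot l (suc e)) (sym (excess-just l i eq)))
    (trans (ballot-central l e) (cong (λ z → fromℕ l · (central l (suc e) ⊖ z)) (centralAt-suc {i} {l} (excess-suc l i eq))))

centralAt-> : ∀ {i l} → i < l → centralAt i l ≡ 0ℚ
centralAt-> {i} {l} i<l = cong (λ m → at m (central l)) (excess-> i<l)

ballotAt-0 : ∀ i → ballotAt (suc i) 0 ≡ 0ℚ
ballotAt-0 i = *-cancelʳ-fromℕ (suc i) (trans (·-comm (ballotAt (suc i) 0) (fromℕ (suc i)))
  (trans (ballotAt-euler (suc i) 0) (trans (·-zeroˡ (centralAt (suc i) 0 ⊖ centralAt (suc i) 1)) (sym (·-zeroˡ (fromℕ (suc i)))))))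

-- The coefficients of positive degree in 1/(1 - 2u) = 1 + 2u/(1 - 2u).
centralAt-01 : ∀ i → centralAt (suc i) 0 ≡ fromℕ 2 · centralAt (suc i) 1
centralAt-01 i = trans (sym (cancel (centralAt (suc i) 0) (fromℕ 2 · centralAt (suc i) 1)))
  (trans (cong (_⊕ fromℕ 2 · centralAt (suc i) 1) (trans (sym (ballotAt-central (suc i) 0)) (ballotAt-0 i))) (⊕-identityˡ (fromℕ 2 · centralAt (suc i) 1)))
  where
  cancel : ∀ a b → (a ⊖ b) ⊕ b ≡ a
  cancel = solve-∀ ℚ-ring

-- Forests of l trees are counted by u^l. Both sides satisfy the same recurrence, so only the row l
-- = 0 is compared directly: there u^0 = 1, and no forest without trees has a leaf.
forestCount≡combine : ∀ p l e → forestCount p l e ≡ combine ballot p l e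
forestCount≡combine p l e = go p e (<-wellFounded e) l
  where
  isTree : IsTreeLike (combine ballot)
  isTree = combine-treeLike ballot central-zero ballot-suc
  base : ∀ p e → forestCount p 0 e ≡ combine ballot p 0 e
  base p zero = trans (IsTreeLike.at-00 forestCount-treeLike p) (sym (IsTreeLike.at-00 isTree p))
  base p (suc e) = sym (trans (cong₂ _⊕_ (·-zeroʳ (ballot 0 0)) (vanish e)) (⊕-identityˡ 0ℚ))
    where
    anti-zero : ∀ n (f : ℕ → ℕ → ℚ) → (∀ i j → f i j ≡ 0ℚ) → anti n f ≡ 0ℚ
    anti-zero zero f eq = eq 0 0
    anti-zero (suc n) f eq = trans (cong₂ _⊕_ (eq 0 (suc n)) (anti-zero n _ (λ i → eq (suc i)))) (⊕-identityˡ 0ℚ)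
    vanish : ∀ e → anti e (λ e' d → ballot 0 (suc e') · excessPoly p (suc e') d) ≡ 0ℚ
    vanish e = anti-zero e _ λ e' d → trans (cong (_· excessPoly p (suc e') d) (ballotAt-0 e')) (·-zeroˡ (excessPoly p (suc e') d))
  go : ∀ p e → Acc _<_ e → ∀ l → forestCount p l e ≡ combine ballot p l e
  go p e (acc rs) = treeLike-unique forestCount-treeLike isTree p e (λ q e' e'<e → go q e' (rs e'<e)) (base p e)

-- [leaf^r] of the i-th power of x + y - x².
polyAt : (ℕ → Bool) → ℕ → ℕ → ℚ
polyAt p r i = at (excess i r) (excessPoly p i)

∑-upTo-suc : ∀ n (f : ℕ → ℚ) → ∑< (suc n) f ≡ f 0 ⊕ ∑< n (f ∘ suc)
∑-upTo-suc n f = cong (f 0 ⊕_) (trans (cong (λ l → ∑ l f) (sym (map-upTo suc n))) (∑-map suc (upTo n) f))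

-- Re-indexing by the absolute exponent i = l + e' instead of the excess e', so that the summation
-- range no longer depends on l.
∑-excess : ∀ N l r (h : ℕ → ℕ → ℚ) → r < N →
  ∑< N (λ i → at (excess l i) (λ e → at (excess i r) (h e))) ≡ at (excess l r) (λ e → anti e h)
∑-excess (suc N) zero r h r<N = go (suc N) r h r<N
  where
  go : ∀ N r (h : ℕ → ℕ → ℚ) → r < N → ∑< N (λ i → at (excess i r) (h i)) ≡ anti r h
  go (suc N) zero h _ = trans (∑-upTo-suc N (λ i → at (excess i 0) (h i)))
    (trans (cong (h 0 0 ⊕_) (∑-zero (upTo N) (λ _ → refl))) (⊕-identityʳ (h 0 0)))
  go (suc N) (suc r) h (s≤s r<N) = trans (∑-upTo-suc N (λ i → at (excess i (suc r)) (h i)))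
    (cong (h 0 (suc r) ⊕_) (go N r (λ i j → h (suc i) j) r<N))
∑-excess (suc N) (suc l) zero h r<N = trans (∑-upTo-suc N (λ i → at (excess (suc l) i) (λ e → at (excess i 0) (h e))))
  (trans (⊕-identityˡ (∑< N (λ i → at (excess l i) (λ e → 0ℚ)))) (∑-zero (upTo N) (λ {i} _ → at-0 (excess l i))))
  where
  at-0 : ∀ m → at m (λ _ → 0ℚ) ≡ 0ℚ
  at-0 (just _) = refl
  at-0 nothing = refl
∑-excess (suc N) (suc l) (suc r) h (s≤s r<N) = trans (∑-upTo-suc N (λ i → at (excess (suc l) i) (λ e → at (excess i (suc r)) (h e))))
  (trans (⊕-identityˡ (∑< N (λ i → at (excess l i) (λ e → at (excess i r) (h e))))) (∑-excess N l r h r<N))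

combineAt : ∀ κ p l r N → r < N →
  at (excess l r) (combine κ p l) ≡ ∑< N (λ i → at (excess l i) (κ l) · polyAt p r i)
combineAt κ p l r N r<N = trans (sym (∑-excess N l r (λ e' d → κ l e' · excessPoly p (l + e') d) r<N)) (∑-ext (upTo N) term)
  where
  term : ∀ i → at (excess l i) (λ e → at (excess i r) (λ d → κ l e · excessPoly p (l + e) d)) ≡ at (excess l i) (κ l) · polyAt p r i
  term i with excess l i in eq
  ... | nothing = sym (·-zeroˡ (polyAt p r i))
  ... | just e with refl ← excess-just l i eq with excess (l + e) r
  ... | just d = refl
  ... | nothing = sym (·-zeroʳ (κ l e))

forestCountAt : (ℕ → Bool) → ℕ → ℕ → ℚ
forestCountAt p r l = ∑ (forestsOf l r) (λ F → 𝟙 (p (sumᶠ cherries F)))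

forestCountAt-expand : ∀ p r l N → r < N → forestCountAt p r l ≡ ∑< N (λ i → ballotAt i l · polyAt p r i)
forestCountAt-expand p r l N r<N = trans unfold (combineAt ballot p l r N r<N)
  where
  unfold : forestCountAt p r l ≡ at (excess l r) (combine ballot p l)
  unfold with excess l r
  ... | just e = forestCount≡combine p l e
  ... | nothing = refl


-- Sums over words of given length, and the logarithm

-- shiftSum L f l m is the value at (l , m) of (U + V)^L f, with U and V the two index shifts.
shiftSum : ℕ → (ℕ → ℕ → ℚ) → ℕ → ℕ → ℚ
shiftSum zero f l m = f l m
shiftSum (suc L) f l m = shiftSum L f (suc l) m ⊕ shiftSum L f l (suc m)

shiftSum-ext : ∀ L {f g : ℕ → ℕ → ℚ} → (∀ l m → f l m ≡ g l m) → ∀ l m → shiftSum L f l m ≡ shiftSum L g l m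
shiftSum-ext zero eq l m = eq l m
shiftSum-ext (suc L) eq l m = cong₂ _⊕_ (shiftSum-ext L eq (suc l) m) (shiftSum-ext L eq l (suc m))

private
  mid4 : ∀ a b c d → (a ⊕ b) ⊕ (c ⊕ d) ≡ (a ⊕ c) ⊕ (b ⊕ d)
  mid4 = solve-∀ ℚ-ring

shiftSum-+ : ∀ L (f g : ℕ → ℕ → ℚ) l m → shiftSum L (λ a b → f a b ⊕ g a b) l m ≡ shiftSum L f l m ⊕ shiftSum L g l m
shiftSum-+ zero f g l m = refl
shiftSum-+ (suc L) f g l m = trans (cong₂ _⊕_ (shiftSum-+ L f g (suc l) m) (shiftSum-+ L f g l (suc m)))
  (mid4 (shiftSum L f (suc l) m) (shiftSum L g (suc l) m) (shiftSum L f l (suc m)) (shiftSum L g l (suc m)))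

shiftSum-* : ∀ L c (f : ℕ → ℕ → ℚ) l m → shiftSum L (λ a b → c · f a b) l m ≡ c · shiftSum L f l m
shiftSum-* zero c f l m = refl
shiftSum-* (suc L) c f l m = trans (cong₂ _⊕_ (shiftSum-* L c f (suc l) m) (shiftSum-* L c f l (suc m)))
  (sym (ℚₚ.*-distribˡ-+ c (shiftSum L f (suc l) m) (shiftSum L f l (suc m))))

shiftSum-∑ : ∀ {A : Set} L (xs : List A) (f : A → ℕ → ℕ → ℚ) l m →
  shiftSum L (λ a b → ∑ xs (λ x → f x a b)) l m ≡ ∑ xs (λ x → shiftSum L (f x) l m)
shiftSum-∑ zero xs f l m = refl
shiftSum-∑ (suc L) xs f l m = trans (cong₂ _⊕_ (shiftSum-∑ L xs f (suc l) m) (shiftSum-∑ L xs f l (suc m)))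
  (sym (∑-+ xs (λ x → shiftSum L (f x) (suc l) m) (λ x → shiftSum L (f x) l (suc m))))

shiftSum-shift : ∀ L (f : ℕ → ℕ → ℚ) a b l m → shiftSum L (λ l' m' → f (a + l') (b + m')) l m ≡ shiftSum L f (a + l) (b + m)
shiftSum-shift zero f a b l m = refl
shiftSum-shift (suc L) f a b l m = cong₂ _⊕_
  (trans (shiftSum-shift L f a b (suc l) m) (cong (λ n → shiftSum L f n (b + m)) (+-suc a l)))
  (trans (shiftSum-shift L f a b l (suc m)) (cong (shiftSum L f (a + l)) (+-suc b m)))

shiftSum-step : ∀ L (f : ℕ → ℕ → ℚ) l m → shiftSum L (λ a b → f (suc a) b ⊕ f a (suc b)) l m ≡ shiftSum (suc L) f l m
shiftSum-step L f l m = trans (shiftSum-+ L (λ a b → f (suc a) b) (λ a b → f a (suc b)) l m)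
  (cong₂ _⊕_ (shiftSum-shift L f 1 0 l m) (shiftSum-shift L f 0 1 l m))

shiftSum-vanish : ∀ L {f : ℕ → ℕ → ℚ} {N} → (∀ l m → N ≤ l + m → f l m ≡ 0ℚ) → ∀ l m → N ≤ L + (l + m) → shiftSum L f l m ≡ 0ℚ
shiftSum-vanish zero eq l m N≤ = eq l m N≤
shiftSum-vanish (suc L) {N = N} eq l m N≤ = trans (cong₂ _⊕_
  (shiftSum-vanish L eq (suc l) m (subst (N ≤_) (sym (+-suc L (l + m))) N≤))
  (shiftSum-vanish L eq l (suc m) (subst (N ≤_) (trans (sym (+-suc L (l + m))) (cong (L +_) (sym (+-suc l m)))) N≤)))
  (⊕-identityˡ 0ℚ)

-- The product rule for the Euler operator l U + m V applied to a power of U + V.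
shiftSum-euler : ∀ L (X Y : ℕ → ℕ → ℚ) l m →
  shiftSum (suc L) (λ a b → fromℕ a · X a b ⊕ fromℕ b · Y a b) l m ≡
  (fromℕ l · shiftSum (suc L) X l m ⊕ fromℕ m · shiftSum (suc L) Y l m) ⊕
  fromℕ (suc L) · shiftSum L (λ a b → X (suc a) b ⊕ Y a (suc b)) l m
shiftSum-euler zero X Y l m =
  trans (cong₂ (λ a b → (a · X (suc l) m ⊕ fromℕ m · Y (suc l) m) ⊕ (fromℕ l · X l (suc m) ⊕ b · Y l (suc m))) (fromℕ-suc l) (fromℕ-suc m))
        (ring (fromℕ l) (fromℕ m) (X (suc l) m) (Y (suc l) m) (X l (suc m)) (Y l (suc m)))
  where
  ring : ∀ a b x y x' y' → ((1ℚ ⊕ a) · x ⊕ b · y) ⊕ (a · x' ⊕ (1ℚ ⊕ b) · y') ≡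
    (a · (x ⊕ x') ⊕ b · (y ⊕ y')) ⊕ 1ℚ · (x ⊕ y')
  ring = solve-∀ ℚ-ring
shiftSum-euler (suc L) X Y l m = begin
  shiftSum (suc L) W (suc l) m ⊕ shiftSum (suc L) W l (suc m)
    ≡⟨ cong₂ _⊕_ (shiftSum-euler L X Y (suc l) m) (shiftSum-euler L X Y l (suc m)) ⟩
  ((fromℕ (suc l) · x ⊕ M · y) ⊕ K · h) ⊕ ((Λ · x' ⊕ fromℕ (suc m) · y') ⊕ K · h')
    ≡⟨ cong₂ (λ a b → ((a · x ⊕ M · y) ⊕ K · h) ⊕ ((Λ · x' ⊕ b · y') ⊕ K · h')) (fromℕ-suc l) (fromℕ-suc m) ⟩
  (((1ℚ ⊕ Λ) · x ⊕ M · y) ⊕ K · h) ⊕ ((Λ · x' ⊕ (1ℚ ⊕ M) · y') ⊕ K · h')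
    ≡⟨ ring Λ M K x y x' y' h h' ⟩
  (Λ · (x ⊕ x') ⊕ M · (y ⊕ y')) ⊕ ((x ⊕ y') ⊕ K · (h ⊕ h'))
    ≡⟨ cong (λ z → (Λ · (x ⊕ x') ⊕ M · (y ⊕ y')) ⊕ (z ⊕ K · (h ⊕ h'))) x+y' ⟩
  (Λ · (x ⊕ x') ⊕ M · (y ⊕ y')) ⊕ ((h ⊕ h') ⊕ K · (h ⊕ h'))
    ≡⟨ cong ((Λ · (x ⊕ x') ⊕ M · (y ⊕ y')) ⊕_) (trans (fold K (h ⊕ h')) (cong (_· (h ⊕ h')) (sym (fromℕ-suc (suc L))))) ⟩
  (Λ · (x ⊕ x') ⊕ M · (y ⊕ y')) ⊕ fromℕ (suc (suc L)) · (h ⊕ h') ∎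
  where
  W H : ℕ → ℕ → ℚ
  W a b = fromℕ a · X a b ⊕ fromℕ b · Y a b
  H a b = X (suc a) b ⊕ Y a (suc b)
  Λ = fromℕ l
  M = fromℕ m
  K = fromℕ (suc L)
  x = shiftSum (suc L) X (suc l) m
  y = shiftSum (suc L) Y (suc l) m
  x' = shiftSum (suc L) X l (suc m)
  y' = shiftSum (suc L) Y l (suc m)
  h = shiftSum L H (suc l) m
  h' = shiftSum L H l (suc m)
  x+y' : x ⊕ y' ≡ h ⊕ h'
  x+y' = sym (trans (shiftSum-+ (suc L) (λ a b → X (suc a) b) (λ a b → Y a (suc b)) l m)
    (cong₂ _⊕_ (shiftSum-shift (suc L) X 1 0 l m) (shiftSum-shift (suc L) Y 0 1 l m)))
  fold : ∀ k z → z ⊕ k · z ≡ (1ℚ ⊕ k) · z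
  fold = solve-∀ ℚ-ring
  ring : ∀ a b k x y x' y' h h' →
    (((1ℚ ⊕ a) · x ⊕ b · y) ⊕ k · h) ⊕ ((a · x' ⊕ (1ℚ ⊕ b) · y') ⊕ k · h') ≡
    (a · (x ⊕ x') ⊕ b · (y ⊕ y')) ⊕ ((x ⊕ y') ⊕ k · (h ⊕ h'))
  ring = solve-∀ ℚ-ring

∑-range1 : ∀ n (f : ℕ → ℚ) → ∑₁ n f ≡ ∑< n (f ∘ suc)
∑-range1 n f = ∑-map suc (upTo n) f

∑-telescope : ∀ n (g : ℕ → ℚ) → ∑< n (λ L → g L ⊖ g (suc L)) ≡ g 0 ⊖ g n
∑-telescope zero g = sym (ℚₚ.+-inverseʳ (g 0))
∑-telescope (suc n) g = trans (∑-upTo-suc n (λ L → g L ⊖ g (suc L)))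
  (trans (cong ((g 0 ⊖ g 1) ⊕_) (∑-telescope n (g ∘ suc))) (chain (g 0) (g 1) (g (suc n))))
  where
  chain : ∀ a b c → (a ⊖ b) ⊕ (b ⊖ c) ≡ a ⊖ c
  chain = solve-∀ ℚ-ring

-- [p^i q^j] of Σ_{L≥1} (u + v)^L / L = - log (1 - u - v), where u = p + u² and v = q + v².
module CyclicWords (i j : ℕ) where

  private
    c c' : ℕ → ℚ
    c = centralAt (suc i)
    c' = centralAt (suc j)
    two = 1ℚ ⊕ 1ℚ
    -- All are coefficients of p^(i+1) q^(j+1): `bb` that of u^l v^m, and `X`, `Y`, `Z` those of u^l
    -- v^m times (1 - u)(1 - 2v), (1 - 2u)(1 - v) and u + v - 2uv, each divided by (1 - 2u)(1 - 2v).
    bb X Y Z : ℕ → ℕ → ℚ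
    bb l m = ballotAt (suc i) l · ballotAt (suc j) m
    X l m = (c l ⊖ c (suc l)) · (c' m ⊖ two · c' (suc m))
    Y l m = (c l ⊖ two · c (suc l)) · (c' m ⊖ c' (suc m))
    Z l m = (c (suc l) · c' m ⊕ c l · c' (suc m)) ⊖ two · (c (suc l) · c' (suc m))
    n = suc i + suc j

    2≡two : fromℕ 2 ≡ two
    2≡two = fromℕ-suc 1

    ballot≡ : ∀ k l → ballotAt k l ≡ centralAt k l ⊖ two · centralAt k (suc l)
    ballot≡ k l = trans (ballotAt-central k l) (cong (λ t → centralAt k l ⊖ t · centralAt k (suc l)) 2≡two)

    -- The Euler operator p d/dp + q d/dq multiplies a coefficient of total degree n by n. On u^l
    -- v^m it is computed by the product rule with p du/dp = u(1 - u)/(1 - 2u), and likewise for v.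
    euler : ∀ l m → fromℕ n · bb l m ≡ fromℕ l · X l m ⊕ fromℕ m · Y l m
    euler l m = begin
      fromℕ n · (b · b')
        ≡⟨ cong (_· (b · b')) (fromℕ-+ (suc i) (suc j)) ⟩
      (fromℕ (suc i) ⊕ fromℕ (suc j)) · (b · b')
        ≡⟨ ring (fromℕ (suc i)) (fromℕ (suc j)) b b' ⟩
      (fromℕ (suc i) · b) · b' ⊕ (fromℕ (suc j) · b') · b
        ≡⟨ cong₂ _⊕_ (cong₂ _·_ (ballotAt-euler (suc i) l) (ballot≡ (suc j) m)) (cong₂ _·_ (ballotAt-euler (suc j) m) (ballot≡ (suc i) l)) ⟩
      (fromℕ l · (c l ⊖ c (suc l))) · (c' m ⊖ two · c' (suc m)) ⊕ (fromℕ m · (c' m ⊖ c' (suc m))) · (c l ⊖ two · c (suc l))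
        ≡⟨ ring′ (fromℕ l) (fromℕ m) (c l ⊖ c (suc l)) (c' m ⊖ two · c' (suc m)) (c' m ⊖ c' (suc m)) (c l ⊖ two · c (suc l)) ⟩
      fromℕ l · X l m ⊕ fromℕ m · Y l m ∎
      where
      b = ballotAt (suc i) l
      b' = ballotAt (suc j) m
      ring : ∀ a a' b b' → (a ⊕ a') · (b · b') ≡ (a · b) · b' ⊕ (a' · b') · b
      ring = solve-∀ ℚ-ring
      ring′ : ∀ l m a b d e → (l · a) · b ⊕ (m · d) · e ≡ l · (a · b) ⊕ m · (e · d)
      ring′ = solve-∀ ℚ-ring

    -- u(1-u)(1-2v) + v(1-v)(1-2u) = (1-u-v)(u+v-2uv)
    factor : ∀ l m → X (suc l) m ⊕ Y l (suc m) ≡ Z l m ⊕ ℚ.- (Z (suc l) m ⊕ Z l (suc m))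
    factor l m = ring (c l) (c (suc l)) (c (suc (suc l))) (c' m) (c' (suc m)) (c' (suc (suc m)))
      where
      ring : ∀ a₀ a₁ a₂ b₀ b₁ b₂ →
        (a₁ ⊖ a₂) · (b₀ ⊖ (1ℚ ⊕ 1ℚ) · b₁) ⊕ (a₀ ⊖ (1ℚ ⊕ 1ℚ) · a₁) · (b₁ ⊖ b₂) ≡
        ((a₁ · b₀ ⊕ a₀ · b₁) ⊖ (1ℚ ⊕ 1ℚ) · (a₁ · b₁)) ⊕
        ℚ.- (((a₂ · b₀ ⊕ a₁ · b₁) ⊖ (1ℚ ⊕ 1ℚ) · (a₂ · b₁)) ⊕
             ((a₁ · b₁ ⊕ a₀ · b₂) ⊖ (1ℚ ⊕ 1ℚ) · (a₁ · b₂)))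
      ring = solve-∀ ℚ-ring

    -- The operator applied to (u + v)^(L+1)/(L + 1) loses the denominator, and `factor` splits off
    -- 1 - u - v. Multiplying the power L of u + v by 1 - u - v leaves the difference of two
    -- consecutive powers, so the sum over L telescopes.
    term : ∀ L → fromℕ n · (1/ (suc L) · shiftSum (suc L) bb 0 0) ≡ shiftSum L Z 0 0 ⊖ shiftSum (suc L) Z 0 0
    term L = begin
      fromℕ n · (1/ (suc L) · shiftSum (suc L) bb 0 0)
        ≡⟨ exch (fromℕ n) (1/ (suc L)) (shiftSum (suc L) bb 0 0) ⟩
      1/ (suc L) · (fromℕ n · shiftSum (suc L) bb 0 0)
        ≡⟨ cong (1/ (suc L) ·_) (trans (sym (shiftSum-* (suc L) (fromℕ n) bb 0 0)) (trans (shiftSum-ext (suc L) euler 0 0) (shiftSum-euler L X Y 0 0))) ⟩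
      1/ (suc L) · ((0ℚ · shiftSum (suc L) X 0 0 ⊕ 0ℚ · shiftSum (suc L) Y 0 0) ⊕ fromℕ (suc L) · shiftSum L H 0 0)
        ≡⟨ drop0 (1/ (suc L)) (shiftSum (suc L) X 0 0) (shiftSum (suc L) Y 0 0) (fromℕ (suc L)) (shiftSum L H 0 0) ⟩
      (1/ (suc L) · fromℕ (suc L)) · shiftSum L H 0 0
        ≡⟨ trans (cong (_· shiftSum L H 0 0) (1/-inverse (suc L))) (·-identityˡ (shiftSum L H 0 0)) ⟩
      shiftSum L H 0 0
        ≡⟨ trans (shiftSum-ext L factor 0 0) (shiftSum-+ L Z (λ a b → ℚ.- (Z (suc a) b ⊕ Z a (suc b))) 0 0) ⟩
      shiftSum L Z 0 0 ⊕ shiftSum L (λ a b → ℚ.- (Z (suc a) b ⊕ Z a (suc b))) 0 0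
        ≡⟨ cong (shiftSum L Z 0 0 ⊕_) (trans (shiftSum-ext L (λ a b → neg1 (Z (suc a) b ⊕ Z a (suc b))) 0 0)
             (trans (shiftSum-* L (ℚ.- 1ℚ) (λ a b → Z (suc a) b ⊕ Z a (suc b)) 0 0)
             (trans (sym (neg1 (shiftSum L (λ a b → Z (suc a) b ⊕ Z a (suc b)) 0 0))) (cong ℚ.-_ (shiftSum-step L Z 0 0))))) ⟩
      shiftSum L Z 0 0 ⊖ shiftSum (suc L) Z 0 0 ∎
      where
      H : ℕ → ℕ → ℚ
      H a b = X (suc a) b ⊕ Y a (suc b)
      exch : ∀ a b c → a · (b · c) ≡ b · (a · c)
      exch = solve-∀ ℚ-ring
      drop0 : ∀ a x y k h → a · ((0ℚ · x ⊕ 0ℚ · y) ⊕ k · h) ≡ (a · k) · h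
      drop0 = solve-∀ ℚ-ring
      neg1 : ∀ x → ℚ.- x ≡ (ℚ.- 1ℚ) · x
      neg1 = solve-∀ ℚ-ring

    exceeds : ∀ {a b l m} → a + b < l + m → a < l ⊎ b < m
    exceeds {a} {b} {l} {m} a+b< with suc a ℕ.≤? l
    ... | yes a<l = inj₁ a<l
    ... | no a≮l = inj₂ (+-cancelˡ-< a b m (<-≤-trans a+b< (+-monoˡ-≤ m (≮⇒≥ a≮l))))

    product-vanish : ∀ l m → n < l + m → c l · c' m ≡ 0ℚ
    product-vanish l m n< =
      [ (λ i<l → trans (cong (_· c' m) (centralAt-> {suc i} {l} i<l)) (·-zeroˡ (c' m)))
      , (λ j<m → trans (cong (c l ·_) (centralAt-> {suc j} {m} j<m)) (·-zeroʳ (c l))) ]′ (exceeds {suc i} {suc j} n<)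

    -- Every term of `Z l m` has degree at least l + m + 1 in u and v together, and neither series
    -- has a constant term; this ends the telescoping sum.
    Z-vanish : ∀ l m → n ≤ l + m → Z l m ≡ 0ℚ
    Z-vanish l m n≤ = trans
      (cong₂ (λ a b → a ⊖ two · b)
        (cong₂ _⊕_ (product-vanish (suc l) m (s≤s n≤)) (product-vanish l (suc m) n<l+sm))
        (product-vanish (suc l) (suc m) (m≤n⇒m≤1+n n<l+sm)))
      zeros
      where
      n<l+sm : n < l + suc m
      n<l+sm = subst (n <_) (sym (+-suc l m)) (s≤s n≤)
      zeros : (0ℚ ⊕ 0ℚ) ⊖ two · 0ℚ ≡ 0ℚ
      zeros = refl

    -- u + v - 2uv is half of 1 - (1 - 2u)(1 - 2v), so what remains of the telescope is half a
    -- coefficient of 1/((1 - 2u)(1 - 2v)). This is the 2 in the denominator 2(i + j).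
    value : Z 0 0 ≡ fromℕ n · (1/ (2 * n) · (c 0 · c' 0))
    value = *-cancelʳ-fromℕ 2 (begin
      Z 0 0 · fromℕ 2
        ≡⟨ cong₂ (λ x y → ((c 1 · y ⊕ x · c' 1) ⊖ two · (c 1 · c' 1)) · fromℕ 2)
             (trans (centralAt-01 i) (cong (_· c 1) 2≡two)) (trans (centralAt-01 j) (cong (_· c' 1) 2≡two)) ⟩
      ((c 1 · (two · c' 1) ⊕ (two · c 1) · c' 1) ⊖ two · (c 1 · c' 1)) · fromℕ 2
        ≡⟨ ring (c 1) (c' 1) (fromℕ 2) ⟩
      (fromℕ 2 · c 1) · (two · c' 1)
        ≡⟨ cong₂ _·_ (centralAt-01 i) (trans (centralAt-01 j) (cong (_· c' 1) 2≡two)) ⟨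
      c 0 · c' 0
        ≡⟨ ·-identityˡ (c 0 · c' 0) ⟨
      1ℚ · (c 0 · c' 0)
        ≡⟨ cong (_· (c 0 · c' 0)) (trans (sym (1/-inverse (2 * n))) (cong (1/ (2 * n) ·_) (fromℕ-* 2 n))) ⟩
      (1/ (2 * n) · (fromℕ 2 · fromℕ n)) · (c 0 · c' 0)
        ≡⟨ ring′ (1/ (2 * n)) (fromℕ 2) (fromℕ n) (c 0 · c' 0) ⟩
      (fromℕ n · (1/ (2 * n) · (c 0 · c' 0))) · fromℕ 2 ∎)
      where
      ring : ∀ a b t → ((a · ((1ℚ ⊕ 1ℚ) · b) ⊕ ((1ℚ ⊕ 1ℚ) · a) · b) ⊖ (1ℚ ⊕ 1ℚ) · (a · b)) · t ≡ (t · a) · ((1ℚ ⊕ 1ℚ) · b)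
      ring = solve-∀ ℚ-ring
      ring′ : ∀ a t n c → (a · (t · n)) · c ≡ (n · (a · c)) · t
      ring′ = solve-∀ ℚ-ring

  log-coefficient : ∀ M → suc i + suc j ≤ M →
    ∑₁ M (λ L → 1/ L · shiftSum L (λ l m → ballotAt (suc i) l · ballotAt (suc j) m) 0 0) ≡
    1/ (2 * (suc i + suc j)) · (centralAt (suc i) 0 · centralAt (suc j) 0)
  log-coefficient M n≤M = *-cancelʳ-fromℕ n (trans (·-comm Σ′ (fromℕ n)) (trans body (·-comm (fromℕ n) val)))
    where
    Σ′ = ∑₁ M (λ L → 1/ L · shiftSum L bb 0 0)
    val = 1/ (2 * n) · (c 0 · c' 0)
    body : fromℕ n · Σ′ ≡ fromℕ n · val
    body = begin
      fromℕ n · Σ′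
        ≡⟨ ∑-*ˡ (range1 M) (fromℕ n) (λ L → 1/ L · shiftSum L bb 0 0) ⟨
      ∑₁ M (λ L → fromℕ n · (1/ L · shiftSum L bb 0 0))
        ≡⟨ trans (∑-range1 M (λ L → fromℕ n · (1/ L · shiftSum L bb 0 0))) (∑-ext (upTo M) term) ⟩
      ∑< M (λ L → shiftSum L Z 0 0 ⊖ shiftSum (suc L) Z 0 0)
        ≡⟨ ∑-telescope M (λ L → shiftSum L Z 0 0) ⟩
      Z 0 0 ⊖ shiftSum M Z 0 0
        ≡⟨ cong (λ z → Z 0 0 ⊖ z) (shiftSum-vanish M Z-vanish 0 0 (subst (n ≤_) (sym (+-identityʳ M)) n≤M)) ⟩
      Z 0 0 ⊖ 0ℚ
        ≡⟨ ⊕-identityʳ (Z 0 0) ⟩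
      Z 0 0
        ≡⟨ value ⟩
      fromℕ n · val ∎

wordCount : (p q : ℕ → Bool) → ℕ → ℕ → ℕ → ℚ
wordCount p q r s L = ∑ (words r s L) (λ w → 𝟙 (p (sumAt false cherries w)) · 𝟙 (q (sumAt true cherries w)))

∑-states : ∀ p q r s L l m →
  ∑ (states r s L l m) (test r s p q) ≡ shiftSum L (λ a b → forestCountAt p r a · forestCountAt q s b) l m
∑-states p q r s zero l m = trans (∑-map ([] ,_) (cartesianProduct (forestsOf l r) (forestsOf m s)) (test r s p q))
  (∑-product (forestsOf l r) (forestsOf m s) (λ F → 𝟙 (p (sumᶠ cherries F))) (λ G → 𝟙 (q (sumᶠ cherries G))))
∑-states p q r s (suc L) l m = trans (∑-states-suc r s p q L l m)
  (cong₂ _⊕_ (∑-states p q r s L (suc l) m) (∑-states p q r s L l (suc m)))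

wordCount≡shiftSum : ∀ p q r s L →
  wordCount p q r s L ≡ shiftSum L (λ a b → forestCountAt p r a · forestCountAt q s b) 0 0
wordCount≡shiftSum p q r s L = trans (∑-map proj₁ (states r s L 0 0) (λ w → 𝟙 (p (sumAt false cherries w)) · 𝟙 (q (sumAt true cherries w))))
  (trans (∑-cong (states r s L 0 0) (λ {x} → same x)) (∑-states p q r s L 0 0))
  where
  same : ∀ x → x ∈ states r s L 0 0 → 𝟙 (p (sumAt false cherries (proj₁ x))) · 𝟙 (q (sumAt true cherries (proj₁ x))) ≡ test r s p q x
  same (w , [] , []) _ = cong₂ (λ a b → 𝟙 (p a) · 𝟙 (q b)) (sym (+-identityʳ (sumAt false cherries w))) (sym (+-identityʳ (sumAt true cherries w)))
  same (w , [] , _ ∷ _) x∈ with () ← proj₁ (proj₂ (proj₂ (states-sound r s L 0 0 x∈)))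
  same (w , _ ∷ _ , _) x∈ with () ← proj₁ (proj₂ (states-sound r s L 0 0 x∈))

polyAt-> : ∀ p {r i} → r < i → polyAt p r i ≡ 0ℚ
polyAt-> p {r} {i} r<i = cong (λ m → at m (excessPoly p i)) (excess-> r<i)

cyclicCoeff : ℕ → ℕ → ℚ
cyclicCoeff i j = nz (i + j) (1/ (2 * (i + j)) · (centralAt i 0 · centralAt j 0))

-- Σ_L N_L/L is the logarithm of 1/(1 - u - v): it only depends on x + y - x² on either side.
∑-wordCount/L : ∀ p q r s M N N' → suc r + suc s ≤ M → suc r < N → suc s < N' →
  ∑₁ M (λ L → 1/ L · wordCount p q (suc r) (suc s) L) ≡
  ∑< N (λ i → ∑< N' (λ j → (polyAt p (suc r) i · polyAt q (suc s) j) · cyclicCoeff i j))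
∑-wordCount/L p q r s M N N' M≥ N> N'> = begin
  ∑₁ M (λ L → 1/ L · wordCount p q (suc r) (suc s) L)
    ≡⟨ ∑-ext (range1 M) (λ L → cong (1/ L ·_) (expand L)) ⟩
  ∑₁ M (λ L → 1/ L · ∑< N (λ i → ∑< N' (λ j → PQ i j · S L i j)))
    ≡⟨ ∑-ext (range1 M) (λ L → trans (sym (∑-*ˡ (upTo N) (1/ L) (λ i → ∑< N' (λ j → PQ i j · S L i j))))
         (∑-ext (upTo N) (λ i → trans (sym (∑-*ˡ (upTo N') (1/ L) (λ j → PQ i j · S L i j)))
           (∑-ext (upTo N') (λ j → exch (1/ L) (PQ i j) (S L i j)))))) ⟩
  ∑₁ M (λ L → ∑< N (λ i → ∑< N' (λ j → PQ i j · (1/ L · S L i j))))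
    ≡⟨ trans (∑-swap (range1 M) (upTo N) (λ L i → ∑< N' (λ j → PQ i j · (1/ L · S L i j))))
         (∑-ext (upTo N) (λ i → trans (∑-swap (range1 M) (upTo N') (λ L j → PQ i j · (1/ L · S L i j)))
           (∑-ext (upTo N') (λ j → ∑-*ˡ (range1 M) (PQ i j) (λ L → 1/ L · S L i j))))) ⟩
  ∑< N (λ i → ∑< N' (λ j → PQ i j · ∑₁ M (λ L → 1/ L · S L i j)))
    ≡⟨ ∑-ext (upTo N) (λ i → ∑-ext (upTo N') (λ j → final i j)) ⟩
  ∑< N (λ i → ∑< N' (λ j → PQ i j · cyclicCoeff i j)) ∎
  where
  P Q : ℕ → ℚ
  P = polyAt p (suc r)
  Q = polyAt q (suc s)
  PQ : ℕ → ℕ → ℚ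
  PQ i j = P i · Q j
  bb : ℕ → ℕ → ℕ → ℕ → ℚ
  bb i j l m = ballotAt i l · ballotAt j m
  S : ℕ → ℕ → ℕ → ℚ
  S L i j = shiftSum L (bb i j) 0 0
  exch : ∀ a b c → a · (b · c) ≡ b · (a · c)
  exch = solve-∀ ℚ-ring
  regroup : ∀ a b c d → (a · b) · (c · d) ≡ (b · d) · (a · c)
  regroup = solve-∀ ℚ-ring
  pointwise : ∀ a b → forestCountAt p (suc r) a · forestCountAt q (suc s) b ≡ ∑< N (λ i → ∑< N' (λ j → PQ i j · bb i j a b))
  pointwise a b = trans (cong₂ _·_ (forestCountAt-expand p (suc r) a N N>) (forestCountAt-expand q (suc s) b N' N'>))
    (trans (sym (∑-*ʳ (upTo N) (∑< N' (λ j → ballotAt j b · Q j)) (λ i → ballotAt i a · P i)))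
    (∑-ext (upTo N) (λ i → trans (sym (∑-*ˡ (upTo N') (ballotAt i a · P i) (λ j → ballotAt j b · Q j)))
      (∑-ext (upTo N') (λ j → regroup (ballotAt i a) (P i) (ballotAt j b) (Q j))))))
  expand : ∀ L → wordCount p q (suc r) (suc s) L ≡ ∑< N (λ i → ∑< N' (λ j → PQ i j · S L i j))
  expand L = trans (wordCount≡shiftSum p q (suc r) (suc s) L) (trans (shiftSum-ext L pointwise 0 0)
    (trans (shiftSum-∑ L (upTo N) (λ i a b → ∑< N' (λ j → PQ i j · bb i j a b)) 0 0)
    (∑-ext (upTo N) (λ i → trans (shiftSum-∑ L (upTo N') (λ j a b → PQ i j · bb i j a b) 0 0)
      (∑-ext (upTo N') (λ j → shiftSum-* L (PQ i j) (bb i j) 0 0))))))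
  zero-factor : ∀ {a b x y} → a · b ≡ 0ℚ → (a · b) · x ≡ (a · b) · y
  zero-factor {a} {b} {x} {y} eq = trans (cong (_· x) eq) (trans (·-zeroˡ x) (sym (trans (cong (_· y) eq) (·-zeroˡ y))))
  final : ∀ i j → PQ i j · ∑₁ M (λ L → 1/ L · S L i j) ≡ PQ i j · cyclicCoeff i j
  -- The power 0 of x + y - x² has no term of positive degree, so i = 0 and j = 0 contribute
  -- nothing; `log-coefficient` covers positive exponents only.
  final zero j = zero-factor {P 0} {Q j} (·-zeroˡ (Q j))
  final (suc i) zero = zero-factor {P (suc i)} {Q 0} (·-zeroʳ (P (suc i)))
  final (suc i) (suc j) = case-≤ (suc i ℕ.≤? suc r) (suc j ℕ.≤? suc s)
    where
    case-≤ : Dec (suc i ≤ suc r) → Dec (suc j ≤ suc s) →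
      PQ (suc i) (suc j) · ∑₁ M (λ L → 1/ L · S L (suc i) (suc j)) ≡ PQ (suc i) (suc j) · cyclicCoeff (suc i) (suc j)
    case-≤ (yes i≤) (yes j≤) = cong (PQ (suc i) (suc j) ·_)
      (CyclicWords.log-coefficient i j M (≤-trans (+-mono-≤ i≤ j≤) M≥))
    case-≤ (no i≰) _ = zero-factor {P (suc i)} {Q (suc j)}
      (trans (cong (_· Q (suc j)) (polyAt-> p {suc r} {suc i} (≰⇒> i≰))) (·-zeroˡ (Q (suc j))))
    case-≤ _ (no j≰) = zero-factor {P (suc i)} {Q (suc j)}
      (trans (cong (P (suc i) ·_) (polyAt-> q {suc s} {suc j} (≰⇒> j≰))) (·-zeroʳ (P (suc i))))

-- Palindromes and bicoloured Motzkin paths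

palindromes : (ℕ → Bool) → ℕ → ℕ → ℚ
palindromes p r m = 2^ m · forestCountAt p r m

-- The m letters of half a palindrome have free orientations, whence 2^m and the geometric series of
-- 2u. It telescopes, because u^m is the difference of u^m/(1 - 2u) and 2u^(m+1)/(1 - 2u).
∑-2^forestCount : ∀ p r →
  ∑< (suc r) (λ m → palindromes p r m) ≡ ∑< (suc r) (λ i → centralAt i 0 · polyAt p r i)
∑-2^forestCount p r = begin
  ∑< (suc r) (λ m → palindromes p r m)
    ≡⟨ ∑-ext (upTo (suc r)) (λ m → trans (cong (2^ m ·_) (forestCountAt-expand p r m (suc r) ≤-refl))
         (trans (sym (∑-*ˡ (upTo (suc r)) (2^ m) (λ i → ballotAt i m · polyAt p r i)))
                (∑-ext (upTo (suc r)) (λ i → sym (·-assoc (2^ m) (ballotAt i m) (polyAt p r i)))))) ⟩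
  ∑< (suc r) (λ m → ∑< (suc r) (λ i → (2^ m · ballotAt i m) · polyAt p r i))
    ≡⟨ trans (∑-swap (upTo (suc r)) (upTo (suc r)) (λ m i → (2^ m · ballotAt i m) · polyAt p r i))
         (∑-cong (upTo (suc r)) (λ {i} i∈ → trans (∑-*ʳ (upTo (suc r)) (polyAt p r i) (λ m → 2^ m · ballotAt i m))
           (cong (_· polyAt p r i) (telescoped i (∈-upTo⁻ i∈))))) ⟩
  ∑< (suc r) (λ i → centralAt i 0 · polyAt p r i) ∎
  where
  telescoped : ∀ i → i < suc r → ∑< (suc r) (λ m → 2^ m · ballotAt i m) ≡ centralAt i 0
  telescoped i i<r = trans (∑-ext (upTo (suc r)) term) (trans (∑-telescope (suc r) g)
      (trans (cong₂ _⊖_ (·-identityˡ (centralAt i 0)) (trans (cong (2^ (suc r) ·_) (centralAt-> {i} {suc r} i<r)) (·-zeroʳ (2^ (suc r)))))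
             (⊕-identityʳ (centralAt i 0))))
    where
    g : ℕ → ℚ
    g m = 2^ m · centralAt i m
    ring : ∀ a t c c' → a · (c ⊖ t · c') ≡ a · c ⊖ (t · a) · c'
    ring = solve-∀ ℚ-ring
    term : ∀ m → 2^ m · ballotAt i m ≡ g m ⊖ g (suc m)
    term m = trans (cong (2^ m ·_) (ballotAt-central i m))
      (trans (ring (2^ m) (fromℕ 2) (centralAt i m) (centralAt i (suc m)))
             (cong (λ z → g m ⊖ z · centralAt i (suc m)) (sym (fromℕ-* 2 (2 ^ m)))))

trinomial : ℕ → ℕ → ℕ → ℚ
trinomial a b c = fromℕ ((a + b + c) !) · (1/ (a !) · (1/ (b !) · 1/ (c !)))

private
  ℕ! : ∀ n → NonZero (n !)
  ℕ! = _!≢0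

trinomial-swap : ∀ a b c → trinomial a b c ≡ trinomial b a c
trinomial-swap a b c = cong₂ _·_ (cong (λ n → fromℕ ((n + c) !)) (+-comm a b)) (swap (1/ (a !)) (1/ (b !)) (1/ (c !)))
  where
  swap : ∀ x y z → x · (y · z) ≡ y · (x · z)
  swap = solve-∀ ℚ-ring

trinomial-swapʳ : ∀ a b c → trinomial a b c ≡ trinomial a c b
trinomial-swapʳ a b c = cong₂ _·_ (cong (λ n → fromℕ (n !)) (trans (+-assoc a b c) (trans (cong (a +_) (+-comm b c)) (sym (+-assoc a c b)))))
  (cong (1/ (a !) ·_) (·-comm (1/ (b !)) (1/ (c !))))

-- The value at a - 1, where a negative argument counts as 0.
pre : ℕ → (ℕ → ℚ) → ℚ
pre zero f = 0ℚ
pre (suc a) f = f a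

1/!-suc : ∀ a → fromℕ (suc a) · 1/ (suc a !) ≡ 1/ (a !)
1/!-suc a = begin
  fromℕ (suc a) · 1/ (suc a * a !) ≡⟨ cong (fromℕ (suc a) ·_) (1/-* (suc a) (a !) {{_}} {{ℕ! a}}) ⟩
  fromℕ (suc a) · (1/ (suc a) · 1/ (a !)) ≡⟨ ring (fromℕ (suc a)) (1/ (suc a)) (1/ (a !)) ⟩
  (1/ (suc a) · fromℕ (suc a)) · 1/ (a !) ≡⟨ cong (_· 1/ (a !)) (1/-inverse (suc a)) ⟩
  1ℚ · 1/ (a !) ≡⟨ ·-identityˡ (1/ (a !)) ⟩
  1/ (a !) ∎
  where
  ring : ∀ x y z → x · (y · z) ≡ (y · x) · z
  ring = solve-∀ ℚ-ring

pre-trinomial : ∀ a b c → pre a (λ a' → trinomial a' b c) · fromℕ (a + b + c) ≡ fromℕ a · trinomial a b c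
pre-trinomial zero b c = trans (·-zeroˡ (fromℕ (b + c))) (sym (·-zeroˡ (trinomial 0 b c)))
pre-trinomial (suc a) b c = begin
  (fromℕ (n !) · (1/ (a !) · y)) · fromℕ (suc n)
    ≡⟨ cong (λ z → (fromℕ (n !) · (z · y)) · fromℕ (suc n)) (1/!-suc a) ⟨
  (fromℕ (n !) · ((fromℕ (suc a) · 1/ (suc a !)) · y)) · fromℕ (suc n)
    ≡⟨ ring (fromℕ (n !)) (fromℕ (suc a)) (1/ (suc a !)) y (fromℕ (suc n)) ⟩
  fromℕ (suc a) · ((fromℕ (suc n) · fromℕ (n !)) · (1/ (suc a !) · y))
    ≡⟨ cong (λ z → fromℕ (suc a) · (z · (1/ (suc a !) · y))) (fromℕ-* (suc n) (n !)) ⟨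
  fromℕ (suc a) · (fromℕ (suc n !) · (1/ (suc a !) · y)) ∎
  where
  n = a + b + c
  y = 1/ (b !) · 1/ (c !)
  ring : ∀ f s i y m → (f · ((s · i) · y)) · m ≡ s · ((m · f) · (i · y))
  ring = solve-∀ ℚ-ring

pre-cong : ∀ a {f g : ℕ → ℚ} → (∀ x → f x ≡ g x) → pre a f ≡ pre a g
pre-cong zero eq = refl
pre-cong (suc a) eq = eq a

-- After multiplication by a + b + c the lowered trinomials become a, b and c times
-- `trinomial a b c`.
trinomial-rec : ∀ a b c .{{_ : NonZero (a + b + c)}} → trinomial a b c ≡
  (pre a (λ a' → trinomial a' b c) ⊕ pre b (λ b' → trinomial a b' c)) ⊕ pre c (λ c' → trinomial a b c')
trinomial-rec a b c = *-cancelʳ-fromℕ (a + b + c) (begin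
  t · n ≡⟨ cong (t ·_) (trans (fromℕ-+ (a + b) c) (cong (_⊕ fromℕ c) (fromℕ-+ a b))) ⟩
  t · ((fromℕ a ⊕ fromℕ b) ⊕ fromℕ c) ≡⟨ ring t (fromℕ a) (fromℕ b) (fromℕ c) ⟩
  (fromℕ a · t ⊕ fromℕ b · t) ⊕ fromℕ c · t ≡⟨ cong₂ _⊕_ (cong₂ _⊕_ (sym (pre-trinomial a b c)) (sym middle)) (sym last) ⟩
  (pa · n ⊕ pb · n) ⊕ pc · n ≡⟨ ring′ pa pb pc n ⟩
  ((pa ⊕ pb) ⊕ pc) · n ∎)
  where
  t = trinomial a b c
  n = fromℕ (a + b + c)
  pa = pre a (λ a' → trinomial a' b c)
  pb = pre b (λ b' → trinomial a b' c)
  pc = pre c (λ c' → trinomial a b c')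
  ring : ∀ t a b c → t · ((a ⊕ b) ⊕ c) ≡ (a · t ⊕ b · t) ⊕ c · t
  ring = solve-∀ ℚ-ring
  ring′ : ∀ a b c n → (a · n ⊕ b · n) ⊕ c · n ≡ ((a ⊕ b) ⊕ c) · n
  ring′ = solve-∀ ℚ-ring
  middle : pb · n ≡ fromℕ b · t
  middle = trans (cong₂ _·_ (pre-cong b (λ b' → trinomial-swap a b' c)) (cong (λ m → fromℕ (m + c)) (+-comm a b)))
    (trans (pre-trinomial b a c) (cong (fromℕ b ·_) (trinomial-swap b a c)))
  rotated : ∀ x → trinomial a b x ≡ trinomial x a b
  rotated x = trans (trinomial-swapʳ a b x) (trinomial-swap a x b)
  +-rot : ∀ a b c → a + b + c ≡ c + a + b
  +-rot = ℕ-Ring.solve-∀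
  last : pc · n ≡ fromℕ c · t
  last = trans (cong₂ _·_ (pre-cong c rotated) (cong fromℕ (+-rot a b c)))
    (trans (pre-trinomial c a b) (cong (fromℕ c ·_) (sym (rotated c))))

equals : ℕ → ℕ → Bool
equals c n = n ℕ.≡ᵇ c

always : ℕ → Bool
always _ = true

excessPoly-never : ∀ i d → excessPoly (λ _ → false) i d ≡ 0ℚ
excessPoly-never zero zero = refl
excessPoly-never zero (suc d) = refl
excessPoly-never (suc i) zero = excessPoly-never i zero
excessPoly-never (suc i) (suc d) = trans (cong₂ _⊕_ (excessPoly-never i (suc d)) (cong₂ _⊖_ (excessPoly-never i d) (excessPoly-never i d))) refl

excessPoly-always-0 : ∀ i → excessPoly always i 0 ≡ 1ℚ
excessPoly-always-0 zero = refl
excessPoly-always-0 (suc i) = excessPoly-always-0 i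

excessPoly-always-suc : ∀ i d → excessPoly always i (suc d) ≡ 0ℚ
excessPoly-always-suc zero d = refl
excessPoly-always-suc (suc i) d = trans (cong₂ _⊕_ (excessPoly-always-suc i d) (ℚₚ.+-inverseʳ (excessPoly always i d))) (⊕-identityˡ 0ℚ)

-- The terms of (x + y - x²)ⁱ with c factors y, d - c factors -x² and i - d factors x.
trinomialTerm : ℕ → ℕ → ℕ → ℚ
trinomialTerm c i d = at (excess c d) (λ b → at (excess d i) (λ a → pm1 b · trinomial a b c))

at-0 : ∀ m → at m (λ _ → 0ℚ) ≡ 0ℚ
at-0 (just _) = refl
at-0 nothing = refl

-- The trinomial theorem, one factor at a time: the three summands of `trinomial-rec` correspond to
-- choosing x, -x² or y from the new factor. A cherry and a pair of leaves both raise the excess by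
-- one.
excessPoly-equals : ∀ c i d → excessPoly (equals c) i d ≡ trinomialTerm c i d
excessPoly-equals zero zero zero = refl
excessPoly-equals (suc c) zero zero = refl
excessPoly-equals c zero (suc d) = sym (at-0 (excess c (suc d)))
excessPoly-equals zero (suc i) zero = trans (excessPoly-equals zero i zero) (cong (1ℚ ·_) (sym step))
  where
  step : trinomial (suc i) 0 0 ≡ trinomial i 0 0
  step = trans (trinomial-rec (suc i) 0 0) (plus0 (trinomial i 0 0))
    where
    plus0 : ∀ x → (x ⊕ 0ℚ) ⊕ 0ℚ ≡ x
    plus0 = solve-∀ ℚ-ring
excessPoly-equals (suc c) (suc i) zero = excessPoly-equals (suc c) i zero
excessPoly-equals c (suc i) (suc d) = trans
  (cong₂ _⊕_ (excessPoly-equals c i (suc d)) (cong₂ _⊖_ (shifted c) (excessPoly-equals c i d)))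
  (go (excess c (suc d)) refl (excess d i) refl)
  where
  lower : ℕ → ℚ
  lower zero = 0ℚ
  lower (suc c) = trinomialTerm c i d
  shifted : ∀ c → excessPoly (equals c ∘ suc) i d ≡ lower c
  shifted zero = excessPoly-never i d
  shifted (suc c) = excessPoly-equals c i d
  termᵃ : Maybe ℕ → ℕ → ℕ → ℚ
  termᵃ m b c = at m (λ a → pm1 b · trinomial a b c)
  Goal : Maybe ℕ → Maybe ℕ → Set
  Goal m n = at m (λ b → at (excess (suc d) i) (λ a → pm1 b · trinomial a b c)) ⊕
      (lower c ⊖ trinomialTerm c i d) ≡ at m (λ b → termᵃ n b c)
  lower≡ : ∀ c {m} → excess c (suc d) ≡ m → ∀ {n} → excess d i ≡ n → lower c ≡ pre c (λ c' → at m (λ b → termᵃ n b c'))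
  lower≡ zero _ _ = refl
  lower≡ (suc c) refl refl = refl
  term≡ : ∀ {m} → excess c d ≡ m → ∀ {n} → excess d i ≡ n → trinomialTerm c i d ≡ at m (λ b → termᵃ n b c)
  term≡ refl refl = refl
  go : ∀ m → excess c (suc d) ≡ m → ∀ n → excess d i ≡ n → Goal m n
  go nothing eq n en = trans (cong₂ (λ x y → 0ℚ ⊕ (x ⊖ y)) (trans (lower≡ c eq en) (pre-0 c)) (term≡ (no-d c eq) en)) refl
    where
    pre-0 : ∀ c → pre c (λ _ → 0ℚ) ≡ 0ℚ
    pre-0 zero = refl
    pre-0 (suc _) = refl
    no-d : ∀ c → excess c (suc d) ≡ nothing → excess c d ≡ nothing
    no-d (suc c) eq = excess-suc∅ c d eq
  go (just b) eq nothing en = trans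
    (cong₂ _⊕_ (cong (λ m → termᵃ m b c) (excess-suc∅ d i en))
      (cong₂ _⊖_ (trans (lower≡ c eq en) (pre-0 c)) (trans (term≡ refl en) (at-0 (excess c d))))) refl
    where
    pre-0 : ∀ c → pre c (λ c' → 0ℚ) ≡ 0ℚ
    pre-0 zero = refl
    pre-0 (suc _) = refl
  go (just b) eq (just a) en = begin
    at (excess (suc d) i) (λ a → pm1 b · trinomial a b c) ⊕ (lower c ⊖ trinomialTerm c i d)
      ≡⟨ cong₂ _⊕_ (top a en) (cong₂ _⊖_ (trans (lower≡ c eq en) (pre-* c)) (bottom b eq)) ⟩
    σ · pre a (λ a' → trinomial a' b c) ⊕ (σ · pre c (λ c' → trinomial a b c') ⊖ (ℚ.- (σ · pre b (λ b' → trinomial a b' c))))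
      ≡⟨ ring σ (pre a (λ a' → trinomial a' b c)) (pre b (λ b' → trinomial a b' c)) (pre c (λ c' → trinomial a b c')) ⟩
    σ · ((pre a (λ a' → trinomial a' b c) ⊕ pre b (λ b' → trinomial a b' c)) ⊕ pre c (λ c' → trinomial a b c'))
      ≡⟨ cong (σ ·_) (trinomial-rec a b c {{nonzero}}) ⟨
    σ · trinomial a b c ∎
    where
    σ = pm1 b
    nonzero : NonZero (a + b + c)
    nonzero = subst NonZero (sym (trans (+-assoc a b c) (trans (cong (a +_) (trans (+-comm b c) (excess-just c (suc d) eq))) (+-suc a d)))) _
    pre-* : ∀ c → pre c (λ c' → σ · trinomial a b c') ≡ σ · pre c (λ c' → trinomial a b c')
    pre-* zero = sym (·-zeroʳ σ)
    pre-* (suc c) = refl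
    top : ∀ a → excess d i ≡ just a → at (excess (suc d) i) (λ a → σ · trinomial a b c) ≡ σ · pre a (λ a' → trinomial a' b c)
    top zero en = trans (cong (λ m → at m (λ a → σ · trinomial a b c)) (excess-suc0 d i en)) (sym (·-zeroʳ σ))
    top (suc a) en = cong (λ m → at m (λ a → σ · trinomial a b c)) (excess-suc d i en)
    bottom : ∀ b → excess c (suc d) ≡ just b → trinomialTerm c i d ≡ ℚ.- (pm1 b · pre b (λ b' → trinomial a b' c))
    bottom zero eq = trans (term≡ (excess-> {c} {d} (≤-reflexive (sym (trans (sym (+-identityʳ c)) (excess-just c (suc d) eq))))) en) refl
    bottom (suc b) eq = trans (term≡ {just b} (excess-suc′ c d eq) en) (double (pm1 b) (trinomial a b c))
      where
      excess-suc′ : ∀ c d {b} → excess c (suc d) ≡ just (suc b) → excess c d ≡ just b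
      excess-suc′ c d eq = excess-suc c (suc d) eq
      double : ∀ x y → x · y ≡ ℚ.- ((ℚ.- x) · y)
      double = solve-∀ ℚ-ring
    ring : ∀ s x y z → s · x ⊕ (s · z ⊖ (ℚ.- (s · y))) ≡ s · ((x ⊕ y) ⊕ z)
    ring = solve-∀ ℚ-ring

-- Kept apart from `2 *` because it computes to two successors, through which `excess` reduces.
double : ℕ → ℕ
double zero = 0
double (suc n) = suc (suc (double n))

double≡2* : ∀ n → double n ≡ 2 * n
double≡2* zero = refl
double≡2* (suc n) = cong suc (trans (cong suc (double≡2* n)) (sym (+-suc n (n + 0))))

excess-drop : ∀ c d → excess c (suc d) ≡ nothing → excess c d ≡ nothing
excess-drop (suc c) d eq = excess-suc∅ c d eq

-- The number of bicoloured Motzkin paths from height h to 0 with b down and b - h up steps; as a power series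
-- in the leaf and cherry variables it is (u - x)^h/(1-2u).
motzkin : ℕ → ℕ → ℕ → ℚ
motzkin e h b = at (excess (double b) e) (λ a → at (excess h b) (λ c → 2^ a · trinomial a c b))

at-cong : ∀ m {f g : ℕ → ℚ} → (∀ x → f x ≡ g x) → at m f ≡ at m g
at-cong (just x) eq = eq x
at-cong nothing eq = refl

motz : Maybe ℕ → Maybe ℕ → ℕ → ℚ
motz A H b = at A (λ a → at H (λ c → 2^ a · trinomial a c b))

motz-nothingʳ : ∀ A b → motz A nothing b ≡ 0ℚ
motz-nothingʳ A b = at-0 A

2^-suc : ∀ a → 2^ (suc a) ≡ fromℕ 2 · 2^ a
2^-suc a = fromℕ-* 2 (2 ^ a)

pre-2^ : ∀ a (f : ℕ → ℚ) → 2^ a · pre a f ≡ fromℕ 2 · pre a (λ a' → 2^ a' · f a')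
pre-2^ zero f = refl
pre-2^ (suc a) f = trans (cong (_· f a) (2^-suc a)) (·-assoc (fromℕ 2) (2^ a) (f a))

pre-*ˡ : ∀ c x (f : ℕ → ℚ) → x · pre c f ≡ pre c (λ c' → x · f c')
pre-*ˡ zero x f = ·-zeroʳ x
pre-*ˡ (suc c) x f = refl

excess-predᵃ : ∀ {m e} A → excess m e ≡ A → (k : ℕ → ℚ) → at (excess (suc m) e) k ≡ at A (λ a → pre a k)
excess-predᵃ {m} {e} nothing eq k = cong (λ z → at z k) (excess-suc∅ m e eq)
excess-predᵃ {m} {e} (just zero) eq k = cong (λ z → at z k) (excess-suc0 m e eq)
excess-predᵃ {m} {e} (just (suc a)) eq k = cong (λ z → at z k) (excess-suc m e eq)

-- By the first step of the path: level in one of two colours, up, or down. The length e = a + 2b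
-- charges 1 to a level step, 2 to a down step and nothing to an up step.
motzkin-rec : ∀ e h b → motzkin (suc (suc e)) (suc h) b ≡
  (fromℕ 2 · motzkin (suc e) (suc h) b ⊕ motzkin (suc (suc e)) (suc (suc h)) b) ⊕ pre b (motzkin e h)
motzkin-rec e h zero = refl
motzkin-rec e h (suc b) = go (excess (double b) e) refl (excess h b) refl
  where
  go : ∀ A → excess (double b) e ≡ A → ∀ H → excess h b ≡ H →
    motz A H (suc b) ≡ (fromℕ 2 · motzkin (suc e) (suc h) (suc b) ⊕ motzkin (suc (suc e)) (suc (suc h)) (suc b)) ⊕ motzkin e h b
  go A eA nothing eH = trans (motz-nothingʳ A (suc b)) (sym (cong₂ _⊕_ (cong₂ _⊕_ (cong (fromℕ 2 ·_) first) second) third))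
    where
    first : motzkin (suc e) (suc h) (suc b) ≡ 0ℚ
    first = trans (cong (λ H → motz (excess (suc (double b)) e) H (suc b)) eH)
      (trans (excess-predᵃ {double b} {e} A eA (λ _ → 0ℚ)) (trans (at-cong A λ { zero → refl ; (suc _) → refl }) (at-0 A)))
    second : motzkin (suc (suc e)) (suc (suc h)) (suc b) ≡ 0ℚ
    second = trans (cong (λ H → motz (excess (double b) e) H (suc b)) (excess-suc∅ h b eH)) (motz-nothingʳ (excess (double b) e) (suc b))
    third : motzkin e h b ≡ 0ℚ
    third = trans (cong (λ H → motz (excess (double b) e) H b) eH) (motz-nothingʳ (excess (double b) e) b)
  go nothing eA (just c) eH = sym (trans (cong₂ _⊕_ (cong₂ _⊕_ (cong (fromℕ 2 ·_) first) second) third) refl)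
    where
    first : motzkin (suc e) (suc h) (suc b) ≡ 0ℚ
    first = excess-predᵃ {double b} {e} nothing eA (λ a → at (excess h b) (λ c → 2^ a · trinomial a c (suc b)))
    second : motzkin (suc (suc e)) (suc (suc h)) (suc b) ≡ 0ℚ
    second = cong (λ A → motz A (excess (suc h) b) (suc b)) eA
    third : motzkin e h b ≡ 0ℚ
    third = cong (λ A → motz A (excess h b) b) eA
  go (just a) eA (just c) eH = begin
    P · trinomial a c (suc b)
      ≡⟨ cong (P ·_) (trinomial-rec a c (suc b) {{subst NonZero (sym (+-suc (a + c) b)) _}}) ⟩
    P · ((pre a (λ a' → trinomial a' c (suc b)) ⊕ pre c (λ c' → trinomial a c' (suc b))) ⊕ trinomial a c b)
      ≡⟨ distrib P (pre a (λ a' → trinomial a' c (suc b))) (pre c (λ c' → trinomial a c' (suc b))) (trinomial a c b) ⟩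
    (P · pre a (λ a' → trinomial a' c (suc b)) ⊕ P · pre c (λ c' → trinomial a c' (suc b))) ⊕ P · trinomial a c b
      ≡⟨ cong₂ _⊕_ (cong₂ _⊕_ (trans (pre-2^ a (λ a' → trinomial a' c (suc b))) (cong (fromℕ 2 ·_) (sym first)))
           (trans (pre-*ˡ c P (λ c' → trinomial a c' (suc b))) (sym second))) (sym third) ⟩
    (fromℕ 2 · motzkin (suc e) (suc h) (suc b) ⊕ motzkin (suc (suc e)) (suc (suc h)) (suc b)) ⊕ motzkin e h b ∎
    where
    P = 2^ a
    distrib : ∀ p x y z → p · ((x ⊕ y) ⊕ z) ≡ (p · x ⊕ p · y) ⊕ p · z
    distrib = solve-∀ ℚ-ring
    first : motzkin (suc e) (suc h) (suc b) ≡ pre a (λ a' → 2^ a' · trinomial a' c (suc b))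
    first = trans (excess-predᵃ {double b} {e} (just a) eA (λ a → at (excess h b) (λ c → 2^ a · trinomial a c (suc b))))
      (pre-cong a (λ a' → cong (λ H → at H (λ c → 2^ a' · trinomial a' c (suc b))) eH))
    second : motzkin (suc (suc e)) (suc (suc h)) (suc b) ≡ pre c (λ c' → P · trinomial a c' (suc b))
    second = trans (cong (λ A → motz A (excess (suc h) b) (suc b)) eA) (excess-predᵃ {h} {b} (just c) eH (λ c → P · trinomial a c (suc b)))
    third : motzkin e h b ≡ P · trinomial a c b
    third = cong₂ (λ A H → motz A H b) eA eH

-- Paths may go below height 0. From height 0 as many of them start downwards as upwards, by
-- symmetry, so both kinds are counted by the up step.
motzkin-rec₀ : ∀ e b → motzkin (suc e) 0 b ≡ fromℕ 2 · (motzkin e 0 b ⊕ motzkin (suc e) 1 b)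
motzkin-rec₀ e b = go (excess (double b) (suc e)) refl
  where
  lower : ∀ A → excess (double b) (suc e) ≡ A → (k : ℕ → ℚ) → at (excess (double b) e) k ≡ at A (λ a → pre a k)
  lower nothing eq k = cong (λ z → at z k) (excess-drop (double b) e eq)
  lower (just zero) eq k = cong (λ z → at z k) (excess-> {double b} {e} (≤-reflexive (sym (trans (sym (+-identityʳ (double b))) (excess-just (double b) (suc e) eq)))))
  lower (just (suc a)) eq k = cong (λ z → at z k) (excess-suc (double b) (suc e) eq)
  go : ∀ A → excess (double b) (suc e) ≡ A → motz A (just b) b ≡ fromℕ 2 · (motzkin e 0 b ⊕ motzkin (suc e) 1 b)
  go nothing eA = sym (trans (cong₂ (λ x y → fromℕ 2 · (x ⊕ y)) (lower nothing eA (λ a → 2^ a · trinomial a b b)) (cong (λ A → motz A (excess 1 b) b) eA)) refl)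
  go (just a) eA = begin
    P · trinomial a b b
      ≡⟨ cong (P ·_) (trinomial-rec a b b {{nonzero}}) ⟩
    P · ((pre a (λ a' → trinomial a' b b) ⊕ X) ⊕ pre b (λ c' → trinomial a b c'))
      ≡⟨ cong (λ z → P · ((pre a (λ a' → trinomial a' b b) ⊕ X) ⊕ z)) (pre-cong b (λ c' → trinomial-swapʳ a b c')) ⟩
    P · ((pre a (λ a' → trinomial a' b b) ⊕ X) ⊕ X)
      ≡⟨ distrib P (pre a (λ a' → trinomial a' b b)) X ⟩
    P · pre a (λ a' → trinomial a' b b) ⊕ (1ℚ ⊕ 1ℚ) · (P · X)
      ≡⟨ cong₂ _⊕_ (pre-2^ a (λ a' → trinomial a' b b)) (cong (_· (P · X)) (sym (fromℕ-suc 1))) ⟩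
    fromℕ 2 · pre a (λ a' → 2^ a' · trinomial a' b b) ⊕ fromℕ 2 · (P · X)
      ≡⟨ ℚₚ.*-distribˡ-+ (fromℕ 2) (pre a (λ a' → 2^ a' · trinomial a' b b)) (P · X) ⟨
    fromℕ 2 · (pre a (λ a' → 2^ a' · trinomial a' b b) ⊕ P · X)
      ≡⟨ cong (fromℕ 2 ·_) (cong₂ _⊕_ (lower (just a) eA (λ a → 2^ a · trinomial a b b)) second) ⟨
    fromℕ 2 · (motzkin e 0 b ⊕ motzkin (suc e) 1 b) ∎
    where
    P = 2^ a
    X = pre b (λ b' → trinomial a b' b)
    distrib : ∀ p x y → p · ((x ⊕ y) ⊕ y) ≡ p · x ⊕ (1ℚ ⊕ 1ℚ) · (p · y)
    distrib = solve-∀ ℚ-ring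
    second : motzkin (suc e) 1 b ≡ P · X
    second = trans (cong (λ A → motz A (excess 1 b) b) eA)
      (trans (excess-predᵃ {0} {b} (just b) refl (λ c → P · trinomial a c b)) (sym (pre-*ˡ b P (λ b' → trinomial a b' b))))
    shape : ∀ a b → a + b + b ≡ 2 * b + a
    shape = ℕ-Ring.solve-∀
    nonzero : NonZero (a + b + b)
    nonzero = subst NonZero (sym (trans (shape a b) (trans (cong (_+ a) (sym (double≡2* b))) (excess-just (double b) (suc e) eA)))) _

-- (u - x)^h u^l/(1-2u), expanded by u = x + (u - x).
motzkinTrees : ℕ → ℕ → ℕ → ℕ → ℚ
motzkinTrees h zero e b = motzkin e h b
motzkinTrees h (suc l) e b = motzkinTrees h l e b ⊕ motzkinTrees (suc h) l (suc e) b

-- Every term of u - x has at least two leaves, hence every term of its power h has at least 2h; in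
-- terms of paths, h down steps are unavoidable.
motzkinTrees-vanish : ∀ h l e b → e < double h → motzkinTrees h l e b ≡ 0ℚ
motzkinTrees-vanish h zero e b e< = trans (go (excess h b) refl) refl
  where
  double-mono : ∀ {m n} → m ≤ n → double m ≤ double n
  double-mono z≤n = z≤n
  double-mono (s≤s m≤n) = s≤s (s≤s (double-mono m≤n))
  go : ∀ H → excess h b ≡ H → at (excess (double b) e) (λ a → at (excess h b) (λ c → 2^ a · trinomial a c b)) ≡ 0ℚ
  go nothing eH = trans (cong (λ H → motz (excess (double b) e) H b) eH) (at-0 (excess (double b) e))
  go (just c) eH = cong (λ A → motz A (excess h b) b)
    (excess-> (<-≤-trans e< (double-mono (≤-trans (m≤m+n h c) (≤-reflexive (excess-just h b eH))))))
motzkinTrees-vanish h (suc l) e b e< = trans (cong₂ _⊕_ (motzkinTrees-vanish h l e b e<)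
  (motzkinTrees-vanish (suc h) l (suc e) b (s≤s (m≤n⇒m≤1+n e<)))) refl

-- The recurrence of `IsTreeLike` once more: for the condition of having exactly b cherries, the
-- shifted predicate asks for b - 1, which is `pre b`.
motzkinTrees-rec : ∀ h l e b → motzkinTrees h (suc l) (suc e) b ≡
  (motzkinTrees h l (suc e) b ⊕ motzkinTrees h (suc (suc l)) e b) ⊕ (pre b (motzkinTrees h l e) ⊖ motzkinTrees h l e b)
motzkinTrees-rec h zero e b = trans (cong (motzkin (suc e) h b ⊕_) (trans (motzkin-rec e h b)
    (cong (λ z → (z · motzkin (suc e) (suc h) b ⊕ motzkin (suc (suc e)) (suc (suc h)) b) ⊕ pre b (motzkin e h)) (fromℕ-suc 1))))
  (ring (motzkin (suc e) h b) (motzkin (suc e) (suc h) b) (motzkin (suc (suc e)) (suc (suc h)) b) (pre b (motzkin e h)) (motzkin e h b))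
  where
  ring : ∀ a b c d f → a ⊕ (((1ℚ ⊕ 1ℚ) · b ⊕ c) ⊕ d) ≡ (a ⊕ ((f ⊕ b) ⊕ (b ⊕ c))) ⊕ (d ⊖ f)
  ring = solve-∀ ℚ-ring
motzkinTrees-rec h (suc l) e b = trans
  (cong₂ _⊕_ (motzkinTrees-rec h l e b) (motzkinTrees-rec (suc h) l (suc e) b))
  (trans (ring (M h l (suc e)) (M h (suc (suc l)) e) (pre b (motzkinTrees h l e)) (M h l e)
            (M (suc h) l (suc (suc e))) (M (suc h) (suc (suc l)) (suc e)) (pre b (motzkinTrees (suc h) l (suc e))) (M (suc h) l (suc e)))
         (cong (λ z → ((M h l (suc e) ⊕ M (suc h) l (suc (suc e))) ⊕ (M h (suc (suc l)) e ⊕ M (suc h) (suc (suc l)) (suc e))) ⊕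
            (z ⊖ (M h l e ⊕ M (suc h) l (suc e)))) (pre-+ b)))
  where
  M : ℕ → ℕ → ℕ → ℚ
  M h l e = motzkinTrees h l e b
  pre-+ : ∀ b → pre b (motzkinTrees h l e) ⊕ pre b (motzkinTrees (suc h) l (suc e)) ≡ pre b (motzkinTrees h (suc l) e)
  pre-+ zero = refl
  pre-+ (suc b) = refl
  ring : ∀ a b c d a' b' c' d' → ((a ⊕ b) ⊕ (c ⊖ d)) ⊕ ((a' ⊕ b') ⊕ (c' ⊖ d')) ≡
    ((a ⊕ a') ⊕ (b ⊕ b')) ⊕ ((c ⊕ c') ⊖ (d ⊕ d'))
  ring = solve-∀ ℚ-ring

anti-*ˡ : ∀ n x (f : ℕ → ℕ → ℚ) → anti n (λ i j → x · f i j) ≡ x · anti n f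
anti-*ˡ zero x f = refl
anti-*ˡ (suc n) x f = trans (cong (x · f 0 (suc n) ⊕_) (anti-*ˡ n x (λ i j → f (suc i) j))) (sym (ℚₚ.*-distribˡ-+ x (f 0 (suc n)) (anti n (λ i j → f (suc i) j))))

centralTree : IsTreeLike (combine central)
centralTree = combine-treeLike central central-zero central-suc

combine-never : ∀ l e → combine central (λ _ → false) l e ≡ 0ℚ
combine-never l e = trans (anti-ext e (λ i j → trans (cong (central l i ·_) (excessPoly-never (l + i) j)) (trans (·-zeroʳ (central l i)) (sym (·-zeroˡ 0ℚ)))))
  (trans (anti-*ˡ e 0ℚ (λ _ _ → 0ℚ)) (·-zeroˡ (anti e (λ _ _ → 0ℚ))))

combine-central-0 : ∀ p e → combine central p 0 (suc e) ≡ fromℕ 2 · combine central p 1 e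
combine-central-0 p e = trans (cong₂ _⊕_ (·-zeroʳ (central 0 0))
    (trans (anti-ext e (λ i j → trans (cong (_· excessPoly p (suc i) j) (centralAt-01 i)) (·-assoc (fromℕ 2) (central 1 i) (excessPoly p (suc i) j))))
           (anti-*ˡ e (fromℕ 2) (λ i j → central 1 i · excessPoly p (suc i) j))))
  (⊕-identityˡ (fromℕ 2 · combine central p 1 e))

-- The induction is that for forests, except that the row l = 0 is not constant: on both sides it is
-- twice the entry at l = 1 of the preceding excess, since 1/(1 - 2u) = 1 + 2u/(1 - 2u).
combine-central : ∀ e l b → combine central (equals b) l e ≡ motzkinTrees 0 l e b
combine-central zero zero zero = refl
combine-central zero zero (suc b) = refl
combine-central (suc e) zero b = trans (combine-central-0 (equals b) e) (trans (cong (fromℕ 2 ·_) (combine-central e 1 b)) (sym (motzkin-rec₀ e b)))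
combine-central zero (suc l) b = trans (IsTreeLike.at-s0 centralTree (equals b) l) (trans (combine-central zero l b)
  (trans (sym (⊕-identityʳ (motzkinTrees 0 l 0 b))) (cong (motzkinTrees 0 l 0 b ⊕_) (sym (motzkinTrees-vanish 1 l 1 b (s≤s (s≤s z≤n)))))))
combine-central (suc e) (suc l) b = trans (IsTreeLike.at-ss centralTree (equals b) l e)
  (trans (cong₂ _⊕_ (cong₂ _⊕_ (combine-central (suc e) l b) (combine-central e (suc (suc l)) b)) (cong₂ _⊖_ (shifted b) (combine-central e l b)))
         (sym (motzkinTrees-rec 0 l e b)))
  where
  shifted : ∀ b → combine central (equals b ∘ suc) l e ≡ pre b (motzkinTrees 0 l e)
  shifted zero = combine-never l e
  shifted (suc b) = combine-central e l b

∑-central-equals : ∀ a b → ∑< (suc (a + 2 * b)) (λ i → centralAt i 0 · polyAt (equals b) (a + 2 * b) i) ≡ 2^ a · trinomial a b b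
∑-central-equals a b = trans (sym (combineAt central (equals b) 0 (a + 2 * b) (suc (a + 2 * b)) ≤-refl))
  (trans (combine-central (a + 2 * b) 0 b)
  (cong (λ A → motz A (just b) b) (trans (cong (excess (double b)) (trans (+-comm a (2 * b)) (cong (_+ a) (sym (double≡2* b))))) (excess-+ (double b) a))))

-- Disregarding cherries means y = x², and x + y - x² collapses to x.
polyAt-always : ∀ r i → polyAt always r i ≡ δ ℕ._≟_ i r
polyAt-always r i = go (excess i r) refl
  where
  go : ∀ m → excess i r ≡ m → at m (excessPoly always i) ≡ δ ℕ._≟_ i r
  go nothing eq = sym (δ-≢ ℕ._≟_ {i} {r} (λ { refl → absurd (trans (sym (excess-+ i 0)) (trans (cong (excess i) (+-identityʳ i)) eq)) }))
    where
    absurd : ¬ (just 0 ≡ nothing)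
    absurd ()
  go (just zero) eq = trans (excessPoly-always-0 i) (trans (sym (δ-refl ℕ._≟_ i)) (cong (δ ℕ._≟_ i) (trans (sym (+-identityʳ i)) (excess-just i r eq))))
  go (just (suc d)) eq = trans (excessPoly-always-suc i d) (sym (δ-≢ ℕ._≟_ {i} {r} (<⇒≢ (<-≤-trans (m<m+n i (s≤s z≤n)) (≤-reflexive (excess-just i r eq))))))

∑-central-always : ∀ r → ∑< (suc r) (λ i → centralAt i 0 · polyAt always r i) ≡ centralAt r 0
∑-central-always r = trans (∑-ext (upTo (suc r)) (λ i → trans (cong (centralAt i 0 ·_) (polyAt-always r i)) (·-comm (centralAt i 0) (δ ℕ._≟_ i r))))
  (∑-δ ℕ._≟_ r (λ i → centralAt i 0) (Uniqueₚ.upTo⁺ (suc r)) (∈-upTo⁺ ≤-refl))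

-- Words fixed by rotations and by reflections

pick-swap : ∀ b c n → pick b (not c) n ≡ pick (not b) c n
pick-swap true true n = refl
pick-swap true false n = refl
pick-swap false true n = refl
pick-swap false false n = refl

sumAt-++ : ∀ b f v w → sumAt b f (v ++ w) ≡ sumAt b f v + sumAt b f w
sumAt-++ b f [] w = refl
sumAt-++ b f ((c , t) ∷ v) w = trans (cong (pick b c (f t) +_) (sumAt-++ b f v w)) (sym (+-assoc (pick b c (f t)) (sumAt b f v) (sumAt b f w)))

sumAt-rot1 : ∀ b f w → sumAt b f (rot1 w) ≡ sumAt b f w
sumAt-rot1 b f [] = refl
sumAt-rot1 b f (x ∷ xs) = trans (sumAt-++ b f xs [ x ]) (trans (+-comm (sumAt b f xs) (sumAt b f [ x ])) (sym (sumAt-++ b f [ x ] xs)))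

sumAt-rot : ∀ b f d w → sumAt b f (rot d w) ≡ sumAt b f w
sumAt-rot b f zero w = refl
sumAt-rot b f (suc d) w = trans (sumAt-rot b f d (rot1 w)) (sumAt-rot1 b f w)

sumAt-pow : ∀ b f k v → sumAt b f (pow k v) ≡ k * sumAt b f v
sumAt-pow b f zero v = refl
sumAt-pow b f (suc k) v = trans (sumAt-++ b f v (pow k v)) (cong (sumAt b f v +_) (sumAt-pow b f k v))

flip : Letter → Letter
flip (b , t) = not b , t

flip-flip : ∀ x → flip (flip x) ≡ x
flip-flip (b , t) = cong (_, t) (not-involutive b)

open Mirror flip flip-flip public

sumAt-flip : ∀ b f w → sumAt b f (map flip w) ≡ sumAt (not b) f w
sumAt-flip b f [] = refl
sumAt-flip b f ((c , t) ∷ w) = cong₂ _+_ (pick-swap b c (f t)) (sumAt-flip b f w)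

sumAt-reverse : ∀ b f w → sumAt b f (reverse w) ≡ sumAt b f w
sumAt-reverse b f [] = refl
sumAt-reverse b f (x ∷ w) = trans (cong (sumAt b f) (unfold-reverse x w))
  (trans (sumAt-++ b f (reverse w) [ x ]) (trans (cong (_+ sumAt b f [ x ]) (sumAt-reverse b f w))
  (trans (+-comm (sumAt b f w) (sumAt b f [ x ])) (sym (sumAt-++ b f [ x ] w)))))

sumAt-mirror : ∀ b f w → sumAt b f (mirror w) ≡ sumAt (not b) f w
sumAt-mirror b f w = trans (sumAt-reverse b f (map flip w)) (sumAt-flip b f w)

length≤sumAt : ∀ w → length w ≤ sumAt false leaves w + sumAt true leaves w
length≤sumAt [] = z≤n
length≤sumAt ((true , t) ∷ w) = ≤-trans (+-mono-≤ (1≤leaves t) (length≤sumAt w)) (≤-reflexive (exch (leaves t) (sumAt false leaves w) (sumAt true leaves w)))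
  where
  exch : ∀ a b c → a + (b + c) ≡ b + (a + c)
  exch = ℕ-Ring.solve-∀
length≤sumAt ((false , t) ∷ w) = ≤-trans (+-mono-≤ (1≤leaves t) (length≤sumAt w)) (≤-reflexive (sym (+-assoc (leaves t) (sumAt false leaves w) (sumAt true leaves w))))

module _ (p q : ℕ → Bool) where

  admissible : Word → Bool
  admissible w = p (sumAt false cherries w) ∧ q (sumAt true cherries w)

  test₂ : Word → ℚ
  test₂ w = 𝟙 (p (sumAt false cherries w)) · 𝟙 (q (sumAt true cherries w))

  module _ (r s : ℕ) where

    allWords : List Word
    allWords = concatMap (words r s) (range1 (r + s))

    admissible? : ∀ w → Dec (admissible w ≡ true)
    admissible? w = admissible w Bool.≟ true

    admissibleWords : List Word
    admissibleWords = filter admissible? allWords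

    Admissible : Word → Set
    Admissible w = (sumAt false leaves w ≡ r × sumAt true leaves w ≡ s) × admissible w ≡ true

    admissibleWords-sound : ∀ {w} → w ∈ admissibleWords → Admissible w
    admissibleWords-sound w∈ with ∈-filter⁻ admissible? {xs = allWords} w∈
    ... | w∈all , adm with ∈-concatMap⁻ (words r s) {xs = range1 (r + s)} w∈all
    ... | w∈some with find w∈some
    ... | L , L∈ , w∈L = proj₂ (words-sound r s L w∈L) , adm

    admissibleWords-complete : ∀ {w} → 1 ≤ r → Admissible w → w ∈ admissibleWords
    admissibleWords-complete {w} 1≤r ((er , es) , adm) = ∈-filter⁺ admissible?
      (∈-concatMap⁺ (words r s) (lose (≤⇒range1 (nonempty w er) bound) (words-complete r s (length w) (refl , er , es)))) adm
      where
      nonempty : ∀ w → sumAt false leaves w ≡ r → 1 ≤ length w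
      nonempty [] refl = contradiction 1≤r 1+n≰n
      nonempty (_ ∷ _) _ = s≤s z≤n
      bound : length w ≤ r + s
      bound = ≤-trans (length≤sumAt w) (≤-reflexive (cong₂ _+_ er es))

    admissibleWords-Unique : Unique admissibleWords
    admissibleWords-Unique = Uniqueₚ.filter⁺ admissible? (Uniqueₚ.concat⁺
      (Allₚ.map⁺ (All.tabulate λ {L} _ → words-Unique r s L))
      (AllPairsₚ.map⁺ (AllPairs.map (λ {L} {L'} → apart L L') (range1-Unique (r + s)))))
      where
      apart : ∀ L L' → L ≢ L' → ∀ {w} → ¬ (w ∈ words r s L × w ∈ words r s L')
      apart L L' L≢L' (w∈ , w∈') = L≢L' (trans (sym (proj₁ (words-sound r s L w∈))) (proj₁ (words-sound r s L' w∈')))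

    ∑-admissible : ∀ (f : Word → ℚ) → ∑ admissibleWords f ≡ ∑₁ (r + s) (λ L → ∑ (words r s L) (λ w → test₂ w · f w))
    ∑-admissible f = trans (∑-filter admissible? allWords f) (trans (∑-concatMap (words r s) (range1 (r + s)) (λ w → 𝟙 (does (admissible? w)) · f w))
      (∑-ext (range1 (r + s)) (λ L → ∑-ext (words r s L) (λ w → cong (_· f w) (trans (cong 𝟙 (≟true (admissible w))) (𝟙-∧ (p (sumAt false cherries w)) (q (sumAt true cherries w))))))))
      where
      ≟true : ∀ b → does (b Bool.≟ true) ≡ b
      ≟true true = refl
      ≟true false = refl

    rotFixed : ℕ → ℕ → ℚ
    rotFixed L d = ∑ (words r s L) (λ w → test₂ w · δ _≟ᵂ_ w (rot d w))

    -- Words of length k g fixed by rotation through g are k-th powers.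
    powers : ℕ → ℕ → ℚ
    powers k g = 𝟙 (does (k ∣? r)) · (𝟙 (does (k ∣? s)) · wordCount (p ∘ (k *_)) (q ∘ (k *_)) (r /ℕ k) (s /ℕ k) g)

    rotFixed-powers : ∀ k g → rotFixed (suc k * g) g ≡ powers (suc k) g
    rotFixed-powers k g = trans (trans (∑-ext (words r s L) (λ w → ·-comm (test₂ w) (δ _≟ᵂ_ w (rot g w)))) (sym (∑-filter fixed? (words r s L) test₂)))
        (cases (K ∣? r) (K ∣? s))
      where
      K = suc k
      L = suc k * g
      fixed? : ∀ w → Dec (w ≡ rot g w)
      fixed? w = w ≟ᵂ rot g w
      root′ : ∀ {w} → w ∈ filter fixed? (words r s L) → Σ Word λ v → length v ≡ g × w ≡ pow K v × K * sumAt false leaves v ≡ r × K * sumAt true leaves v ≡ s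
      root′ {w} w∈ with ∈-filter⁻ fixed? {xs = words r s L} w∈
      ... | w∈L , fix with words-sound r s L w∈L
      ... | len , er , es with rot-fixed⇒pow k g w len (sym fix)
      ... | v , lv , refl = v , lv , refl , trans (sym (sumAt-pow false leaves K v)) er , trans (sym (sumAt-pow true leaves K v)) es
      zero-case : ∀ {P : Set} → ¬ P → (∀ {w} → w ∈ filter fixed? (words r s L) → P) → ∑ (filter fixed? (words r s L)) test₂ ≡ 0ℚ
      zero-case ¬P has = ∑-zero (filter fixed? (words r s L)) (λ w∈ → contradiction (has w∈) ¬P)
      cases : (dr : Dec (K ∣ r)) (ds : Dec (K ∣ s)) → ∑ (filter fixed? (words r s L)) test₂ ≡
        𝟙 (does dr) · (𝟙 (does ds) · wordCount (p ∘ (K *_)) (q ∘ (K *_)) (r /ℕ K) (s /ℕ K) g)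
      cases (no K∤r) ds = trans (zero-case K∤r (λ w∈ → let v , _ , _ , er , _ = root′ w∈ in divides (sumAt false leaves v) (trans (sym er) (*-comm K (sumAt false leaves v)))))
        (sym (·-zeroˡ (𝟙 (does ds) · wordCount (p ∘ (K *_)) (q ∘ (K *_)) (r /ℕ K) (s /ℕ K) g)))
      cases (yes K∣r) (no K∤s) = trans (zero-case K∤s (λ w∈ → let v , _ , _ , _ , es = root′ w∈ in divides (sumAt true leaves v) (trans (sym es) (*-comm K (sumAt true leaves v)))))
        (sym (trans (cong (1ℚ ·_) (·-zeroˡ (wordCount (p ∘ (K *_)) (q ∘ (K *_)) (r /ℕ K) (s /ℕ K) g))) refl))
      cases (yes (divides r' er)) (yes (divides s' es)) = trans (∑-↭ test₂ perm) (trans (∑-map (pow K) (words (r /ℕ K) (s /ℕ K) g) test₂)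
          (trans (∑-ext (words (r /ℕ K) (s /ℕ K) g) (λ v → cong₂ (λ a b → 𝟙 (p a) · 𝟙 (q b)) (sumAt-pow false cherries K v) (sumAt-pow true cherries K v)))
                 (sym (trans (·-identityˡ _) (·-identityˡ _)))))
        where
        r/K : K * (r /ℕ K) ≡ r
        r/K = trans (cong (λ n → K * (n /ℕ K)) er) (trans (cong (K *_) (/ℕ-* r' K)) (trans (*-comm K r') (sym er)))
        s/K : K * (s /ℕ K) ≡ s
        s/K = trans (cong (λ n → K * (n /ℕ K)) es) (trans (cong (K *_) (/ℕ-* s' K)) (trans (*-comm K s') (sym es)))
        to : ∀ {w} → w ∈ filter fixed? (words r s L) → w ∈ map (pow K) (words (r /ℕ K) (s /ℕ K) g)
        to w∈ with root′ w∈
        ... | v , lv , refl , rv , sv = ∈-map⁺ (pow K) (words-complete (r /ℕ K) (s /ℕ K) g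
          (lv , *-cancelˡ-≡ _ _ K (trans rv (sym r/K)) , *-cancelˡ-≡ _ _ K (trans sv (sym s/K))))
        from : ∀ {w} → w ∈ map (pow K) (words (r /ℕ K) (s /ℕ K) g) → w ∈ filter fixed? (words r s L)
        from w∈ with ∈-map⁻ (pow K) w∈
        ... | v , v∈ , refl with words-sound (r /ℕ K) (s /ℕ K) g v∈
        ... | lv , rv , sv = ∈-filter⁺ fixed? (words-complete r s L
            (trans (length-pow K v) (cong (K *_) lv) , trans (sumAt-pow false leaves K v) (trans (cong (K *_) rv) r/K) , trans (sumAt-pow true leaves K v) (trans (cong (K *_) sv) s/K)))
            (sym (trans (cong (λ n → rot n (pow K v)) (sym lv)) (rot-pow K v)))
        inj : ∀ {v v'} → v ∈ words (r /ℕ K) (s /ℕ K) g → v' ∈ words (r /ℕ K) (s /ℕ K) g → pow K v ≡ pow K v' → v ≡ v'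
        inj {v} {v'} v∈ v'∈ eq = proj₁ (++-cancel-length v v' (trans (proj₁ (words-sound (r /ℕ K) (s /ℕ K) g v∈)) (sym (proj₁ (words-sound (r /ℕ K) (s /ℕ K) g v'∈)))) eq)
        perm : filter fixed? (words r s L) ↭ map (pow K) (words (r /ℕ K) (s /ℕ K) g)
        perm = Unique-set⇒↭ (Uniqueₚ.filter⁺ fixed? (words-Unique r s L)) (Unique-map-∈ (pow K) inj (words-Unique (r /ℕ K) (s /ℕ K) g)) to from

    -- By Bézout a word of length L is fixed by d steps exactly if it is fixed by gcd(d, L) steps,
    -- so only divisors of L need to be considered.
    rotFixed-gcd : ∀ L d → rotFixed L d ≡ rotFixed L (gcd d L)
    rotFixed-gcd L d = ∑-cong (words r s L) λ {w} w∈ → cong (test₂ w ·_) (same w (proj₁ (words-sound r s L w∈)))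
      where
      δ-iff : ∀ {w x y} → (w ≡ x → w ≡ y) → (w ≡ y → w ≡ x) → δ _≟ᵂ_ w x ≡ δ _≟ᵂ_ w y
      δ-iff {w} {x} {y} to from = cong 𝟙 (iff (w ≟ᵂ x) (w ≟ᵂ y))
        where
        iff : (a : Dec (w ≡ x)) (b : Dec (w ≡ y)) → does a ≡ does b
        iff (yes _) (yes _) = refl
        iff (no _) (no _) = refl
        iff (yes e) (no n) = contradiction (to e) n
        iff (no n) (yes e) = contradiction (from e) n
      same : ∀ w → length w ≡ L → δ _≟ᵂ_ w (rot d w) ≡ δ _≟ᵂ_ w (rot (gcd d L) w)
      same w refl = δ-iff (λ e → sym (rot-gcd d w (sym e))) (λ e → sym (rot-∣ w (gcd[m,n]∣m d (length w)) (sym e)))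

    private
      n = r + s
      term : ℕ → ℕ → ℚ
      term g k = 1/ (g * k) · (fromℕ (φ k) · powers k g)

    words-long : ∀ r s g → r + s < g → ∀ p q → wordCount p q r s g ≡ 0ℚ
    words-long r s g < p q = ∑-zero (words r s g) λ {w} w∈ → let l , a , b = words-sound r s g w∈ in
      contradiction (≤-trans (≤-reflexive (sym l)) (≤-trans (length≤sumAt w) (≤-reflexive (cong₂ _+_ a b)))) (<⇒≱ <)

    -- A word of length g has at least g leaves, whereas the k-th root of a word with n leaves has
    -- only n/k of them.
    powers-vanish : ∀ k g .{{_ : NonZero k}} → n < g * k → powers k g ≡ 0ℚ
    powers-vanish k g n< = cases (k ∣? r) (k ∣? s)
      where
      W = wordCount (p ∘ (k *_)) (q ∘ (k *_)) (r /ℕ k) (s /ℕ k) g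
      cases : (dr : Dec (k ∣ r)) (ds : Dec (k ∣ s)) → 𝟙 (does dr) · (𝟙 (does ds) · W) ≡ 0ℚ
      cases (no _) ds = ·-zeroˡ (𝟙 (does ds) · W)
      cases (yes _) (no _) = trans (cong (1ℚ ·_) (·-zeroˡ W)) refl
      cases (yes (divides r' er)) (yes (divides s' es)) = trans (cong (λ z → 1ℚ · (1ℚ · z)) (words-long (r /ℕ k) (s /ℕ k) g small (p ∘ (k *_)) (q ∘ (k *_)))) refl
        where
        small : r /ℕ k + s /ℕ k < g
        small = *-cancelʳ-< k (r /ℕ k + s /ℕ k) g (≤-<-trans (≤-reflexive (trans (*-distribʳ-+ k (r /ℕ k) (s /ℕ k))
          (cong₂ _+_ (trans (cong (λ z → z /ℕ k * k) er) (trans (cong (_* k) (/ℕ-* r' k)) (sym er))) (trans (cong (λ z → z /ℕ k * k) es) (trans (cong (_* k) (/ℕ-* s' k)) (sym es)))))) n<)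

    -- Pairs (L, g) with g dividing L become pairs (g, k) with L = g k. The condition g k ≤ n
    -- disappears, because `h` vanishes beyond it.
    ∑-by-quotient : ∀ (h : ℕ → ℕ → ℚ) → (∀ g k → 1 ≤ g → 1 ≤ k → n < g * k → h g k ≡ 0ℚ) →
      ∑₁ n (λ L → ∑₁ n (λ g → 𝟙 (does (g ∣? L)) · h g (L /ℕ g))) ≡ ∑₁ n (λ k → ∑₁ n (λ g → h g k))
    ∑-by-quotient h vanish = begin
      ∑₁ n (λ L → ∑₁ n (λ g → 𝟙 (does (g ∣? L)) · h g (L /ℕ g)))
        ≡⟨ ∑-cong (range1 n) (λ {L} L∈ → ∑-cong (range1 n) (λ {g} g∈ → by-k L g L∈ g∈ (g ∣? L))) ⟩
      ∑₁ n (λ L → ∑₁ n (λ g → ∑₁ n (λ k → δ ℕ._≟_ L (g * k) · h g k)))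
        ≡⟨ ∑-swap (range1 n) (range1 n) (λ L g → ∑₁ n (λ k → δ ℕ._≟_ L (g * k) · h g k)) ⟩
      ∑₁ n (λ g → ∑₁ n (λ L → ∑₁ n (λ k → δ ℕ._≟_ L (g * k) · h g k)))
        ≡⟨ ∑-ext (range1 n) (λ g → ∑-swap (range1 n) (range1 n) (λ L k → δ ℕ._≟_ L (g * k) · h g k)) ⟩
      ∑₁ n (λ g → ∑₁ n (λ k → ∑₁ n (λ L → δ ℕ._≟_ L (g * k) · h g k)))
        ≡⟨ ∑-cong (range1 n) (λ {g} g∈ → ∑-cong (range1 n) (λ {k} k∈ → by-L g k (proj₁ (range1⇒≤ g∈)) (proj₁ (range1⇒≤ k∈)) (g * k ℕ.≤? n))) ⟩
      ∑₁ n (λ g → ∑₁ n (λ k → h g k))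
        ≡⟨ ∑-swap (range1 n) (range1 n) h ⟩
      ∑₁ n (λ k → ∑₁ n (λ g → h g k)) ∎
      where
      by-L : ∀ g k → 1 ≤ g → 1 ≤ k → Dec (g * k ≤ n) → ∑₁ n (λ L → δ ℕ._≟_ L (g * k) · h g k) ≡ h g k
      by-L g k 1≤g 1≤k (yes gk≤) = ∑-δ ℕ._≟_ (g * k) (λ _ → h g k) (range1-Unique n) (≤⇒range1 (*-mono-≤ 1≤g 1≤k) gk≤)
      by-L g k 1≤g 1≤k (no gk≰) = trans (∑-ext (range1 n) (λ L → cong (δ ℕ._≟_ L (g * k) ·_) h0)) (trans (∑-zero (range1 n) (λ {L} _ → ·-zeroʳ (δ ℕ._≟_ L (g * k)))) (sym h0))
        where
        h0 : h g k ≡ 0ℚ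
        h0 = vanish g k 1≤g 1≤k (≰⇒> gk≰)
      by-k : ∀ L g → L ∈ range1 n → g ∈ range1 n → (d : Dec (g ∣ L)) → 𝟙 (does d) · h g (L /ℕ g) ≡ ∑₁ n (λ k → δ ℕ._≟_ L (g * k) · h g k)
      by-k L g L∈ g∈ (no g∤L) = trans (·-zeroˡ (h g (L /ℕ g))) (sym (∑-zero (range1 n) (λ {k} _ →
        trans (cong (_· h g k) (δ-≢ ℕ._≟_ {L} {g * k} (λ e → g∤L (divides k (trans e (*-comm g k)))))) (·-zeroˡ (h g k)))))
      by-k L g L∈ g∈ (yes (divides k e)) = trans (·-identityˡ (h g (L /ℕ g))) (trans (cong (h g) L/g)
        (trans (sym (∑-δ ℕ._≟_ k (h g) (range1-Unique n) k∈)) (∑-ext (range1 n) (λ k' → cong (_· h g k') (δ-same k')))))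
        where
        instance
          g≢0 : NonZero g
          g≢0 = >-nonZero (proj₁ (range1⇒≤ g∈))
        L/g : L /ℕ g ≡ k
        L/g = trans (cong (_/ℕ g) e) (/ℕ-* k g)
        1≤k : 1 ≤ k
        1≤k = n≢0⇒n>0 λ { refl → 1+n≰n (≤-trans (proj₁ (range1⇒≤ L∈)) (≤-reflexive e)) }
        k∈ : k ∈ range1 n
        k∈ = ≤⇒range1 1≤k (≤-trans (≤-trans (m≤m*n k g) (≤-reflexive (sym e))) (proj₂ (range1⇒≤ L∈)))
        δ-same : ∀ k' → δ ℕ._≟_ k' k ≡ δ ℕ._≟_ L (g * k')
        δ-same k' = cong 𝟙 (iff (k' ℕ.≟ k) (L ℕ.≟ g * k'))
          where
          iff : (a : Dec (k' ≡ k)) (b : Dec (L ≡ g * k')) → does a ≡ does b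
          iff (yes _) (yes _) = refl
          iff (no _) (no _) = refl
          iff (yes refl) (no ne) = contradiction (trans e (*-comm k g)) ne
          iff (no ne) (yes e') = contradiction (*-cancelˡ-≡ k' k g (trans (sym e') (trans e (*-comm k g)))) ne

    -- For L = g k the weight φ(k)/L splits into φ(k)/k and 1/g. For each k there remains a sum over
    -- all lengths g weighted by 1/g, which is the logarithm evaluated above.
    ∑-rotFixed : ∑₁ n (λ L → 1/ L · ∑₁ L (rotFixed L)) ≡
      ∑₁ n (λ k → φ/ k · ∑₁ n (λ g → 1/ g · powers k g))
    ∑-rotFixed = begin
      ∑₁ n (λ L → 1/ L · ∑₁ L (rotFixed L))
        ≡⟨ ∑-cong (range1 n) (λ {L} L∈ → inner L L∈) ⟩
      ∑₁ n (λ L → ∑₁ n (λ g → 𝟙 (does (g ∣? L)) · term g (L /ℕ g)))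
        ≡⟨ ∑-by-quotient term vanish ⟩
      ∑₁ n (λ k → ∑₁ n (λ g → term g k))
        ≡⟨ ∑-cong (range1 n) (λ {k} k∈ → trans (∑-cong (range1 n) (λ {g} g∈ → split g k (proj₁ (range1⇒≤ g∈)) (proj₁ (range1⇒≤ k∈)))) (∑-*ˡ (range1 n) (φ/ k) (λ g → 1/ g · powers k g))) ⟩
      ∑₁ n (λ k → φ/ k · ∑₁ n (λ g → 1/ g · powers k g)) ∎
      where
      vanish : ∀ g k → 1 ≤ g → 1 ≤ k → n < g * k → term g k ≡ 0ℚ
      vanish g k _ 1≤k n< = trans (cong (λ z → 1/ (g * k) · (fromℕ (φ k) · z)) (powers-vanish k g {{>-nonZero 1≤k}} n<)) (zeros (1/ (g * k)) (fromℕ (φ k)))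
        where
        zeros : ∀ a b → a · (b · 0ℚ) ≡ 0ℚ
        zeros = solve-∀ ℚ-ring
      split : ∀ g k → 1 ≤ g → 1 ≤ k → term g k ≡ φ/ k · (1/ g · powers k g)
      split g k 1≤g 1≤k = trans (cong (_· (fromℕ (φ k) · powers k g)) (1/-* g k {{>-nonZero 1≤g}} {{>-nonZero 1≤k}}))
        (trans (ring (1/ g) (1/ k) (fromℕ (φ k)) (powers k g)) (cong (_· (1/ g · powers k g)) (sym (frac≡*1/ (φ k) k))))
        where
        ring : ∀ a b c d → (a · b) · (c · d) ≡ (c · b) · (a · d)
        ring = solve-∀ ℚ-ring
      at-divisor : ∀ L g → g ∈ range1 n → L ∈ range1 n → (d : Dec (g ∣ L)) →
        1/ L · (𝟙 (does d) · (fromℕ (φ (L /ℕ g)) · rotFixed L g)) ≡ 𝟙 (does d) · term g (L /ℕ g)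
      at-divisor L g g∈ L∈ (no _) = trans (cong (1/ L ·_) (·-zeroˡ (fromℕ (φ (L /ℕ g)) · rotFixed L g))) (trans (·-zeroʳ (1/ L)) (sym (·-zeroˡ (term g (L /ℕ g)))))
      at-divisor L g g∈ L∈ (yes (divides zero e)) = contradiction (≤-trans (proj₁ (range1⇒≤ L∈)) (≤-reflexive e)) 1+n≰n
      at-divisor L g g∈ L∈ (yes (divides (suc k) e)) = trans (cong (1/ L ·_) (·-identityˡ (fromℕ (φ (L /ℕ g)) · rotFixed L g)))
        (trans (cong₂ (λ a b → 1/ a · (fromℕ (φ (L /ℕ g)) · b)) L≡ (trans (cong (λ z → rotFixed z g) e) (trans (rotFixed-powers k g) (cong (λ z → powers z g) (sym L/g)))))
        (sym (·-identityˡ (term g (L /ℕ g)))))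
        where
        L/g : L /ℕ g ≡ suc k
        L/g = trans (cong (_/ℕ g) e) (/ℕ-* (suc k) g {{>-nonZero (proj₁ (range1⇒≤ g∈))}})
        L≡ : L ≡ g * (L /ℕ g)
        L≡ = trans e (trans (*-comm (suc k) g) (cong (g *_) (sym L/g)))
      inner : ∀ L → L ∈ range1 n → 1/ L · ∑₁ L (rotFixed L) ≡ ∑₁ n (λ g → 𝟙 (does (g ∣? L)) · term g (L /ℕ g))
      inner L L∈ = trans (cong (1/ L ·_) (trans (∑-ext (range1 L) (rotFixed-gcd L)) (∑-gcd n L {{>-nonZero (proj₁ (range1⇒≤ L∈))}} (proj₂ (range1⇒≤ L∈)) (rotFixed L))))
        (trans (sym (∑-*ˡ (range1 n) (1/ L) (λ g → 𝟙 (does (g ∣? L)) · (fromℕ (φ (L /ℕ g)) · rotFixed L g))))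
               (∑-cong (range1 n) (λ {g} g∈ → at-divisor L g g∈ L∈ (g ∣? L))))

sumAll : (Shape → ℕ) → Word → ℕ
sumAll f w = sumAt false f w + sumAt true f w

sumAll-∷ : ∀ f b t w → sumAll f ((b , t) ∷ w) ≡ f t + sumAll f w
sumAll-∷ f false t w = +-assoc (f t) (sumAt false f w) (sumAt true f w)
sumAll-∷ f true t w = exch (sumAt false f w) (f t) (sumAt true f w)
  where
  exch : ∀ a b c → a + (b + c) ≡ b + (a + c)
  exch = ℕ-Ring.solve-∀

module _ (r : ℕ) where

  take₁ : Bool → Word × Forest → Word × Forest
  take₁ b (w , t ∷ F) = (b , t) ∷ w , F
  take₁ b (w , []) = w , []

  -- Words of length m with l spare trees, r leaves in total regardless of the orientations.
  halfStates : ℕ → ℕ → List (Word × Forest)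
  halfStates zero l = map ([] ,_) (forestsOf l r)
  halfStates (suc m) l = map (take₁ false) (halfStates m (suc l)) ++ map (take₁ true) (halfStates m (suc l))

  IsHalfState : ℕ → ℕ → Word × Forest → Set
  IsHalfState m l (w , F) = length w ≡ m × length F ≡ l × sumAll leaves w + sumᶠ leaves F ≡ r

  private
    move : ∀ f b t w F → sumAll f ((b , t) ∷ w) + sumᶠ f F ≡ sumAll f w + sumᶠ f (t ∷ F)
    move f b t w F = trans (cong (_+ sumᶠ f F) (sumAll-∷ f b t w)) (exch (f t) (sumAll f w) (sumᶠ f F))
      where
      exch : ∀ a b c → a + b + c ≡ b + (a + c)
      exch = ℕ-Ring.solve-∀

    HalfSound : ℕ → ℕ → List (Word × Forest) → Set
    HalfSound m l xs = ∀ {x} → x ∈ xs → IsHalfState m l x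

    take₁-sound : ∀ b {m l xs} → HalfSound m (suc l) xs → HalfSound (suc m) l (map (take₁ b) xs)
    take₁-sound b sound x∈ with ∈-map⁻ (take₁ b) x∈
    ... | (w , t ∷ F) , y∈ , refl = let l , lF , lv = sound y∈ in cong suc l , suc-injective lF , trans (move leaves b t w F) lv
    ... | (w , []) , y∈ , refl with () ← proj₁ (proj₂ (sound y∈))

    take₁-cons : ∀ {m l xs} → HalfSound m (suc l) xs → ∀ {x} → x ∈ xs → ∃ λ t → ∃ λ F → proj₂ x ≡ t ∷ F
    take₁-cons sound {w , t ∷ F} x∈ = t , F , refl
    take₁-cons sound {w , []} x∈ with () ← proj₁ (proj₂ (sound x∈))

    take₁-inj : ∀ b {m l xs} → HalfSound m (suc l) xs → ∀ {x y} → x ∈ xs → y ∈ xs → take₁ b x ≡ take₁ b y → x ≡ y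
    take₁-inj b sound x∈ y∈ eq with take₁-cons sound x∈ | take₁-cons sound y∈
    take₁-inj b sound {w , t ∷ F} {_ , _ ∷ _} x∈ y∈ refl | _ | _ = refl

  halfStates-sound : ∀ m l → HalfSound m l (halfStates m l)
  halfStates-sound zero l x∈ with ∈-map⁻ ([] ,_) x∈
  ... | F , F∈ , refl = let len , lv = forestsOf-sound l r F∈ in refl , len , lv
  halfStates-sound (suc m) l x∈ =
    [ take₁-sound false {m} {l} (halfStates-sound m (suc l)) , take₁-sound true {m} {l} (halfStates-sound m (suc l)) ]′
      (∈-++⁻ (map (take₁ false) (halfStates m (suc l))) x∈)

  halfStates-complete : ∀ m l {x} → IsHalfState m l x → x ∈ halfStates m l
  halfStates-complete zero l {[] , F} (refl , refl , refl) = ∈-map⁺ ([] ,_) (forestsOf-complete F)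
  halfStates-complete (suc m) l {(false , t) ∷ w , F} (len , lF , lv) = ∈-++⁺ˡ (∈-map⁺ (take₁ false)
    (halfStates-complete m (suc l) {w , t ∷ F} (suc-injective len , cong suc lF , trans (sym (move leaves false t w F)) lv)))
  halfStates-complete (suc m) l {(true , t) ∷ w , F} (len , lF , lv) = ∈-++⁺ʳ (map (take₁ false) (halfStates m (suc l))) (∈-map⁺ (take₁ true)
    (halfStates-complete m (suc l) {w , t ∷ F} (suc-injective len , cong suc lF , trans (sym (move leaves true t w F)) lv)))

  halfStates-Unique : ∀ m l → Unique (halfStates m l)
  halfStates-Unique zero l = Uniqueₚ.map⁺ ,-injectiveʳ (forestsOf-Unique l r)
  halfStates-Unique (suc m) l = Uniqueₚ.++⁺
    (Unique-map-∈ (take₁ false) (take₁-inj false {m} {l} (halfStates-sound m (suc l))) (halfStates-Unique m (suc l)))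
    (Unique-map-∈ (take₁ true) (take₁-inj true {m} {l} (halfStates-sound m (suc l))) (halfStates-Unique m (suc l)))
    disjoint
    where
    disjoint : ∀ {x} → ¬ (x ∈ map (take₁ false) (halfStates m (suc l)) × x ∈ map (take₁ true) (halfStates m (suc l)))
    disjoint (p , q) with ∈-map⁻ (take₁ false) p | ∈-map⁻ (take₁ true) q
    ... | y , y∈ , refl | z , z∈ , eq with take₁-cons {m} {l} (halfStates-sound m (suc l)) y∈ | take₁-cons {m} {l} (halfStates-sound m (suc l)) z∈
    disjoint (p , q) | (_ , _ ∷ _) , y∈ , refl | (_ , _ ∷ _) , z∈ , () | _ | _

  halfTest : (ℕ → Bool) → Word × Forest → ℚ
  halfTest p (w , F) = 𝟙 (p (sumAll cherries w + sumᶠ cherries F))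

  ∑-halfStates : ∀ p m l → ∑ (halfStates m l) (halfTest p) ≡ 2^ m · forestCountAt p r (m + l)
  ∑-halfStates p zero l = trans (∑-map ([] ,_) (forestsOf l r) (halfTest p)) (sym (·-identityˡ (forestCountAt p r l)))
  ∑-halfStates p (suc m) l = trans (∑-++ (map (take₁ false) (halfStates m (suc l))) (map (take₁ true) (halfStates m (suc l))) (halfTest p))
    (trans (cong₂ _⊕_ (side false) (side true)) (trans (twice (2^ m) (forestCountAt p r (m + suc l)))
      (cong₂ _·_ (trans (cong (_· 2^ m) (sym (fromℕ-suc 1))) (sym (fromℕ-* 2 (2 ^ m)))) (cong (forestCountAt p r) (+-suc m l)))))
    where
    twice : ∀ x y → x · y ⊕ x · y ≡ ((1ℚ ⊕ 1ℚ) · x) · y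
    twice = solve-∀ ℚ-ring
    step : ∀ b x → x ∈ halfStates m (suc l) → halfTest p (take₁ b x) ≡ halfTest p x
    step b (w , t ∷ F) _ = cong (λ z → 𝟙 (p z)) (move cherries b t w F)
    step b (w , []) x∈ with () ← proj₁ (proj₂ (halfStates-sound m (suc l) x∈))
    side : ∀ b → ∑ (map (take₁ b) (halfStates m (suc l))) (halfTest p) ≡ 2^ m · forestCountAt p r (m + suc l)
    side b = trans (∑-map (take₁ b) (halfStates m (suc l)) (halfTest p)) (trans (∑-cong (halfStates m (suc l)) (λ {x} → step b x)) (∑-halfStates p m (suc l)))

  halfWords : ℕ → List Word
  halfWords m = map proj₁ (halfStates m 0)

  halfWords-sound : ∀ m {w} → w ∈ halfWords m → length w ≡ m × sumAll leaves w ≡ r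
  halfWords-sound m w∈ with ∈-map⁻ proj₁ w∈
  ... | (w , F) , x∈ , refl with halfStates-sound m 0 x∈
  halfWords-sound m w∈ | (w , []) , x∈ , refl | l , _ , lv = l , trans (sym (+-identityʳ (sumAll leaves w))) lv

  halfWords-complete : ∀ {w} → sumAll leaves w ≡ r → w ∈ halfWords (length w)
  halfWords-complete {w} lv = ∈-map⁺ proj₁ (halfStates-complete (length w) 0 {w , []} (refl , refl , trans (+-identityʳ (sumAll leaves w)) lv))

  halfWords-Unique : ∀ m → Unique (halfWords m)
  halfWords-Unique m = Unique-map-∈ proj₁ inj (halfStates-Unique m 0)
    where
    inj : ∀ {x y} → x ∈ halfStates m 0 → y ∈ halfStates m 0 → proj₁ x ≡ proj₁ y → x ≡ y
    inj {_ , F} {_ , F'} x∈ y∈ refl with halfStates-sound m 0 x∈ | halfStates-sound m 0 y∈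
    inj {_ , []} {_ , []} x∈ y∈ refl | _ | _ = refl

  ∑-halfWords : ∀ p m → ∑ (halfWords m) (λ w → 𝟙 (p (sumAll cherries w))) ≡ palindromes p r m
  ∑-halfWords p m = trans (∑-map proj₁ (halfStates m 0) (λ w → 𝟙 (p (sumAll cherries w))))
    (trans (∑-cong (halfStates m 0) (λ {x} → same x)) (trans (∑-halfStates p m 0) (cong (λ z → 2^ m · forestCountAt p r z) (+-identityʳ m))))
    where
    same : ∀ x → x ∈ halfStates m 0 → 𝟙 (p (sumAll cherries (proj₁ x))) ≡ halfTest p x
    same (w , []) _ = cong (λ z → 𝟙 (p z)) (sym (+-identityʳ (sumAll cherries w)))
    same (w , _ ∷ _) x∈ with () ← proj₁ (proj₂ (halfStates-sound m 0 x∈))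

∑-upTo-∷ʳ : ∀ n (f : ℕ → ℚ) → ∑< (suc n) f ≡ ∑< n f ⊕ f n
∑-upTo-∷ʳ zero f = trans (⊕-identityʳ (f 0)) (sym (⊕-identityˡ (f 0)))
∑-upTo-∷ʳ (suc n) f = trans (∑-upTo-suc (suc n) f) (trans (cong (f 0 ⊕_) (∑-upTo-∷ʳ n (f ∘ suc)))
  (trans (sym (ℚₚ.+-assoc (f 0) (∑< n (f ∘ suc)) (f (suc n)))) (cong (_⊕ f (suc n)) (sym (∑-upTo-suc n f)))))

∑-range1-even : ∀ r (f : ℕ → ℚ) → (∀ m → f (suc (m + m)) ≡ 0ℚ) → ∑₁ (r + r) f ≡ ∑₁ r (λ m → f (m + m))
∑-range1-even zero f odd = refl
∑-range1-even (suc r) f odd = begin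
  ∑₁ (suc r + suc r) f ≡⟨ ∑-range1 (suc r + suc r) f ⟩
  ∑< (suc r + suc r) (f ∘ suc) ≡⟨ cong (λ n → ∑< n (f ∘ suc)) (+-suc (suc r) r) ⟩
  ∑< (suc (suc (r + r))) (f ∘ suc) ≡⟨ ∑-upTo-∷ʳ (suc (r + r)) (f ∘ suc) ⟩
  ∑< (suc (r + r)) (f ∘ suc) ⊕ f (suc (suc (r + r))) ≡⟨ cong₂ _⊕_ (∑-upTo-∷ʳ (r + r) (f ∘ suc)) (cong f (sym (+-suc (suc r) r))) ⟩
  (∑< (r + r) (f ∘ suc) ⊕ f (suc (r + r))) ⊕ f (suc r + suc r) ≡⟨ cong (_⊕ f (suc r + suc r)) (trans (cong (∑< (r + r) (f ∘ suc) ⊕_) (odd r)) (⊕-identityʳ (∑< (r + r) (f ∘ suc)))) ⟩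
  ∑< (r + r) (f ∘ suc) ⊕ f (suc r + suc r) ≡⟨ cong (_⊕ f (suc r + suc r)) (trans (sym (∑-range1 (r + r) f)) (trans (∑-range1-even r f odd) (∑-range1 r (λ m → f (m + m))))) ⟩
  ∑< r (λ m → f (suc m + suc m)) ⊕ f (suc r + suc r) ≡⟨ ∑-upTo-∷ʳ r (λ m → f (suc m + suc m)) ⟨
  ∑< (suc r) (λ m → f (suc m + suc m)) ≡⟨ ∑-range1 (suc r) (λ m → f (m + m)) ⟨
  ∑₁ (suc r) (λ m → f (m + m)) ∎

module _ (p : ℕ → Bool) (r : ℕ) where

  private
    test′ = test₂ p p
    W = words r r

  mirrorFixed : ℕ → ℕ → ℚ
  mirrorFixed L d = ∑ (W L) (λ w → test′ w · δ _≟ᵂ_ w (rot d (mirror w)))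

  W-rot1 : ∀ L → map rot1 (W L) ↭ W L
  W-rot1 L = Unique-set⇒↭ (Uniqueₚ.map⁺ rot1-injective (words-Unique r r L)) (words-Unique r r L) to from
    where
    to : ∀ {w} → w ∈ map rot1 (W L) → w ∈ W L
    to w∈ with ∈-map⁻ rot1 w∈
    ... | v , v∈ , refl = let l , a , b = words-sound r r L v∈ in
      words-complete r r L (trans (length-rot1 v) l , trans (sumAt-rot1 false leaves v) a , trans (sumAt-rot1 true leaves v) b)
    from : ∀ {w} → w ∈ W L → w ∈ map rot1 (W L)
    from {w} w∈ = let l , a , b = words-sound r r L w∈ ; d = length w ∸ 1 in
      subst (_∈ map rot1 (W L)) (rot1-unrot w) (∈-map⁺ rot1 (words-complete r r L {unrot w}
        (trans (length-rot d w) l , trans (sumAt-rot false leaves d w) a , trans (sumAt-rot true leaves d w) b)))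

  ∑-rot1 : ∀ L (f : Word → ℚ) → ∑ (W L) f ≡ ∑ (W L) (f ∘ rot1)
  ∑-rot1 L f = trans (∑-↭ f (↭-sym (W-rot1 L))) (∑-map rot1 (W L) f)

  test-rot1 : ∀ w → test′ (rot1 w) ≡ test′ w
  test-rot1 w = cong₂ (λ a b → 𝟙 (p a) · 𝟙 (p b)) (sumAt-rot1 false cherries w) (sumAt-rot1 true cherries w)

  iff-does : ∀ {A B : Set} (a : Dec A) (b : Dec B) → (A → B) → (B → A) → does a ≡ does b
  iff-does (yes _) (yes _) _ _ = refl
  iff-does (no _) (no _) _ _ = refl
  iff-does (yes a) (no ¬b) to _ = contradiction (to a) ¬b
  iff-does (no ¬a) (yes b) _ from = contradiction (from b) ¬a

  -- Conjugating the reflection by a rotation shifts it by 2.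
  mirrorFixed-+2 : ∀ L d → mirrorFixed L (suc (suc d)) ≡ mirrorFixed L d
  mirrorFixed-+2 L d = trans (∑-rot1 L (λ w → test′ w · δ _≟ᵂ_ w (rot (suc (suc d)) (mirror w))))
      (∑-ext (W L) (λ w → cong₂ _·_ (test-rot1 w) (cong 𝟙 (iff-does (rot1 w ≟ᵂ rot (suc (suc d)) (mirror (rot1 w))) (w ≟ᵂ rot d (mirror w)) (to w) (from w)))))
    where
    shift : ∀ w → rot (suc (suc d)) (mirror (rot1 w)) ≡ rot1 (rot d (mirror w))
    shift w = trans (cong (λ z → rot d (rot1 z)) (rot1-mirror-rot1 w)) (rot-rot1 d (mirror w))
    to : ∀ w → rot1 w ≡ rot (suc (suc d)) (mirror (rot1 w)) → w ≡ rot d (mirror w)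
    to w e = rot1-injective (trans e (shift w))
    from : ∀ w → w ≡ rot d (mirror w) → rot1 w ≡ rot (suc (suc d)) (mirror (rot1 w))
    from w e = trans (cong rot1 e) (sym (shift w))

  flip-≢ : ∀ x → x ≢ flip x
  flip-≢ (true , t) ()
  flip-≢ (false , t) ()

  -- This reflection has an axis through a letter, which would have to equal itself with reversed
  -- orientation.
  mirrorFixed-1 : ∀ L → mirrorFixed (suc L) 1 ≡ 0ℚ
  mirrorFixed-1 L = trans (∑-rot1 (suc L) (λ w → test′ w · δ _≟ᵂ_ w (rot 1 (mirror w))))
      (∑-zero (W (suc L)) (λ {w} w∈ → trans (cong (test′ (rot1 w) ·_) (δ-≢ _≟ᵂ_ (apart w (proj₁ (words-sound r r (suc L) w∈))))) (·-zeroʳ (test′ (rot1 w)))))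
    where
    apart : ∀ w → length w ≡ suc L → rot1 w ≢ rot 1 (mirror (rot1 w))
    apart (x ∷ xs) _ e = flip-≢ x (proj₂ (∷ʳ-injective xs (mirror xs) (trans e (trans (rot1-mirror-rot1 (x ∷ xs)) (mirror-++ [ x ] xs)))))

  mirrorFixed-L : ∀ L → mirrorFixed L L ≡ mirrorFixed L 0
  mirrorFixed-L L = ∑-cong (W L) (λ {w} w∈ → cong (λ z → test′ w · δ _≟ᵂ_ w z)
    (trans (cong (λ n → rot n (mirror w)) (sym (trans (length-mirror w) (proj₁ (words-sound r r L w∈))))) (rot-length (mirror w))))

  -- The values of the reflections have period 2 in d, with f 1 = 0 and f L = f 0. For even L half
  -- of the L reflections contribute f 0; for odd L the two conditions force f 0 = 0. Either way
  -- twice the sum is L times f 0.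
  ∑-mirrorFixed : ∀ L → fromℕ 2 · ∑₁ (suc L) (mirrorFixed (suc L)) ≡ fromℕ (suc L) · mirrorFixed (suc L) 0
  ∑-mirrorFixed L = trans (cong (fromℕ 2 ·_) (∑-range1 (suc L) f)) (go (suc L) (mirrorFixed-L (suc L)))
    where
    f = mirrorFixed (suc L)
    go : ∀ n → f n ≡ f 0 → fromℕ 2 · ∑< n (f ∘ suc) ≡ fromℕ n · f 0
    go zero eq = trans (·-zeroʳ (fromℕ 2)) (sym (·-zeroˡ (f 0)))
    go (suc zero) eq = trans (cong (fromℕ 2 ·_) (trans (⊕-identityʳ (f 1)) (mirrorFixed-1 L)))
      (trans (·-zeroʳ (fromℕ 2)) (sym (trans (·-identityˡ (f 0)) (trans (sym eq) (mirrorFixed-1 L)))))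
    go (suc (suc n)) eq = begin
      fromℕ 2 · ∑< (suc (suc n)) (f ∘ suc)
        ≡⟨ cong (fromℕ 2 ·_) (trans (∑-upTo-suc (suc n) (f ∘ suc)) (cong (f 1 ⊕_) (∑-upTo-suc n (f ∘ suc ∘ suc)))) ⟩
      fromℕ 2 · (f 1 ⊕ (f 2 ⊕ ∑< n (f ∘ suc ∘ suc ∘ suc)))
        ≡⟨ cong₂ (λ a b → fromℕ 2 · (a ⊕ b)) (mirrorFixed-1 L) (cong₂ _⊕_ (mirrorFixed-+2 (suc L) 0) (∑-ext (upTo n) (λ d → mirrorFixed-+2 (suc L) (suc d)))) ⟩
      fromℕ 2 · (0ℚ ⊕ (f 0 ⊕ ∑< n (f ∘ suc)))
        ≡⟨ ring (fromℕ 2) (f 0) (∑< n (f ∘ suc)) ⟩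
      fromℕ 2 · f 0 ⊕ fromℕ 2 · ∑< n (f ∘ suc)
        ≡⟨ cong (fromℕ 2 · f 0 ⊕_) (go n (trans (sym (mirrorFixed-+2 (suc L) n)) eq)) ⟩
      fromℕ 2 · f 0 ⊕ fromℕ n · f 0
        ≡⟨ ℚₚ.*-distribʳ-+ (f 0) (fromℕ 2) (fromℕ n) ⟨
      (fromℕ 2 ⊕ fromℕ n) · f 0
        ≡⟨ cong (_· f 0) (fromℕ-+ 2 n) ⟨
      fromℕ (suc (suc n)) · f 0 ∎
      where
      ring : ∀ t a b → t · (0ℚ ⊕ (a ⊕ b)) ≡ t · a ⊕ t · b
      ring = solve-∀ ℚ-ring

  mirrorFixed-odd : ∀ m → mirrorFixed (suc (m + m)) 0 ≡ 0ℚ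
  mirrorFixed-odd m = trans (sym (mirrorFixed-L (suc (m + m)))) (trans (down m (suc (m + m)) 1) (mirrorFixed-1 (m + m)))
    where
    down : ∀ m L d → mirrorFixed L (d + (m + m)) ≡ mirrorFixed L d
    down zero L d = cong (mirrorFixed L) (+-identityʳ d)
    down (suc m) L d = trans (cong (mirrorFixed L) (shape d m)) (trans (mirrorFixed-+2 L (d + (m + m))) (down m L d))
      where
      shape : ∀ d m → d + (suc m + suc m) ≡ suc (suc (d + (m + m)))
      shape = ℕ-Ring.solve-∀

  -- A fixed word is a half v followed by its mirror image. Each letter of v then occurs once in
  -- either orientation, so v has r leaves altogether and its orientations are free.
  mirrorFixed-even : ∀ m → mirrorFixed (m + m) 0 ≡ palindromes p r m
  mirrorFixed-even m = trans (trans (∑-ext (W (m + m)) (λ w → ·-comm (test′ w) (δ _≟ᵂ_ w (mirror w)))) (sym (∑-filter fixed? (W (m + m)) test′)))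
      (trans (∑-↭ test′ perm) (trans (∑-map palindrome (halfWords r m) test′) (trans (∑-ext (halfWords r m) test-palindrome) (∑-halfWords r p m))))
    where
    fixed? : ∀ w → Dec (w ≡ mirror w)
    fixed? w = w ≟ᵂ mirror w
    palindrome : Word → Word
    palindrome v = v ++ mirror v
    sum-palindromeᶠ : ∀ f v → sumAt false f (palindrome v) ≡ sumAll f v
    sum-palindromeᶠ f v = trans (sumAt-++ false f v (mirror v)) (cong (sumAt false f v +_) (sumAt-mirror false f v))
    sum-palindromeᵗ : ∀ f v → sumAt true f (palindrome v) ≡ sumAll f v
    sum-palindromeᵗ f v = trans (sumAt-++ true f v (mirror v)) (trans (cong (sumAt true f v +_) (sumAt-mirror true f v)) (+-comm (sumAt true f v) (sumAt false f v)))
    𝟙² : ∀ b → 𝟙 b · 𝟙 b ≡ 𝟙 b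
    𝟙² true = refl
    𝟙² false = refl
    test-palindrome : ∀ v → test′ (palindrome v) ≡ 𝟙 (p (sumAll cherries v))
    test-palindrome v = trans (cong₂ (λ a b → 𝟙 (p a) · 𝟙 (p b)) (sum-palindromeᶠ cherries v) (sum-palindromeᵗ cherries v)) (𝟙² (p (sumAll cherries v)))
    to : ∀ {w} → w ∈ filter fixed? (W (m + m)) → w ∈ map palindrome (halfWords r m)
    to {w} w∈ with ∈-filter⁻ fixed? {xs = W (m + m)} w∈
    ... | w∈W , fix with words-sound r r (m + m) w∈W
    ... | len , er , _ = subst (_∈ map palindrome (halfWords r m)) (sym w≡) (∈-map⁺ palindrome v∈)
      where
      v = take m w
      u = drop m w
      w≡vu : v ++ u ≡ w
      w≡vu = take++drop≡id m w
      lv : length v ≡ m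
      lv = trans (length-take m w) (m≤n⇒m⊓n≡m (≤-trans (m≤m+n m m) (≤-reflexive (sym len))))
      lu : length u ≡ m
      lu = trans (length-drop m w) (trans (cong (_∸ m) len) (m+n∸m≡n m m))
      u≡ : u ≡ mirror v
      u≡ = proj₂ (++-cancel-length v (mirror u) (trans lv (sym (trans (length-mirror u) lu)))
        (trans w≡vu (trans fix (trans (cong mirror (sym w≡vu)) (mirror-++ v u)))))
      w≡ : w ≡ palindrome v
      w≡ = trans (sym w≡vu) (cong (v ++_) u≡)
      v∈ : v ∈ halfWords r m
      v∈ = subst (λ n → v ∈ halfWords r n) lv (halfWords-complete r {v} (trans (sym (sum-palindromeᶠ leaves v)) (trans (cong (sumAt false leaves) (sym w≡)) er)))
    from : ∀ {w} → w ∈ map palindrome (halfWords r m) → w ∈ filter fixed? (W (m + m))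
    from w∈ with ∈-map⁻ palindrome w∈
    ... | v , v∈ , refl with halfWords-sound r m v∈
    ... | lv , sv = ∈-filter⁺ fixed? (words-complete r r (m + m)
        (trans (length-++ v) (cong₂ _+_ lv (trans (length-mirror v) lv)) , trans (sum-palindromeᶠ leaves v) sv , trans (sum-palindromeᵗ leaves v) sv))
        (sym (trans (mirror-++ v (mirror v)) (cong (_++ mirror v) (mirror-mirror v))))
    inj : ∀ {v v'} → v ∈ halfWords r m → v' ∈ halfWords r m → palindrome v ≡ palindrome v' → v ≡ v'
    inj {v} {v'} v∈ v'∈ eq = proj₁ (++-cancel-length v v' (trans (proj₁ (halfWords-sound r m v∈)) (sym (proj₁ (halfWords-sound r m v'∈)))) eq)
    perm : filter fixed? (W (m + m)) ↭ map palindrome (halfWords r m)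
    perm = Unique-set⇒↭ (Uniqueₚ.filter⁺ fixed? (words-Unique r r (m + m))) (Unique-map-∈ palindrome inj (halfWords-Unique r m)) to from

  ∑-palindromes : ∑₁ (r + r) (λ L → mirrorFixed L 0) ≡ ∑₁ r (λ m → palindromes p r m)
  ∑-palindromes = trans (∑-range1-even r (λ L → mirrorFixed L 0) mirrorFixed-odd) (∑-ext (range1 r) mirrorFixed-even)

-- Burnside counts for words

rotations-↭ : ∀ (x y : Word) → y ∈ rots x → rots y ↭ rots x
rotations-↭ x y = rots-↭ {x = x} {y = y}

reflections-↭ : ∀ x y → y ∈ dihedral x → dihedral y ↭ dihedral x
reflections-↭ x y = dihedral-↭ {x} {y}

module RotationClasses = Burnside _≟ᵂ_ rots self∈rots rotations-↭

module DihedralClasses = Burnside _≟ᵂ_ dihedral self∈dihedral reflections-↭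

rotationTotal : (p q : ℕ → Bool) → ℕ → ℕ → ℚ
rotationTotal p q r s = ∑₁ (r + s) (λ k → φ/ k · ∑₁ (r + s) (λ g → 1/ g · powers p q r s k g))

-- Lists of 2L images halve the weight of the rotations. The L reflections together contribute L/2
-- times the number of palindromes of length L, so division by 2L leaves 1/4 for every L.
dihedralTotal : (ℕ → Bool) → ℕ → ℚ
dihedralTotal p r = half · rotationTotal p p r r ⊕ 1/ 4 · ∑< (suc r) (λ m → palindromes p r m)

private
  multiplicity-rots : ∀ w v → length w ≡ length v → ∑ (rots w) (δ _≟ᵂ_ v) ≡ ∑₁ (length v) (λ d → δ _≟ᵂ_ v (rot d w)) ⊎ v ≡ []
  multiplicity-rots [] [] l = inj₂ refl
  multiplicity-rots (x ∷ w) (y ∷ v) l = inj₁ (trans (∑-map (λ d → rot d (x ∷ w)) (range1 (length (x ∷ w))) (δ _≟ᵂ_ (y ∷ v)))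
    (cong (λ n → ∑₁ n (λ d → δ _≟ᵂ_ (y ∷ v) (rot d (x ∷ w)))) l))

  nonempty : ∀ {r s L w} → L ∈ range1 (r + s) → w ∈ words r s L → Σ Letter λ x → Σ Word λ xs → w ≡ x ∷ xs
  nonempty {r} {s} {L} {x ∷ xs} L∈ w∈ = x , xs , refl
  nonempty {r} {s} {L} {[]} L∈ w∈ = contradiction (≤-trans (proj₁ (range1⇒≤ L∈)) (≤-reflexive (sym (proj₁ (words-sound r s L w∈))))) 1+n≰n

module _ (p q : ℕ → Bool) (r s : ℕ) where

  private
    n = r + s
    X = admissibleWords p q r s

  ∑-rotationWeight : ∑ X RotationClasses.weight ≡ rotationTotal p q r s
  ∑-rotationWeight = trans (∑-admissible p q r s RotationClasses.weight) (trans (∑-cong (range1 n) (λ {L} L∈ → per-length L L∈)) (∑-rotFixed p q r s))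
    where
    per-length : ∀ L → L ∈ range1 n → ∑ (words r s L) (λ w → test₂ p q w · RotationClasses.weight w) ≡ 1/ L · ∑₁ L (rotFixed p q r s L)
    per-length L L∈ = begin
      ∑ (words r s L) (λ w → test₂ p q w · RotationClasses.weight w)
        ≡⟨ ∑-cong (words r s L) (λ {w} w∈ → trans (cong (test₂ p q w ·_) (weight≡ w w∈)) (exch (test₂ p q w) (∑₁ L (λ d → δ _≟ᵂ_ w (rot d w))) (1/ L))) ⟩
      ∑ (words r s L) (λ w → 1/ L · (test₂ p q w · ∑₁ L (λ d → δ _≟ᵂ_ w (rot d w))))
        ≡⟨ ∑-*ˡ (words r s L) (1/ L) (λ w → test₂ p q w · ∑₁ L (λ d → δ _≟ᵂ_ w (rot d w))) ⟩
      1/ L · ∑ (words r s L) (λ w → test₂ p q w · ∑₁ L (λ d → δ _≟ᵂ_ w (rot d w)))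
        ≡⟨ cong (1/ L ·_) (trans (∑-ext (words r s L) (λ w → sym (∑-*ˡ (range1 L) (test₂ p q w) (λ d → δ _≟ᵂ_ w (rot d w))))) (∑-swap (words r s L) (range1 L) (λ w d → test₂ p q w · δ _≟ᵂ_ w (rot d w)))) ⟩
      1/ L · ∑₁ L (rotFixed p q r s L) ∎
      where
      exch : ∀ a b c → a · (b · c) ≡ c · (a · b)
      exch = solve-∀ ℚ-ring
      weight≡ : ∀ w → w ∈ words r s L → RotationClasses.weight w ≡ ∑₁ L (λ d → δ _≟ᵂ_ w (rot d w)) · 1/ L
      weight≡ w w∈ with nonempty L∈ w∈
      ... | x , xs , refl with multiplicity-rots w w refl
      ... | inj₁ e = cong₂ _·_ (trans e (cong (λ l → ∑₁ l (λ d → δ _≟ᵂ_ w (rot d w))) len)) (cong 1/ (trans (length-rots x xs) len))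
        where len = proj₁ (words-sound r s L w∈)

  rotation-closed : 1 ≤ r → ∀ {x y} → x ∈ X → y ∈ rots x → y ∈ X
  rotation-closed 1≤r {x} x∈ y∈ with rots⇒rot {w = x} y∈
  ... | d , refl = let (a , b) , adm = admissibleWords-sound p q r s x∈ in admissibleWords-complete p q r s {rot d x} 1≤r
    ((trans (sumAt-rot false leaves d x) a , trans (sumAt-rot true leaves d x) b) ,
     trans (cong₂ (λ a b → p a ∧ q b) (sumAt-rot false cherries d x) (sumAt-rot true cherries d x)) adm)

module _ (p : ℕ → Bool) (r : ℕ) where

  private
    n = r + r
    X = admissibleWords p p r r

  ∑-dihedralWeight : 1 ≤ r → ∑ X DihedralClasses.weight ≡ dihedralTotal p r
  ∑-dihedralWeight 1≤r = begin
    ∑ X DihedralClasses.weight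
      ≡⟨ ∑-admissible p p r r DihedralClasses.weight ⟩
    ∑₁ n (λ L → ∑ (words r r L) (λ w → test₂ p p w · DihedralClasses.weight w))
      ≡⟨ ∑-cong (range1 n) (λ {L} L∈ → per-length L L∈) ⟩
    ∑₁ n (λ L → half · (1/ L · ∑₁ L (rotFixed p p r r L)) ⊕ 1/ 4 · mirrorFixed p r L 0)
      ≡⟨ trans (∑-+ (range1 n) (λ L → half · (1/ L · ∑₁ L (rotFixed p p r r L))) (λ L → 1/ 4 · mirrorFixed p r L 0))
               (cong₂ _⊕_ (∑-*ˡ (range1 n) half (λ L → 1/ L · ∑₁ L (rotFixed p p r r L))) (∑-*ˡ (range1 n) (1/ 4) (λ L → mirrorFixed p r L 0))) ⟩
    half · ∑₁ n (λ L → 1/ L · ∑₁ L (rotFixed p p r r L)) ⊕ 1/ 4 · ∑₁ n (λ L → mirrorFixed p r L 0)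
      ≡⟨ cong₂ (λ a b → half · a ⊕ 1/ 4 · b) (∑-rotFixed p p r r) (trans (∑-palindromes p r) (from-zero r 1≤r)) ⟩
    dihedralTotal p r ∎
    where
    -- The term m = 0 is 0, as a positive number of leaves needs a tree; it is added to complete the
    -- geometric series.
    from-zero : ∀ r → 1 ≤ r → ∑₁ r (λ m → palindromes p r m) ≡ ∑< (suc r) (λ m → palindromes p r m)
    from-zero r@(suc _) _ = trans (∑-range1 r (λ m → palindromes p r m))
      (trans (sym (⊕-identityˡ (∑< r (λ m → 2^ (suc m) · forestCountAt p r (suc m)))))
             (sym (∑-upTo-suc r (λ m → palindromes p r m))))
    per-length : ∀ L → L ∈ range1 n → ∑ (words r r L) (λ w → test₂ p p w · DihedralClasses.weight w) ≡
      half · (1/ L · ∑₁ L (rotFixed p p r r L)) ⊕ 1/ 4 · mirrorFixed p r L 0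
    per-length L L∈ = begin
      ∑ (words r r L) (λ w → test₂ p p w · DihedralClasses.weight w)
        ≡⟨ ∑-cong (words r r L) (λ {w} w∈ → trans (cong (test₂ p p w ·_) (weight≡ w w∈)) (distrib (test₂ p p w) (A w) (B w) (half · 1/ L))) ⟩
      ∑ (words r r L) (λ w → (half · 1/ L) · (test₂ p p w · A w) ⊕ (half · 1/ L) · (test₂ p p w · B w))
        ≡⟨ trans (∑-+ (words r r L) (λ w → (half · 1/ L) · (test₂ p p w · A w)) (λ w → (half · 1/ L) · (test₂ p p w · B w)))
             (cong₂ _⊕_ (∑-*ˡ (words r r L) (half · 1/ L) (λ w → test₂ p p w · A w)) (∑-*ˡ (words r r L) (half · 1/ L) (λ w → test₂ p p w · B w))) ⟩
      (half · 1/ L) · ∑ (words r r L) (λ w → test₂ p p w · A w) ⊕ (half · 1/ L) · ∑ (words r r L) (λ w → test₂ p p w · B w)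
        ≡⟨ cong₂ (λ a b → (half · 1/ L) · a ⊕ (half · 1/ L) · b) (swapped (λ w d → δ _≟ᵂ_ w (rot d w))) (swapped (λ w d → δ _≟ᵂ_ w (rot d (mirror w)))) ⟩
      (half · 1/ L) · ∑₁ L (rotFixed p p r r L) ⊕ (half · 1/ L) · ∑₁ L (mirrorFixed p r L)
        ≡⟨ cong₂ _⊕_ (·-assoc half (1/ L) (∑₁ L (rotFixed p p r r L))) (quarter L L∈) ⟩
      half · (1/ L · ∑₁ L (rotFixed p p r r L)) ⊕ 1/ 4 · mirrorFixed p r L 0 ∎
      where
      A B : Word → ℚ
      A w = ∑₁ L (λ d → δ _≟ᵂ_ w (rot d w))
      B w = ∑₁ L (λ d → δ _≟ᵂ_ w (rot d (mirror w)))
      distrib : ∀ t a b h → t · ((a ⊕ b) · h) ≡ h · (t · a) ⊕ h · (t · b)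
      distrib = solve-∀ ℚ-ring
      swapped : ∀ (f : Word → ℕ → ℚ) → ∑ (words r r L) (λ w → test₂ p p w · ∑₁ L (f w)) ≡ ∑₁ L (λ d → ∑ (words r r L) (λ w → test₂ p p w · f w d))
      swapped f = trans (∑-ext (words r r L) (λ w → sym (∑-*ˡ (range1 L) (test₂ p p w) (f w)))) (∑-swap (words r r L) (range1 L) (λ w d → test₂ p p w · f w d))
      halfL : ∀ l → 1 ≤ l → 1/ (l + l) ≡ half · 1/ l
      halfL l 1≤l = trans (cong (λ z → 1/ (l + z)) (sym (+-identityʳ l))) (1/-* 2 l {{_}} {{>-nonZero 1≤l}})
      weight≡ : ∀ w → w ∈ words r r L → DihedralClasses.weight w ≡ (A w ⊕ B w) · (half · 1/ L)
      weight≡ w w∈ with nonempty L∈ w∈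
      ... | x , xs , refl with multiplicity-rots w w refl | multiplicity-rots (mirror w) w (length-mirror w)
      ... | inj₁ e | inj₁ e' = cong₂ _·_
          (trans (∑-++ (rots w) (rots (mirror w)) (δ _≟ᵂ_ w)) (cong₂ _⊕_ (trans e (cong (λ l → ∑₁ l (λ d → δ _≟ᵂ_ w (rot d w))) len)) (trans e' (cong (λ l → ∑₁ l (λ d → δ _≟ᵂ_ w (rot d (mirror w)))) len))))
          (trans (cong 1/ (trans (length-++ (rots w)) (cong₂ _+_ (trans (length-rots x xs) len) (mirror-length (mirror w) (trans (length-mirror w) len))))) (halfL L (proj₁ (range1⇒≤ L∈))))
        where
        len = proj₁ (words-sound r r L w∈)
        mirror-length : ∀ v → length v ≡ L → length (rots v) ≡ L
        mirror-length (y ∷ ys) l = trans (length-rots y ys) l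
        mirror-length [] l = contradiction (≤-trans (proj₁ (range1⇒≤ L∈)) (≤-reflexive (sym l))) 1+n≰n
      quarter : ∀ L → L ∈ range1 n → (half · 1/ L) · ∑₁ L (mirrorFixed p r L) ≡ 1/ 4 · mirrorFixed p r L 0
      quarter zero L∈ = contradiction (proj₁ (range1⇒≤ L∈)) 1+n≰n
      quarter (suc L) L∈ = trans (cong (_· S) (cong (_· 1/ (suc L)) half≡))
        (trans (ring (1/ 4) (fromℕ 2) (1/ (suc L)) S) (trans (cong (λ z → 1/ 4 · (1/ (suc L) · z)) (∑-mirrorFixed p r L))
        (trans (ring′ (1/ 4) (1/ (suc L)) (fromℕ (suc L)) (mirrorFixed p r (suc L) 0)) (trans (cong (λ z → 1/ 4 · (z · mirrorFixed p r (suc L) 0)) (1/-inverse (suc L))) (cong (1/ 4 ·_) (·-identityˡ (mirrorFixed p r (suc L) 0)))))))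
        where
        half≡ : half ≡ 1/ 4 · fromℕ 2
        half≡ = refl
        S = ∑₁ (suc L) (mirrorFixed p r (suc L))
        ring : ∀ q t l s → ((q · t) · l) · s ≡ q · (l · (t · s))
        ring = solve-∀ ℚ-ring
        ring′ : ∀ q l m s → q · (l · (m · s)) ≡ q · ((l · m) · s)
        ring′ = solve-∀ ℚ-ring

  dihedral-closed : 1 ≤ r → ∀ {x y} → x ∈ X → y ∈ dihedral x → y ∈ X
  dihedral-closed 1≤r {x} x∈ y∈ with dihedral⇒ {x} y∈
  ... | d , inj₁ refl = rotation-closed p p r r 1≤r x∈ (rot∈rots d x)
  ... | d , inj₂ refl = rotation-closed p p r r 1≤r mirror∈ (rot∈rots d (mirror x))
    where
    mirror∈ : mirror x ∈ X
    mirror∈ = let (a , b) , adm = admissibleWords-sound p p r r x∈ in admissibleWords-complete p p r r {mirror x} 1≤r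
      ((trans (sumAt-mirror false leaves x) b , trans (sumAt-mirror true leaves x) a) ,
       trans (cong₂ (λ a b → p a ∧ p b) (sumAt-mirror false cherries x) (sumAt-mirror true cherries x)) (trans (∧-comm (p (sumAt true cherries x)) (p (sumAt false cherries x))) adm))

-- Comparison with the stated formulas

pm1-+ : ∀ m n → pm1 (m + n) ≡ pm1 m · pm1 n
pm1-+ zero n = sym (·-identityˡ (pm1 n))
pm1-+ (suc m) n = trans (cong ℚ.-_ (pm1-+ m n)) (ℚₚ.neg-distribˡ-* (pm1 m) (pm1 n))

pm1-double : ∀ n → pm1 (n + n) ≡ 1ℚ
pm1-double zero = refl
pm1-double (suc n) = trans (cong (λ m → ℚ.- pm1 m) (+-suc n n)) (trans (negneg (pm1 (n + n))) (pm1-double n))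
  where
  negneg : ∀ x → ℚ.- (ℚ.- x) ≡ x
  negneg = solve-∀ ℚ-ring

+-+⇒+ : ∀ {m n a} → m ≡ n + a → ℤ.+ m ⊟ ℤ.+ n ≡ ℤ.+ a
+-+⇒+ {n = n} {a} refl = trans (ℤₚ.[+m]-[+n]≡m⊖n (n + a) n) (trans (ℤₚ.⊖-≥ (m≤m+n n a)) (cong ℤ.+_ (m+n∸m≡n n a)))

+-+⇒- : ∀ {m n} → m < n → Σ ℕ λ a → ℤ.+ m ⊟ ℤ.+ n ≡ ℤ.-[1+ a ]
+-+⇒- {m} {n} m<n with m≤n⇒∃[o]m+o≡n m<n
... | a , refl = a , trans (ℤₚ.[+m]-[+n]≡m⊖n m (suc m + a)) (trans (ℤₚ.⊖-< m<n)
  (cong (λ z → ℤ.- (ℤ.+ z)) (trans (cong (_∸ m) (sym (+-suc m a))) (m+n∸m≡n m (suc a)))))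

centralAt-factorials : ∀ i → centralAt i 0 ≡ fromℕ ((2 * i) !) · (1/ (i !) · 1/ (i !))
centralAt-factorials i = *-cancelʳ-fromℕ (i ! * i !) {{_!*_!≢0 i i}} (begin
  fromℕ ((2 * i) C i) · fromℕ (i ! * i !) ≡⟨ fromℕ-* ((2 * i) C i) (i ! * i !) ⟨
  fromℕ (((2 * i) C i) * (i ! * i !)) ≡⟨ cong fromℕ (subst (λ m → (m C i) * (i ! * i !) ≡ m !) (cong (i +_) (sym (+-identityʳ i))) (C-factorials i i)) ⟩
  fromℕ ((2 * i) !) ≡⟨ ·-identityʳ (fromℕ ((2 * i) !)) ⟨
  fromℕ ((2 * i) !) · 1ℚ ≡⟨ cong (fromℕ ((2 * i) !) ·_) (cong₂ _·_ (1/-inverse (i !) {{_!≢0 i}}) (1/-inverse (i !) {{_!≢0 i}})) ⟨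
  fromℕ ((2 * i) !) · ((1/ (i !) · fromℕ (i !)) · (1/ (i !) · fromℕ (i !)))
    ≡⟨ ring (fromℕ ((2 * i) !)) (1/ (i !)) (fromℕ (i !)) ⟩
  fromℕ ((2 * i) !) · (1/ (i !) · 1/ (i !)) · (fromℕ (i !) · fromℕ (i !))
    ≡⟨ cong (fromℕ ((2 * i) !) · (1/ (i !) · 1/ (i !)) ·_) (fromℕ-* (i !) (i !)) ⟨
  fromℕ ((2 * i) !) · (1/ (i !) · 1/ (i !)) · fromℕ (i ! * i !) ∎)
  where
  ring : ∀ f x y → f · ((x · y) · (x · y)) ≡ f · (x · x) · (y · y)
  ring = solve-∀ ℚ-ring

multinomial₄ : ℕ → ℤ → ℕ → ℤ → ℚ
multinomial₄ i x c y = multinom (2 * i) (ℤ.+ i ∷ x ∷ ℤ.+ c ∷ y ∷ [])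

-- (2i)!/(i! a! c! b!) is C(2i, i) times i!/(a! b! c!), and the latter is a trinomial coefficient
-- because i = a + b + c.
multinomial₄-nonneg : ∀ a b c i → i ≡ a + b + c → multinomial₄ i (ℤ.+ a) c (ℤ.+ b) ≡ centralAt i 0 · trinomial a b c
multinomial₄-nonneg a b c i eq = begin
  frac (ℤ.+ ((2 * i) !)) (i ! * (a ! * (c ! * (b ! * 1))))
    ≡⟨ frac≡*1/ ((2 * i) !) (i ! * (a ! * (c ! * (b ! * 1)))) ⟩
  F · 1/ (i ! * (a ! * (c ! * (b ! * 1))))
    ≡⟨ cong (λ z → F · 1/ (i ! * (a ! * (c ! * z)))) (*-identityʳ (b !)) ⟩
  F · 1/ (i ! * (a ! * (c ! * b !)))
    ≡⟨ cong (F ·_) (trans (1/-* (i !) (a ! * (c ! * b !)) {{i!}} {{m*n≢0 (a !) (c ! * b !) {{a!}} {{m*n≢0 (c !) (b !) {{c!}} {{b!}}}}}})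
         (cong (1/ (i !) ·_) (trans (1/-* (a !) (c ! * b !) {{a!}} {{m*n≢0 (c !) (b !) {{c!}} {{b!}}}})
           (cong (1/ (a !) ·_) (1/-* (c !) (b !) {{c!}} {{b!}}))))) ⟩
  F · (1/ (i !) · (1/ (a !) · (1/ (c !) · 1/ (b !))))
    ≡⟨ ·-identityʳ (F · (1/ (i !) · (1/ (a !) · (1/ (c !) · 1/ (b !))))) ⟨
  F · (1/ (i !) · (1/ (a !) · (1/ (c !) · 1/ (b !)))) · 1ℚ
    ≡⟨ cong (F · (1/ (i !) · (1/ (a !) · (1/ (c !) · 1/ (b !)))) ·_) (1/-inverse (i !) {{i!}}) ⟨
  F · (1/ (i !) · (1/ (a !) · (1/ (c !) · 1/ (b !)))) · (1/ (i !) · fromℕ (i !))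
    ≡⟨ ring F (1/ (i !)) (1/ (a !)) (1/ (c !)) (1/ (b !)) (fromℕ (i !)) ⟩
  (F · (1/ (i !) · 1/ (i !))) · (fromℕ (i !) · (1/ (a !) · (1/ (b !) · 1/ (c !))))
    ≡⟨ cong₂ _·_ (sym (centralAt-factorials i)) (cong (λ m → fromℕ (m !) · (1/ (a !) · (1/ (b !) · 1/ (c !)))) eq) ⟩
  centralAt i 0 · trinomial a b c ∎
  where
  F = fromℕ ((2 * i) !)
  i! = _!≢0 i
  a! = _!≢0 a
  b! = _!≢0 b
  c! = _!≢0 c
  ring : ∀ f x a c b g → f · (x · (a · (c · b))) · (x · g) ≡ (f · (x · x)) · (g · (a · (b · c)))
  ring = solve-∀ ℚ-ring

multinomial₄-negʳ : ∀ i x c b → multinomial₄ i x c (ℤ.-[1+ b ]) ≡ 0ℚ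
multinomial₄-negʳ i (ℤ.+ _) c b = refl
multinomial₄-negʳ i ℤ.-[1+ _ ] c b = refl

-- Put a = 2i - r and b = r - c - i: beside c factors y these are the numbers of factors x and -x²
-- in a term of the power i. The sign is right since r + c + i = 2(i + c) + b, and when a or b is
-- negative both sides are 0.
signed-multinomial : ∀ r c i → c ≤ r →
  pm1 (r + c) · (pm1 i · multinomial₄ i (ℤ.+ (2 * i) ⊟ ℤ.+ r) c (ℤ.+ (r ∸ c) ⊟ ℤ.+ i)) ≡ centralAt i 0 · polyAt (equals c) r i
signed-multinomial r c i c≤r = go (excess i r) refl
  where
  Goal : ℚ → Set
  Goal z = pm1 (r + c) · (pm1 i · multinomial₄ i (ℤ.+ (2 * i) ⊟ ℤ.+ r) c (ℤ.+ (r ∸ c) ⊟ ℤ.+ i)) ≡ centralAt i 0 · z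
  zeros : ∀ a b x → a · (b · 0ℚ) ≡ x · 0ℚ
  zeros = solve-∀ ℚ-ring
  vanish : multinomial₄ i (ℤ.+ (2 * i) ⊟ ℤ.+ r) c (ℤ.+ (r ∸ c) ⊟ ℤ.+ i) ≡ 0ℚ → Goal 0ℚ
  vanish eq = trans (cong (λ z → pm1 (r + c) · (pm1 i · z)) eq) (zeros (pm1 (r + c)) (pm1 i) (centralAt i 0))
  negʳ : r ∸ c < i → Goal 0ℚ
  negʳ lt = let b , eq = +-+⇒- lt in vanish (trans (cong (multinomial₄ i (ℤ.+ (2 * i) ⊟ ℤ.+ r) c) eq) (multinomial₄-negʳ i (ℤ.+ (2 * i) ⊟ ℤ.+ r) c b))
  negˡ : 2 * i < r → Goal 0ℚ
  negˡ lt = let a , eq = +-+⇒- lt in vanish (cong (λ x → multinomial₄ i x c (ℤ.+ (r ∸ c) ⊟ ℤ.+ i)) eq)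
  excess-≥ : ∀ m n → excess m n ≡ nothing → n < m
  excess-≥ (suc m) zero eq = s≤s z≤n
  excess-≥ (suc m) (suc n) eq = s≤s (excess-≥ m n eq)
  go″ : ∀ d b → i + d ≡ r → c + b ≡ d → ∀ m → excess d i ≡ m → Goal (at m (λ a → pm1 b · trinomial a b c))
  go″ d b refl refl nothing eq = negˡ (+-monoʳ-< i (≤-<-trans (≤-reflexive (+-identityʳ i)) (excess-≥ d i eq)))
  go″ d b refl refl (just a) eq = begin
    pm1 (r + c) · (pm1 i · multinomial₄ i (ℤ.+ (2 * i) ⊟ ℤ.+ r) c (ℤ.+ (r ∸ c) ⊟ ℤ.+ i))
      ≡⟨ cong₂ (λ x y → pm1 (r + c) · (pm1 i · multinomial₄ i x c y))
           (+-+⇒+ {2 * i} {r} {a} (trans (cong (λ z → i + (z + 0)) (sym d+a)) (shape₁ i (c + b) a))) (+-+⇒+ {r ∸ c} {i} {b} (trans (cong (_∸ c) (shape₂ i c b)) (m+n∸n≡m (i + b) c))) ⟩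
    pm1 (r + c) · (pm1 i · multinomial₄ i (ℤ.+ a) c (ℤ.+ b))
      ≡⟨ cong (λ z → pm1 (r + c) · (pm1 i · z)) (multinomial₄-nonneg a b c i (trans (sym d+a) (shape₃ a b c))) ⟩
    pm1 (r + c) · (pm1 i · (centralAt i 0 · trinomial a b c))
      ≡⟨ ring (pm1 (r + c)) (pm1 i) (centralAt i 0) (trinomial a b c) ⟩
    centralAt i 0 · ((pm1 (r + c) · pm1 i) · trinomial a b c)
      ≡⟨ cong (λ z → centralAt i 0 · (z · trinomial a b c)) sign ⟩
    centralAt i 0 · (pm1 b · trinomial a b c) ∎
    where
    d+a : d + a ≡ i
    d+a = excess-just d i eq
    shape₁ : ∀ i d a → i + (d + a + 0) ≡ i + d + a
    shape₁ = ℕ-Ring.solve-∀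
    shape₂ : ∀ i c b → i + (c + b) ≡ i + b + c
    shape₂ = ℕ-Ring.solve-∀
    shape₃ : ∀ a b c → c + b + a ≡ a + b + c
    shape₃ = ℕ-Ring.solve-∀
    shape₄ : ∀ i c b → i + (c + b) + c + i ≡ ((i + c) + (i + c)) + b
    shape₄ = ℕ-Ring.solve-∀
    ring : ∀ s t x y → s · (t · (x · y)) ≡ x · ((s · t) · y)
    ring = solve-∀ ℚ-ring
    sign : pm1 (r + c) · pm1 i ≡ pm1 b
    sign = trans (sym (pm1-+ (r + c) i)) (trans (cong pm1 (shape₄ i c b)) (trans (pm1-+ ((i + c) + (i + c)) b)
      (trans (cong (_· pm1 b) (pm1-double (i + c))) (·-identityˡ (pm1 b)))))
  go′ : ∀ d → i + d ≡ r → ∀ m → excess c d ≡ m → Goal (at m (λ b → at (excess d i) (λ a → pm1 b · trinomial a b c)))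
  go′ d e nothing eq = negʳ (m<n+o⇒m∸n<o r c {i} {{>-nonZero pos}} (≤-<-trans (≤-reflexive (sym e)) (<-≤-trans (+-monoʳ-< i (excess-≥ c d eq)) (≤-reflexive (+-comm i c)))))
    where
    -- For i = 0 the excess d is r itself, and c > d contradicts c ≤ r. Only for positive i does the
    -- truncated `r ∸ c` lie below i.
    pos : 0 < i
    pos = n≢0⇒n>0 λ { refl → <⇒≱ (excess-≥ c d eq) (≤-trans c≤r (≤-reflexive (sym e))) }
  go′ d e (just b) eq = go″ d b e (excess-just c d eq) (excess d i) refl
  go : ∀ m → excess i r ≡ m → Goal (at m (excessPoly (equals c) i))
  go nothing eq = negʳ (≤-<-trans (m∸n≤m r c) (excess-≥ i r eq))
  go (just d) eq = trans (go′ d (excess-just i r eq) (excess c d) refl) (cong (centralAt i 0 ·_) (sym (excessPoly-equals c i d)))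

T-signed : ∀ r r₂ k r' c .{{_ : NonZero k}} → r ≡ r' * k → r₂ ≡ c * k → c ≤ r' → ∀ i →
  pm1 (r' + c) · (pm1 i · T r r₂ k i) ≡ centralAt i 0 · polyAt (equals c) r' i
T-signed _ _ k r' c refl refl c≤r' i = trans
  (cong₂ (λ a b → pm1 (r' + c) · (pm1 i · multinom (2 * i) (ℤ.+ i ∷ (ℤ.+ (2 * i) ⊟ ℤ.+ ((r' * k) /ℕ k)) ∷ ℤ.+ a ∷ (ℤ.+ b ⊟ ℤ.+ i) ∷ [])))
    (/ℕ-* c k) (trans (cong (_/ℕ k) (sym (*-distribʳ-∸ k r' c))) (/ℕ-* (r' ∸ c) k)))
  (trans (cong (λ z → pm1 (r' + c) · (pm1 i · multinomial₄ i (ℤ.+ (2 * i) ⊟ ℤ.+ z) c (ℤ.+ (r' ∸ c) ⊟ ℤ.+ i))) (/ℕ-* r' k))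
         (signed-multinomial r' c i c≤r'))

pow2-quarter : ∀ a → pow2 (ℤ.+ a ⊟ ℤ.+ 2) ≡ 1/ 4 · 2^ a
pow2-quarter 0 = refl
pow2-quarter 1 = refl
pow2-quarter (suc (suc a)) = sym (trans (cong (1/ 4 ·_) (trans (cong fromℕ (sym (*-assoc 2 2 (2 ^ a)))) (fromℕ-* 4 (2 ^ a))))
  (trans (sym (·-assoc (1/ 4) (fromℕ 4) (2^ a))) (·-identityˡ (2^ a))))

-- As r - 2r₂ = r₁, the first term of the symmetric formula is a quarter of the number of bicoloured
-- paths with r₁ level, r₂ up and r₂ down steps.
reflection-term : ∀ r₁ r₂ → let r = r₁ + 2 * r₂ in
  pow2 ((ℤ.+ r ⊟ ℤ.+ (2 * r₂)) ⊟ ℤ.+ 2) · multinom r (ℤ.+ r₂ ∷ ℤ.+ r₂ ∷ (ℤ.+ r ⊟ ℤ.+ (2 * r₂)) ∷ []) ≡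
  1/ 4 · (2^ r₁ · trinomial r₁ r₂ r₂)
reflection-term r₁ r₂ = begin
  pow2 ((ℤ.+ r ⊟ ℤ.+ (2 * r₂)) ⊟ ℤ.+ 2) · multinom r (ℤ.+ r₂ ∷ ℤ.+ r₂ ∷ (ℤ.+ r ⊟ ℤ.+ (2 * r₂)) ∷ [])
    ≡⟨ cong (λ z → pow2 (z ⊟ ℤ.+ 2) · multinom r (ℤ.+ r₂ ∷ ℤ.+ r₂ ∷ z ∷ [])) (+-+⇒+ {r} {2 * r₂} (+-comm r₁ (2 * r₂))) ⟩
  pow2 (ℤ.+ r₁ ⊟ ℤ.+ 2) · frac (ℤ.+ (r !)) (r₂ ! * (r₂ ! * (r₁ ! * 1)))
    ≡⟨ cong₂ _·_ (pow2-quarter r₁) (trans (cong (λ z → frac (ℤ.+ (r !)) (r₂ ! * (r₂ ! * z))) (*-identityʳ (r₁ !))) (frac≡*1/ (r !) (r₂ ! * (r₂ ! * r₁ !)))) ⟩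
  (1/ 4 · P) · (fromℕ (r !) · 1/ (r₂ ! * (r₂ ! * r₁ !)))
    ≡⟨ cong (λ z → (1/ 4 · P) · (fromℕ (r !) · z)) (trans (1/-* (r₂ !) (r₂ ! * r₁ !) {{_!≢0 r₂}} {{_!*_!≢0 r₂ r₁}}) (cong (1/ (r₂ !) ·_) (1/-* (r₂ !) (r₁ !) {{_!≢0 r₂}} {{_!≢0 r₁}}))) ⟩
  (1/ 4 · P) · (fromℕ (r !) · (1/ (r₂ !) · (1/ (r₂ !) · 1/ (r₁ !))))
    ≡⟨ cong (λ z → (1/ 4 · P) · (fromℕ (z !) · (1/ (r₂ !) · (1/ (r₂ !) · 1/ (r₁ !))))) (shape r₁ r₂) ⟩
  (1/ 4 · P) · (fromℕ ((r₁ + r₂ + r₂) !) · (1/ (r₂ !) · (1/ (r₂ !) · 1/ (r₁ !))))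
    ≡⟨ ring (1/ 4) P (fromℕ ((r₁ + r₂ + r₂) !)) (1/ (r₂ !)) (1/ (r₁ !)) ⟩
  1/ 4 · (P · trinomial r₁ r₂ r₂) ∎
  where
  r = r₁ + 2 * r₂
  P = 2^ r₁
  shape : ∀ a b → a + 2 * b ≡ a + b + b
  shape = ℕ-Ring.solve-∀
  ring : ∀ q p f x y → (q · p) · (f · (x · (x · y))) ≡ q · (p · (f · (y · (x · x))))
  ring = solve-∀ ℚ-ring

excessPoly-cong : ∀ {p q : ℕ → Bool} → (∀ n → p n ≡ q n) → ∀ i d → excessPoly p i d ≡ excessPoly q i d
excessPoly-cong eq zero zero = cong 𝟙 (eq 0)
excessPoly-cong eq zero (suc d) = refl
excessPoly-cong eq (suc i) zero = excessPoly-cong eq i zero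
excessPoly-cong eq (suc i) (suc d) = cong₂ _⊕_ (excessPoly-cong eq i (suc d)) (cong₂ _⊖_ (excessPoly-cong (eq ∘ suc) i d) (excessPoly-cong eq i d))

polyAt-cong : ∀ {p q : ℕ → Bool} → (∀ n → p n ≡ q n) → ∀ r i → polyAt p r i ≡ polyAt q r i
polyAt-cong {p} {q} eq r i = go (excess i r)
  where
  go : ∀ m → at m (excessPoly p i) ≡ at m (excessPoly q i)
  go nothing = refl
  go (just d) = excessPoly-cong eq i d

polyAt-never : ∀ r i → polyAt (λ _ → false) r i ≡ 0ℚ
polyAt-never r i = go (excess i r)
  where
  go : ∀ m → at m (excessPoly (λ _ → false) i) ≡ 0ℚ
  go nothing = refl
  go (just d) = excessPoly-never i d

∑-range1-cut : ∀ a b (f : ℕ → ℚ) → (∀ k → a < k → f k ≡ 0ℚ) → ∑₁ (a + b) f ≡ ∑₁ a f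
∑-range1-cut a zero f eq = cong (λ n → ∑₁ n f) (+-identityʳ a)
∑-range1-cut a (suc b) f eq = begin
  ∑₁ (a + suc b) f ≡⟨ ∑-range1 (a + suc b) f ⟩
  ∑< (a + suc b) (f ∘ suc) ≡⟨ cong (λ n → ∑< n (f ∘ suc)) (+-suc a b) ⟩
  ∑< (suc (a + b)) (f ∘ suc) ≡⟨ ∑-upTo-∷ʳ (a + b) (f ∘ suc) ⟩
  ∑< (a + b) (f ∘ suc) ⊕ f (suc (a + b)) ≡⟨ cong₂ _⊕_ (trans (sym (∑-range1 (a + b) f)) (∑-range1-cut a b f eq)) (eq (suc (a + b)) (s≤s (m≤m+n a b))) ⟩
  ∑₁ a f ⊕ 0ℚ ≡⟨ ⊕-identityʳ (∑₁ a f) ⟩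
  ∑₁ a f ∎

cyclicSum : (p q : ℕ → Bool) → ℕ → ℕ → ℕ → ℕ → ℚ
cyclicSum p q r s N N' = ∑< N (λ i → ∑< N' (λ j → (polyAt p r i · polyAt q s j) · cyclicCoeff i j))

quotient≥1 : ∀ {r q k} → 1 ≤ r → r ≡ q * k → 1 ≤ q
quotient≥1 {q = zero} 1≤r refl = 1≤r
quotient≥1 {q = suc q} _ _ = s≤s z≤n

quotient≤ : ∀ {r q k} .{{_ : NonZero k}} → r ≡ q * k → q ≤ r
quotient≤ {q = q} {k} refl = m≤m*n q k

-- Divisors of r do not exceed r, so k runs only up to r, as in the stated formulas. The ranges of i
-- and j stay 0, ..., r and 0, ..., s for every k, again as stated; the terms beyond r/k and s/k are
-- 0.
rotationTotal-expand : ∀ p q r s → 1 ≤ r → 1 ≤ s → rotationTotal p q r s ≡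
  ∑₁ r (λ k → φ/ k · (𝟙 (does (k ∣? r)) · (𝟙 (does (k ∣? s)) · cyclicSum (p ∘ (k *_)) (q ∘ (k *_)) (r /ℕ k) (s /ℕ k) (suc r) (suc s))))
rotationTotal-expand p q r s 1≤r 1≤s = trans (∑-cong (range1 (r + s)) (λ {k} k∈ → cong (φ/ k ·_) (inner k (proj₁ (range1⇒≤ k∈)) (k ∣? r) (k ∣? s))))
    (∑-range1-cut r s (λ k → φ/ k · (𝟙 (does (k ∣? r)) · (𝟙 (does (k ∣? s)) · cyc k))) (λ k r<k → large k r<k (k ∣? r)))
  where
  n = r + s
  cyc : ℕ → ℚ
  cyc k = cyclicSum (p ∘ (k *_)) (q ∘ (k *_)) (r /ℕ k) (s /ℕ k) (suc r) (suc s)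
  wc : ℕ → ℕ → ℚ
  wc k g = wordCount (p ∘ (k *_)) (q ∘ (k *_)) (r /ℕ k) (s /ℕ k) g
  large : ∀ k → r < k → (d : Dec (k ∣ r)) → φ/ k · (𝟙 (does d) · (𝟙 (does (k ∣? s)) · cyc k)) ≡ 0ℚ
  large k r<k (yes k∣r) = contradiction (∣⇒≤ {{>-nonZero 1≤r}} k∣r) (<⇒≱ r<k)
  large k r<k (no _) = trans (cong (φ/ k ·_) (·-zeroˡ (𝟙 (does (k ∣? s)) · cyc k))) (·-zeroʳ (φ/ k))
  pull : ∀ a b c x → c · (a · (b · x)) ≡ (a · b) · (c · x)
  pull = solve-∀ ℚ-ring
  main : ∀ k → 1 ≤ k → ∀ r' s' → r ≡ r' * k → s ≡ s' * k → ∑₁ n (λ g → 1/ g · wc k g) ≡ cyc k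
  main k 1≤k r' s' er es = go (r /ℕ k) (s /ℕ k) r/k s/k
    where
    instance
      k≢0 : NonZero k
      k≢0 = >-nonZero 1≤k
    r/k : r /ℕ k ≡ r'
    r/k = trans (cong (_/ℕ k) er) (/ℕ-* r' k)
    s/k : s /ℕ k ≡ s'
    s/k = trans (cong (_/ℕ k) es) (/ℕ-* s' k)
    go : ∀ a b → a ≡ r' → b ≡ s' → ∑₁ n (λ g → 1/ g · wordCount (p ∘ (k *_)) (q ∘ (k *_)) a b g) ≡ cyclicSum (p ∘ (k *_)) (q ∘ (k *_)) a b (suc r) (suc s)
    go zero b ea eb = contradiction (quotient≥1 {r} {r'} {k} 1≤r er) (subst (λ z → ¬ (1 ≤ z)) ea (λ ()))
    go (suc a) zero ea eb = contradiction (quotient≥1 {s} {s'} {k} 1≤s es) (subst (λ z → ¬ (1 ≤ z)) eb (λ ()))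
    go (suc a) (suc b) ea eb = ∑-wordCount/L (p ∘ (k *_)) (q ∘ (k *_)) a b n (suc r) (suc s) (+-mono-≤ a≤ b≤) (s≤s a≤) (s≤s b≤)
      where
      a≤ : suc a ≤ r
      a≤ = ≤-trans (≤-reflexive ea) (quotient≤ er)
      b≤ : suc b ≤ s
      b≤ = ≤-trans (≤-reflexive eb) (quotient≤ es)
  factor : ∀ k (a b : ℚ) → ∑₁ n (λ g → 1/ g · (a · (b · wc k g))) ≡ (a · b) · ∑₁ n (λ g → 1/ g · wc k g)
  factor k a b = trans (∑-ext (range1 n) (λ g → pull a b (1/ g) (wc k g))) (∑-*ˡ (range1 n) (a · b) (λ g → 1/ g · wc k g))
  inner : ∀ k → 1 ≤ k → (dr : Dec (k ∣ r)) (ds : Dec (k ∣ s)) →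
    ∑₁ n (λ g → 1/ g · (𝟙 (does dr) · (𝟙 (does ds) · wc k g))) ≡ 𝟙 (does dr) · (𝟙 (does ds) · cyc k)
  inner k 1≤k (no _) ds = trans (factor k 0ℚ (𝟙 (does ds))) (ring (𝟙 (does ds)) (∑₁ n (λ g → 1/ g · wc k g)) (cyc k))
    where
    ring : ∀ a x y → (0ℚ · a) · x ≡ 0ℚ · (a · y)
    ring = solve-∀ ℚ-ring
  inner k 1≤k (yes _) (no _) = trans (factor k 1ℚ 0ℚ) (ring (∑₁ n (λ g → 1/ g · wc k g)) (cyc k))
    where
    ring : ∀ x y → (1ℚ · 0ℚ) · x ≡ 1ℚ · (0ℚ · y)
    ring = solve-∀ ℚ-ring
  inner k 1≤k (yes (divides r' er)) (yes (divides s' es)) = trans (factor k 1ℚ 1ℚ) (trans (cong ((1ℚ · 1ℚ) ·_) (main k 1≤k r' s' er es)) (·-assoc 1ℚ 1ℚ (cyc k)))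

nz-cong : ∀ m {x y} → (NonZero m → x ≡ y) → nz m x ≡ nz m y
nz-cong zero eq = refl
nz-cong (suc m) eq = eq _

nz-*ˡ : ∀ m c x → c · nz m x ≡ nz m (c · x)
nz-*ˡ zero c x = ·-zeroʳ c
nz-*ˡ (suc m) c x = refl

ΣIJ≡∑ : ∀ a b f → ΣIJ a b f ≡ ∑< (suc a) (λ i → ∑< (suc b) (λ j → nz (i + j) (f i j)))
ΣIJ≡∑ a b f = trans (ΣQ≡∑ (range0 a) (λ i → ΣQ (range0 b) (λ j → nz (i + j) (f i j)))) (∑-ext (upTo (suc a)) (λ i → ΣQ≡∑ (range0 b) (λ j → nz (i + j) (f i j))))

∑∑-*ˡ : ∀ N N' c (f : ℕ → ℕ → ℚ) → c · ∑< N (λ i → ∑< N' (f i)) ≡ ∑< N (λ i → ∑< N' (λ j → c · f i j))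
∑∑-*ˡ N N' c f = trans (sym (∑-*ˡ (upTo N) c (λ i → ∑< N' (f i)))) (∑-ext (upTo N) (λ i → sym (∑-*ˡ (upTo N') c (f i))))

∑∑-ext : ∀ N N' {f g : ℕ → ℕ → ℚ} → (∀ i j → f i j ≡ g i j) → ∑< N (λ i → ∑< N' (f i)) ≡ ∑< N (λ i → ∑< N' (g i))
∑∑-ext N N' eq = ∑-ext (upTo N) (λ i → ∑-ext (upTo N') (eq i))

equals-scale : ∀ k c .{{_ : NonZero k}} n → equals (c * k) (k * n) ≡ equals c n
equals-scale k c n = iff (k * n ℕ.≟ c * k) (n ℕ.≟ c)
  where
  iff : (a : Dec (k * n ≡ c * k)) (b : Dec (n ≡ c)) → does a ≡ does b
  iff (yes _) (yes _) = refl
  iff (no _) (no _) = refl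
  iff (yes e) (no ne) = contradiction (*-cancelˡ-≡ n c k (trans e (*-comm c k))) ne
  iff (no ne) (yes refl) = contradiction (*-comm k n) ne

equals-∤ : ∀ k c → ¬ (k ∣ c) → ∀ n → equals c (k * n) ≡ false
equals-∤ k c k∤c n = dec-false (k * n ℕ.≟ c) (λ e → k∤c (divides n (trans (sym e) (*-comm k n))))

-- A k-fold repetition has a multiple of k cherries on each side. This is the origin of the
-- conditions that k divides r₂ and s₂.
cyclicSum-∤ˡ : ∀ q k c r s N N' → ¬ (k ∣ c) → cyclicSum (equals c ∘ (k *_)) q r s N N' ≡ 0ℚ
cyclicSum-∤ˡ q k c r s N N' k∤c = ∑-zero (upTo N) (λ {i} _ → ∑-zero (upTo N') (λ {j} _ →
  trans (cong (λ z → (z · polyAt q s j) · cyclicCoeff i j) (trans (polyAt-cong (equals-∤ k c k∤c) r i) (polyAt-never r i))) (ring (polyAt q s j) (cyclicCoeff i j))))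
  where
  ring : ∀ x y → (0ℚ · x) · y ≡ 0ℚ
  ring = solve-∀ ℚ-ring

cyclicSum-∤ʳ : ∀ p k c r s N N' → ¬ (k ∣ c) → cyclicSum p (equals c ∘ (k *_)) r s N N' ≡ 0ℚ
cyclicSum-∤ʳ p k c r s N N' k∤c = ∑-zero (upTo N) (λ {i} _ → ∑-zero (upTo N') (λ {j} _ →
  trans (cong (λ z → (polyAt p r i · z) · cyclicCoeff i j) (trans (polyAt-cong (equals-∤ k c k∤c) s j) (polyAt-never s j))) (ring (polyAt p r i) (cyclicCoeff i j))))
  where
  ring : ∀ x y → (x · 0ℚ) · y ≡ 0ℚ
  ring = solve-∀ ℚ-ring

cherries≤ : ∀ {r₁ r₂ k r' c} .{{_ : NonZero k}} → r₁ + 2 * r₂ ≡ r' * k → r₂ ≡ c * k → c ≤ r'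
cherries≤ {r₁} {r₂} {k} {r'} {c} er refl = *-cancelʳ-≤ c r' k (≤-trans (m≤m+n (c * k) (c * k + 0)) (≤-trans (m≤n+m (2 * (c * k)) r₁) (≤-reflexive er)))

T-product : ∀ r₁ r₂ s₁ s₂ k r' c s' c' .{{_ : NonZero k}} →
  r₁ + 2 * r₂ ≡ r' * k → r₂ ≡ c * k → s₁ + 2 * s₂ ≡ s' * k → s₂ ≡ c' * k → ∀ i j x →
  pm1 ((r' + c) + (s' + c')) · (pm1 (i + j) · x · T (r₁ + 2 * r₂) r₂ k i · T (s₁ + 2 * s₂) s₂ k j) ≡
  (polyAt (equals r₂ ∘ (k *_)) ((r₁ + 2 * r₂) /ℕ k) i · polyAt (equals s₂ ∘ (k *_)) ((s₁ + 2 * s₂) /ℕ k) j) · (x · (centralAt i 0 · centralAt j 0))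
T-product r₁ r₂ s₁ s₂ k r' c s' c' er ec es ec' i j x = begin
  pm1 ((r' + c) + (s' + c')) · (pm1 (i + j) · x · Tr · Ts)
    ≡⟨ cong₂ (λ a b → a · (b · x · Tr · Ts)) (pm1-+ (r' + c) (s' + c')) (pm1-+ i j) ⟩
  (pm1 (r' + c) · pm1 (s' + c')) · ((pm1 i · pm1 j) · x · Tr · Ts)
    ≡⟨ ring (pm1 (r' + c)) (pm1 (s' + c')) (pm1 i) (pm1 j) x Tr Ts ⟩
  (pm1 (r' + c) · (pm1 i · Tr)) · (pm1 (s' + c') · (pm1 j · Ts)) · x
    ≡⟨ cong₂ (λ a b → a · b · x) (side r₁ r₂ r' c er ec i) (side s₁ s₂ s' c' es ec' j) ⟩
  (centralAt i 0 · P) · (centralAt j 0 · Q) · x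
    ≡⟨ ring′ (centralAt i 0) P (centralAt j 0) Q x ⟩
  (P · Q) · (x · (centralAt i 0 · centralAt j 0)) ∎
  where
  Tr = T (r₁ + 2 * r₂) r₂ k i
  Ts = T (s₁ + 2 * s₂) s₂ k j
  P = polyAt (equals r₂ ∘ (k *_)) ((r₁ + 2 * r₂) /ℕ k) i
  Q = polyAt (equals s₂ ∘ (k *_)) ((s₁ + 2 * s₂) /ℕ k) j
  side : ∀ r₁ r₂ r' c → r₁ + 2 * r₂ ≡ r' * k → r₂ ≡ c * k → ∀ i →
    pm1 (r' + c) · (pm1 i · T (r₁ + 2 * r₂) r₂ k i) ≡ centralAt i 0 · polyAt (equals r₂ ∘ (k *_)) ((r₁ + 2 * r₂) /ℕ k) i
  side r₁ r₂ r' c er ec i = trans (T-signed (r₁ + 2 * r₂) r₂ k r' c er ec (cherries≤ {r₁} {r₂} {k} {r'} {c} er ec) i)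
    (cong (centralAt i 0 ·_) (trans (cong (λ z → polyAt (equals c) z i) (sym (trans (cong (_/ℕ k) er) (/ℕ-* r' k))))
      (polyAt-cong (λ n → trans (sym (equals-scale k c n)) (cong (λ z → equals z (k * n)) (sym ec))) ((r₁ + 2 * r₂) /ℕ k) i)))
  ring : ∀ a b s t x u v → (a · b) · ((s · t) · x · u · v) ≡ (a · (s · u)) · (b · (t · v)) · x
  ring = solve-∀ ℚ-ring
  ring′ : ∀ a p b q x → (a · p) · (b · q) · x ≡ (p · q) · (x · (a · b))
  ring′ = solve-∀ ℚ-ring

rotationTotal≡formulaGen : ∀ r₁ r₂ s₁ s₂ → 1 ≤ r₁ + 2 * r₂ → 1 ≤ s₁ + 2 * s₂ →
  rotationTotal (equals r₂) (equals s₂) (r₁ + 2 * r₂) (s₁ + 2 * s₂) ≡ formulaGen r₁ r₂ s₁ s₂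
rotationTotal≡formulaGen r₁ r₂ s₁ s₂ 1≤r 1≤s = sym (begin
  formulaGen r₁ r₂ s₁ s₂
    ≡⟨ ΣQ≡∑ (filter div? (range1 r)) body ⟩
  ∑ (filter div? (range1 r)) body
    ≡⟨ ∑-filter div? (range1 r) body ⟩
  ∑₁ r (λ k → 𝟙 (does (div? k)) · body k)
    ≡⟨ ∑-cong (range1 r) (λ {k} k∈ → term k (proj₁ (range1⇒≤ k∈)) (k ∣? r) (k ∣? r₂) (k ∣? s) (k ∣? s₂)) ⟩
  ∑₁ r (λ k → φ/ k · (𝟙 (does (k ∣? r)) · (𝟙 (does (k ∣? s)) · cyc k)))
    ≡⟨ rotationTotal-expand (equals r₂) (equals s₂) r s 1≤r 1≤s ⟨
  rotationTotal (equals r₂) (equals s₂) r s ∎)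
  where
  r = r₁ + 2 * r₂
  s = s₁ + 2 * s₂
  div? : ∀ k → Dec ((k ∣ r × k ∣ r₂) × (k ∣ s × k ∣ s₂))
  div? k = ((k ∣? r) ×-dec (k ∣? r₂)) ×-dec ((k ∣? s) ×-dec (k ∣? s₂))
  summand : ℕ → ℕ → ℕ → ℚ
  summand k i j = pm1 (i + j) · 1/ (2 * (i + j)) · T r r₂ k i · T s s₂ k j
  body cyc : ℕ → ℚ
  body k = φ/ k · pm1 ((r + r₂ + s + s₂) /ℕ k) · ΣIJ r s (summand k)
  cyc k = cyclicSum (equals r₂ ∘ (k *_)) (equals s₂ ∘ (k *_)) (r /ℕ k) (s /ℕ k) (suc r) (suc s)
  zeros : ∀ x y a b c → c ≡ 0ℚ → 0ℚ · x ≡ y · (a · (b · c))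
  zeros x y a b _ refl = ring x y a b
    where
    ring : ∀ x y a b → 0ℚ · x ≡ y · (a · (b · 0ℚ))
    ring = solve-∀ ℚ-ring
  term : ∀ k → 1 ≤ k → (a : Dec (k ∣ r)) (b : Dec (k ∣ r₂)) (c : Dec (k ∣ s)) (d : Dec (k ∣ s₂)) →
    𝟙 ((does a ∧ does b) ∧ (does c ∧ does d)) · body k ≡ φ/ k · (𝟙 (does a) · (𝟙 (does c) · cyc k))
  term k 1≤k (no _) b c d = ring (body k) (φ/ k) (𝟙 (does c)) (cyc k)
    where
    ring : ∀ x y b c → 0ℚ · x ≡ y · (0ℚ · (b · c))
    ring = solve-∀ ℚ-ring
  term k 1≤k (yes _) (no k∤) c d = zeros (body k) (φ/ k) 1ℚ (𝟙 (does c)) (cyc k) (cyclicSum-∤ˡ (equals s₂ ∘ (k *_)) k r₂ (r /ℕ k) (s /ℕ k) (suc r) (suc s) k∤)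
  term k 1≤k (yes _) (yes _) (no _) d = ring (body k) (φ/ k) 1ℚ (cyc k)
    where
    ring : ∀ x y a c → 0ℚ · x ≡ y · (a · (0ℚ · c))
    ring = solve-∀ ℚ-ring
  term k 1≤k (yes _) (yes _) (yes _) (no k∤) = zeros (body k) (φ/ k) 1ℚ 1ℚ (cyc k) (cyclicSum-∤ʳ (equals r₂ ∘ (k *_)) k s₂ (r /ℕ k) (s /ℕ k) (suc r) (suc s) k∤)
  term k 1≤k (yes (divides r' er)) (yes (divides c ec)) (yes (divides s' es)) (yes (divides c' ec')) = begin
    1ℚ · body k
      ≡⟨ ring (φ/ k) (pm1 ((r + r₂ + s + s₂) /ℕ k)) (ΣIJ r s (summand k)) ⟩
    φ/ k · (1ℚ · (1ℚ · (pm1 ((r + r₂ + s + s₂) /ℕ k) · ΣIJ r s (summand k))))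
      ≡⟨ cong (λ z → φ/ k · (1ℚ · (1ℚ · z))) (trans (cong₂ (λ a b → pm1 a · b) total (ΣIJ≡∑ r s (summand k)))
           (trans (∑∑-*ˡ (suc r) (suc s) (pm1 σ) (λ i j → nz (i + j) (summand k i j))) (∑∑-ext (suc r) (suc s) pointwise))) ⟩
    φ/ k · (1ℚ · (1ℚ · cyc k)) ∎
    where
    instance
      k≢0 : NonZero k
      k≢0 = >-nonZero 1≤k
    σ = (r' + c) + (s' + c')
    ring : ∀ f p x → 1ℚ · (f · p · x) ≡ f · (1ℚ · (1ℚ · (p · x)))
    ring = solve-∀ ℚ-ring
    collect : ∀ a b c d k → a * k + b * k + c * k + d * k ≡ ((a + b) + (c + d)) * k
    collect = ℕ-Ring.solve-∀
    total : (r + r₂ + s + s₂) /ℕ k ≡ σ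
    total = trans (cong (_/ℕ k) (trans (cong₂ _+_ (cong₂ _+_ (cong₂ _+_ er ec) es) ec') (collect r' c s' c' k))) (/ℕ-* σ k)
    pointwise : ∀ i j → pm1 σ · nz (i + j) (summand k i j) ≡
      (polyAt (equals r₂ ∘ (k *_)) (r /ℕ k) i · polyAt (equals s₂ ∘ (k *_)) (s /ℕ k) j) · cyclicCoeff i j
    pointwise i j = trans (nz-*ˡ (i + j) (pm1 σ) (summand k i j)) (trans (nz-cong (i + j) (λ _ → T-product r₁ r₂ s₁ s₂ k r' c s' c' er ec es ec' i j (1/ (2 * (i + j)))))
      (sym (nz-*ˡ (i + j) (polyAt (equals r₂ ∘ (k *_)) (r /ℕ k) i · polyAt (equals s₂ ∘ (k *_)) (s /ℕ k) j) (1/ (2 * (i + j)) · (centralAt i 0 · centralAt j 0)))))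

dihedralTotal≡formulaSym : ∀ r₁ r₂ → 1 ≤ r₁ + 2 * r₂ → let r = r₁ + 2 * r₂ in
  dihedralTotal (equals r₂) r ≡ formulaSym r₁ r₂
dihedralTotal≡formulaSym r₁ r₂ 1≤r = sym (begin
  formulaSym r₁ r₂
    ≡⟨ cong₂ _⊕_ (reflection-term r₁ r₂) (ΣQ≡∑ (filter div? (range1 r)) body) ⟩
  1/ 4 · (2^ r₁ · trinomial r₁ r₂ r₂) ⊕ ∑ (filter div? (range1 r)) body
    ≡⟨ ℚₚ.+-comm (1/ 4 · (2^ r₁ · trinomial r₁ r₂ r₂)) (∑ (filter div? (range1 r)) body) ⟩
  ∑ (filter div? (range1 r)) body ⊕ 1/ 4 · (2^ r₁ · trinomial r₁ r₂ r₂)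
    ≡⟨ cong₂ (λ a b → a ⊕ 1/ 4 · b) rotations (trans (sym (∑-central-equals r₁ r₂)) (sym (∑-2^forestCount (equals r₂) r))) ⟩
  dihedralTotal (equals r₂) r ∎)
  where
  r = r₁ + 2 * r₂
  div? : ∀ k → Dec (k ∣ r × k ∣ r₂)
  div? k = (k ∣? r) ×-dec (k ∣? r₂)
  summand : ℕ → ℕ → ℕ → ℚ
  summand k i j = φ/ k · (pm1 (i + j) · 1/ (4 * (i + j))) · T r r₂ k i · T r r₂ k j
  body cyc : ℕ → ℚ
  body k = ΣIJ r r (summand k)
  cyc k = cyclicSum (equals r₂ ∘ (k *_)) (equals r₂ ∘ (k *_)) (r /ℕ k) (r /ℕ k) (suc r) (suc r)
  term : ∀ k → 1 ≤ k → (a : Dec (k ∣ r)) (b : Dec (k ∣ r₂)) →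
    𝟙 (does a ∧ does b) · body k ≡ half · (φ/ k · (𝟙 (does a) · (𝟙 (does a) · cyc k)))
  term k 1≤k (no _) b = ring half (body k) (φ/ k) (cyc k)
    where
    ring : ∀ h x y c → 0ℚ · x ≡ h · (y · (0ℚ · (0ℚ · c)))
    ring = solve-∀ ℚ-ring
  term k 1≤k (yes _) (no k∤) = trans (ring half (body k) (φ/ k))
      (cong (λ z → half · (φ/ k · (1ℚ · (1ℚ · z)))) (sym (cyclicSum-∤ˡ (equals r₂ ∘ (k *_)) k r₂ (r /ℕ k) (r /ℕ k) (suc r) (suc r) k∤)))
    where
    ring : ∀ h x y → 0ℚ · x ≡ h · (y · (1ℚ · (1ℚ · 0ℚ)))
    ring = solve-∀ ℚ-ring
  term k 1≤k (yes (divides r' er)) (yes (divides c ec)) = begin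
    1ℚ · body k
      ≡⟨ trans (·-identityˡ (body k)) (ΣIJ≡∑ r r (summand k)) ⟩
    ∑< (suc r) (λ i → ∑< (suc r) (λ j → nz (i + j) (summand k i j)))
      ≡⟨ ∑∑-ext (suc r) (suc r) pointwise ⟩
    ∑< (suc r) (λ i → ∑< (suc r) (λ j → (half · f) · (PQ i j · cyclicCoeff i j)))
      ≡⟨ ∑∑-*ˡ (suc r) (suc r) (half · f) (λ i j → PQ i j · cyclicCoeff i j) ⟨
    (half · f) · cyc k
      ≡⟨ ring half f (cyc k) ⟩
    half · (f · (1ℚ · (1ℚ · cyc k))) ∎
    where
    instance
      k≢0 : NonZero k
      k≢0 = >-nonZero 1≤k
    f = φ/ k
    PQ : ℕ → ℕ → ℚ
    PQ i j = polyAt (equals r₂ ∘ (k *_)) (r /ℕ k) i · polyAt (equals r₂ ∘ (k *_)) (r /ℕ k) j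
    ring : ∀ h f x → (h · f) · x ≡ h · (f · (1ℚ · (1ℚ · x)))
    ring = solve-∀ ℚ-ring
    -- Equal parameters make the exponent of the overall sign even, which is why the symmetric
    -- formula shows no such sign.
    σ = (r' + c) + (r' + c)
    quarter : ∀ m .{{_ : NonZero m}} → 1/ (4 * m) ≡ half · 1/ (2 * m)
    quarter m = trans (cong 1/ (*-assoc 2 2 m)) (1/-* 2 (2 * m) {{_}} {{m*n≢0 2 m}})
    exch : ∀ f p h x t u → f · (p · (h · x)) · t · u ≡ (h · f) · (1ℚ · (p · x · t · u))
    exch = solve-∀ ℚ-ring
    value : ∀ i j → NonZero (i + j) → summand k i j ≡ (half · f) · (PQ i j · (1/ (2 * (i + j)) · (centralAt i 0 · centralAt j 0)))
    value i j nzm = begin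
      f · (pm1 (i + j) · 1/ (4 * (i + j))) · T r r₂ k i · T r r₂ k j
        ≡⟨ cong (λ z → f · (pm1 (i + j) · z) · T r r₂ k i · T r r₂ k j) (quarter (i + j) {{nzm}}) ⟩
      f · (pm1 (i + j) · (half · 1/ (2 * (i + j)))) · T r r₂ k i · T r r₂ k j
        ≡⟨ exch f (pm1 (i + j)) half (1/ (2 * (i + j))) (T r r₂ k i) (T r r₂ k j) ⟩
      (half · f) · (1ℚ · (pm1 (i + j) · 1/ (2 * (i + j)) · T r r₂ k i · T r r₂ k j))
        ≡⟨ cong (λ z → (half · f) · (z · (pm1 (i + j) · 1/ (2 * (i + j)) · T r r₂ k i · T r r₂ k j))) (pm1-double (r' + c)) ⟨
      (half · f) · (pm1 σ · (pm1 (i + j) · 1/ (2 * (i + j)) · T r r₂ k i · T r r₂ k j))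
        ≡⟨ cong ((half · f) ·_) (T-product r₁ r₂ r₁ r₂ k r' c r' c er ec er ec i j (1/ (2 * (i + j)))) ⟩
      (half · f) · (PQ i j · (1/ (2 * (i + j)) · (centralAt i 0 · centralAt j 0))) ∎
    pointwise : ∀ i j → nz (i + j) (summand k i j) ≡ (half · f) · (PQ i j · cyclicCoeff i j)
    pointwise i j = trans (nz-cong (i + j) (value i j)) (trans (sym (nz-*ˡ (i + j) (half · f) (PQ i j · (1/ (2 * (i + j)) · (centralAt i 0 · centralAt j 0)))))
      (cong ((half · f) ·_) (sym (nz-*ˡ (i + j) (PQ i j) (1/ (2 * (i + j)) · (centralAt i 0 · centralAt j 0))))))
  rotations : ∑ (filter div? (range1 r)) body ≡ half · rotationTotal (equals r₂) (equals r₂) r r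
  rotations = trans (∑-filter div? (range1 r) body) (trans (∑-cong (range1 r) (λ {k} k∈ → term k (proj₁ (range1⇒≤ k∈)) (k ∣? r) (k ∣? r₂)))
    (trans (∑-*ˡ (range1 r) half (λ k → φ/ k · (𝟙 (does (k ∣? r)) · (𝟙 (does (k ∣? r)) · cyc k))))
           (cong (half ·_) (sym (rotationTotal-expand (equals r₂) (equals r₂) r r 1≤r 1≤r)))))

-- With x in place of x + y - x² on both sides, only i = r and j = s survive.
cyclicSum-always : ∀ r s N N' → r < N → s < N' → cyclicSum always always r s N N' ≡ cyclicCoeff r s
cyclicSum-always r s N N' r<N s<N' = begin
  ∑< N (λ i → ∑< N' (λ j → (polyAt always r i · polyAt always s j) · cyclicCoeff i j))
    ≡⟨ ∑∑-ext N N' (λ i j → trans (cong₂ (λ a b → (a · b) · cyclicCoeff i j) (polyAt-always r i) (polyAt-always s j)) (ring (δ ℕ._≟_ i r) (δ ℕ._≟_ j s) (cyclicCoeff i j))) ⟩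
  ∑< N (λ i → ∑< N' (λ j → δ ℕ._≟_ j s · (δ ℕ._≟_ i r · cyclicCoeff i j)))
    ≡⟨ ∑-ext (upTo N) (λ i → ∑-δ ℕ._≟_ s (λ j → δ ℕ._≟_ i r · cyclicCoeff i j) (Uniqueₚ.upTo⁺ N') (∈-upTo⁺ s<N')) ⟩
  ∑< N (λ i → δ ℕ._≟_ i r · cyclicCoeff i s)
    ≡⟨ ∑-δ ℕ._≟_ r (λ i → cyclicCoeff i s) (Uniqueₚ.upTo⁺ N) (∈-upTo⁺ r<N) ⟩
  cyclicCoeff r s ∎
  where
  ring : ∀ a b c → (a · b) · c ≡ b · (a · c)
  ring = solve-∀ ℚ-ring

always-term : ∀ k r s → 1 ≤ k → 1 ≤ r → k ∣ r → k ∣ s →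
  φ/ k · cyclicSum always always (r /ℕ k) (s /ℕ k) (suc r) (suc s) ≡
  half · (frac (ℤ.+ φ k) (r + s) · fromℕ ((((2 * r) /ℕ k) C (r /ℕ k)) * (((2 * s) /ℕ k) C (s /ℕ k))))
always-term k r s 1≤k 1≤r (divides r' er) (divides s' es) = begin
  φ/ k · cyclicSum always always (r /ℕ k) (s /ℕ k) (suc r) (suc s)
    ≡⟨ cong₂ (λ a b → φ/ k · cyclicSum always always a b (suc r) (suc s)) r/k s/k ⟩
  φ/ k · cyclicSum always always r' s' (suc r) (suc s)
    ≡⟨ cong₂ _·_ (frac≡*1/ (φ k) k) (trans (cyclicSum-always r' s' (suc r) (suc s) (s≤s (quotient≤ er)) (s≤s (quotient≤ es))) (nz-elim (r' + s') m≢0)) ⟩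
  (F · 1/ k) · (1/ (2 * (r' + s')) · (centralAt r' 0 · centralAt s' 0))
    ≡⟨ cong (λ z → (F · 1/ k) · (z · (centralAt r' 0 · centralAt s' 0))) (1/-* 2 (r' + s') {{_}} {{m≢0}}) ⟩
  (F · 1/ k) · ((half · 1/ (r' + s')) · (centralAt r' 0 · centralAt s' 0))
    ≡⟨ ring F (1/ k) half (1/ (r' + s')) (centralAt r' 0) (centralAt s' 0) ⟩
  half · ((F · (1/ (r' + s') · 1/ k)) · (centralAt r' 0 · centralAt s' 0))
    ≡⟨ cong₂ (λ a b → half · ((F · a) · b)) (trans (sym (1/-* (r' + s') k {{m≢0}})) (cong 1/ (trans (*-distribʳ-+ k r' s') (cong₂ _+_ (sym er) (sym es))))) (sym (fromℕ-* ((2 * r') C r') ((2 * s') C s'))) ⟩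
  half · ((F · 1/ (r + s)) · fromℕ (((2 * r') C r') * ((2 * s') C s')))
    ≡⟨ cong₂ (λ a b → half · (a · fromℕ b)) (sym (frac≡*1/ (φ k) (r + s))) (cong₂ _*_ (cong₂ _C_ (sym (2r/k r r' er)) (sym r/k)) (cong₂ _C_ (sym (2r/k s s' es)) (sym s/k))) ⟩
  half · (frac (ℤ.+ φ k) (r + s) · fromℕ ((((2 * r) /ℕ k) C (r /ℕ k)) * (((2 * s) /ℕ k) C (s /ℕ k)))) ∎
  where
  instance
    k≢0 : NonZero k
    k≢0 = >-nonZero 1≤k
  F = fromℕ (φ k)
  m≢0 : NonZero (r' + s')
  m≢0 = >-nonZero (≤-trans (quotient≥1 {r} {r'} {k} 1≤r er) (m≤m+n r' s'))
  nz-elim : ∀ m {x} → NonZero m → nz m x ≡ x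
  nz-elim (suc m) _ = refl
  r/k : r /ℕ k ≡ r'
  r/k = trans (cong (_/ℕ k) er) (/ℕ-* r' k)
  s/k : s /ℕ k ≡ s'
  s/k = trans (cong (_/ℕ k) es) (/ℕ-* s' k)
  2r/k : ∀ r r' → r ≡ r' * k → (2 * r) /ℕ k ≡ 2 * r'
  2r/k _ r' refl = trans (cong (_/ℕ k) (sym (*-assoc 2 r' k))) (/ℕ-* (2 * r') k)
  ring : ∀ f k h m a b → (f · k) · ((h · m) · (a · b)) ≡ h · ((f · (m · k)) · (a · b))
  ring = solve-∀ ℚ-ring

rotationTotal≡aTilde : ∀ r s → 1 ≤ r → 1 ≤ s → rotationTotal always always r s ≡ aTildeNeq r s
rotationTotal≡aTilde r s 1≤r 1≤s = trans (rotationTotal-expand always always r s 1≤r 1≤s) (sym (trans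
    (cong (half ·_) (trans (ΣQ≡∑ (filter div? (range1 r)) body) (∑-filter div? (range1 r) body)))
    (trans (sym (∑-*ˡ (range1 r) half (λ k → 𝟙 (does (div? k)) · body k))) (∑-cong (range1 r) (λ {k} k∈ → term k (proj₁ (range1⇒≤ k∈)) (k ∣? r) (k ∣? s))))))
  where
  div? : ∀ k → Dec (k ∣ r × k ∣ s)
  div? k = (k ∣? r) ×-dec (k ∣? s)
  body cyc : ℕ → ℚ
  body k = frac (ℤ.+ φ k) (r + s) · fromℕ ((((2 * r) /ℕ k) C (r /ℕ k)) * (((2 * s) /ℕ k) C (s /ℕ k)))
  cyc k = cyclicSum always always (r /ℕ k) (s /ℕ k) (suc r) (suc s)
  term : ∀ k → 1 ≤ k → (a : Dec (k ∣ r)) (b : Dec (k ∣ s)) →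
    half · (𝟙 (does a ∧ does b) · body k) ≡ φ/ k · (𝟙 (does a) · (𝟙 (does b) · cyc k))
  term k 1≤k (no _) b = ring half (body k) (φ/ k) (𝟙 (does b)) (cyc k)
    where
    ring : ∀ h x y b c → h · (0ℚ · x) ≡ y · (0ℚ · (b · c))
    ring = solve-∀ ℚ-ring
  term k 1≤k (yes _) (no _) = ring half (body k) (φ/ k) (cyc k)
    where
    ring : ∀ h x y c → h · (0ℚ · x) ≡ y · (1ℚ · (0ℚ · c))
    ring = solve-∀ ℚ-ring
  term k 1≤k (yes k∣r) (yes k∣s) = trans (cong (half ·_) (·-identityˡ (body k))) (trans (sym (always-term k r s 1≤k 1≤r k∣r k∣s))
    (cong (φ/ k ·_) (sym (trans (·-identityˡ (1ℚ · cyc k)) (·-identityˡ (cyc k))))))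

dihedralTotal≡aTilde : ∀ r → 1 ≤ r →
  dihedralTotal always r ≡ aTildeEq r
dihedralTotal≡aTilde r 1≤r = begin
  dihedralTotal always r
    ≡⟨ cong₂ (λ a b → half · a ⊕ 1/ 4 · b) rotations (trans (∑-2^forestCount always r) (∑-central-always r)) ⟩
  half · ∑ (filter div? (range1 r)) body ⊕ 1/ 4 · fromℕ ((2 * r) C r)
    ≡⟨ ring half (∑ (filter div? (range1 r)) body) (fromℕ ((2 * r) C r)) ⟩
  half · (half · fromℕ ((2 * r) C r) ⊕ ∑ (filter div? (range1 r)) body)
    ≡⟨ cong (λ z → half · (half · fromℕ ((2 * r) C r) ⊕ z)) (ΣQ≡∑ (filter div? (range1 r)) body) ⟨
  aTildeEq r ∎
  where
  div? : ∀ k → Dec (k ∣ r)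
  div? k = k ∣? r
  body cyc : ℕ → ℚ
  body k = frac (ℤ.+ φ k) (4 * r) · fromℕ ((((2 * r) /ℕ k) C (r /ℕ k)) ^ 2)
  cyc k = cyclicSum always always (r /ℕ k) (r /ℕ k) (suc r) (suc r)
  ring : ∀ h x y → h · x ⊕ (h · h) · y ≡ h · (h · y ⊕ x)
  ring = solve-∀ ℚ-ring
  ring′ : ∀ h a b c → h · ((a · b) · c) ≡ (a · (h · b)) · c
  ring′ = solve-∀ ℚ-ring
  fourth : ∀ k → 1 ≤ k → k ∣ r → φ/ k · cyc k ≡ body k
  fourth k 1≤k k∣r = trans (always-term k r r 1≤k 1≤r k∣r k∣r) (trans (cong₂ (λ a b → half · (a · fromℕ b)) (frac≡*1/ (φ k) (r + r)) (cong (c *_) (sym (*-identityʳ c))))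
    (trans (ring′ half (fromℕ (φ k)) (1/ (r + r)) (fromℕ (c ^ 2))) (cong (_· fromℕ (c ^ 2)) (trans (cong (fromℕ (φ k) ·_) (trans (sym (1/-* 2 (r + r) {{_}} {{>-nonZero (≤-trans 1≤r (m≤m+n r r))}})) (cong 1/ (shape r)))) (sym (frac≡*1/ (φ k) (4 * r)))))))
    where
    c = ((2 * r) /ℕ k) C (r /ℕ k)
    shape : ∀ r → 2 * (r + r) ≡ 4 * r
    shape = ℕ-Ring.solve-∀
  term : ∀ k → 1 ≤ k → (a : Dec (k ∣ r)) → φ/ k · (𝟙 (does a) · (𝟙 (does a) · cyc k)) ≡ 𝟙 (does a) · body k
  term k 1≤k (no _) = zeros (φ/ k) (cyc k) (body k)
    where
    zeros : ∀ f c b → f · (0ℚ · (0ℚ · c)) ≡ 0ℚ · b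
    zeros = solve-∀ ℚ-ring
  term k 1≤k (yes k∣r) = trans (cong (φ/ k ·_) (trans (·-identityˡ (1ℚ · cyc k)) (·-identityˡ (cyc k)))) (trans (fourth k 1≤k k∣r) (sym (·-identityˡ (body k))))
  rotations : rotationTotal always always r r ≡ ∑ (filter div? (range1 r)) body
  rotations = trans (rotationTotal-expand always always r r 1≤r 1≤r) (trans (∑-cong (range1 r) (λ {k} k∈ → term k (proj₁ (range1⇒≤ k∈)) (k ∣? r))) (sym (∑-filter div? (range1 r) body)))

-- Drawings and their matrices

-- Drawings: a cyclic word with its vertices named. The bead (x , b , t) is the cycle vertex x followed by a base
-- arrow of orientation b carrying the tree t. Every node of a tree and every base arrow is a triangle, of which
-- the sides labelled by leaves are missing; the quiver is the sum of the oriented triangles.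
Bead : Set → Set
Bead X = X × Bool × Tree X

Drawing : Set → Set
Drawing X = List (Bead X)

Triangle : Set → Set
Triangle X = Maybe X × Maybe X × Maybe X

module _ {X : Set} where

  top : Tree X → Maybe X
  top leaf = nothing
  top (node z _ _) = just z

  cells : Tree X → List (Triangle X)
  cells leaf = []
  cells (node z l r) = (just z , top l , top r) ∷ cells l ++ cells r

  baseCell : X → X → Bool → Tree X → Triangle X
  baseCell x y true t = just x , just y , top t
  baseCell x y false t = just y , just x , top t

  -- The default closes the cycle: the last bead is followed by the vertex at which the cycle
  -- started.
  next : Drawing X → X → X
  next [] y = y
  next ((x , _) ∷ _) y = x

  path : Drawing X → X → List (Triangle X)
  path [] y = []
  path ((x , b , t) ∷ D) y = baseCell x (next D y) b t ∷ cells t ++ path D y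

  triangles : Drawing X → List (Triangle X)
  triangles [] = []
  triangles D@((x , _) ∷ _) = path D x

  names : Tree X → List X
  names leaf = []
  names (node z l r) = z ∷ names l ++ names r

  labels : Drawing X → List X
  labels [] = []
  labels ((x , b , t) ∷ D) = x ∷ names t ++ labels D

  orientations : Drawing X → List Bool
  orientations = map (λ (_ , b , _) → b)

mapTree : ∀ {X Y : Set} → (X → Y) → Tree X → Tree Y
mapTree f leaf = leaf
mapTree f (node z l r) = node (f z) (mapTree f l) (mapTree f r)

treeShape : ∀ {X} → Tree X → Shape
treeShape = mapTree (λ _ → tt)

shape : ∀ {X} → Drawing X → Word
shape = map (λ (_ , b , t) → b , treeShape t)

module _ {n : ℕ} where

  private
    Vert = Fin n

  indicator : Maybe Vert → Vert → ℤ
  indicator nothing y = ℤ.+ 0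
  indicator (just x) y = if does (x Fin.≟ y) then ℤ.+ 1 else ℤ.+ 0

  -- The matrix of an arrow from a to b as an exterior product of basis vectors. A missing side is
  -- the zero vector, so boundary segments need no separate treatment.
  wedge : Maybe Vert → Maybe Vert → Vert → Vert → ℤ
  wedge a b x y = indicator a x ⊠ indicator b y ⊟ indicator b x ⊠ indicator a y

  cellForm : Triangle Vert → Vert → Vert → ℤ
  cellForm (a , b , c) x y = wedge a b x y ⊞ (wedge b c x y ⊞ wedge c a x y)

  form : List (Triangle Vert) → Mat n
  form [] x y = ℤ.+ 0
  form (t ∷ ts) x y = cellForm t x y ⊞ form ts x y

  ⟦_⟧ : Drawing Vert → Mat n
  ⟦ D ⟧ = form (triangles D)

  form-++ : ∀ ts us x y → form (ts ++ us) x y ≡ form ts x y ⊞ form us x y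
  form-++ [] us x y = sym (ℤₚ.+-identityˡ (form us x y))
  form-++ (t ∷ ts) us x y = trans (cong (λ f → cellForm t x y ⊞ f) (form-++ ts us x y)) (sym (ℤₚ.+-assoc (cellForm t x y) (form ts x y) (form us x y)))

  form-↭ : ∀ {ts us} → ts ↭ us → ∀ x y → form ts x y ≡ form us x y
  form-↭ Perm.refl x y = refl
  form-↭ (Perm.prep t p) x y = cong (λ f → cellForm t x y ⊞ f) (form-↭ p x y)
  form-↭ {_ ∷ _ ∷ ts} {_ ∷ _ ∷ us} (Perm.swap t u p) x y = trans (cong (λ f → cellForm t x y ⊞ (cellForm u x y ⊞ f)) (form-↭ p x y)) (exch (cellForm t x y) (cellForm u x y) (form us x y))
    where
    exch : ∀ a b c → a ⊞ (b ⊞ c) ≡ b ⊞ (a ⊞ c)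
    exch = ℤ-Ring.solve-∀
  form-↭ (Perm.trans p q) x y = trans (form-↭ p x y) (form-↭ q x y)

  indicator-refl : ∀ x → indicator (just x) x ≡ ℤ.+ 1
  indicator-refl x = cong (λ b → if b then ℤ.+ 1 else ℤ.+ 0) (dec-true (x Fin.≟ x) refl)

  indicator-≢ : ∀ {a y} → a ≢ just y → indicator a y ≡ ℤ.+ 0
  indicator-≢ {nothing} {y} _ = refl
  indicator-≢ {just x} {y} ne = cong (λ b → if b then ℤ.+ 1 else ℤ.+ 0) (dec-false (x Fin.≟ y) (ne ∘ cong just))

  Avoids : Vert → Triangle Vert → Set
  Avoids v (a , b , c) = a ≢ just v × b ≢ just v × c ≢ just v

  wedge-avoidˡ : ∀ {a b v} → a ≢ just v → b ≢ just v → ∀ y → wedge a b v y ≡ ℤ.+ 0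
  wedge-avoidˡ {a} {b} {v} a≢ b≢ y = trans (cong₂ (λ p q → p ⊠ indicator b y ⊟ q ⊠ indicator a y) (indicator-≢ {a} a≢) (indicator-≢ {b} b≢)) (ring (indicator b y) (indicator a y))
    where
    ring : ∀ p q → ℤ.+ 0 ⊠ p ⊟ ℤ.+ 0 ⊠ q ≡ ℤ.+ 0
    ring = ℤ-Ring.solve-∀

  cellForm-skew : ∀ t x y → cellForm t x y ≡ ℤ.- cellForm t y x
  cellForm-skew (a , b , c) x y = ring (indicator a x) (indicator b x) (indicator c x) (indicator a y) (indicator b y) (indicator c y)
    where
    ring : ∀ a b c a' b' c' → (a ⊠ b' ⊟ b ⊠ a') ⊞ ((b ⊠ c' ⊟ c ⊠ b') ⊞ (c ⊠ a' ⊟ a ⊠ c')) ≡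
      ℤ.- ((a' ⊠ b ⊟ b' ⊠ a) ⊞ ((b' ⊠ c ⊟ c' ⊠ b) ⊞ (c' ⊠ a ⊟ a' ⊠ c)))
    ring = ℤ-Ring.solve-∀

  form-skew : ∀ ts x y → form ts x y ≡ ℤ.- form ts y x
  form-skew [] x y = refl
  form-skew (t ∷ ts) x y = trans (cong₂ _⊞_ (cellForm-skew t x y) (form-skew ts x y)) (sym (ℤₚ.neg-distrib-+ (cellForm t y x) (form ts y x)))

  form-avoid : ∀ {v ts} → All (Avoids v) ts → ∀ y → form ts v y ≡ ℤ.+ 0
  form-avoid [] y = refl
  form-avoid {v} {(a , b , c) ∷ ts} ((a≢ , b≢ , c≢) ∷ avoid) y =
    cong₂ _⊞_ (cong₂ _⊞_ (wedge-avoidˡ {a} {b} a≢ b≢ y) (cong₂ _⊞_ (wedge-avoidˡ {b} {c} b≢ c≢ y) (wedge-avoidˡ {c} {a} c≢ a≢ y))) (form-avoid avoid y)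

  cellForm-rotate : ∀ a b c x y → cellForm (a , b , c) x y ≡ cellForm (b , c , a) x y
  cellForm-rotate a b c x y = ring (wedge a b x y) (wedge b c x y) (wedge c a x y)
    where
    ring : ∀ a b c → a ⊞ (b ⊞ c) ≡ b ⊞ (c ⊞ a)
    ring = ℤ-Ring.solve-∀

  cellForm-at : ∀ v p q y → p ≢ just v → q ≢ just v → cellForm (just v , p , q) v y ≡ indicator p y ⊟ indicator q y
  cellForm-at v p q y p≢ q≢ = trans (cong₂ (λ s t → (i (just v) v ⊠ i p y ⊟ s ⊠ i (just v) y) ⊞ ((s ⊠ i q y ⊟ t ⊠ i p y) ⊞ (t ⊠ i (just v) y ⊟ i (just v) v ⊠ i q y))) (indicator-≢ {p} p≢) (indicator-≢ {q} q≢))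
    (trans (cong (λ u → (u ⊠ i p y ⊟ ℤ.+ 0 ⊠ i (just v) y) ⊞ ((ℤ.+ 0 ⊠ i q y ⊟ ℤ.+ 0 ⊠ i p y) ⊞ (ℤ.+ 0 ⊠ i (just v) y ⊟ u ⊠ i q y))) (indicator-refl v)) (ring (i p y) (i q y) (i (just v) y)))
    where
    i = indicator
    ring : ∀ p q w → (ℤ.+ 1 ⊠ p ⊟ ℤ.+ 0 ⊠ w) ⊞ ((ℤ.+ 0 ⊠ q ⊟ ℤ.+ 0 ⊠ p) ⊞ (ℤ.+ 0 ⊠ w ⊟ ℤ.+ 1 ⊠ q)) ≡ p ⊟ q
    ring = ℤ-Ring.solve-∀

  -- Not the same vertex; two missing sides are compatible.
  _#_ : Maybe Vert → Maybe Vert → Set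
  a # b = ∀ {z} → a ≡ just z → b ≢ just z

  -- v is a diagonal of the quadrilateral a b c d: it lies in the triangles v a b and v c d of F and nowhere else.
  record DiagonalFlip (v : Vert) (F F' : Mat n) : Set where
    field
      a b c d : Maybe Vert
      rest : Mat n
      before : ∀ x y → F x y ≡ (cellForm (just v , a , b) x y ⊞ cellForm (just v , c , d) x y) ⊞ rest x y
      after : ∀ x y → F' x y ≡ (cellForm (just v , b , c) x y ⊞ cellForm (just v , d , a) x y) ⊞ rest x y
      restˡ : ∀ y → rest v y ≡ ℤ.+ 0
      restʳ : ∀ x → rest x v ≡ ℤ.+ 0
      a≢v : a ≢ just v
      b≢v : b ≢ just v
      c≢v : c ≢ just v
      d≢v : d ≢ just v
      a#b : a # b
      a#d : a # d
      c#b : c # b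
      c#d : c # d

  flip-add : ∀ {v F F'} → DiagonalFlip v F F' → ∀ (H : Mat n) → (∀ y → H v y ≡ ℤ.+ 0) → (∀ x → H x v ≡ ℤ.+ 0) → ∀ {G G' : Mat n} →
    (∀ x y → G x y ≡ F x y ⊞ H x y) → (∀ x y → G' x y ≡ F' x y ⊞ H x y) → DiagonalFlip v G G'
  flip-add {v} {F} {F'} fl H Hˡ Hʳ eq eq' = record
    { a = a ; b = b ; c = c ; d = d
    ; a≢v = a≢v ; b≢v = b≢v ; c≢v = c≢v ; d≢v = d≢v ; a#b = a#b ; a#d = a#d ; c#b = c#b ; c#d = c#d
    ; rest = λ x y → rest x y ⊞ H x y
    ; before = λ x y → trans (eq x y) (trans (cong (_⊞ H x y) (before x y)) (ℤₚ.+-assoc (cellForm (just v , a , b) x y ⊞ cellForm (just v , c , d) x y) (rest x y) (H x y)))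
    ; after = λ x y → trans (eq' x y) (trans (cong (_⊞ H x y) (after x y)) (ℤₚ.+-assoc (cellForm (just v , b , c) x y ⊞ cellForm (just v , d , a) x y) (rest x y) (H x y)))
    ; restˡ = λ y → cong₂ _⊞_ (restˡ y) (Hˡ y)
    ; restʳ = λ x → cong₂ _⊞_ (restʳ x) (Hʳ x)
    }
    where open DiagonalFlip fl

  private
    ind : Maybe Vert → Vert → ℕ
    ind nothing y = 0
    ind (just x) y = if does (x Fin.≟ y) then 1 else 0

    indicator≡ : ∀ a y → indicator a y ≡ ℤ.+ ind a y
    indicator≡ nothing y = refl
    indicator≡ (just x) y with does (x Fin.≟ y)
    ... | true = refl
    ... | false = refl

    ind-# : ∀ {a b} → a # b → ∀ y → ind a y ≡ 0 ⊎ ind b y ≡ 0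
    ind-# {nothing} {b} _ y = inj₁ refl
    ind-# {just x} {nothing} _ y = inj₂ refl
    ind-# {just x} {just x'} x#x' y with x Fin.≟ y | x' Fin.≟ y
    ... | yes refl | yes refl = contradiction refl (x#x' refl)
    ... | no _ | _ = inj₁ refl
    ... | yes _ | no _ = inj₂ refl

    exclusive : ∀ {p q s t} → p ≡ 0 ⊎ q ≡ 0 → p ≡ 0 ⊎ t ≡ 0 → s ≡ 0 ⊎ q ≡ 0 → s ≡ 0 ⊎ t ≡ 0 → p + s ≡ 0 ⊎ q + t ≡ 0
    exclusive (inj₁ refl) _ (inj₁ refl) _ = inj₁ refl
    exclusive (inj₁ refl) _ (inj₂ refl) (inj₁ refl) = inj₁ refl
    exclusive (inj₁ refl) _ (inj₂ refl) (inj₂ refl) = inj₂ refl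
    exclusive (inj₂ refl) (inj₂ refl) _ _ = inj₂ refl
    exclusive (inj₂ refl) (inj₁ refl) _ (inj₁ refl) = inj₁ refl
    exclusive (inj₂ refl) (inj₁ refl) _ (inj₂ refl) = inj₂ refl

    -- One of α and β is 0, and one of α' and β', so the two differences record arrows of a definite
    -- direction. On such differences the sign condition in `mutEntry` amounts to a bilinear
    -- expression.
    mutEntry-diff : ∀ α β α' β' → α ≡ 0 ⊎ β ≡ 0 → α' ≡ 0 ⊎ β' ≡ 0 →
      mutEntry (ℤ.+ β ⊟ ℤ.+ α) (ℤ.+ α' ⊟ ℤ.+ β') ≡ ℤ.+ β ⊠ ℤ.+ α' ⊟ ℤ.+ α ⊠ ℤ.+ β'
    mutEntry-diff zero zero α' β' _ _ = zero-left (ℤ.+ α' ⊟ ℤ.+ β')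
      where
      zero-left : ∀ z → mutEntry (ℤ.+ 0) z ≡ ℤ.+ 0
      zero-left (ℤ.+ _) = refl
      zero-left ℤ.-[1+ _ ] = refl
    mutEntry-diff zero (suc β) zero zero _ _ = trans (cong (λ m → mutEntry (ℤ.+ m) (ℤ.+ 0)) (+-identityʳ (suc β))) (sym (trans (cong (_⊟ ℤ.+ 0) (ℤₚ.*-zeroʳ (ℤ.+ suc β))) refl))
    mutEntry-diff zero (suc β) (suc α') zero _ _ = trans (cong₂ (λ m k → mutEntry (ℤ.+ m) (ℤ.+ k)) (+-identityʳ (suc β)) (+-identityʳ (suc α'))) (trans (ℤₚ.pos-* (suc β) (suc α')) (sym (ℤₚ.+-identityʳ (ℤ.+ suc β ⊠ ℤ.+ suc α'))))
    mutEntry-diff zero (suc β) zero (suc β') _ _ = trans (cong (λ m → mutEntry (ℤ.+ m) ℤ.-[1+ β' ]) (+-identityʳ (suc β))) (sym (cong (_⊟ ℤ.+ 0) (ℤₚ.*-zeroʳ (ℤ.+ suc β))))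
    mutEntry-diff zero (suc β) (suc α') (suc β') _ (inj₁ ())
    mutEntry-diff zero (suc β) (suc α') (suc β') _ (inj₂ ())
    mutEntry-diff (suc α) zero zero zero _ _ = sym (cong (λ z → ℤ.+ 0 ⊟ z) (ℤₚ.*-zeroʳ (ℤ.+ suc α)))
    mutEntry-diff (suc α) zero (suc α') zero _ _ = sym (cong (λ z → ℤ.+ 0 ⊟ z) (ℤₚ.*-zeroʳ (ℤ.+ suc α)))
    mutEntry-diff (suc α) zero zero (suc β') _ _ = trans (cong ℤ.-_ (ℤₚ.pos-* (suc α) (suc β'))) (sym (ℤₚ.+-identityˡ (ℤ.- (ℤ.+ suc α ⊠ ℤ.+ suc β'))))
    mutEntry-diff (suc α) zero (suc α') (suc β') _ (inj₁ ())
    mutEntry-diff (suc α) zero (suc α') (suc β') _ (inj₂ ())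
    mutEntry-diff (suc α) (suc β) _ _ (inj₁ ()) _
    mutEntry-diff (suc α) (suc β) _ _ (inj₂ ()) _

  μ-≢ : ∀ {v : Vert} {B x y} → x ≢ v → y ≢ v → μ v B x y ≡ B x y ⊞ mutEntry (B x v) (B v y)
  μ-≢ {v} {B} {x} {y} x≢ y≢ with x Fin.≟ v | y Fin.≟ v
  ... | yes e | _ = contradiction e x≢
  ... | no _ | yes e = contradiction e y≢
  ... | no _ | no _ = refl

  μ-≡ˡ : ∀ {v : Vert} {B y} → μ v B v y ≡ ℤ.- B v y
  μ-≡ˡ {v} {B} {y} with v Fin.≟ v | y Fin.≟ v
  ... | yes _ | _ = refl
  ... | no ne | _ = contradiction refl ne

  μ-≡ʳ : ∀ {v : Vert} {B x} → μ v B x v ≡ ℤ.- B x v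
  μ-≡ʳ {v} {B} {x} with x Fin.≟ v | v Fin.≟ v
  ... | _ | no ne = contradiction refl ne
  ... | yes _ | yes _ = refl
  ... | no _ | yes _ = refl

  -- The arrows at v lead to a and c and come from b and d. Since a, c are distinct from b, d, no
  -- arrows at v cancel, and mutation adds exactly the four composites through v: two of them cancel
  -- the old sides a b and c d, the others are the new sides b c and d a. Coincidences a = c or b =
  -- d are permitted and stand for double arrows.
  flip⇒μ : ∀ {v F F'} → DiagonalFlip v F F' → ∀ x y → F' x y ≡ μ v F x y
  flip⇒μ {v} {F} {F'} fl x y = cases (x Fin.≟ v) (y Fin.≟ v)
    where
    open DiagonalFlip fl
    i : Maybe Vert → Vert → ℤ
    i = indicator
    atˡ = cellForm-at v
    atʳ : ∀ p q x → p ≢ just v → q ≢ just v → cellForm (just v , p , q) x v ≡ i q x ⊟ i p x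
    atʳ p q x p≢ q≢ = trans (cellForm-skew (just v , p , q) x v) (trans (cong ℤ.-_ (atˡ p q x p≢ q≢)) (neg (i p x) (i q x)))
      where
      neg : ∀ p q → ℤ.- (p ⊟ q) ≡ q ⊟ p
      neg = ℤ-Ring.solve-∀
    Fˡ : ∀ y → F v y ≡ (i a y ⊟ i b y) ⊞ (i c y ⊟ i d y)
    Fˡ y = trans (before v y) (trans (cong₂ _⊞_ (cong₂ _⊞_ (atˡ a b y a≢v b≢v) (atˡ c d y c≢v d≢v)) (restˡ y)) (ℤₚ.+-identityʳ _))
    Fʳ : ∀ x → F x v ≡ (i b x ⊟ i a x) ⊞ (i d x ⊟ i c x)
    Fʳ x = trans (before x v) (trans (cong₂ _⊞_ (cong₂ _⊞_ (atʳ a b x a≢v b≢v) (atʳ c d x c≢v d≢v)) (restʳ x)) (ℤₚ.+-identityʳ _))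
    F'ˡ : ∀ y → F' v y ≡ (i b y ⊟ i c y) ⊞ (i d y ⊟ i a y)
    F'ˡ y = trans (after v y) (trans (cong₂ _⊞_ (cong₂ _⊞_ (atˡ b c y b≢v c≢v) (atˡ d a y d≢v a≢v)) (restˡ y)) (ℤₚ.+-identityʳ _))
    F'ʳ : ∀ x → F' x v ≡ (i c x ⊟ i b x) ⊞ (i a x ⊟ i d x)
    F'ʳ x = trans (after x v) (trans (cong₂ _⊞_ (cong₂ _⊞_ (atʳ b c x b≢v c≢v) (atʳ d a x d≢v a≢v)) (restʳ x)) (ℤₚ.+-identityʳ _))
    negˡ : ∀ a b c d → (b ⊟ c) ⊞ (d ⊟ a) ≡ ℤ.- ((a ⊟ b) ⊞ (c ⊟ d))
    negˡ = ℤ-Ring.solve-∀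
    negʳ : ∀ a b c d → (c ⊟ b) ⊞ (a ⊟ d) ≡ ℤ.- ((b ⊟ a) ⊞ (d ⊟ c))
    negʳ = ℤ-Ring.solve-∀
    -- Away from v the triangle v p q contributes only its side p q
    far : ∀ p q {x y} → x ≢ v → y ≢ v → cellForm (just v , p , q) x y ≡ wedge p q x y
    far p q {x} {y} x≢ y≢ = trans (cong₂ (λ s t → (s ⊠ i p y ⊟ i p x ⊠ t) ⊞ (wedge p q x y ⊞ (i q x ⊠ t ⊟ s ⊠ i q y))) (indicator-≢ {just v} (x≢ ∘ sym ∘ just-injective)) (indicator-≢ {just v} (y≢ ∘ sym ∘ just-injective)))
      (ring (i p x) (i p y) (i q x) (i q y) (wedge p q x y))
      where
      ring : ∀ p p' q q' w → (ℤ.+ 0 ⊠ p' ⊟ p ⊠ ℤ.+ 0) ⊞ (w ⊞ (q ⊠ ℤ.+ 0 ⊟ ℤ.+ 0 ⊠ q')) ≡ w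
      ring = ℤ-Ring.solve-∀
    α β : Vert → ℕ
    α z = ind a z + ind c z
    β z = ind b z + ind d z
    αβ : ∀ z → α z ≡ 0 ⊎ β z ≡ 0
    αβ z = exclusive (ind-# a#b z) (ind-# a#d z) (ind-# c#b z) (ind-# c#d z)
    α≡ : ∀ z → ℤ.+ α z ≡ i a z ⊞ i c z
    α≡ z = sym (cong₂ _⊞_ (indicator≡ a z) (indicator≡ c z))
    β≡ : ∀ z → ℤ.+ β z ≡ i b z ⊞ i d z
    β≡ z = sym (cong₂ _⊞_ (indicator≡ b z) (indicator≡ d z))
    shuffleˡ : ∀ a b c d → (a ⊟ b) ⊞ (c ⊟ d) ≡ (a ⊞ c) ⊟ (b ⊞ d)
    shuffleˡ = ℤ-Ring.solve-∀
    entry : mutEntry (F x v) (F v y) ≡ (i b x ⊞ i d x) ⊠ (i a y ⊞ i c y) ⊟ (i a x ⊞ i c x) ⊠ (i b y ⊞ i d y)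
    entry = trans (cong₂ mutEntry
        (trans (Fʳ x) (trans (shuffleˡ (i b x) (i a x) (i d x) (i c x)) (cong₂ _⊟_ (sym (β≡ x)) (sym (α≡ x)))))
        (trans (Fˡ y) (trans (shuffleˡ (i a y) (i b y) (i c y) (i d y)) (cong₂ _⊟_ (sym (α≡ y)) (sym (β≡ y))))))
      (trans (mutEntry-diff (α x) (β x) (α y) (β y) (αβ x) (αβ y))
        (cong₂ _⊟_ (cong₂ _⊠_ (β≡ x) (α≡ y)) (cong₂ _⊠_ (α≡ x) (β≡ y))))
    ringF : ∀ a b c d a' b' c' d' g →
      ((b ⊠ c' ⊟ c ⊠ b') ⊞ (d ⊠ a' ⊟ a ⊠ d')) ⊞ g ≡
      (((a ⊠ b' ⊟ b ⊠ a') ⊞ (c ⊠ d' ⊟ d ⊠ c')) ⊞ g) ⊞ ((b ⊞ d) ⊠ (a' ⊞ c') ⊟ (a ⊞ c) ⊠ (b' ⊞ d'))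
    ringF = ℤ-Ring.solve-∀
    cases : Dec (x ≡ v) → Dec (y ≡ v) → F' x y ≡ μ v F x y
    cases (yes refl) _ = trans (F'ˡ y) (trans (negˡ (i a y) (i b y) (i c y) (i d y)) (sym (trans (μ-≡ˡ {B = F}) (cong ℤ.-_ (Fˡ y)))))
    cases (no _) (yes refl) = trans (F'ʳ x) (trans (negʳ (i a x) (i b x) (i c x) (i d x)) (sym (trans (μ-≡ʳ {B = F}) (cong ℤ.-_ (Fʳ x)))))
    cases (no x≢) (no y≢) = begin
      F' x y
        ≡⟨ trans (after x y) (cong (_⊞ rest x y) (cong₂ _⊞_ (far b c x≢ y≢) (far d a x≢ y≢))) ⟩
      (wedge b c x y ⊞ wedge d a x y) ⊞ rest x y
        ≡⟨ ringF (i a x) (i b x) (i c x) (i d x) (i a y) (i b y) (i c y) (i d y) (rest x y) ⟩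
      ((wedge a b x y ⊞ wedge c d x y) ⊞ rest x y) ⊞ ((i b x ⊞ i d x) ⊠ (i a y ⊞ i c y) ⊟ (i a x ⊞ i c x) ⊠ (i b y ⊞ i d y))
        ≡⟨ cong₂ _⊞_ (sym (trans (before x y) (cong (_⊞ rest x y) (cong₂ _⊞_ (far a b x≢ y≢) (far c d x≢ y≢))))) (sym entry) ⟩
      F x y ⊞ mutEntry (F x v) (F v y)
        ≡⟨ μ-≢ {B = F} x≢ y≢ ⟨
      μ v F x y ∎

  #-sym : ∀ {a b} → a # b → b # a
  #-sym a#b b≡ a≡ = a#b a≡ b≡

  -- The new diagonal sees the same quadrilateral turned by one corner.
  flip-sym : ∀ {v F F'} → DiagonalFlip v F F' → DiagonalFlip v F' F
  flip-sym {v} fl = record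
    { a = b ; b = c ; c = d ; d = a ; rest = rest
    ; before = after
    ; after = λ x y → trans (before x y) (cong (_⊞ rest x y) (ℤₚ.+-comm (cellForm (just v , a , b) x y) (cellForm (just v , c , d) x y)))
    ; restˡ = restˡ ; restʳ = restʳ
    ; a≢v = b≢v ; b≢v = c≢v ; c≢v = d≢v ; d≢v = a≢v
    ; a#b = #-sym {c} {b} c#b ; a#d = #-sym {a} {b} a#b ; c#b = #-sym {c} {d} c#d ; c#d = #-sym {a} {d} a#d
    }
    where open DiagonalFlip fl

-- Flips of drawings

Unique-++⁻ : ∀ {A : Set} (xs : List A) {ys} → Unique (xs ++ ys) → Unique xs × Unique ys × (∀ {z} → z ∈ xs → z ∉ ys)
Unique-++⁻ [] u = [] , u , λ ()
Unique-++⁻ (x ∷ xs) (px ∷ u) =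
  let ux , uy , disj = Unique-++⁻ xs u
  in Allₚ.++⁻ˡ xs px ∷ ux , uy , λ { (here refl) z∈ → All.lookup (Allₚ.++⁻ʳ xs px) z∈ refl ; (there z∈) → disj z∈ }

Unique-↭ : ∀ {A : Set} {xs ys : List A} → xs ↭ ys → Unique xs → Unique ys
Unique-↭ Perm.refl u = u
Unique-↭ (Perm.prep x p) (px ∷ u) = All-resp-↭ p px ∷ Unique-↭ p u
Unique-↭ (Perm.swap x y p) ((x≢y ∷ px) ∷ (py ∷ u)) = ((x≢y ∘ sym) ∷ All-resp-↭ p py) ∷ All-resp-↭ p px ∷ Unique-↭ p u
Unique-↭ (Perm.trans p q) u = Unique-↭ q (Unique-↭ p u)

data TreeFlip {X : Set} (v : X) : Tree X → Tree X → Set where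
  rotˡ : ∀ z p q s → TreeFlip v (node z (node v p q) s) (node z p (node v q s))
  rotʳ : ∀ z p q s → TreeFlip v (node z p (node v q s)) (node z (node v p q) s)
  inˡ : ∀ z {l l'} r → TreeFlip v l l' → TreeFlip v (node z l r) (node z l' r)
  inʳ : ∀ z l {r r'} → TreeFlip v r r' → TreeFlip v (node z l r) (node z l r')

-- The tree on the base arrow left when v is removed from between two base arrows of orientation b.
join : ∀ {X : Set} → Bool → X → Tree X → Tree X → Tree X
join true v t t' = node v t' t
join false v t t' = node v t t'

-- The flipped diagonal v is a cycle vertex between base arrows of equal orientation (`merge`) or of
-- opposite orientation (`swap`), the root of a tree (`split`), or a deeper node (`inner`). A flip
-- always happens at the front of the list; other places are reached by rotating.
data Flip {X : Set} (v : X) : Drawing X → Drawing X → Set where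
  merge : ∀ x b t t' D → Flip v ((x , b , t) ∷ (v , b , t') ∷ D) ((x , b , join b v t t') ∷ D)
  split : ∀ x b t t' D → Flip v ((x , b , join b v t t') ∷ D) ((x , b , t) ∷ (v , b , t') ∷ D)
  swap : ∀ x b t t' D → Flip v ((x , b , t) ∷ (v , not b , t') ∷ D) ((x , not b , t') ∷ (v , b , t) ∷ D)
  inner : ∀ x b {t t'} D → TreeFlip v t t' → Flip v ((x , b , t) ∷ D) ((x , b , t') ∷ D)

↭-shifts : ∀ {A : Set} (xs ys zs : List A) → xs ++ (ys ++ zs) ↭ ys ++ (xs ++ zs)
↭-shifts xs ys zs = Permₚ.shifts xs ys

module _ {X : Set} where

  treeFlip-labels : ∀ {v : X} {t t'} → TreeFlip v t t' → names t ↭ names t'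
  treeFlip-labels {v} (rotˡ z p q s) = ↭-prep z (↭-trans (↭-prep v (↭-reflexive (++-assoc (names p) (names q) (names s))))
    (↭-sym (Permₚ.shift v (names p) (names q ++ names s))))
  treeFlip-labels {v} (rotʳ z p q s) = ↭-sym (treeFlip-labels (rotˡ {v = v} z p q s))
  treeFlip-labels (inˡ z r f) = ↭-prep z (Permₚ.++⁺ʳ (names r) (treeFlip-labels f))
  treeFlip-labels (inʳ z l f) = ↭-prep z (Permₚ.++⁺ˡ (names l) (treeFlip-labels f))

  treeFlip-leaves : ∀ {v : X} {t t'} → TreeFlip v t t' → leaves t ≡ leaves t'
  treeFlip-leaves (rotˡ z p q s) = +-assoc (leaves p) (leaves q) (leaves s)
  treeFlip-leaves (rotʳ z p q s) = sym (+-assoc (leaves p) (leaves q) (leaves s))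
  treeFlip-leaves (inˡ z r f) = cong (_+ leaves r) (treeFlip-leaves f)
  treeFlip-leaves (inʳ z l f) = cong (leaves l +_) (treeFlip-leaves f)

  treeFlip-top : ∀ {v : X} {t t'} → TreeFlip v t t' → top t ≡ top t'
  treeFlip-top (rotˡ z p q s) = refl
  treeFlip-top (rotʳ z p q s) = refl
  treeFlip-top (inˡ z r f) = refl
  treeFlip-top (inʳ z l f) = refl

  top∈ : ∀ {v : X} t → top t ≡ just v → v ∈ names t
  top∈ (node v l r) refl = here refl

  top-∉ : ∀ {v : X} t → v ∉ names t → top t ≢ just v
  top-∉ t v∉ eq = v∉ (top∈ t eq)

  below : Tree X → List X
  below leaf = []
  below (node z l r) = names l ++ names r

  treeFlip-below : ∀ {v : X} {t t'} → TreeFlip v t t' → v ∈ below t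
  treeFlip-∈ : ∀ {v : X} {t t'} → TreeFlip v t t' → v ∈ names t
  treeFlip-below (rotˡ z p q s) = here refl
  treeFlip-below (rotʳ z p q s) = ∈-++⁺ʳ (names p) (here refl)
  treeFlip-below (inˡ z r f) = ∈-++⁺ˡ (treeFlip-∈ f)
  treeFlip-below (inʳ z l f) = ∈-++⁺ʳ (names l) (treeFlip-∈ f)
  treeFlip-∈ {t = node z l r} f = there (treeFlip-below f)

  treeFlip-top-≢ : ∀ {v : X} {t t'} → TreeFlip v t t' → Unique (names t) → top t ≢ just v
  treeFlip-top-≢ {t = node z l r} f u refl = head∉tail u (treeFlip-below f)

  join-labels : ∀ b (v : X) t t' D → names t ++ v ∷ names t' ++ labels D ↭ names (join b v t t') ++ labels D
  join-labels true v t t' D = ↭-trans (Permₚ.shift v (names t) (names t' ++ labels D))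
    (↭-prep v (↭-trans (↭-shifts (names t) (names t') (labels D)) (↭-reflexive (sym (++-assoc (names t') (names t) (labels D))))))
  join-labels false v t t' D = ↭-trans (Permₚ.shift v (names t) (names t' ++ labels D))
    (↭-prep v (↭-reflexive (sym (++-assoc (names t) (names t') (labels D)))))

  flip-labels : ∀ {v : X} {D D'} → Flip v D D' → labels D ↭ labels D'
  flip-labels {v} (merge x b t t' D) = ↭-prep x (join-labels b v t t' D)
  flip-labels {v} (split x b t t' D) = ↭-prep x (↭-sym (join-labels b v t t' D))
  flip-labels {v} (swap x b t t' D) = ↭-prep x (↭-trans (Permₚ.shift v (names t) (names t' ++ labels D))
    (↭-trans (↭-prep v (↭-shifts (names t) (names t') (labels D))) (↭-sym (Permₚ.shift v (names t') (names t ++ labels D)))))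
  flip-labels (inner x b D f) = ↭-prep x (Permₚ.++⁺ʳ (labels D) (treeFlip-labels f))

  -- The cycle is non-oriented; in particular it has at least two vertices.
  Mixed : Drawing X → Set
  Mixed D = true ∈ orientations D × false ∈ orientations D

  mixed-tail : ∀ {β : Bead X} {D} → Mixed (β ∷ D) → Σ (Bead X) λ β' → Σ (Drawing X) λ D' → D ≡ β' ∷ D'
  mixed-tail {β} {β' ∷ D'} _ = β' , D' , refl
  mixed-tail {x , true , t} {[]} (_ , here ())
  mixed-tail {x , true , t} {[]} (_ , there ())
  mixed-tail {x , false , t} {[]} (here () , _)
  mixed-tail {x , false , t} {[]} (there () , _)

  mixed-drop : ∀ {x y b} {t t' : Tree X} {D} → Mixed ((x , b , t) ∷ (y , b , t') ∷ D) → Mixed ((y , b , t') ∷ D)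
  mixed-drop (p , q) = keep p , keep q
    where
    keep : ∀ {b c bs} → c ∈ b ∷ b ∷ bs → c ∈ b ∷ bs
    keep (here refl) = here refl
    keep (there c∈) = c∈

  flip-mixed : ∀ {v : X} {D D'} → Flip v D D' → Mixed D → Mixed D'
  flip-mixed {v} (merge x b t t' D) m = mixed-drop {x = x} {y = v} {t = t} {t' = t'} m
  flip-mixed (split x b t t' D) (p , q) = there p , there q
  flip-mixed (swap x b t t' D) (p , q) = exch p , exch q
    where
    exch : ∀ {b b' c : Bool} {bs} → c ∈ b ∷ b' ∷ bs → c ∈ b' ∷ b ∷ bs
    exch (here refl) = there (here refl)
    exch (there (here refl)) = here refl
    exch (there (there c∈)) = there (there c∈)
  flip-mixed (inner x b D f) m = m

leaves-treeShape : ∀ {X} (t : Tree X) → leaves (treeShape t) ≡ leaves t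
leaves-treeShape leaf = refl
leaves-treeShape (node z l r) = cong₂ _+_ (leaves-treeShape l) (leaves-treeShape r)

leavesAt : ∀ {X} → Bool → Drawing X → ℕ
leavesAt b D = sumAt b leaves (shape D)

flip-leaves : ∀ {X} {v : X} {D D'} → Flip v D D' → ∀ c → leavesAt c D ≡ leavesAt c D'
flip-leaves {v = v} (merge x b t t' D) c = merge-leaves b c
  where
  pick-+ : ∀ c b m n → pick c b m + pick c b n ≡ pick c b (m + n)
  pick-+ true true m n = refl
  pick-+ true false m n = refl
  pick-+ false true m n = refl
  pick-+ false false m n = refl
  joined : ∀ b → leaves (treeShape t) + leaves (treeShape t') ≡ leaves (treeShape (join b v t t'))
  joined true = +-comm (leaves (treeShape t)) (leaves (treeShape t'))
  joined false = refl
  merge-leaves : ∀ b c → leavesAt c ((x , b , t) ∷ (v , b , t') ∷ D) ≡ leavesAt c ((x , b , join b v t t') ∷ D)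
  merge-leaves b c = trans (sym (+-assoc (pick c b (leaves (treeShape t))) (pick c b (leaves (treeShape t'))) (leavesAt c D)))
    (cong (_+ leavesAt c D) (trans (pick-+ c b (leaves (treeShape t)) (leaves (treeShape t'))) (cong (pick c b) (joined b))))
flip-leaves {v = v} (split x b t t' D) c = sym (flip-leaves (merge {v = v} x b t t' D) c)
flip-leaves (swap x b t t' D) c = exch (pick c b (leaves (treeShape t))) (pick c (not b) (leaves (treeShape t'))) (leavesAt c D)
  where
  exch : ∀ a b c → a + (b + c) ≡ b + (a + c)
  exch = ℕ-Ring.solve-∀
flip-leaves (inner x b {t} {t'} D f) c = cong (λ m → pick c b m + leavesAt c D)
  (trans (leaves-treeShape t) (trans (treeFlip-leaves f) (sym (leaves-treeShape t'))))

module _ {n : ℕ} where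

  private
    Vert = Fin n

  cells-avoid : ∀ {v : Vert} t → v ∉ names t → All (Avoids v) (cells t)
  cells-avoid leaf v∉ = []
  cells-avoid (node z l r) v∉ =
    ((λ { refl → v∉ (here refl) }) , top-∉ l v∉l , top-∉ r v∉r) ∷ Allₚ.++⁺ (cells-avoid l v∉l) (cells-avoid r v∉r)
    where
    v∉l = λ v∈ → v∉ (there (∈-++⁺ˡ v∈))
    v∉r = λ v∈ → v∉ (there (∈-++⁺ʳ (names l) v∈))

  next-≢ : ∀ {v : Vert} D {y} → v ∉ labels D → y ≢ v → next D y ≢ v
  next-≢ [] v∉ y≢ = y≢
  next-≢ (_ ∷ _) v∉ y≢ = λ { refl → v∉ (here refl) }

  baseCell-avoid : ∀ {v x y : Vert} b t → x ≢ v → y ≢ v → top t ≢ just v → Avoids v (baseCell x y b t)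
  baseCell-avoid true t x≢ y≢ t≢ = x≢ ∘ just-injective , y≢ ∘ just-injective , t≢
  baseCell-avoid false t x≢ y≢ t≢ = y≢ ∘ just-injective , x≢ ∘ just-injective , t≢

  path-avoid : ∀ {v : Vert} D {y} → v ∉ labels D → y ≢ v → All (Avoids v) (path D y)
  path-avoid [] v∉ y≢ = []
  path-avoid ((x , b , t) ∷ D) v∉ y≢ =
    baseCell-avoid b t (λ { refl → v∉ (here refl) }) (next-≢ D v∉D y≢) (top-∉ t v∉t) ∷ Allₚ.++⁺ (cells-avoid t v∉t) (path-avoid D v∉D y≢)
    where
    v∉t = λ v∈ → v∉ (there (∈-++⁺ˡ v∈))
    v∉D = λ v∈ → v∉ (there (∈-++⁺ʳ (names t) v∈))

  form-avoidʳ : ∀ {v : Vert} {ts} → All (Avoids v) ts → ∀ x → form ts x v ≡ ℤ.+ 0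
  form-avoidʳ {v} {ts} avoid x = trans (form-skew ts x v) (cong ℤ.-_ (form-avoid avoid x))

  rot₁ : ∀ (a b c : Maybe Vert) x y → cellForm (a , b , c) x y ≡ cellForm (b , c , a) x y
  rot₁ = cellForm-rotate
  rot₂ : ∀ (a b c : Maybe Vert) x y → cellForm (a , b , c) x y ≡ cellForm (c , a , b) x y
  rot₂ a b c x y = trans (rot₁ a b c x y) (rot₁ b c a x y)

  #-∉ : ∀ {x : Vert} t → x ∉ names t → top t # just x
  #-∉ t x∉ eq refl = x∉ (top∈ t eq)

  #-trees : ∀ (t t' : Tree Vert) → (∀ {z} → z ∈ names t → z ∉ names t') → top t # top t'
  #-trees t t' disj eq eq' = disj (top∈ t eq) (top∈ t' eq')

  #-just : ∀ {x y : Vert} → x ≢ y → just x # just y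
  #-just x≢y refl refl = x≢y refl

  rotˡ-form : ∀ {v : Vert} z p q s → Unique (names (node z (node v p q) s)) →
    DiagonalFlip v (form (cells (node z (node v p q) s))) (form (cells (node z p (node v q s))))
  rotˡ-form {v} z p q s u@(_ ∷ u₁@(_ ∷ u₂)) = record
    { a = top s ; b = just z ; c = top p ; d = top q
    ; rest = form (cells p ++ cells q ++ cells s)
    ; before = λ x y → trans (cong₂ _⊞_ (rot₁ (just z) (just v) (top s) x y)
        (cong (λ ts → cellForm (just v , top p , top q) x y ⊞ form ts x y) (++-assoc (cells p) (cells q) (cells s))))
        (sym (ℤₚ.+-assoc (cellForm (just v , top s , just z) x y) (cellForm (just v , top p , top q) x y) (form (cells p ++ cells q ++ cells s) x y)))
    ; after = λ x y → trans (cong₂ _⊞_ (rot₂ (just z) (top p) (just v) x y)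
        (form-↭ (Permₚ.shift (just v , top q , top s) (cells p) (cells q ++ cells s)) x y))
        (sym (ℤₚ.+-assoc (cellForm (just v , just z , top p) x y) (cellForm (just v , top q , top s) x y) (form (cells p ++ cells q ++ cells s) x y)))
    ; restˡ = form-avoid avoid ; restʳ = form-avoidʳ avoid
    ; a≢v = top-∉ s v∉s ; b≢v = λ { refl → z∉ (here refl) } ; c≢v = top-∉ p v∉p ; d≢v = top-∉ q v∉q
    ; a#b = #-∉ s (λ z∈ → z∉ (there (∈-++⁺ʳ (names p ++ names q) z∈)))
    ; a#d = #-trees s q (λ z∈ z∈' → proj₂ (proj₂ pq-s) (∈-++⁺ʳ (names p) z∈') z∈)
    ; c#b = #-∉ p (λ z∈ → z∉ (there (∈-++⁺ˡ (∈-++⁺ˡ z∈))))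
    ; c#d = #-trees p q (proj₂ (proj₂ (Unique-++⁻ (names p) (proj₁ pq-s))))
    }
    where
    z∉ = head∉tail u
    v∉ = head∉tail u₁
    v∉s = λ v∈ → v∉ (∈-++⁺ʳ (names p ++ names q) v∈)
    v∉p = λ v∈ → v∉ (∈-++⁺ˡ (∈-++⁺ˡ v∈))
    v∉q = λ v∈ → v∉ (∈-++⁺ˡ (∈-++⁺ʳ (names p) v∈))
    pq-s = Unique-++⁻ (names p ++ names q) u₂
    avoid = Allₚ.++⁺ (cells-avoid p v∉p) (Allₚ.++⁺ (cells-avoid q v∉q) (cells-avoid s v∉s))

  treeFlip-form : ∀ {v : Vert} {t t'} → TreeFlip v t t' → Unique (names t) → DiagonalFlip v (form (cells t)) (form (cells t'))
  treeFlip-form (rotˡ z p q s) u = rotˡ-form z p q s u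
  treeFlip-form {v} (rotʳ z p q s) u = flip-sym (rotˡ-form z p q s (Unique-↭ (↭-sym (treeFlip-labels (rotˡ {v = v} z p q s))) u))
  treeFlip-form {v} (inˡ z {l} {l'} r f) u@(_ ∷ u₁) =
      flip-add (treeFlip-form f ul) (form us) (form-avoid avoid) (form-avoidʳ avoid)
        (λ x y → split-form (cells l) x y)
        (λ x y → trans (cong (λ m → form ((just z , m , top r) ∷ cells l' ++ cells r) x y) (sym (treeFlip-top f))) (split-form (cells l') x y))
    where
    z∉ = head∉tail u
    ul = proj₁ (Unique-++⁻ (names l) u₁)
    v∈l = treeFlip-∈ f
    v∉r = proj₂ (proj₂ (Unique-++⁻ (names l) u₁)) v∈l
    us = (just z , top l , top r) ∷ cells r
    avoid : All (Avoids v) us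
    avoid = ((λ { refl → z∉ (∈-++⁺ˡ v∈l) }) , treeFlip-top-≢ f ul , top-∉ r v∉r) ∷ cells-avoid r v∉r
    split-form : ∀ ts x y → form ((just z , top l , top r) ∷ ts ++ cells r) x y ≡ form ts x y ⊞ form us x y
    split-form ts x y = trans (form-↭ (↭-sym (Permₚ.shift (just z , top l , top r) ts (cells r))) x y) (form-++ ts us x y)
  treeFlip-form {v} (inʳ z l {r} {r'} f) u@(_ ∷ u₁) =
      flip-add (treeFlip-form f ur) (form us) (form-avoid avoid) (form-avoidʳ avoid)
        (λ x y → split-form (cells r) x y)
        (λ x y → trans (cong (λ m → form ((just z , top l , m) ∷ cells l ++ cells r') x y) (sym (treeFlip-top f))) (split-form (cells r') x y))
    where
    z∉ = head∉tail u
    ur = proj₁ (proj₂ (Unique-++⁻ (names l) u₁))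
    v∈r = treeFlip-∈ f
    v∉l = λ v∈ → proj₂ (proj₂ (Unique-++⁻ (names l) u₁)) v∈ v∈r
    us = (just z , top l , top r) ∷ cells l
    avoid : All (Avoids v) us
    avoid = ((λ { refl → z∉ (∈-++⁺ʳ (names l) v∈r) }) , top-∉ l v∉l , treeFlip-top-≢ f ur) ∷ cells-avoid l v∉l
    split-form : ∀ ts x y → form ((just z , top l , top r) ∷ cells l ++ ts) x y ≡ form ts x y ⊞ form us x y
    split-form ts x y = trans (form-++ us ts x y) (ℤₚ.+-comm (form us x y) (form ts x y))

  next-∷-≢ : ∀ {x : Vert} {D} β D' → D ≡ β ∷ D' → x ∉ labels D → next D x ≢ x
  next-∷-≢ β D' refl x∉ refl = x∉ (here refl)

  -- On a cycle of length two the vertex `y` after v is x again, so x ≠ y is not among the facts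
  -- collected here.
  module TwoBeads {x v : Vert} {t t' D} (u : Unique (x ∷ names t ++ v ∷ names t' ++ labels D)) where
    private
      u₁ = Unique-++⁻ (names t) (AllPairs.tail u)
      uv = proj₁ (proj₂ u₁)
      u₂ = Unique-++⁻ (names t') (AllPairs.tail uv)
      x∉ = head∉tail u
      v∉′ = head∉tail uv
    x∉t : x ∉ names t
    x∉t p = x∉ (∈-++⁺ˡ p)
    x≢v : x ≢ v
    x≢v refl = x∉ (∈-++⁺ʳ (names t) (here refl))
    x∉t' : x ∉ names t'
    x∉t' p = x∉ (∈-++⁺ʳ (names t) (there (∈-++⁺ˡ p)))
    x∉D : x ∉ labels D
    x∉D p = x∉ (∈-++⁺ʳ (names t) (there (∈-++⁺ʳ (names t') p)))
    v∉t : v ∉ names t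
    v∉t p = proj₂ (proj₂ u₁) p (here refl)
    v∉t' : v ∉ names t'
    v∉t' p = v∉′ (∈-++⁺ˡ p)
    v∉D : v ∉ labels D
    v∉D p = v∉′ (∈-++⁺ʳ (names t') p)
    t#t' : ∀ {z} → z ∈ names t → z ∉ names t'
    t#t' p q = proj₂ (proj₂ u₁) p (there (∈-++⁺ˡ q))
    t#D : ∀ {z} → z ∈ names t → z ∉ labels D
    t#D p q = proj₂ (proj₂ u₁) p (there (∈-++⁺ʳ (names t') q))
    t'#D : ∀ {z} → z ∈ names t' → z ∉ labels D
    t'#D p q = proj₂ (proj₂ u₂) p q
    y = next D x
    y≢v : y ≢ v
    y≢v = next-≢ D v∉D x≢v
    y∉t : y ∉ names t
    y∉t p = case-next D x∉t p (t#D p)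
      where
      case-next : ∀ D {x} → x ∉ names t → next D x ∈ names t → next D x ∉ labels D → ⊥
      case-next [] x∉ p _ = x∉ p
      case-next (_ ∷ _) _ _ q = q (here refl)
    y∉t' : y ∉ names t'
    y∉t' p = case-next D x∉t' p (t'#D p)
      where
      case-next : ∀ D {x} → x ∉ names t' → next D x ∈ names t' → next D x ∉ labels D → ⊥
      case-next [] x∉ p _ = x∉ p
      case-next (_ ∷ _) _ _ q = q (here refl)
    rest : List (Triangle Vert)
    rest = cells t ++ cells t' ++ path D x
    avoid : All (Avoids v) rest
    avoid = Allₚ.++⁺ (cells-avoid t v∉t) (Allₚ.++⁺ (cells-avoid t' v∉t') (path-avoid D v∉D x≢v))
    expand : ∀ b b' p q → form (path ((x , b , t) ∷ (v , b' , t') ∷ D) x) p q ≡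
      (cellForm (baseCell x v b t) p q ⊞ cellForm (baseCell v y b' t') p q) ⊞ form rest p q
    expand b b' p q = trans (cong (λ z → cellForm (baseCell x v b t) p q ⊞ z)
        (form-↭ (Permₚ.shift (baseCell v y b' t') (cells t) (cells t' ++ path D x)) p q))
      (sym (ℤₚ.+-assoc (cellForm (baseCell x v b t) p q) (cellForm (baseCell v y b' t') p q) (form rest p q)))

  -- The neighbours x and y of v on the cycle are adjacent corners of the quadrilateral and must
  -- differ. Two beads of equal orientation cannot be the whole of a mixed cycle, so there is a
  -- further bead, whose vertex is y.
  merge-form : ∀ {v : Vert} x b t t' D → Unique (labels ((x , b , t) ∷ (v , b , t') ∷ D)) → Mixed ((x , b , t) ∷ (v , b , t') ∷ D) →
    DiagonalFlip v (⟦ (x , b , t) ∷ (v , b , t') ∷ D ⟧) (⟦ (x , b , join b v t t') ∷ D ⟧)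
  merge-form {v} x true t t' D u m = record
    { a = top t ; b = just x ; c = just y ; d = top t' ; rest = form rest
    ; before = λ p q → trans (expand true true p q) (cong (λ z → (z ⊞ cellForm (just v , just y , top t') p q) ⊞ form rest p q) (rot₁ (just x) (just v) (top t) p q))
    ; after = λ p q → trans (cong₂ (λ z w → z ⊞ (cellForm (just v , top t' , top t) p q ⊞ w)) (rot₂ (just x) (just y) (just v) p q)
          (form-↭ (↭-trans (↭-reflexive (++-assoc (cells t') (cells t) (path D x))) (↭-shifts (cells t') (cells t) (path D x))) p q))
        (sym (ℤₚ.+-assoc (cellForm (just v , just x , just y) p q) (cellForm (just v , top t' , top t) p q) (form rest p q)))
    ; restˡ = form-avoid avoid ; restʳ = form-avoidʳ avoid
    ; a≢v = top-∉ t v∉t ; b≢v = x≢v ∘ just-injective ; c≢v = y≢v ∘ just-injective ; d≢v = top-∉ t' v∉t'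
    ; a#b = #-∉ t x∉t ; a#d = #-trees t t' t#t' ; c#b = #-just y≢x ; c#d = #-sym {a = top t'} {b = just y} (#-∉ t' y∉t')
    }
    where
    open TwoBeads {x} {v} {t} {t'} {D} u
    y≢x : y ≢ x
    y≢x = let β , D' , eq = mixed-tail {β = v , true , t'} {D = D} (mixed-drop {x = x} {y = v} {t = t} {t' = t'} m) in next-∷-≢ β D' eq x∉D
  merge-form {v} x false t t' D u m = record
    { a = just x ; b = top t ; c = top t' ; d = just y ; rest = form rest
    ; before = λ p q → trans (expand false false p q) (cong (λ z → (cellForm (just v , just x , top t) p q ⊞ z) ⊞ form rest p q) (rot₁ (just y) (just v) (top t') p q))
    ; after = λ p q → trans (cong₂ (λ z w → z ⊞ (cellForm (just v , top t , top t') p q ⊞ w)) (rot₂ (just y) (just x) (just v) p q)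
          (cong (λ ts → form ts p q) (++-assoc (cells t) (cells t') (path D x))))
        (trans (exch (cellForm (just v , just y , just x) p q) (cellForm (just v , top t , top t') p q) (form rest p q)) refl)
    ; restˡ = form-avoid avoid ; restʳ = form-avoidʳ avoid
    ; a≢v = x≢v ∘ just-injective ; b≢v = top-∉ t v∉t ; c≢v = top-∉ t' v∉t' ; d≢v = y≢v ∘ just-injective
    ; a#b = #-sym {a = top t} {b = just x} (#-∉ t x∉t) ; a#d = #-just (y≢x ∘ sym) ; c#b = #-sym {a = top t} {b = top t'} (#-trees t t' t#t') ; c#d = #-∉ t' y∉t'
    }
    where
    open TwoBeads {x} {v} {t} {t'} {D} u
    y≢x : y ≢ x
    y≢x = let β , D' , eq = mixed-tail {β = v , false , t'} {D = D} (mixed-drop {x = x} {y = v} {t = t} {t' = t'} m) in next-∷-≢ β D' eq x∉D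
    exch : ∀ a b c → a ⊞ (b ⊞ c) ≡ (b ⊞ a) ⊞ c
    exch = ℤ-Ring.solve-∀

  -- Here x and y are not consecutive in the quadrilateral and may coincide, namely on a cycle of
  -- length two, where v meets a double arrow.
  swap-form : ∀ {v : Vert} x t t' D → Unique (labels ((x , true , t) ∷ (v , false , t') ∷ D)) →
    DiagonalFlip v (⟦ (x , true , t) ∷ (v , false , t') ∷ D ⟧) (⟦ (x , false , t') ∷ (v , true , t) ∷ D ⟧)
  swap-form {v} x t t' D u = record
    { a = top t ; b = just x ; c = top t' ; d = just y ; rest = form rest
    ; before = λ p q → trans (expand true false p q) (cong₂ (λ z w → (z ⊞ w) ⊞ form rest p q) (rot₁ (just x) (just v) (top t) p q) (rot₁ (just y) (just v) (top t') p q))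
    ; after = λ p q → trans (cong (λ w → cellForm (just v , just x , top t') p q ⊞ w)
          (trans (form-↭ (Permₚ.shift (just v , just y , top t) (cells t') (cells t ++ path D x)) p q)
                 (cong (λ w → cellForm (just v , just y , top t) p q ⊞ w) (form-↭ (↭-shifts (cells t') (cells t) (path D x)) p q))))
        (sym (ℤₚ.+-assoc (cellForm (just v , just x , top t') p q) (cellForm (just v , just y , top t) p q) (form rest p q)))
    ; restˡ = form-avoid avoid ; restʳ = form-avoidʳ avoid
    ; a≢v = top-∉ t v∉t ; b≢v = x≢v ∘ just-injective ; c≢v = top-∉ t' v∉t' ; d≢v = y≢v ∘ just-injective
    ; a#b = #-∉ t x∉t ; a#d = #-∉ t y∉t ; c#b = #-∉ t' x∉t' ; c#d = #-∉ t' y∉t'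
    }
    where open TwoBeads {x} {v} {t} {t'} {D} u

  flip-form : ∀ {v : Vert} {D D'} → Flip v D D' → Unique (labels D) → Mixed D → DiagonalFlip v (⟦ D ⟧) (⟦ D' ⟧)
  flip-form (merge x b t t' D) u m = merge-form x b t t' D u m
  flip-form {v} fl@(split x b t t' D) u m = flip-sym (merge-form x b t t' D (Unique-↭ (flip-labels fl) u) (flip-mixed fl m))
  flip-form (swap x true t t' D) u m = swap-form x t t' D u
  flip-form {v} fl@(swap x false t t' D) u m = flip-sym (swap-form x t' t D (Unique-↭ (flip-labels fl) u))
  flip-form {v} (inner x b {t} {t'} D f) u@(_ ∷ u₁) m =
      flip-add (treeFlip-form f ut) (form us) (form-avoid avoid) (form-avoidʳ avoid)
        (λ p q → split-form (cells t) p q)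
        (λ p q → trans (cong (λ z → form (z ∷ cells t' ++ path D x) p q) (same-base b)) (split-form (cells t') p q))
    where
    ut = proj₁ (Unique-++⁻ (names t) u₁)
    v∈t = treeFlip-∈ f
    v∉D = proj₂ (proj₂ (Unique-++⁻ (names t) u₁)) v∈t
    x≢v : x ≢ v
    x≢v refl = head∉tail u (∈-++⁺ˡ v∈t)
    y = next D x
    us = baseCell x y b t ∷ path D x
    avoid : All (Avoids v) us
    avoid = baseCell-avoid b t x≢v (next-≢ D v∉D x≢v) (treeFlip-top-≢ f ut) ∷ path-avoid D v∉D x≢v
    same-base : ∀ b → baseCell x y b t' ≡ baseCell x y b t
    same-base true = cong (λ z → just x , just y , z) (sym (treeFlip-top f))
    same-base false = cong (λ z → just y , just x , z) (sym (treeFlip-top f))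
    split-form : ∀ ts p q → form (baseCell x y b t ∷ ts ++ path D x) p q ≡ form ts p q ⊞ form us p q
    split-form ts p q = trans (form-↭ (↭-sym (Permₚ.shift (baseCell x y b t) ts (path D x))) p q) (form-++ ts us p q)

-- Rotation and reflection of drawings; existence of flips

module _ {X : Set} where

  next-++ : ∀ (D E : Drawing X) y → next (D ++ E) y ≡ next D (next E y)
  next-++ [] E y = refl
  next-++ (_ ∷ _) E y = refl

  path-++ : ∀ (D E : Drawing X) y → path (D ++ E) y ≡ path D (next E y) ++ path E y
  path-++ [] E y = refl
  path-++ ((x , b , t) ∷ D) E y = cong₂ _∷_ (cong (λ z → baseCell x z b t) (next-++ D E y))
    (trans (cong (cells t ++_) (path-++ D E y)) (sym (++-assoc (cells t) (path D (next E y)) (path E y))))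

  triangles-path : ∀ (D : Drawing X) z → triangles D ≡ path D (next D z)
  triangles-path [] z = refl
  triangles-path (_ ∷ _) z = refl

  triangles-swap : ∀ (D E : Drawing X) → triangles (E ++ D) ↭ triangles (D ++ E)
  triangles-swap [] E = ↭-reflexive (cong triangles (++-identityʳ E))
  triangles-swap D@(_ ∷ _) [] = ↭-reflexive (cong triangles (sym (++-identityʳ D)))
  triangles-swap D@((x , _) ∷ _) E@((y , _) ∷ _) = ↭-trans (↭-reflexive (path-++ E D y))
    (↭-trans (Permₚ.++-comm (path E x) (path D y)) (↭-reflexive (sym (path-++ D E x))))

  triangles-rot : ∀ d (D : Drawing X) → triangles (rot d D) ↭ triangles D
  triangles-rot zero D = ↭-refl
  triangles-rot (suc d) D = ↭-trans (triangles-rot d (rot1 D)) (rot1-case D)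
    where
    rot1-case : ∀ D → triangles (rot1 D) ↭ triangles D
    rot1-case [] = ↭-refl
    rot1-case (β ∷ E) = triangles-swap [ β ] E

  rot-↭ : ∀ d (D : Drawing X) → rot d D ↭ D
  rot-↭ zero D = ↭-refl
  rot-↭ (suc d) [] = rot-↭ d []
  rot-↭ (suc d) (β ∷ E) = ↭-trans (rot-↭ d (E ++ [ β ])) (Permₚ.++-comm E [ β ])

  labels-++ : ∀ (D E : Drawing X) → labels (D ++ E) ≡ labels D ++ labels E
  labels-++ [] E = refl
  labels-++ ((x , b , t) ∷ D) E = cong (x ∷_) (trans (cong (names t ++_) (labels-++ D E)) (sym (++-assoc (names t) (labels D) (labels E))))

  labels-↭ : ∀ {D E : Drawing X} → D ↭ E → labels D ↭ labels E
  labels-↭ Perm.refl = ↭-refl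
  labels-↭ (Perm.prep (x , b , t) p) = ↭-prep x (Permₚ.++⁺ˡ (names t) (labels-↭ p))
  labels-↭ {β ∷ γ ∷ D} {_ ∷ _ ∷ E} (Perm.swap (x , b , t) (y , c , s) p) = ↭-trans (↭-reflexive (two β γ D)) (↭-trans
    (Permₚ.++⁺ (Permₚ.++-comm (labels [ β ]) (labels [ γ ])) (labels-↭ p)) (↭-reflexive (sym (two γ β E))))
    where
    two : ∀ β γ (D : Drawing X) → labels (β ∷ γ ∷ D) ≡ (labels [ β ] ++ labels [ γ ]) ++ labels D
    two β γ D = trans (labels-++ [ β ] (γ ∷ D)) (trans (cong (labels [ β ] ++_) (labels-++ [ γ ] D)) (sym (++-assoc (labels [ β ]) (labels [ γ ]) (labels D))))
  labels-↭ (Perm.trans p q) = ↭-trans (labels-↭ p) (labels-↭ q)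

  vertices treeParts : Drawing X → List X
  vertices = map proj₁
  treeParts [] = []
  treeParts ((x , b , t) ∷ D) = names t ++ treeParts D

  labels-parts : ∀ (D : Drawing X) → labels D ↭ vertices D ++ treeParts D
  labels-parts [] = ↭-refl
  labels-parts ((x , b , t) ∷ D) = ↭-prep x (↭-trans (Permₚ.++⁺ˡ (names t) (labels-parts D)) (Permₚ.shifts (names t) (vertices D)))

  vertex-not-in-tree : ∀ {v} (D : Drawing X) → Unique (labels D) → v ∈ vertices D → v ∉ treeParts D
  vertex-not-in-tree D u v∈ = proj₂ (proj₂ (Unique-++⁻ (vertices D) (Unique-↭ (labels-parts D) u))) v∈

  vertices-Unique : ∀ (D : Drawing X) → Unique (labels D) → Unique (vertices D)
  vertices-Unique D u = proj₁ (Unique-++⁻ (vertices D) (Unique-↭ (labels-parts D) u))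

  -- Reading the cycle backwards: the base arrow after x_i is now the one before it.
  turn : X → Drawing X → Drawing X
  turn y [] = []
  turn y ((x , b , t) ∷ D) = (next D y , not b , t) ∷ turn y D

  reflect : Drawing X → Drawing X
  reflect [] = []
  reflect D@((x , _) ∷ _) = reverse (turn x D)

  turn-++ : ∀ D E y → turn y (D ++ E) ≡ turn (next E y) D ++ turn y E
  turn-++ [] E y = refl
  turn-++ ((x , b , t) ∷ D) E y = cong₂ _∷_ (cong (λ z → z , not b , t) (next-++ D E y)) (turn-++ D E y)

  next-turn : ∀ β D y z → next (reverse (turn y (β ∷ D))) z ≡ y
  next-turn (x , b , t) D y z = trans (cong (λ R → next R z) (unfold-reverse (next D y , not b , t) (turn y D)))
    (trans (next-++ (reverse (turn y D)) [ next D y , not b , t ] z) (rest D))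
    where
    rest : ∀ D → next (reverse (turn y D)) (next D y) ≡ y
    rest [] = refl
    rest (γ ∷ D) = next-turn γ D y (proj₁ γ)

  baseCell-turn : ∀ x y b t → baseCell {X} y x (not b) t ≡ baseCell x y b t
  baseCell-turn x y true t = refl
  baseCell-turn x y false t = refl

  path-turn : ∀ D y → path (reverse (turn y D)) (next D y) ↭ path D y
  path-turn [] y = ↭-refl
  path-turn ((x , b , t) ∷ D) y = ↭-trans (↭-reflexive (trans (cong (λ R → path R x) (unfold-reverse γ (turn y D))) (path-++ (reverse (turn y D)) [ γ ] x)))
    (↭-trans (Permₚ.++⁺ʳ (path [ γ ] x) (path-turn D y)) (↭-trans (Permₚ.++-comm (path D y) (path [ γ ] x))
    (↭-reflexive (cong₂ _∷_ (baseCell-turn x (next D y) b t) (++-assoc (cells t) [] (path D y))))))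
    where
    γ = next D y , not b , t

  triangles-reflect : ∀ D → triangles (reflect D) ↭ triangles D
  triangles-reflect [] = ↭-refl
  triangles-reflect D@(β@(x , _) ∷ E) = ↭-trans (↭-reflexive (trans (triangles-path (reflect D) x) (cong (path (reflect D)) (next-turn β E x x)))) (path-turn D x)

  labels-turn : ∀ D y → next D y ∷ labels (turn y D) ↭ y ∷ labels D
  labels-turn [] y = ↭-refl
  labels-turn ((x , b , t) ∷ D) y = ↭-trans (↭-prep x (↭-sym (Permₚ.shift (next D y) (names t) (labels (turn y D)))))
    (↭-trans (↭-prep x (Permₚ.++⁺ˡ (names t) (labels-turn D y))) (Permₚ.shift y (x ∷ names t) (labels D)))

  labels-reflect : ∀ D → labels (reflect D) ↭ labels D
  labels-reflect [] = ↭-refl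
  labels-reflect D@((x , _) ∷ _) = ↭-trans (labels-↭ (↭-reverse (turn x D))) (Permₚ.drop-∷ (labels-turn D x))

  rot1-reflect-rot1 : ∀ D → rot1 (reflect (rot1 D)) ≡ reflect D
  rot1-reflect-rot1 [] = refl
  rot1-reflect-rot1 ((x , b , t) ∷ []) = refl
  rot1-reflect-rot1 (β@(x , b , t) ∷ E@((x₁ , _) ∷ _)) = begin
    rot1 (reverse (turn x₁ (E ++ [ β ]))) ≡⟨ cong (rot1 ∘ reverse) (turn-++ E [ β ] x₁) ⟩
    rot1 (reverse (turn x E ++ [ x₁ , not b , t ])) ≡⟨ cong rot1 (reverse-++ (turn x E) [ x₁ , not b , t ]) ⟩
    reverse (turn x E) ++ [ x₁ , not b , t ] ≡⟨ unfold-reverse (x₁ , not b , t) (turn x E) ⟨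
    reverse (turn x (β ∷ E)) ∎

  reflect-rot1 : ∀ D → reflect (rot1 D) ≡ unrot (reflect D)
  reflect-rot1 D = rot1-injective (trans (rot1-reflect-rot1 D) (sym (rot1-unrot (reflect D))))

  -- The same triangulation: only the choice of the first bead and the reading direction may differ,
  -- the names of the vertices are kept.
  _≋_ : Drawing X → Drawing X → Set
  D ≋ E = ∃ λ d → E ≡ rot d D ⊎ E ≡ rot d (reflect D)

  ≋-rotʳ : ∀ {D E} d → D ≋ rot d E → D ≋ E
  ≋-rotʳ {D} {E} d D≋ with rot-inverse d E
  ≋-rotʳ {D} {E} d (e , inj₁ eq) | f , back = e + f , inj₁ (trans (sym back) (trans (cong (rot f) eq) (sym (rot-+ e f D))))
  ≋-rotʳ {D} {E} d (e , inj₂ eq) | f , back = e + f , inj₂ (trans (sym back) (trans (cong (rot f) eq) (sym (rot-+ e f (reflect D)))))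

  ≋-rotˡ : ∀ d {D E} → rot d D ≋ E → D ≋ E
  ≋-rotˡ zero D≋ = D≋
  ≋-rotˡ (suc d) {D} {E} D≋ with ≋-rotˡ d D≋
  ... | e , inj₁ eq = suc e , inj₁ eq
  ... | e , inj₂ eq = (length (reflect D) ∸ 1) + e ,
    inj₂ (trans eq (trans (cong (rot e) (reflect-rot1 D)) (sym (rot-+ (length (reflect D) ∸ 1) e (reflect D)))))

  Valid : Drawing X → Set
  Valid D = Unique (labels D) × Mixed D

  mixed-↭ : ∀ {D E : Drawing X} → D ↭ E → Mixed D → Mixed E
  mixed-↭ p (a , b) = ∈-resp-↭ (Permₚ.map⁺ _ p) a , ∈-resp-↭ (Permₚ.map⁺ _ p) b

  valid-rot : ∀ d {D} → Valid D → Valid (rot d D)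
  valid-rot d {D} (u , m) = Unique-↭ (labels-↭ (↭-sym (rot-↭ d D))) u , mixed-↭ (↭-sym (rot-↭ d D)) m

  valid-flip : ∀ {v : X} {D D'} → Flip v D D' → Valid D → Valid D'
  valid-flip fl (u , m) = Unique-↭ (flip-labels fl) u , flip-mixed fl m

  orientations-turn : ∀ y D → orientations (turn y D) ≡ map not (orientations D)
  orientations-turn y [] = refl
  orientations-turn y (_ ∷ D) = cong (_ ∷_) (orientations-turn y D)

  valid-reflect : ∀ {D} → Valid D → Valid (reflect D)
  valid-reflect {[]} v = v
  valid-reflect {D@((x , _) ∷ _)} (u , (a , b)) = Unique-↭ (↭-sym (labels-reflect D)) u ,
    mixed-↭ (↭-sym (↭-reverse (turn x D))) (subst (true ∈_) (sym (orientations-turn x D)) (∈-map⁺ not b) , subst (false ∈_) (sym (orientations-turn x D)) (∈-map⁺ not a))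

  map-rot : ∀ {A B : Set} (f : A → B) d w → map f (rot d w) ≡ rot d (map f w)
  map-rot f zero w = refl
  map-rot f (suc d) [] = map-rot f d []
  map-rot f (suc d) (x ∷ w) = trans (map-rot f d (w ++ [ x ])) (cong (rot d) (map-++ f w [ x ]))

  shape-reflect : ∀ D → shape (reflect D) ≡ mirror (shape D)
  shape-reflect [] = refl
  shape-reflect D@((x , _) ∷ _) = trans (reverse-map _ (turn x D)) (cong reverse (shape-turn x D))
    where
    shape-turn : ∀ y D → shape (turn y D) ≡ map flip (shape D)
    shape-turn y [] = refl
    shape-turn y (_ ∷ D) = cong (_ ∷_) (shape-turn y D)

  ≋⇒dihedral : ∀ {D E} → D ≋ E → shape E ∈ dihedral (shape D)
  ≋⇒dihedral {D} (d , inj₁ refl) = ∈-++⁺ˡ (subst (_∈ rots (shape D)) (sym (map-rot _ d D)) (rot∈rots d (shape D)))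
  ≋⇒dihedral {D} (d , inj₂ refl) = ∈-++⁺ʳ (rots (shape D)) (subst (_∈ rots (mirror (shape D)))
    (sym (trans (map-rot _ d (reflect D)) (cong (rot d) (shape-reflect D)))) (rot∈rots d (mirror (shape D))))

  tree-position : ∀ {v : X} t → v ∈ names t → (∃ λ l → ∃ λ r → t ≡ node v l r) ⊎ ∃ (TreeFlip v t)
  tree-position (node z l r) (here refl) = inj₁ (l , r , refl)
  tree-position (node z l r) (there v∈) with ∈-++⁻ (names l) v∈
  ... | inj₁ v∈l with tree-position l v∈l
  ... | inj₁ (p , q , refl) = inj₂ (_ , rotˡ z p q r)
  ... | inj₂ (l' , f) = inj₂ (_ , inˡ z r f)
  tree-position (node z l r) (there v∈) | inj₂ v∈r with tree-position r v∈r
  ... | inj₁ (p , q , refl) = inj₂ (_ , rotʳ z l p q)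
  ... | inj₂ (r' , f) = inj₂ (_ , inʳ z l f)

  bead-position : ∀ {v : X} D → v ∈ labels D → ∃ λ d → ∃ λ x → ∃ λ b → ∃ λ t → ∃ λ E → rot d D ≡ (x , b , t) ∷ E × (v ≡ x ⊎ v ∈ names t)
  bead-position {v} D v∈ = let as , x , b , t , bs , eq , pos = go D v∈ in
      length as , x , b , t , bs ++ as , trans (cong (rot (length as)) eq) (rot-++ as ((x , b , t) ∷ bs)) , pos
    where
    go : ∀ D → v ∈ labels D → ∃ λ as → ∃ λ x → ∃ λ b → ∃ λ t → ∃ λ bs → D ≡ as ++ (x , b , t) ∷ bs × (v ≡ x ⊎ v ∈ names t)
    go ((x , b , t) ∷ D) (here refl) = [] , x , b , t , D , refl , inj₁ refl
    go ((x , b , t) ∷ D) (there v∈) with ∈-++⁻ (names t) v∈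
    ... | inj₁ v∈t = [] , x , b , t , D , refl , inj₂ v∈t
    ... | inj₂ v∈D = let as , y , c , s , bs , eq , pos = go D v∈D in (x , b , t) ∷ as , y , c , s , bs , cong ((x , b , t) ∷_) eq , pos

  node≡join : ∀ b (v : X) l r → ∃ λ t → ∃ λ t' → node v l r ≡ join b v t t'
  node≡join true v l r = r , l , refl
  node≡join false v l r = l , r , refl

  unsnoc : ∀ (β : Bead X) E → ∃ λ F → ∃ λ γ → β ∷ E ≡ F ++ [ γ ]
  unsnoc β [] = [] , β , refl
  unsnoc β (γ ∷ E) = let F , γ' , eq = unsnoc γ E in β ∷ F , γ' , cong (β ∷_) eq

  vertex-second : ∀ (β γ : Bead X) F → rot (length (β ∷ F)) (β ∷ (F ++ [ γ ])) ≡ γ ∷ β ∷ F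
  vertex-second β γ F = rot-++ (β ∷ F) [ γ ]

  flip-at : ∀ {v : X} {A B B'} → A ≡ B → Flip v B B' → ∃ (Flip v A)
  flip-at refl fl = _ , fl

  -- Every diagonal can be flipped: the root of a tree splits its bead, a deeper node is rotated
  -- with its parent, and a cycle vertex is merged or swapped according to the two base arrows at
  -- it.
  flip-exists : ∀ {v : X} D → Mixed D → v ∈ labels D → ∃ λ d → ∃ (Flip v (rot d D))
  flip-exists {v} D m v∈ with bead-position D v∈
  ... | d , x , b , t , E , eq , inj₂ v∈t with tree-position t v∈t
  ... | inj₁ (l , r , refl) = let s , s' , j = node≡join b v l r in
            d , flip-at (trans eq (cong (λ z → (x , b , z) ∷ E) j)) (split x b s s' E)
  ... | inj₂ (t' , f) = d , flip-at eq (inner x b E f)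
  flip-exists {v} D m v∈ | d , _ , b , t , E , eq , inj₁ refl with mixed-tail {β = v , b , t} {D = E} (subst Mixed eq (mixed-↭ (↭-sym (rot-↭ d D)) m))
  -- The last bead precedes v on the cycle. Rotating it to the front puts v in second place, where
  -- `Flip` expects it.
  ... | β , E' , refl with unsnoc β E'
  ... | F , (x , c , s) , eq' = d + e , by-orientation (c Bool.≟ b)
    where
    e = length ((v , b , t) ∷ F)
    position : rot (d + e) D ≡ (x , c , s) ∷ (v , b , t) ∷ F
    position = trans (rot-+ d e D) (trans (cong (rot e) (trans eq (cong ((v , b , t) ∷_) eq'))) (vertex-second (v , b , t) (x , c , s) F))
    ≢⇒not : ∀ {c b} → c ≢ b → b ≡ not c
    ≢⇒not {true} {true} c≢b = contradiction refl c≢b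
    ≢⇒not {true} {false} c≢b = refl
    ≢⇒not {false} {true} c≢b = refl
    ≢⇒not {false} {false} c≢b = contradiction refl c≢b
    by-orientation : Dec (c ≡ b) → ∃ (Flip v (rot (d + e) D))
    by-orientation (yes refl) = flip-at position (merge x c s t F)
    by-orientation (no c≢b) = flip-at (trans position (cong (λ z → (x , c , s) ∷ (v , z , t) ∷ F) (≢⇒not c≢b))) (swap x c s t F)

-- Bare cycles recognised from their matrices

sign : Bool → ℤ
sign true = ℤ.+ 1
sign false = ℤ.-[1+ 0 ]

sign-≢0 : ∀ b → sign b ≢ ℤ.+ 0
sign-≢0 true ()
sign-≢0 false ()

sign-injective : ∀ b c → sign b ≡ sign c → b ≡ c
sign-injective true true _ = refl
sign-injective false false _ = refl
sign-injective true false ()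
sign-injective false true ()

sign-neg : ∀ b → ℤ.- sign b ≡ sign (not b)
sign-neg true = refl
sign-neg false = refl

sign-double : ∀ b c → sign b ⊞ sign b ≢ sign c
sign-double true true ()
sign-double true false ()
sign-double false true ()
sign-double false false ()

sign-double-≢0 : ∀ b → sign b ⊞ sign b ≢ ℤ.+ 0
sign-double-≢0 true ()
sign-double-≢0 false ()

sign-double-injective : ∀ b c → sign b ⊞ sign b ≡ sign c ⊞ sign c → b ≡ c
sign-double-injective true true _ = refl
sign-double-injective false false _ = refl
sign-double-injective true false ()
sign-double-injective false true ()

reflect-second : ∀ {X : Set} (x z : X) b b' t t' E → rot (length E) (reflect ((x , b , t) ∷ (z , b' , t') ∷ E)) ≡
  (next E x , not b' , t') ∷ (z , not b , t) ∷ reverse (turn x E)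
reflect-second x z b b' t t' E = trans (cong₂ rot (sym (trans (length-reverse (turn x E)) (length-turn E))) (trans
    (reverse-++ ((z , not b , t) ∷ (next E x , not b' , t') ∷ []) (turn x E)) refl))
  (rot-++ (reverse (turn x E)) ((next E x , not b' , t') ∷ (z , not b , t) ∷ []))
  where
  length-turn : ∀ E → length (turn x E) ≡ length E
  length-turn [] = refl
  length-turn (_ ∷ E) = cong suc (length-turn E)

module _ {n : ℕ} where

  private
    Vert = Fin n
    i : Maybe Vert → Vert → ℤ
    i = indicator

    i-≢ : ∀ {x y : Vert} → x ≢ y → i (just x) y ≡ ℤ.+ 0
    i-≢ x≢y = indicator-≢ (x≢y ∘ just-injective)

    i-∉ : ∀ {y : Vert} t → y ∉ names t → i (top t) y ≡ ℤ.+ 0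
    i-∉ t y∉ = indicator-≢ (top-∉ t y∉)

  -- The base triangles before and after v are the only cells at a cycle vertex, so its row is
  -- supported on their other corners.
  vertex-form : ∀ {p v : Vert} {b b' t t' E} → Unique (labels ((p , b , t) ∷ (v , b' , t') ∷ E)) → ∀ w →
    ⟦ (p , b , t) ∷ (v , b' , t') ∷ E ⟧ v w ≡
    sign b ⊠ (i (top t) w ⊟ i (just p) w) ⊞ sign b' ⊠ (i (just (next E p)) w ⊟ i (top t') w)
  vertex-form {p} {v} {b} {b'} {t} {t'} {E} u w = trans (expand b b' v w)
      (trans (cong₂ (λ z r → (z ⊞ cellForm (baseCell v y b' t') v w) ⊞ r) (first b) (form-avoid avoid w))
      (trans (ℤₚ.+-identityʳ _) (cong (λ z → sign b ⊠ (i (top t) w ⊟ i (just p) w) ⊞ z) (second b'))))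
    where
    open TwoBeads {x = p} {v} {t} {t'} {E} u
    first : ∀ b → cellForm (baseCell p v b t) v w ≡ sign b ⊠ (i (top t) w ⊟ i (just p) w)
    first true = trans (cellForm-rotate (just p) (just v) (top t) v w) (trans (cellForm-at v (top t) (just p) w (top-∉ t v∉t) (x≢v ∘ just-injective)) (sym (ℤₚ.*-identityˡ _)))
    first false = trans (cellForm-at v (just p) (top t) w (x≢v ∘ just-injective) (top-∉ t v∉t)) (neg (i (just p) w) (i (top t) w))
      where
      neg : ∀ a b → a ⊟ b ≡ ℤ.-[1+ 0 ] ⊠ (b ⊟ a)
      neg = ℤ-Ring.solve-∀
    second : ∀ b' → cellForm (baseCell v y b' t') v w ≡ sign b' ⊠ (i (just y) w ⊟ i (top t') w)
    second true = trans (cellForm-at v (just y) (top t') w (y≢v ∘ just-injective) (top-∉ t' v∉t')) (sym (ℤₚ.*-identityˡ _))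
    second false = trans (cellForm-rotate (just y) (just v) (top t') v w) (trans (cellForm-at v (top t') (just y) w (top-∉ t' v∉t') (y≢v ∘ just-injective)) (neg (i (top t') w) (i (just y) w)))
      where
      neg : ∀ a b → a ⊟ b ≡ ℤ.-[1+ 0 ] ⊠ (b ⊟ a)
      neg = ℤ-Ring.solve-∀

  module RootBead {x z : Vert} {b l r E} (u : Unique (labels ((x , b , node z l r) ∷ E))) where
    private
      x∉ = head∉tail u
      uz = AllPairs.tail u
      z∉ = head∉tail uz
      ulr = Unique-++⁻ (names l ++ names r) (AllPairs.tail uz)
    x≢z : x ≢ z
    x≢z refl = x∉ (here refl)
    x∉l : x ∉ names l
    x∉l q = x∉ (there (∈-++⁺ˡ (∈-++⁺ˡ q)))
    x∉r : x ∉ names r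
    x∉r q = x∉ (there (∈-++⁺ˡ (∈-++⁺ʳ (names l) q)))
    x∉E : x ∉ labels E
    x∉E q = x∉ (there (∈-++⁺ʳ (names l ++ names r) q))
    z∉l : z ∉ names l
    z∉l q = z∉ (∈-++⁺ˡ (∈-++⁺ˡ q))
    z∉r : z ∉ names r
    z∉r q = z∉ (∈-++⁺ˡ (∈-++⁺ʳ (names l) q))
    z∉E : z ∉ labels E
    z∉E q = z∉ (∈-++⁺ʳ (names l ++ names r) q)
    lr#E : ∀ {v} → v ∈ names l ++ names r → v ∉ labels E
    lr#E = proj₂ (proj₂ ulr)
    y = next E x
    y≢z : y ≢ z
    y≢z = next-≢ E z∉E x≢z
    avoid : All (Avoids z) ((cells l ++ cells r) ++ path E x)
    avoid = Allₚ.++⁺ (Allₚ.++⁺ (cells-avoid l z∉l) (cells-avoid r z∉r)) (path-avoid E z∉E x≢z)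
    row : ∀ w → ⟦ (x , b , node z l r) ∷ E ⟧ z w ≡ sign b ⊠ (i (just x) w ⊟ i (just y) w) ⊞ (i (top l) w ⊟ i (top r) w)
    row w = cong₂ _⊞_ (base b) (trans (cong₂ _⊞_ (cellForm-at z (top l) (top r) w (top-∉ l z∉l) (top-∉ r z∉r)) (form-avoid avoid w)) (ℤₚ.+-identityʳ _))
      where
      base : ∀ b → cellForm (baseCell x y b (node z l r)) z w ≡ sign b ⊠ (i (just x) w ⊟ i (just y) w)
      base true = trans (cellForm-rotate (just x) (just y) (just z) z w) (trans (cellForm-rotate (just y) (just z) (just x) z w)
        (trans (cellForm-at z (just x) (just y) w (x≢z ∘ just-injective) (y≢z ∘ just-injective)) (sym (ℤₚ.*-identityˡ _))))
      base false = trans (cellForm-rotate (just y) (just x) (just z) z w) (trans (cellForm-rotate (just x) (just z) (just y) z w)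
        (trans (cellForm-at z (just y) (just x) w (y≢z ∘ just-injective) (x≢z ∘ just-injective)) (neg (i (just y) w) (i (just x) w))))
        where
        neg : ∀ a b → a ⊟ b ≡ ℤ.-[1+ 0 ] ⊠ (b ⊟ a)
        neg = ℤ-Ring.solve-∀

  minus-cancel : ∀ a b c → a ⊟ c ≡ b ⊟ c → a ≡ b
  minus-cancel a b c eq = trans (sym (ring a c)) (trans (cong (_⊞ c) eq) (ring b c))
    where
    ring : ∀ a c → (a ⊟ c) ⊞ c ≡ a
    ring = ℤ-Ring.solve-∀

  LeafBead : Bead Vert → Set
  LeafBead (_ , _ , t) = t ≡ leaf

  leaf-row : ∀ {p v : Vert} {c c' E} → Unique (labels ((p , c , leaf) ∷ (v , c' , leaf) ∷ E)) → ∀ w →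
    ⟦ (p , c , leaf) ∷ (v , c' , leaf) ∷ E ⟧ v w ≡ sign c' ⊠ i (just (next E p)) w ⊟ sign c ⊠ i (just p) w
  leaf-row {p} {v} {c} {c'} {E} u w = trans (vertex-form {p} {v} {c} {c'} {leaf} {leaf} {E} u w) (ring (sign c) (sign c') (i (just p) w) (i (just (next E p)) w))
    where
    ring : ∀ c c' p q → c ⊠ (ℤ.+ 0 ⊟ p) ⊞ c' ⊠ (q ⊟ ℤ.+ 0) ≡ c' ⊠ q ⊟ c ⊠ p
    ring = ℤ-Ring.solve-∀

  module BareRow {c c' : Bool} {p q w : Vert} where
    private
      Row = sign c' ⊠ i (just q) w ⊟ sign c ⊠ i (just p) w
      value : ∀ {a b} → i (just q) w ≡ a → i (just p) w ≡ b → Row ≡ sign c' ⊠ a ⊟ sign c ⊠ b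
      value = cong₂ (λ a b → sign c' ⊠ a ⊟ sign c ⊠ b)
      at-w : ∀ {v} → v ≡ w → i (just v) w ≡ ℤ.+ 1
      at-w refl = indicator-refl w

    row00 : q ≢ w → p ≢ w → Row ≡ ℤ.+ 0
    row00 q≢ p≢ = trans (value (i-≢ q≢) (i-≢ p≢)) (ring (sign c) (sign c'))
      where
      ring : ∀ s s' → s' ⊠ ℤ.+ 0 ⊟ s ⊠ ℤ.+ 0 ≡ ℤ.+ 0
      ring = ℤ-Ring.solve-∀
    row10 : q ≡ w → p ≢ w → Row ≡ sign c'
    row10 q≡ p≢ = trans (value (at-w q≡) (i-≢ p≢)) (ring (sign c) (sign c'))
      where
      ring : ∀ s s' → s' ⊠ ℤ.+ 1 ⊟ s ⊠ ℤ.+ 0 ≡ s'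
      ring = ℤ-Ring.solve-∀
    row01 : q ≢ w → p ≡ w → Row ≡ sign (not c)
    row01 q≢ p≡ = trans (value (i-≢ q≢) (at-w p≡)) (trans (ring (sign c) (sign c')) (sign-neg c))
      where
      ring : ∀ s s' → s' ⊠ ℤ.+ 0 ⊟ s ⊠ ℤ.+ 1 ≡ ℤ.- s
      ring = ℤ-Ring.solve-∀
    row11 : q ≡ w → p ≡ w → Row ≡ sign c' ⊞ sign (not c)
    row11 q≡ p≡ = trans (value (at-w q≡) (at-w p≡)) (trans (ring (sign c) (sign c')) (cong (λ e → sign c' ⊞ e) (sign-neg c)))
      where
      ring : ∀ s s' → s' ⊠ ℤ.+ 1 ⊟ s ⊠ ℤ.+ 1 ≡ s' ⊞ ℤ.- s
      ring = ℤ-Ring.solve-∀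

  mixed-two : ∀ {X : Set} {β γ : Bead X} → Mixed (β ∷ γ ∷ []) → proj₁ (proj₂ γ) ≡ not (proj₁ (proj₂ β))
  mixed-two {β = _ , true , _} {_ , true , _} (_ , here ())
  mixed-two {β = _ , true , _} {_ , true , _} (_ , there (here ()))
  mixed-two {β = _ , true , _} {_ , false , _} _ = refl
  mixed-two {β = _ , false , _} {_ , true , _} _ = refl
  mixed-two {β = _ , false , _} {_ , false , _} (here () , _)
  mixed-two {β = _ , false , _} {_ , false , _} (there (here ()) , _)

  mixed-three : ∀ {X : Set} {x y z : X} {t t' t'' : Tree X} {b} → ¬ Mixed ((x , b , t) ∷ (y , b , t') ∷ (z , b , t'') ∷ [])
  mixed-three {b = true} (_ , here ())
  mixed-three {b = true} (_ , there (here ()))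
  mixed-three {b = true} (_ , there (there (here ())))
  mixed-three {b = false} (here () , _)
  mixed-three {b = false} (there (here ()) , _)
  mixed-three {b = false} (there (there (here ())) , _)

  -- The base arrow x y below a nonempty tree is not cancelled.
  base-arrow : ∀ {x z : Vert} {b l r E} → Valid ((x , b , node z l r) ∷ E) →
    let f = ⟦ (x , b , node z l r) ∷ E ⟧ x (next E x) in f ≡ sign b ⊎ f ≡ sign b ⊞ sign b
  base-arrow {x} {z} {b} {l} {r} {E} val@(u , m) with mixed-tail {β = x , b , node z l r} {D = E} m
  ... | β , E' , refl with unsnoc β E'
  ... | F , (p , c , t) , eq = by-cases F val′ y≡ value (p Fin.≟ y)
    where
    N = node z l r
    d = length ((x , b , N) ∷ F)
    y = proj₁ β
    position : rot d ((x , b , N) ∷ β ∷ E') ≡ (p , c , t) ∷ (x , b , N) ∷ F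
    position = trans (cong (λ D → rot d ((x , b , N) ∷ D)) eq) (vertex-second (x , b , N) (p , c , t) F)
    val′ : Valid ((p , c , t) ∷ (x , b , N) ∷ F)
    val′ = subst Valid position (valid-rot d val)
    open TwoBeads {x = p} {x} {t} {N} {F} (proj₁ val′) using (y∉t; y∉t')
    y≡ : next F p ≡ y
    y≡ = sym (trans (cong (λ D → next D x) eq) (next-++ F [ p , c , t ] x))
    f = ⟦ (x , b , N) ∷ β ∷ E' ⟧ x y
    value : f ≡ sign b ⊟ sign c ⊠ i (just p) y
    value = trans (sym (form-↭ (triangles-rot d ((x , b , N) ∷ β ∷ E')) x y)) (trans (cong (λ D → ⟦ D ⟧ x y) position)
      (trans (vertex-form {p} {x} {c} {b} {t} {N} {F} (proj₁ val′) y)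
      (trans (cong₂ (λ a e → sign c ⊠ (a ⊟ i (just p) y) ⊞ sign b ⊠ (i (just (next F p)) y ⊟ e))
               (i-∉ t (subst (_∉ names t) y≡ y∉t)) (i-≢ {z} {y} (λ z≡y → y∉t' (here (trans y≡ (sym z≡y))))))
      (trans (cong (λ e → sign c ⊠ (ℤ.+ 0 ⊟ i (just p) y) ⊞ sign b ⊠ (e ⊟ ℤ.+ 0)) (trans (cong (λ e → i (just e) y) y≡) (indicator-refl y)))
             (ring (sign c) (sign b) (i (just p) y))))))
      where
      ring : ∀ c b e → c ⊠ (ℤ.+ 0 ⊟ e) ⊞ b ⊠ (ℤ.+ 1 ⊟ ℤ.+ 0) ≡ b ⊟ c ⊠ e
      ring = ℤ-Ring.solve-∀
    by-cases : ∀ F → Valid ((p , c , t) ∷ (x , b , N) ∷ F) → next F p ≡ y → f ≡ sign b ⊟ sign c ⊠ i (just p) y → Dec (p ≡ y) → f ≡ sign b ⊎ f ≡ sign b ⊞ sign b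
    by-cases F _ _ val (no p≢y) = inj₁ (trans val (trans (cong (λ e → sign b ⊟ sign c ⊠ e) (i-≢ p≢y)) (ring (sign b) (sign c))))
      where
      ring : ∀ b c → b ⊟ c ⊠ ℤ.+ 0 ≡ b
      ring = ℤ-Ring.solve-∀
    by-cases [] (_ , m′) _ val (yes refl) = inj₂ (trans val (trans (cong (λ e → sign b ⊟ sign c ⊠ e) (indicator-refl p))
      (cong (λ e → sign b ⊞ e) (trans (cong ℤ.-_ (ℤₚ.*-identityʳ (sign c))) (trans (sign-neg c) (cong sign (sym (mixed-two {β = p , c , t} {γ = x , b , N} m′))))))))
    by-cases (γ ∷ F′) (u′ , _) y≡ val (yes refl) = contradiction (here (sym y≡)) (TwoBeads.x∉D {x = p} {x} {t} {N} {γ ∷ F′} u′)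

  -- A triangle with a tree on it would be an oriented 3-cycle, which a non-oriented cycle does not contain.
  no-tree : ∀ {p c z c' E₁ x b l r E₂} → Valid ((p , c , leaf) ∷ (z , c' , leaf) ∷ E₁) → All LeafBead E₁ → Valid ((x , b , node z l r) ∷ E₂) →
    (∀ v w → ⟦ (p , c , leaf) ∷ (z , c' , leaf) ∷ E₁ ⟧ v w ≡ ⟦ (x , b , node z l r) ∷ E₂ ⟧ v w) → ⊥
  no-tree {p} {c} {z} {c'} {E₁} {x} {b} {l} {r} {E₂} valA@(uA , mA) leavesE₁ valB@(uB , mB) same =
      by-cases (q Fin.≟ x) (p Fin.≟ x) (q Fin.≟ y) (p Fin.≟ y)
    where
    A = (p , c , leaf) ∷ (z , c' , leaf) ∷ E₁
    B = (x , b , node z l r) ∷ E₂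
    open RootBead {x} {z} {b} {l} {r} {E₂} uB using (y; x∉l; x∉r; x∉E; lr#E; row)
    open BareRow
    q = next E₁ p
    tail = mixed-tail {β = x , b , node z l r} {D = E₂} mB
    y≢x : y ≢ x
    y≢x = next-∷-≢ (proj₁ tail) (proj₁ (proj₂ tail)) (proj₂ (proj₂ tail)) x∉E
    y∈E : y ∈ labels E₂
    y∈E = subst (λ D → next D x ∈ labels D) (sym (proj₂ (proj₂ tail))) (here refl)
    y∉l : y ∉ names l
    y∉l y∈ = lr#E (∈-++⁺ˡ y∈) y∈E
    y∉r : y ∉ names r
    y∉r y∈ = lr#E (∈-++⁺ʳ (names l) y∈) y∈E
    rowA : ∀ w → sign c' ⊠ i (just q) w ⊟ sign c ⊠ i (just p) w ≡ ⟦ B ⟧ z w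
    rowA w = trans (sym (leaf-row {p} {z} {c} {c'} {E₁} uA w)) (same z w)
    zx : ⟦ B ⟧ z x ≡ sign b
    zx = trans (row x) (trans (cong₂ (λ a e → sign b ⊠ (a ⊟ i (just y) x) ⊞ e) (indicator-refl x) (cong₂ _⊟_ (i-∉ l x∉l) (i-∉ r x∉r)))
      (trans (cong (λ a → sign b ⊠ (ℤ.+ 1 ⊟ a) ⊞ (ℤ.+ 0 ⊟ ℤ.+ 0)) (i-≢ y≢x)) (ring (sign b))))
      where
      ring : ∀ b → b ⊠ (ℤ.+ 1 ⊟ ℤ.+ 0) ⊞ (ℤ.+ 0 ⊟ ℤ.+ 0) ≡ b
      ring = ℤ-Ring.solve-∀
    zy : ⟦ B ⟧ z y ≡ sign (not b)
    zy = trans (row y) (trans (cong₂ (λ a e → sign b ⊠ (i (just x) y ⊟ a) ⊞ e) (indicator-refl y) (cong₂ _⊟_ (i-∉ l y∉l) (i-∉ r y∉r)))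
      (trans (cong (λ a → sign b ⊠ (a ⊟ ℤ.+ 1) ⊞ (ℤ.+ 0 ⊟ ℤ.+ 0)) (i-≢ (y≢x ∘ sym))) (trans (ring (sign b)) (sign-neg b))))
      where
      ring : ∀ b → b ⊠ (ℤ.+ 0 ⊟ ℤ.+ 1) ⊞ (ℤ.+ 0 ⊟ ℤ.+ 0) ≡ ℤ.- b
      ring = ℤ-Ring.solve-∀
    none : ∀ {w e} → q ≢ w → p ≢ w → ⟦ B ⟧ z w ≡ sign e → ⊥
    none {w} {e} q≢ p≢ val = sign-≢0 e (trans (sym val) (trans (sym (rowA w)) (row00 {c} {c'} q≢ p≢)))
    atq : ∀ {w e} → q ≡ w → p ≢ w → ⟦ B ⟧ z w ≡ sign e → c' ≡ e
    atq {w} {e} q≡ p≢ val = sign-injective c' e (trans (sym (row10 {c} {c'} q≡ p≢)) (trans (rowA w) val))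
    atp : ∀ {w e} → q ≢ w → p ≡ w → ⟦ B ⟧ z w ≡ sign e → not c ≡ e
    atp {w} {e} q≢ p≡ val = sign-injective (not c) e (trans (sym (row01 {c} {c'} q≢ p≡)) (trans (rowA w) val))
    -- In a bare cycle two different neighbours q and p of z are joined only if the cycle has length
    -- three.
    third : ∀ E₁ → Valid ((p , c , leaf) ∷ (z , c' , leaf) ∷ E₁) → All LeafBead E₁ → next E₁ p ≢ p →
      ⟦ (p , c , leaf) ∷ (z , c' , leaf) ∷ E₁ ⟧ (next E₁ p) p ≡ ℤ.+ 0 ⊎
      ∃ λ c'' → E₁ ≡ (next E₁ p , c'' , leaf) ∷ [] × ⟦ (p , c , leaf) ∷ (z , c' , leaf) ∷ E₁ ⟧ (next E₁ p) p ≡ sign c''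
    third [] _ _ q≢p = contradiction refl q≢p
    third ((q , c'' , leaf) ∷ E') val@(u , _) (refl ∷ _) q≢p = last E' refl
      where
      D = (p , c , leaf) ∷ (z , c' , leaf) ∷ (q , c'' , leaf) ∷ E'
      z≢p : z ≢ p
      z≢p refl = head∉tail u (here refl)
      entry : ⟦ D ⟧ q p ≡ sign c'' ⊠ i (just (next (E' ++ [ p , c , leaf ]) z)) p ⊟ sign c' ⊠ i (just z) p
      entry = trans (sym (form-↭ (triangles-rot 1 D) q p)) (leaf-row {z} {q} {c'} {c''} {E' ++ [ p , c , leaf ]} (proj₁ (valid-rot 1 {D} val)) p)
      last : ∀ E″ → E″ ≡ E' → ⟦ D ⟧ q p ≡ ℤ.+ 0 ⊎ ∃ λ e → (q , c'' , leaf) ∷ E' ≡ (q , e , leaf) ∷ [] × ⟦ D ⟧ q p ≡ sign e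
      last [] refl = inj₂ (c'' , refl , trans entry (row10 {c'} {c''} refl z≢p))
      last ((e , _) ∷ _) refl = inj₁ (trans entry (row00 {c'} {c''} {z} {e} (λ { refl → head∉tail u (there (there (here refl))) }) z≢p))
    finish : ∀ e → c ≡ e → c' ≡ e → q ≢ p → (⟦ A ⟧ q p ≡ sign e ⊎ ⟦ A ⟧ q p ≡ sign e ⊞ sign e) → ⊥
    finish e c≡ c'≡ q≢p side = contradict (third E₁ valA leavesE₁ q≢p) side
      where
      contradict : ⟦ A ⟧ q p ≡ ℤ.+ 0 ⊎ (∃ λ c'' → E₁ ≡ (q , c'' , leaf) ∷ [] × ⟦ A ⟧ q p ≡ sign c'') →
        ⟦ A ⟧ q p ≡ sign e ⊎ ⟦ A ⟧ q p ≡ sign e ⊞ sign e → ⊥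
      contradict (inj₁ none′) (inj₁ once) = sign-≢0 e (trans (sym once) none′)
      contradict (inj₁ none′) (inj₂ twice) = sign-double-≢0 e (trans (sym twice) none′)
      contradict (inj₂ (c'' , E≡ , val)) (inj₂ twice) = sign-double e c'' (trans (sym twice) val)
      contradict (inj₂ (c'' , E≡ , val)) (inj₁ once) = mixed-three {x = p} {z} {q} {leaf} {leaf} {leaf} {e} (subst Mixed
        (trans (cong (λ E → (p , c , leaf) ∷ (z , c' , leaf) ∷ E) E≡) (cong₂ (λ a d → (p , a , leaf) ∷ (z , proj₁ d , leaf) ∷ (q , proj₂ d , leaf) ∷ []) c≡ (cong₂ _,_ c'≡ (sign-injective c'' e (trans (sym val) once))))) mA)
    neg-double : ∀ b → ℤ.- (sign b ⊞ sign b) ≡ sign (not b) ⊞ sign (not b)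
    neg-double true = refl
    neg-double false = refl
    -- The row of z is nonzero at x and at y in B, but supported on p and q in A; so the two pairs
    -- agree. The base arrow between x and y then has to close A to a triangle of three equal
    -- orientations, which a mixed cycle cannot be.
    by-cases : Dec (q ≡ x) → Dec (p ≡ x) → Dec (q ≡ y) → Dec (p ≡ y) → ⊥
    by-cases (no q≢x) (no p≢x) _ _ = none {x} {b} q≢x p≢x zx
    by-cases (yes refl) _ _ (no p≢y) = none {y} {not b} (y≢x ∘ sym) p≢y zy
    by-cases (yes q≡x) _ _ (yes p≡y) = finish b (trans (sym (not-involutive c)) (trans (cong not (atp {y} {not b} q≢y p≡y zy)) (not-involutive b))) (atq {x} {b} q≡x p≢x zx)
        (λ q≡p → q≢y (trans q≡p p≡y)) (subst₂ (λ a e → ⟦ A ⟧ a e ≡ sign b ⊎ ⟦ A ⟧ a e ≡ sign b ⊞ sign b) (sym q≡x) (sym p≡y)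
          (subst (λ f → f ≡ sign b ⊎ f ≡ sign b ⊞ sign b) (sym (same x y)) (base-arrow {x} {z} {b} {l} {r} {E₂} valB)))
      where
      q≢y : q ≢ y
      q≢y q≡y = y≢x (trans (sym q≡y) q≡x)
      p≢x : p ≢ x
      p≢x p≡x = y≢x (trans (sym p≡y) p≡x)
    by-cases (no q≢x) (yes refl) (no q≢y) _ = none {y} {not b} q≢y (y≢x ∘ sym) zy
    by-cases (no q≢x) (yes p≡x) (yes q≡y) _ = finish (not b) (trans (sym (not-involutive c)) (cong not (atp {x} {b} q≢x p≡x zx))) (atq {y} {not b} q≡y p≢y zy)
        (λ q≡p → q≢x (trans q≡p p≡x)) (subst₂ (λ a e → ⟦ A ⟧ a e ≡ sign (not b) ⊎ ⟦ A ⟧ a e ≡ sign (not b) ⊞ sign (not b)) (sym q≡y) (sym p≡x)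
          (subst (λ f → f ≡ sign (not b) ⊎ f ≡ sign (not b) ⊞ sign (not b)) (sym (trans (same y x) (form-skew (triangles B) y x)))
            (negate (base-arrow {x} {z} {b} {l} {r} {E₂} valB))))
      where
      p≢y : p ≢ y
      p≢y p≡y = y≢x (trans (sym p≡y) p≡x)
      negate : ∀ {f} → f ≡ sign b ⊎ f ≡ sign b ⊞ sign b → ℤ.- f ≡ sign (not b) ⊎ ℤ.- f ≡ sign (not b) ⊞ sign (not b)
      negate (inj₁ refl) = inj₁ (sign-neg b)
      negate (inj₂ refl) = inj₂ (neg-double b)

  head∈ : ∀ (pre : Drawing Vert) u → next pre (proj₁ u) ∈ labels (pre ++ [ u ])
  head∈ [] u = here refl
  head∈ (_ ∷ _) u = here refl

  -- Two bare cycles that agree up to u continue in the same way: the row of the next vertex has only one entry off u.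
  walk : ∀ (pre : Drawing Vert) u b E₁ E₂ → All LeafBead E₁ → All LeafBead E₂ →
    Unique (labels (pre ++ (u , b , leaf) ∷ E₁)) → Unique (labels (pre ++ (u , b , leaf) ∷ E₂)) →
    (∀ v w → ⟦ pre ++ (u , b , leaf) ∷ E₁ ⟧ v w ≡ ⟦ pre ++ (u , b , leaf) ∷ E₂ ⟧ v w) →
    next E₁ (next pre u) ≡ next E₂ (next pre u) → E₁ ≡ E₂
  walk pre u b [] [] _ _ _ _ _ _ = refl
  walk pre u b [] (γ ∷ E₂) _ _ _ u₂ _ eq = contradiction (here eq) (disjoint (head∈ pre (u , b , leaf)))
    where
    disjoint = proj₂ (proj₂ (Unique-++⁻ (labels (pre ++ [ u , b , leaf ])) (subst Unique (trans (cong labels (sym (++-assoc pre [ u , b , leaf ] (γ ∷ E₂)))) (labels-++ (pre ++ [ u , b , leaf ]) (γ ∷ E₂))) u₂)))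
  walk pre u b (γ ∷ E₁) [] _ _ u₁ _ _ eq = contradiction (here (sym eq)) (disjoint (head∈ pre (u , b , leaf)))
    where
    disjoint = proj₂ (proj₂ (Unique-++⁻ (labels (pre ++ [ u , b , leaf ])) (subst Unique (trans (cong labels (sym (++-assoc pre [ u , b , leaf ] (γ ∷ E₁)))) (labels-++ (pre ++ [ u , b , leaf ]) (γ ∷ E₁))) u₁)))
  walk pre u b ((v , b₁ , leaf) ∷ E₁) ((_ , b₂ , leaf) ∷ E₂) (refl ∷ l₁) (refl ∷ l₂) u₁ u₂ same refl = cong₂ (λ c E → (v , c , leaf) ∷ E) b₁≡b₂
      (walk (pre ++ [ u , b , leaf ]) v b₁ E₁ E₂ l₁ l₂ (subst (Unique ∘ labels) (assoc b₁ E₁) u₁) (subst (Unique ∘ labels) (trans (assoc b₂ E₂) (cong (λ c → (pre ++ [ u , b , leaf ]) ++ (v , c , leaf) ∷ E₂) (sym b₁≡b₂))) u₂)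
        (λ x y → trans (cong (λ D → ⟦ D ⟧ x y) (sym (assoc b₁ E₁))) (trans (same x y) (cong (λ D → ⟦ D ⟧ x y) (trans (assoc b₂ E₂) (cong (λ c → (pre ++ [ u , b , leaf ]) ++ (v , c , leaf) ∷ E₂) (sym b₁≡b₂))))))
        (trans (cong (next E₁) (next-++ pre [ u , b , leaf ] v)) (trans q₁≡q₂ (cong (next E₂) (sym (next-++ pre [ u , b , leaf ] v))))))
    where
    assoc : ∀ c E → pre ++ (u , b , leaf) ∷ (v , c , leaf) ∷ E ≡ (pre ++ [ u , b , leaf ]) ++ (v , c , leaf) ∷ E
    assoc c E = sym (++-assoc pre [ u , b , leaf ] ((v , c , leaf) ∷ E))
    h = next pre u
    q₁ = next E₁ h
    q₂ = next E₂ h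
    row : ∀ c E → Unique (labels (pre ++ (u , b , leaf) ∷ (v , c , leaf) ∷ E)) → ∀ w →
      ⟦ pre ++ (u , b , leaf) ∷ (v , c , leaf) ∷ E ⟧ v w ≡ sign c ⊠ i (just (next E h)) w ⊟ sign b ⊠ i (just u) w
    row c E un w = trans (sym (form-↭ (triangles-rot d D) v w)) (trans (cong (λ D → ⟦ D ⟧ v w) position)
      (trans (leaf-row {u} {v} {b} {c} {E ++ pre} (Unique-↭ (labels-↭ (↭-sym (↭-trans (↭-reflexive (sym position)) (rot-↭ d D)))) un) w)
             (cong (λ e → sign c ⊠ i (just e) w ⊟ sign b ⊠ i (just u) w) (next-++ E pre u))))
      where
      D = pre ++ (u , b , leaf) ∷ (v , c , leaf) ∷ E
      d = length pre
      position : rot d D ≡ (u , b , leaf) ∷ (v , c , leaf) ∷ E ++ pre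
      position = rot-++ pre ((u , b , leaf) ∷ (v , c , leaf) ∷ E)
    entries : ∀ w → sign b₁ ⊠ i (just q₁) w ≡ sign b₂ ⊠ i (just q₂) w
    entries w = minus-cancel (sign b₁ ⊠ i (just q₁) w) (sign b₂ ⊠ i (just q₂) w) (sign b ⊠ i (just u) w) (trans (sym (row b₁ E₁ u₁ w)) (trans (same v w) (row b₂ E₂ u₂ w)))
    q₁≡q₂ : q₁ ≡ q₂
    q₁≡q₂ with q₂ Fin.≟ q₁
    ... | yes e = sym e
    ... | no ne = contradiction (trans (sym (ℤₚ.*-identityʳ (sign b₁))) (trans (cong (sign b₁ ⊠_) (sym (indicator-refl q₁))) (trans (entries q₁) (trans (cong (sign b₂ ⊠_) (i-≢ ne)) (ℤₚ.*-zeroʳ (sign b₂)))))) (sign-≢0 b₁)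
    b₁≡b₂ : b₁ ≡ b₂
    b₁≡b₂ = sign-injective b₁ b₂ (trans (sym (ℤₚ.*-identityʳ (sign b₁))) (trans (cong (sign b₁ ⊠_) (sym (indicator-refl q₁)))
      (trans (entries q₁) (trans (cong (λ e → sign b₂ ⊠ i (just e) q₁) (sym q₁≡q₂)) (trans (cong (sign b₂ ⊠_) (indicator-refl q₁)) (ℤₚ.*-identityʳ (sign b₂)))))))

  leaf-turn : ∀ {y : Vert} E → All LeafBead E → All LeafBead (reverse (turn y E))
  leaf-turn {y} E l = All-resp-↭ (↭-sym (↭-reverse (turn y E))) (turned E l)
    where
    turned : ∀ E → All LeafBead E → All LeafBead (turn y E)
    turned [] [] = []
    turned (_ ∷ E) (l ∷ ls) = l ∷ turned E ls

  next-self : ∀ {x : Vert} E → x ∉ labels E → next E x ≡ x → E ≡ []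
  next-self [] _ _ = refl
  next-self (_ ∷ _) x∉ refl = contradiction (here refl) x∉

  -- In both cycles z comes second, and its row shows that p₂ is p or q. In the first case the
  -- cycles are walked in the same direction, in the second after a reflection. Cycles of length two
  -- are told apart by their entries of absolute value 2.
  cycles-rigid : ∀ {p c z c' E₁ p₂ d d' E₂} → Valid ((p , c , leaf) ∷ (z , c' , leaf) ∷ E₁) → All LeafBead E₁ →
    Valid ((p₂ , d , leaf) ∷ (z , d' , leaf) ∷ E₂) → All LeafBead E₂ →
    (∀ v w → ⟦ (p , c , leaf) ∷ (z , c' , leaf) ∷ E₁ ⟧ v w ≡ ⟦ (p₂ , d , leaf) ∷ (z , d' , leaf) ∷ E₂ ⟧ v w) →
    ((p , c , leaf) ∷ (z , c' , leaf) ∷ E₁) ≋ ((p₂ , d , leaf) ∷ (z , d' , leaf) ∷ E₂)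
  cycles-rigid {p} {c} {z} {c'} {E₁} {p₂} {d} {d'} {E₂} valA@(uA , mA) lA valB@(uB , mB) lB same =
      by-cases (q₂ Fin.≟ p₂) (p Fin.≟ p₂) (q Fin.≟ p₂)
    where
    A = (p , c , leaf) ∷ (z , c' , leaf) ∷ E₁
    B = (p₂ , d , leaf) ∷ (z , d' , leaf) ∷ E₂
    q = next E₁ p
    q₂ = next E₂ p₂
    p∉E₁ : p ∉ labels E₁
    p∉E₁ p∈ = head∉tail uA (there p∈)
    p₂∉E₂ : p₂ ∉ labels E₂
    p₂∉E₂ p∈ = head∉tail uB (there p∈)
    row : sign c' ⊠ i (just q) p₂ ⊟ sign c ⊠ i (just p) p₂ ≡ sign d' ⊠ i (just q₂) p₂ ⊟ sign d ⊠ i (just p₂) p₂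
    row = trans (sym (leaf-row {p} {z} {c} {c'} {E₁} uA p₂)) (trans (same z p₂) (leaf-row {p₂} {z} {d} {d'} {E₂} uB p₂))
    closed : ∀ {p c c' E} → Valid ((p , c , leaf) ∷ (z , c' , leaf) ∷ E) → next E p ≡ p → c' ≡ not c
    closed {p} {c} {c'} {E} (u , m) e with refl ← next-self E (λ p∈ → head∉tail u (there p∈)) e = mixed-two {β = p , c , leaf} {γ = z , c' , leaf} m
    open BareRow
    L11 : p ≡ p₂ → q ≡ p₂ → sign c' ⊠ i (just q) p₂ ⊟ sign c ⊠ i (just p) p₂ ≡ sign (not c) ⊞ sign (not c)
    L11 p≡ q≡ = trans (row11 {c} {c'} q≡ p≡) (cong (λ e → sign e ⊞ sign (not c)) (closed {p} {c} {c'} {E₁} valA (trans q≡ (sym p≡))))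
    R0 : q₂ ≢ p₂ → sign d' ⊠ i (just q₂) p₂ ⊟ sign d ⊠ i (just p₂) p₂ ≡ sign (not d)
    R0 q₂≢ = row01 {d} {d'} q₂≢ refl
    R1 : q₂ ≡ p₂ → sign d' ⊠ i (just q₂) p₂ ⊟ sign d ⊠ i (just p₂) p₂ ≡ sign (not d) ⊞ sign (not d)
    R1 q₂≡ = trans (row11 {d} {d'} q₂≡ refl) (cong (λ e → sign e ⊞ sign (not d)) (closed {p₂} {d} {d'} {E₂} valB q₂≡))
    not-injective : ∀ {a b} → not a ≡ not b → a ≡ b
    not-injective {a} {b} e = trans (sym (not-involutive a)) (trans (cong not e) (not-involutive b))
    aligned : p ≡ p₂ → c ≡ d → A ≋ B
    aligned refl refl = 0 , inj₁ (cong ((p , c , leaf) ∷_) (sym (walk [] p c ((z , c' , leaf) ∷ E₁) ((z , d' , leaf) ∷ E₂) (refl ∷ lA) (refl ∷ lB) uA uB same refl)))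
    reversed : q ≡ p₂ → c' ≡ not d → A ≋ B
    reversed refl c'≡ = length E₁ , inj₂ (trans (cong ((q , d , leaf) ∷_) (sym (walk [] q d ((z , not c , leaf) ∷ E'') ((z , d' , leaf) ∷ E₂) (refl ∷ leaf-turn E₁ lA) (refl ∷ lB)
          (proj₁ valA″) uB (λ v w → trans (form-↭ (↭-trans (↭-reflexive (cong triangles (sym A″≡))) (↭-trans (triangles-rot (length E₁) (reflect A)) (triangles-reflect A))) v w) (same v w)) refl))) (sym A″≡))
      where
      E'' = reverse (turn p E₁)
      A″≡ : rot (length E₁) (reflect A) ≡ (q , d , leaf) ∷ (z , not c , leaf) ∷ E''
      A″≡ = trans (reflect-second p z c c' leaf leaf E₁) (cong (λ e → (q , e , leaf) ∷ (z , not c , leaf) ∷ E'') (trans (cong not c'≡) (not-involutive d)))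
      valA″ : Valid ((q , d , leaf) ∷ (z , not c , leaf) ∷ E'')
      valA″ = subst Valid A″≡ (valid-rot (length E₁) (valid-reflect {D = A} valA))
    by-cases : Dec (q₂ ≡ p₂) → Dec (p ≡ p₂) → Dec (q ≡ p₂) → A ≋ B
    by-cases (yes e) (yes p≡) (yes q≡) = aligned p≡ (not-injective (sign-double-injective (not c) (not d) (trans (sym (L11 p≡ q≡)) (trans row (R1 e)))))
    by-cases (yes e) (yes p≡) (no q≢) = contradiction (trans (sym (R1 e)) (trans (sym row) (row01 {c} {c'} q≢ p≡))) (sign-double (not d) (not c))
    by-cases (yes e) (no p≢) (yes q≡) = contradiction (trans (sym (R1 e)) (trans (sym row) (row10 {c} {c'} q≡ p≢))) (sign-double (not d) c')
    by-cases (yes e) (no p≢) (no q≢) = contradiction (trans (sym (R1 e)) (trans (sym row) (row00 {c} {c'} q≢ p≢))) (sign-double-≢0 (not d))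
    by-cases (no ne) (yes p≡) (yes q≡) = contradiction (trans (sym (L11 p≡ q≡)) (trans row (R0 ne))) (sign-double (not c) (not d))
    by-cases (no ne) (yes p≡) (no q≢) = aligned p≡ (not-injective (sign-injective (not c) (not d) (trans (sym (row01 {c} {c'} q≢ p≡)) (trans row (R0 ne)))))
    by-cases (no ne) (no p≢) (yes q≡) = reversed q≡ (sign-injective c' (not d) (trans (sym (row10 {c} {c'} q≡ p≢)) (trans row (R0 ne))))
    by-cases (no ne) (no p≢) (no q≢) = contradiction (trans (sym (R0 ne)) (trans (sym row) (row00 {c} {c'} q≢ p≢))) (sign-≢0 (not d))

-- Undoing flips; drawings recovered from their matrices

module _ {X : Set} where

  rot-split : ∀ {A : Set} d (w : List A) → ∃ λ as → ∃ λ bs → w ≡ as ++ bs × rot d w ≡ bs ++ as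
  rot-split zero w = [] , w , refl , sym (++-identityʳ w)
  rot-split (suc d) w with rot-split d w
  ... | as , y ∷ bs , e , e' = as ++ [ y ] , bs , trans e (sym (++-assoc as [ y ] bs)) , trans (rot-rot1 d w) (trans (cong rot1 e') (++-assoc bs as [ y ]))
  ... | [] , [] , e , e' = [] , [] , e , trans (rot-rot1 d w) (cong rot1 e')
  ... | a ∷ as , [] , e , e' = [ a ] , as , trans e (cong (a ∷_) (++-identityʳ as)) , trans (rot-rot1 d w) (cong rot1 e')

  -- The vertices of the cycle are distinct, so a rotation that keeps the first one is trivial.
  anchor-head : ∀ d (D : Drawing X) {β γ D₁ D₂} → Unique (vertices D) → D ≡ β ∷ D₁ → rot d D ≡ γ ∷ D₂ → proj₁ β ≡ proj₁ γ → rot d D ≡ D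
  anchor-head d D u eD eR e with rot-split d D
  ... | [] , bs , e₁ , e₂ = trans e₂ (trans (++-identityʳ bs) (sym e₁))
  ... | a ∷ as , [] , e₁ , e₂ = trans e₂ (trans (sym (++-identityʳ (a ∷ as))) (sym e₁))
  ... | a ∷ as , b ∷ bs , refl , e₂ with refl , _ ← ∷-injective eD | refl , _ ← ∷-injective (trans (sym e₂) eR) =
    contradiction (here e) (proj₂ (proj₂ (Unique-++⁻ (vertices (a ∷ as)) (subst Unique (map-++ proj₁ (a ∷ as) (b ∷ bs)) u))) (here refl))

  anchor-second : ∀ d {β γ β' γ' : Bead X} {E E'} → Unique (vertices (β ∷ γ ∷ E)) → rot d (β ∷ γ ∷ E) ≡ β' ∷ γ' ∷ E' → proj₁ γ ≡ proj₁ γ' → β' ∷ γ' ∷ E' ≡ β ∷ γ ∷ E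
  anchor-second d {β} {γ} {β'} {γ'} {E} {E'} u eq e = trans (sym eq) (rot1-injective (trans (sym (rot-rot1 d (β ∷ γ ∷ E)))
    (anchor-head d (rot1 (β ∷ γ ∷ E)) (Unique-↭ (Permₚ.map⁺ proj₁ (Permₚ.∷↭∷ʳ β (γ ∷ E))) u) refl (trans (rot-rot1 d (β ∷ γ ∷ E)) (cong rot1 eq)) e)))

  vertices-≋ : ∀ {D E : Drawing X} {v} → D ≋ E → v ∈ vertices D → v ∈ vertices E
  vertices-≋ {D} (d , inj₁ refl) v∈ = ∈-resp-↭ (Permₚ.map⁺ proj₁ (↭-sym (rot-↭ d D))) v∈
  vertices-≋ {D} (d , inj₂ refl) v∈ = ∈-resp-↭ (Permₚ.map⁺ proj₁ (↭-sym (rot-↭ d (reflect D)))) (vertices-reflect D v∈)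
    where
    vertices-turn : ∀ D y → next D y ∷ vertices (turn y D) ↭ y ∷ vertices D
    vertices-turn [] y = ↭-refl
    vertices-turn ((x , _) ∷ D) y = ↭-trans (↭-prep x (vertices-turn D y)) (Perm.swap x y ↭-refl)
    vertices-reflect : ∀ D {v} → v ∈ vertices D → v ∈ vertices (reflect D)
    vertices-reflect D@((x , _) ∷ _) v∈ = ∈-resp-↭ (Permₚ.map⁺ proj₁ (↭-sym (↭-reverse (turn x D)))) (∈-resp-↭ (↭-sym (Permₚ.drop-∷ (vertices-turn D x))) v∈)

  join-not : ∀ b (z : X) t t' → join (not b) z t' t ≡ join b z t t'
  join-not true z t t' = refl
  join-not false z t t' = refl

  not-≢ : ∀ b → not b ≢ b
  not-≢ true ()
  not-≢ false ()

  join∈ : ∀ b (z : X) t t' → z ∈ names (join b z t t')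
  join∈ true z t t' = here refl
  join∈ false z t t' = here refl

  anchor-reflected : ∀ d b {x z : X} {t t' E β γ E'} → Valid ((x , b , t) ∷ (z , b , t') ∷ E) → β ∷ γ ∷ E' ≡ rot d (reflect ((x , b , t) ∷ (z , b , t') ∷ E)) → z ≡ proj₁ γ →
    β ∷ γ ∷ E' ≡ (next E x , not b , t') ∷ (z , not b , t) ∷ reverse (turn x E)
  anchor-reflected d b {x} {z} {t} {t'} {E} val eq z≡ = anchor-second (f + d) {next E x , not b , t'} {z , not b , t} (vertices-Unique A″ (proj₁ valA″))
      (trans (rot-+ f d _) (trans (cong (rot d) (trans (cong (rot f) (sym A″≡)) back)) (sym eq))) z≡
    where
    A = (x , b , t) ∷ (z , b , t') ∷ E
    f = proj₁ (rot-inverse (length E) (reflect A))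
    back = proj₂ (rot-inverse (length E) (reflect A))
    A″≡ = reflect-second x z b b t t' E
    A″ = (next E x , not b , t') ∷ (z , not b , t) ∷ reverse (turn x E)
    valA″ : Valid A″
    valA″ = subst Valid A″≡ (valid-rot (length E) (valid-reflect {D = A} val))

  -- Only the split of the bead carrying the root z can produce two beads of equal orientation around z.
  unsplit : ∀ {x z b t t' E} {B B' : Drawing X} → Flip z B B' → Valid ((x , b , t) ∷ (z , b , t') ∷ E) → Unique (labels B') →
    ((x , b , t) ∷ (z , b , t') ∷ E) ≋ B' → ((x , b , join b z t t') ∷ E) ≋ B
  unsplit {z = z} (merge x₂ b₂ s s' D) _ uB' A'≋ = contradiction (∈-++⁺ˡ (join∈ b₂ z s s')) (vertex-not-in-tree ((x₂ , b₂ , join b₂ z s s') ∷ D) uB' (vertices-≋ A'≋ (there (here refl))))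
  unsplit {z = z} (inner x₂ b₂ {s} {s'} D f) _ uB' A'≋ = contradiction (∈-++⁺ˡ (∈-resp-↭ (treeFlip-labels f) (treeFlip-∈ f))) (vertex-not-in-tree ((x₂ , b₂ , s') ∷ D) uB' (vertices-≋ A'≋ (there (here refl))))
  unsplit {x} {z} {b} {t} {t'} {E} (swap x₂ b₂ s s' D) val uB' (d , inj₁ eq) with anchor-second d {x , b , t} {z , b , t'} (vertices-Unique ((x , b , t) ∷ (z , b , t') ∷ E) (proj₁ val)) (sym eq) refl
  ... | e with refl , e' ← ∷-injective e with e″ , _ ← ∷-injective e' = contradiction (sym (cong (proj₁ ∘ proj₂) e″)) (not-≢ b₂)
  unsplit {x} {z} {b} {t} {t'} {E} (swap x₂ b₂ s s' D) val uB' (d , inj₂ eq) with anchor-reflected d b val eq refl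
  ... | e with e₁ , e' ← ∷-injective e with e₂ , _ ← ∷-injective e' = contradiction (trans (cong (proj₁ ∘ proj₂) e₁) (sym (cong (proj₁ ∘ proj₂) e₂))) (not-≢ b₂)
  unsplit {x} {z} {b} {t} {t'} {E} (split x₂ b₂ s s' D) val uB' (d , inj₁ eq) with anchor-second d {x , b , t} {z , b , t'} (vertices-Unique ((x , b , t) ∷ (z , b , t') ∷ E) (proj₁ val)) (sym eq) refl
  ... | refl = 0 , inj₁ refl
  unsplit {x} {z} {b} {t} {t'} {E} (split x₂ b₂ s s' D) val uB' (d , inj₂ eq) with anchor-reflected d b val eq refl
  ... | refl = length (reverse (turn x E)) , inj₂ (sym (trans (cong (rot (length (reverse (turn x E)))) (unfold-reverse (next E x , not b , join b z t t') (turn x E)))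
    (trans (rot-++ (reverse (turn x E)) [ next E x , not b , join b z t t' ]) (cong (λ j → (next E x , not b , j) ∷ reverse (turn x E)) (sym (join-not b z t t'))))))

module _ {X : Set} where

  nodes : Drawing X → ℕ
  nodes D = length (treeParts D)

  nodes-↭ : ∀ {D E : Drawing X} → D ↭ E → nodes D ≡ nodes E
  nodes-↭ {D} {E} p = +-cancelˡ-≡ (length (vertices D)) (nodes D) (nodes E) (begin
    length (vertices D) + nodes D ≡⟨ length-++ (vertices D) ⟨
    length (vertices D ++ treeParts D) ≡⟨ ↭-length (labels-parts D) ⟨
    length (labels D) ≡⟨ ↭-length (labels-↭ p) ⟩
    length (labels E) ≡⟨ ↭-length (labels-parts E) ⟩
    length (vertices E ++ treeParts E) ≡⟨ length-++ (vertices E) ⟩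
    length (vertices E) + nodes E ≡⟨ cong (_+ nodes E) (sym (↭-length (Permₚ.map⁺ proj₁ p))) ⟩
    length (vertices D) + nodes E ∎)

  nodes-split : ∀ x b (z : X) t t' E → nodes ((x , b , t) ∷ (z , b , t') ∷ E) < nodes ((x , b , join b z t t') ∷ E)
  nodes-split x b z t t' E = ≤-reflexive (trans (cong suc (trans (length-++ (names t)) (cong (length (names t) +_) (length-++ (names t'))))) (sym (joined b)))
    where
    joined : ∀ b → nodes ((x , b , join b z t t') ∷ E) ≡ suc (length (names t) + (length (names t') + nodes E))
    joined true = cong suc (trans (length-++ (names t' ++ names t)) (trans (cong (_+ nodes E) (length-++ (names t')))
      (exch (length (names t')) (length (names t)) (nodes E))))
      where
      exch : ∀ a b c → a + b + c ≡ b + (a + c)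
      exch = ℕ-Ring.solve-∀
    joined false = cong suc (trans (length-++ (names t ++ names t')) (trans (cong (_+ nodes E) (length-++ (names t)))
      (+-assoc (length (names t)) (length (names t')) (nodes E))))

  Bare : Bead X → Set
  Bare (_ , _ , t) = t ≡ leaf

  find-node : ∀ (D : Drawing X) → All Bare D ⊎ (∃ λ d → ∃ λ x → ∃ λ b → ∃ λ z → ∃ λ l → ∃ λ r → ∃ λ E → rot d D ≡ (x , b , node z l r) ∷ E)
  find-node D with go D
    where
    go : ∀ (D : Drawing X) → All Bare D ⊎ (∃ λ as → ∃ λ x → ∃ λ b → ∃ λ z → ∃ λ l → ∃ λ r → ∃ λ bs → D ≡ as ++ (x , b , node z l r) ∷ bs)
    go [] = inj₁ []
    go ((x , b , node z l r) ∷ D) = inj₂ ([] , x , b , z , l , r , D , refl)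
    go ((x , b , leaf) ∷ D) with go D
    ... | inj₁ bare = inj₁ (refl ∷ bare)
    ... | inj₂ (as , y , c , z , l , r , bs , eq) = inj₂ ((x , b , leaf) ∷ as , y , c , z , l , r , bs , cong ((x , b , leaf) ∷_) eq)
  ... | inj₁ bare = inj₁ bare
  ... | inj₂ (as , x , b , z , l , r , bs , eq) = inj₂ (length as , x , b , z , l , r , bs ++ as , trans (cong (rot (length as)) eq) (rot-++ as ((x , b , node z l r) ∷ bs)))

  bare-position : ∀ (D : Drawing X) {z} → All Bare D → Mixed D → z ∈ labels D →
    ∃ λ d → ∃ λ p → ∃ λ c → ∃ λ c' → ∃ λ E → rot d D ≡ (p , c , leaf) ∷ (z , c' , leaf) ∷ E × All Bare E
  bare-position D bare m z∈ with bead-position D z∈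
  ... | d , x , b , t , E , eq , pos with subst (All Bare) eq (All-resp-↭ (↭-sym (rot-↭ d D)) bare)
  bare-position D bare m z∈ | d , x , b , leaf , E , eq , inj₁ refl | refl ∷ bareE with mixed-tail {β = x , b , leaf} {D = E} (subst Mixed eq (mixed-↭ (↭-sym (rot-↭ d D)) m))
  ... | β , E' , refl with unsnoc β E'
  ... | F , (p , c , s) , eq' with Allₚ.++⁻ F (subst (All Bare) eq' bareE)
  ... | bareF , refl ∷ [] = d + length ((x , b , leaf) ∷ F) , p , c , b , F ,
    trans (rot-+ d (length ((x , b , leaf) ∷ F)) D) (trans (cong (rot (length ((x , b , leaf) ∷ F))) (trans eq (cong ((x , b , leaf) ∷_) eq'))) (vertex-second (x , b , leaf) (p , c , leaf) F)) , bareF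

module _ {n : ℕ} where

  private
    Vert = Fin n

  μ-cong : ∀ (v : Vert) {B B' : Mat n} → (∀ x y → B x y ≡ B' x y) → ∀ x y → μ v B x y ≡ μ v B' x y
  μ-cong v {B} {B'} eq x y with x Fin.≟ v | y Fin.≟ v
  ... | no _ | no _ = cong₂ _⊞_ (eq x y) (cong₂ mutEntry (eq x v) (eq v y))
  ... | yes _ | _ = cong ℤ.-_ (eq x y)
  ... | no _ | yes _ = cong ℤ.-_ (eq x y)

  Complete : Drawing Vert → Set
  Complete D = ∀ v → v ∈ labels D

  form-rot : ∀ d (D : Drawing Vert) x y → ⟦ rot d D ⟧ x y ≡ ⟦ D ⟧ x y
  form-rot d D x y = form-↭ (triangles-rot d D) x y

  -- A drawing can be recovered from its quiver: flipping the roots of its trees reduces it to a bare cycle.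
  rigid : ∀ (D₁ D₂ : Drawing Vert) → Valid D₁ → Valid D₂ → Complete D₁ → Complete D₂ →
    (∀ v w → ⟦ D₁ ⟧ v w ≡ ⟦ D₂ ⟧ v w) → D₁ ≋ D₂
  rigid D₁ = go D₁ (<-wellFounded (nodes D₁))
    where
    go : ∀ D₁ → Acc _<_ (nodes D₁) → ∀ D₂ → Valid D₁ → Valid D₂ → Complete D₁ → Complete D₂ →
      (∀ v w → ⟦ D₁ ⟧ v w ≡ ⟦ D₂ ⟧ v w) → D₁ ≋ D₂
    bare : ∀ D₁ D₂ → Valid D₁ → Valid D₂ → Complete D₁ → Complete D₂ →
      (∀ v w → ⟦ D₁ ⟧ v w ≡ ⟦ D₂ ⟧ v w) → All Bare D₁ → D₁ ≋ D₂
    bare D₁ D₂ v₁ v₂ k₁ k₂ same b₁ with find-node D₂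
    ... | inj₂ (d₂ , x , b , z , l , r , E₂ , eq₂) with bare-position D₁ b₁ (proj₂ v₁) (k₁ z)
    ... | d₁ , p , c , c' , E₁ , eq₁ , bE = ⊥-elim (no-tree {p = p} {c} {z} {c'} {E₁} {x} {b} {l} {r} {E₂} (subst Valid eq₁ (valid-rot d₁ v₁)) bE (subst Valid eq₂ (valid-rot d₂ v₂))
        (λ v w → trans (cong (λ D → ⟦ D ⟧ v w) (sym eq₁)) (trans (form-rot d₁ D₁ v w) (trans (same v w) (trans (sym (form-rot d₂ D₂ v w)) (cong (λ D → ⟦ D ⟧ v w) eq₂))))))
    bare [] D₂ (_ , () , _) _ _ _ _ _ | inj₁ _
    bare D₁@((z , _) ∷ _) D₂ v₁ v₂ k₁ k₂ same b₁ | inj₁ b₂ with bare-position D₁ b₁ (proj₂ v₁) (k₁ z) | bare-position D₂ b₂ (proj₂ v₂) (k₂ z)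
    ... | d₁ , p , c , c' , E₁ , eq₁ , bE₁ | d₂ , p₂ , d , d' , E₂ , eq₂ , bE₂ = ≋-rotˡ d₁ (≋-rotʳ d₂ (subst₂ _≋_ (sym eq₁) (sym eq₂)
        (cycles-rigid {p = p} {c} {z} {c'} {E₁} {p₂} {d} {d'} {E₂} (subst Valid eq₁ (valid-rot d₁ v₁)) bE₁ (subst Valid eq₂ (valid-rot d₂ v₂)) bE₂
          (λ v w → trans (cong (λ D → ⟦ D ⟧ v w) (sym eq₁)) (trans (form-rot d₁ D₁ v w) (trans (same v w) (trans (sym (form-rot d₂ D₂ v w)) (cong (λ D → ⟦ D ⟧ v w) eq₂))))))))
    go D₁ (acc rs) D₂ v₁ v₂ k₁ k₂ same with find-node D₁
    ... | inj₁ b₁ = bare D₁ D₂ v₁ v₂ k₁ k₂ same b₁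
    ... | inj₂ (d₁ , x , b , z , l , r , E , eq) with node≡join b z l r
    -- The same vertex z is flipped in D₂. Equal matrices have equal mutations, so the induction
    -- hypothesis compares the flipped drawings, and `unsplit` takes both flips back. Only the tree
    -- nodes of the first drawing have to decrease.
    ... | t , t' , j with flip-exists D₂ (proj₂ v₂) (k₂ z)
    ... | d₂ , B' , fl = ≋-rotˡ d₁ (≋-rotʳ d₂ (subst (_≋ rot d₂ D₂) (sym A≡) (unsplit fl vA' (proj₁ vB') A'≋B')))
      where
      A = (x , b , join b z t t') ∷ E
      A' = (x , b , t) ∷ (z , b , t') ∷ E
      A≡ : rot d₁ D₁ ≡ A
      A≡ = trans eq (cong (λ s → (x , b , s) ∷ E) j)
      vA : Valid A
      vA = subst Valid A≡ (valid-rot d₁ v₁)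
      flA : Flip z A A'
      flA = split x b t t' E
      vA' : Valid A'
      vA' = valid-flip flA vA
      vB : Valid (rot d₂ D₂)
      vB = valid-rot d₂ v₂
      vB' : Valid B'
      vB' = valid-flip fl vB
      smaller : nodes A' < nodes D₁
      smaller = <-≤-trans (nodes-split x b z t t' E) (≤-reflexive (trans (cong nodes (sym A≡)) (nodes-↭ (rot-↭ d₁ D₁))))
      same-before : ∀ v w → ⟦ A ⟧ v w ≡ ⟦ rot d₂ D₂ ⟧ v w
      same-before v w = trans (cong (λ D → ⟦ D ⟧ v w) (sym A≡)) (trans (form-rot d₁ D₁ v w) (trans (same v w) (sym (form-rot d₂ D₂ v w))))
      same-after : ∀ v w → ⟦ A' ⟧ v w ≡ ⟦ B' ⟧ v w
      same-after v w = trans (flip⇒μ (flip-form flA (proj₁ vA) (proj₂ vA)) v w) (trans (μ-cong z same-before v w) (sym (flip⇒μ (flip-form fl (proj₁ vB) (proj₂ vB)) v w)))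
      kA' : Complete A'
      kA' v = ∈-resp-↭ (↭-trans (labels-↭ (↭-sym (↭-trans (↭-reflexive (sym A≡)) (rot-↭ d₁ D₁)))) (flip-labels flA)) (k₁ v)
      kB' : Complete B'
      kB' v = ∈-resp-↭ (↭-trans (labels-↭ (↭-sym (rot-↭ d₂ D₂))) (flip-labels fl)) (k₂ v)
      A'≋B' : A' ≋ B'
      A'≋B' = go A' (rs smaller) B' vA' vB' kA' kB' same-after

-- Relabelling and isomorphism

mapDrawing : ∀ {X Y : Set} → (X → Y) → Drawing X → Drawing Y
mapDrawing f = map (λ (x , b , t) → f x , b , mapTree f t)

mapTriangle : ∀ {X Y : Set} → (X → Y) → Triangle X → Triangle Y
mapTriangle f (a , b , c) = Maybe.map f a , Maybe.map f b , Maybe.map f c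

module _ {X Y : Set} (f : X → Y) where

  top-map : ∀ t → top (mapTree f t) ≡ Maybe.map f (top t)
  top-map leaf = refl
  top-map (node _ _ _) = refl

  cells-map : ∀ t → cells (mapTree f t) ≡ map (mapTriangle f) (cells t)
  cells-map leaf = refl
  cells-map (node z l r) = cong₂ _∷_ (cong₂ (λ a b → just (f z) , a , b) (top-map l) (top-map r))
    (trans (cong₂ _++_ (cells-map l) (cells-map r)) (sym (map-++ (mapTriangle f) (cells l) (cells r))))

  next-map : ∀ D y → next (mapDrawing f D) (f y) ≡ f (next D y)
  next-map [] y = refl
  next-map (_ ∷ _) y = refl

  path-map : ∀ D y → path (mapDrawing f D) (f y) ≡ map (mapTriangle f) (path D y)
  path-map [] y = refl
  path-map ((x , b , t) ∷ D) y = cong₂ _∷_ (base b) (trans (cong₂ _++_ (cells-map t) (path-map D y)) (sym (map-++ (mapTriangle f) (cells t) (path D y))))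
    where
    base : ∀ b → baseCell (f x) (next (mapDrawing f D) (f y)) b (mapTree f t) ≡ mapTriangle f (baseCell x (next D y) b t)
    base true = cong₂ (λ a c → just (f x) , just a , c) (next-map D y) (top-map t)
    base false = cong₂ (λ a c → just a , just (f x) , c) (next-map D y) (top-map t)

  triangles-map : ∀ D → triangles (mapDrawing f D) ≡ map (mapTriangle f) (triangles D)
  triangles-map [] = refl
  triangles-map D@((x , _) ∷ _) = path-map D x

  names-map : ∀ t → names (mapTree f t) ≡ map f (names t)
  names-map leaf = refl
  names-map (node z l r) = cong (f z ∷_) (trans (cong₂ _++_ (names-map l) (names-map r)) (sym (map-++ f (names l) (names r))))

  labels-map : ∀ D → labels (mapDrawing f D) ≡ map f (labels D)
  labels-map [] = refl
  labels-map ((x , b , t) ∷ D) = cong (f x ∷_) (trans (cong₂ _++_ (names-map t) (labels-map D)) (sym (map-++ f (names t) (labels D))))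

  treeShape-map : ∀ t → treeShape (mapTree f t) ≡ treeShape t
  treeShape-map leaf = refl
  treeShape-map (node z l r) = cong₂ (node tt) (treeShape-map l) (treeShape-map r)

  shape-map : ∀ D → shape (mapDrawing f D) ≡ shape D
  shape-map D = trans (sym (map-∘ D)) (map-cong (λ (x , b , t) → cong (b ,_) (treeShape-map t)) D)

  orientations-map : ∀ D → orientations (mapDrawing f D) ≡ orientations D
  orientations-map D = sym (map-∘ D)

  valid-map : (∀ {x y} → f x ≡ f y → x ≡ y) → ∀ {D} → Valid D → Valid (mapDrawing f D)
  valid-map inj {D} (u , (a , b)) = subst Unique (sym (labels-map D)) (Uniqueₚ.map⁺ inj u) ,
    subst (true ∈_) (sym (orientations-map D)) a , subst (false ∈_) (sym (orientations-map D)) b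

module _ {X : Set} where

  edge : Maybe X → Maybe X → List (X × X)
  edge (just x) (just y) = [ x , y ]
  edge _ _ = []

  cellArrows : Triangle X → List (X × X)
  cellArrows (a , b , c) = edge a b ++ edge b c ++ edge c a

  arrows : Drawing X → List (X × X)
  arrows D = concatMap cellArrows (triangles D)

  concatMap-↭ : ∀ {A B : Set} (g : A → List B) {xs ys} → xs ↭ ys → concatMap g xs ↭ concatMap g ys
  concatMap-↭ g Perm.refl = ↭-refl
  concatMap-↭ g (Perm.prep x p) = Permₚ.++⁺ˡ (g x) (concatMap-↭ g p)
  concatMap-↭ g (Perm.swap x y p) = ↭-trans (Permₚ.shifts (g x) (g y)) (Permₚ.++⁺ˡ (g y) (Permₚ.++⁺ˡ (g x) (concatMap-↭ g p)))
  concatMap-↭ g (Perm.trans p q) = ↭-trans (concatMap-↭ g p) (concatMap-↭ g q)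

edge-map : ∀ {X Y : Set} (f : X → Y) a b → edge (Maybe.map f a) (Maybe.map f b) ≡ mapArr f (edge a b)
edge-map f (just _) (just _) = refl
edge-map f (just _) nothing = refl
edge-map f nothing b = refl

arrows-map : ∀ {X Y : Set} (f : X → Y) D → arrows (mapDrawing f D) ≡ mapArr f (arrows D)
arrows-map f D = trans (cong (concatMap cellArrows) (triangles-map f D)) (go (triangles D))
  where
  pair = λ (a , b) → (f a , f b)
  tri′ : ∀ t → cellArrows (mapTriangle f t) ≡ mapArr f (cellArrows t)
  tri′ (a , b , c) = trans (cong₂ _++_ (edge-map f a b) (cong₂ _++_ (edge-map f b c) (edge-map f c a)))
    (sym (trans (map-++ pair (edge a b) (edge b c ++ edge c a)) (cong (mapArr f (edge a b) ++_) (map-++ pair (edge b c) (edge c a)))))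
  go : ∀ ts → concatMap cellArrows (map (mapTriangle f) ts) ≡ mapArr f (concatMap cellArrows ts)
  go [] = refl
  go (t ∷ ts) = trans (cong₂ _++_ (tri′ t) (go ts)) (sym (map-++ pair (cellArrows t) (concatMap cellArrows ts)))

module _ {n : ℕ} where

  private
    Vert = Fin n

  arrowForm : List (Vert × Vert) → Mat n
  arrowForm [] x y = ℤ.+ 0
  arrowForm ((a , b) ∷ L) x y = wedge (just a) (just b) x y ⊞ arrowForm L x y

  arrowForm-++ : ∀ L M x y → arrowForm (L ++ M) x y ≡ arrowForm L x y ⊞ arrowForm M x y
  arrowForm-++ [] M x y = sym (ℤₚ.+-identityˡ (arrowForm M x y))
  arrowForm-++ ((a , b) ∷ L) M x y = trans (cong (λ f → wedge (just a) (just b) x y ⊞ f) (arrowForm-++ L M x y)) (sym (ℤₚ.+-assoc (wedge (just a) (just b) x y) (arrowForm L x y) (arrowForm M x y)))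

  arrowForm-↭ : ∀ {L M} → L ↭ M → ∀ x y → arrowForm L x y ≡ arrowForm M x y
  arrowForm-↭ Perm.refl x y = refl
  arrowForm-↭ (Perm.prep (a , b) p) x y = cong (λ f → wedge (just a) (just b) x y ⊞ f) (arrowForm-↭ p x y)
  arrowForm-↭ {_ ∷ _ ∷ L} {_ ∷ _ ∷ M} (Perm.swap (a , b) (c , d) p) x y = trans (cong (λ f → wedge (just a) (just b) x y ⊞ (wedge (just c) (just d) x y ⊞ f)) (arrowForm-↭ p x y))
    (exch (wedge (just a) (just b) x y) (wedge (just c) (just d) x y) (arrowForm M x y))
    where
    exch : ∀ a b c → a ⊞ (b ⊞ c) ≡ b ⊞ (a ⊞ c)
    exch = ℤ-Ring.solve-∀
  arrowForm-↭ (Perm.trans p q) x y = trans (arrowForm-↭ p x y) (arrowForm-↭ q x y)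

  arrowForm-edge : ∀ a b x y → arrowForm (edge a b) x y ≡ wedge a b x y
  arrowForm-edge (just a) (just b) x y = ℤₚ.+-identityʳ (wedge (just a) (just b) x y)
  arrowForm-edge (just a) nothing x y = ring (indicator (just a) x) (indicator (just a) y)
    where
    ring : ∀ a b → ℤ.+ 0 ≡ a ⊠ ℤ.+ 0 ⊟ ℤ.+ 0 ⊠ b
    ring = ℤ-Ring.solve-∀
  arrowForm-edge nothing b x y = ring (indicator b x) (indicator b y)
    where
    ring : ∀ a b → ℤ.+ 0 ≡ ℤ.+ 0 ⊠ b ⊟ a ⊠ ℤ.+ 0
    ring = ℤ-Ring.solve-∀

  arrowForm-triangles : ∀ ts x y → arrowForm (concatMap cellArrows ts) x y ≡ form ts x y
  arrowForm-triangles [] x y = refl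
  arrowForm-triangles ((a , b , c) ∷ ts) x y = trans (arrowForm-++ (cellArrows (a , b , c)) (concatMap cellArrows ts) x y)
    (cong₂ _⊞_ (trans (arrowForm-++ (edge a b) (edge b c ++ edge c a) x y) (cong₂ _⊞_ (arrowForm-edge a b x y)
      (trans (arrowForm-++ (edge b c) (edge c a) x y) (cong₂ _⊞_ (arrowForm-edge b c x y) (arrowForm-edge c a x y))))) (arrowForm-triangles ts x y))

  arrows-↭⇒form : ∀ {D E : Drawing Vert} → arrows D ↭ arrows E → ∀ x y → ⟦ D ⟧ x y ≡ ⟦ E ⟧ x y
  arrows-↭⇒form {D} {E} p x y = trans (sym (arrowForm-triangles (triangles D) x y)) (trans (arrowForm-↭ p x y) (arrowForm-triangles (triangles E) x y))

  form-map : ∀ {f : Vert → Vert} → (∀ {x y} → f x ≡ f y → x ≡ y) → ∀ D x y → ⟦ mapDrawing f D ⟧ (f x) (f y) ≡ ⟦ D ⟧ x y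
  form-map {f} inj D x y = trans (cong (λ ts → form ts (f x) (f y)) (triangles-map f D)) (go (triangles D))
    where
    ind : ∀ a x → indicator (Maybe.map f a) (f x) ≡ indicator a x
    ind nothing x = refl
    ind (just a) x with a Fin.≟ x
    ... | yes refl = indicator-refl (f a)
    ... | no a≢x = indicator-≢ {a = just (f a)} (a≢x ∘ inj ∘ just-injective)
    wdg : ∀ a b → wedge (Maybe.map f a) (Maybe.map f b) (f x) (f y) ≡ wedge a b x y
    wdg a b = cong₂ _⊟_ (cong₂ _⊠_ (ind a x) (ind b y)) (cong₂ _⊠_ (ind b x) (ind a y))
    go : ∀ ts → form (map (mapTriangle f) ts) (f x) (f y) ≡ form ts x y
    go [] = refl
    go ((a , b , c) ∷ ts) = cong₂ _⊞_ (cong₂ _⊞_ (wdg a b) (cong₂ _⊞_ (wdg b c) (wdg c a))) (go ts)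

lookup-injective : ∀ {A : Set} {xs : List A} → Unique xs → ∀ i j → lookup xs i ≡ lookup xs j → i ≡ j
lookup-injective (px ∷ u) Fin.zero Fin.zero _ = refl
lookup-injective (px ∷ u) Fin.zero (Fin.suc j) eq = contradiction eq (All.lookup px (∈-lookup j))
lookup-injective (px ∷ u) (Fin.suc i) Fin.zero eq = contradiction (sym eq) (All.lookup px (∈-lookup i))
lookup-injective (px ∷ u) (Fin.suc i) (Fin.suc j) eq = cong Fin.suc (lookup-injective u i j eq)

enumeration : ∀ {A : Set} (xs : List A) → Unique xs → (∀ x → x ∈ xs) → A ↔ Fin (length xs)
enumeration xs u complete = mk↔ₛ′ (λ x → Any.index (complete x)) (lookup xs)
  (λ i → lookup-injective u _ i (sym (Anyₚ.lookup-index (complete (lookup xs i))))) (λ x → sym (Anyₚ.lookup-index (complete x)))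

list-bijection : ∀ {X Y : Set} (xs : List X) (ys : List Y) → Unique xs → (∀ x → x ∈ xs) → Unique ys → (∀ y → y ∈ ys) →
  length xs ≡ length ys → Σ (X ↔ Y) λ f → map (Inverse.to f) xs ≡ ys
list-bijection {X} {Y} xs ys ux cx uy cy len = f , (begin
    map to xs ≡⟨ cong (map to) (tabulate-lookup xs) ⟨
    map to (tabulate (lookup xs)) ≡⟨ map-tabulate (lookup xs) to ⟩
    tabulate (to ∘ lookup xs) ≡⟨ tabulate-cong (λ i → cong (λ j → lookup ys (Fin.cast len j)) (Inverse.strictlyInverseˡ ex i)) ⟩
    tabulate (λ i → lookup ys (Fin.cast len i)) ≡⟨ cast-tabulate len ⟩
    ys ∎)
  where
  ex = enumeration xs ux cx
  ey = enumeration ys uy cy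
  to : X → Y
  to x = lookup ys (Fin.cast len (Inverse.to ex x))
  from : Y → X
  from y = lookup xs (Fin.cast (sym len) (Inverse.to ey y))
  f : X ↔ Y
  f = mk↔ₛ′ to from
    (λ y → trans (cong (lookup ys) (trans (cong (Fin.cast len) (Inverse.strictlyInverseˡ ex _)) (Finₚ.cast-involutive len (sym len) (Inverse.to ey y)))) (Inverse.strictlyInverseʳ ey y))
    (λ x → trans (cong (lookup xs) (trans (cong (Fin.cast (sym len)) (Inverse.strictlyInverseˡ ey _)) (Finₚ.cast-involutive (sym len) len (Inverse.to ex x)))) (Inverse.strictlyInverseʳ ex x))
  cast-tabulate : ∀ {m} (eq : m ≡ length ys) → tabulate {n = m} (λ i → lookup ys (Fin.cast eq i)) ≡ ys
  cast-tabulate refl = trans (tabulate-cong (λ i → cong (lookup ys) (Finₚ.cast-is-id refl i))) (tabulate-lookup ys)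

module _ {X : Set} where

  tree-determined : ∀ (t t' : Tree X) {us vs} → treeShape t ≡ treeShape t' → names t ++ us ≡ names t' ++ vs → t ≡ t' × us ≡ vs
  tree-determined leaf leaf _ eq = refl , eq
  tree-determined leaf (node _ _ _) ()
  tree-determined (node _ _ _) leaf ()
  tree-determined (node z l r) (node z' l' r') {us} {vs} es el with ∷-injective el
  ... | refl , el' with tree-determined l l' (left es) (trans (sym (++-assoc (names l) (names r) us)) (trans el' (++-assoc (names l') (names r') vs)))
    where
    left : ∀ {a b c d : Shape} → node tt a b ≡ node tt c d → a ≡ c
    left refl = refl
  ... | refl , er with tree-determined r r' (right es) er
    where
    right : ∀ {a b c d : Shape} → node tt a b ≡ node tt c d → b ≡ d
    right refl = refl
  ... | refl , eq = refl , eq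

  drawing-determined : ∀ (D E : Drawing X) → shape D ≡ shape E → labels D ≡ labels E → D ≡ E
  drawing-determined [] [] _ _ = refl
  drawing-determined [] (_ ∷ _) ()
  drawing-determined (_ ∷ _) [] ()
  drawing-determined ((x , b , t) ∷ D) ((y , c , s) ∷ E) es el with ∷-injective es | ∷-injective el
  ... | e , es' | refl , el' with tree-determined t s (cong proj₂ e) el'
  ... | refl , el″ = cong₂ (λ a D → (x , a , t) ∷ D) (cong proj₁ e) (drawing-determined D E es' el″)

shapeNodes : Shape → ℕ
shapeNodes leaf = 0
shapeNodes (node _ l r) = suc (shapeNodes l + shapeNodes r)

wordSize : Word → ℕ
wordSize [] = 0
wordSize ((_ , t) ∷ w) = suc (shapeNodes t + wordSize w)

length-treeLabels : ∀ {X : Set} (t : Tree X) → length (names t) ≡ shapeNodes (treeShape t)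
length-treeLabels leaf = refl
length-treeLabels (node z l r) = cong suc (trans (length-++ (names l)) (cong₂ _+_ (length-treeLabels l) (length-treeLabels r)))

length-labels : ∀ {X : Set} (D : Drawing X) → length (labels D) ≡ wordSize (shape D)
length-labels [] = refl
length-labels ((x , b , t) ∷ D) = cong suc (trans (length-++ (names t)) (cong₂ _+_ (length-treeLabels t) (length-labels D)))

same-shape : ∀ {X Y : Set} (D : Drawing X) (E : Drawing Y) → Unique (labels D) → (∀ x → x ∈ labels D) → Unique (labels E) → (∀ y → y ∈ labels E) →
  shape D ≡ shape E → Σ (X ↔ Y) λ f → mapDrawing (Inverse.to f) D ≡ E
same-shape D E uD cD uE cE es =
  let f , el = list-bijection (labels D) (labels E) uD cD uE cE (trans (length-labels D) (trans (cong wordSize es) (sym (length-labels E))))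
  in f , drawing-determined (mapDrawing (Inverse.to f) D) E (trans (shape-map (Inverse.to f) D) es) (trans (labels-map (Inverse.to f) D) el)

dihedral⇒relabelling : ∀ {X Y : Set} (D : Drawing X) (E : Drawing Y) → Unique (labels D) → (∀ x → x ∈ labels D) → Unique (labels E) → (∀ y → y ∈ labels E) →
  shape E ∈ dihedral (shape D) → Σ (X ↔ Y) λ f → ∃ λ D' → triangles D' ↭ triangles D × mapDrawing (Inverse.to f) D' ≡ E
dihedral⇒relabelling D E uD cD uE cE sE∈ with dihedral⇒ {shape D} sE∈
... | d , inj₁ eq =
  let f , e = same-shape (rot d D) E (Unique-↭ (↭-sym p) uD) (λ x → ∈-resp-↭ (↭-sym p) (cD x)) uE cE (trans (map-rot {X = ⊤} _ d D) (sym eq))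
  in f , rot d D , triangles-rot d D , e
  where p = labels-↭ (rot-↭ d D)
... | d , inj₂ eq =
  let f , e = same-shape (rot d (reflect D)) E (Unique-↭ (↭-sym p) uD) (λ x → ∈-resp-↭ (↭-sym p) (cD x)) uE cE (trans (map-rot {X = ⊤} _ d (reflect D)) (trans (cong (rot d) (shape-reflect D)) (sym eq)))
  in f , rot d (reflect D) , ↭-trans (triangles-rot d (reflect D)) (triangles-reflect D) , e
  where p = ↭-trans (labels-↭ (rot-↭ d (reflect D))) (labels-reflect D)

to-injective : ∀ {X Y : Set} (f : X ↔ Y) {x y} → Inverse.to f x ≡ Inverse.to f y → x ≡ y
to-injective f {x} {y} eq = trans (sym (Inverse.strictlyInverseʳ f x)) (trans (cong (Inverse.from f) eq) (Inverse.strictlyInverseʳ f y))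

complete-map : ∀ {X Y : Set} (f : X ↔ Y) (D : Drawing X) → (∀ x → x ∈ labels D) → ∀ y → y ∈ labels (mapDrawing (Inverse.to f) D)
complete-map f D cD y = subst (y ∈_) (sym (labels-map (Inverse.to f) D)) (subst (_∈ map (Inverse.to f) (labels D)) (Inverse.strictlyInverseˡ f y) (∈-map⁺ (Inverse.to f) (cD (Inverse.from f y))))

-- Both drawings are named by an initial segment of the numbers, so that their lists of arrows
-- become matrices and `rigid` applies. Passing to matrices may cancel opposite arrows, but only the
-- implication from lists to matrices is used.
arrows-rigid : ∀ {X Y : Set} (D : Drawing X) (E : Drawing Y) → Valid D → (∀ x → x ∈ labels D) → Valid E → (∀ y → y ∈ labels E) →
  (f : X ↔ Y) → mapArr (Inverse.to f) (arrows D) ↭ arrows E → shape E ∈ dihedral (shape D)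
arrows-rigid {X} {Y} D E vD cD vE cE f p = subst₂ (λ a b → b ∈ dihedral a) (trans (shape-map (Inverse.to g) D₁) (shape-map (Inverse.to f) D)) (shape-map (Inverse.to g) E)
    (≋⇒dihedral (rigid (mapDrawing (Inverse.to g) D₁) (mapDrawing (Inverse.to g) E) (valid-map (Inverse.to g) (to-injective g) (valid-map (Inverse.to f) (to-injective f) vD)) (valid-map (Inverse.to g) (to-injective g) vE)
      (complete-map g D₁ (complete-map f D cD)) (complete-map g E cE) (arrows-↭⇒form {D = mapDrawing (Inverse.to g) D₁} {E = mapDrawing (Inverse.to g) E} arrows↭)))
  where
  g : Y ↔ Fin (length (labels E))
  g = enumeration (labels E) (proj₁ vE) cE
  D₁ : Drawing Y
  D₁ = mapDrawing (Inverse.to f) D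
  arrows↭ : arrows (mapDrawing (Inverse.to g) D₁) ↭ arrows (mapDrawing (Inverse.to g) E)
  arrows↭ = ↭-trans (↭-reflexive (arrows-map (Inverse.to g) D₁)) (↭-trans (Permₚ.map⁺ _ (↭-trans (↭-reflexive (arrows-map (Inverse.to f) D)) p)) (↭-reflexive (sym (arrows-map (Inverse.to g) E))))

-- Realizations as drawings

treeRA : (t : RA) → Tree (VA t)
treeRA single = node tt leaf leaf
treeRA (ext true t) = node nothing (mapTree just (treeRA t)) leaf
treeRA (ext false t) = node nothing leaf (mapTree just (treeRA t))
treeRA (tri t u) = node nothing (mapTree (λ v → just (inj₁ v)) (treeRA t)) (mapTree (λ v → just (inj₂ v)) (treeRA u))

treeAtt : (a : Maybe RA) → Tree (AV a)
treeAtt nothing = leaf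
treeAtt (just t) = treeRA t

top-treeRA : ∀ t → top (treeRA t) ≡ just (root t)
top-treeRA single = refl
top-treeRA (ext true t) = refl
top-treeRA (ext false t) = refl
top-treeRA (tri t u) = refl

treeArrows : ∀ {X : Set} → Tree X → List (X × X)
treeArrows t = concatMap cellArrows (cells t)

concatMap-arrows-map : ∀ {X Y : Set} (f : X → Y) ts → concatMap cellArrows (map (mapTriangle f) ts) ≡ mapArr f (concatMap cellArrows ts)
concatMap-arrows-map f [] = refl
concatMap-arrows-map f ((a , b , c) ∷ ts) = trans (cong₂ _++_ (trans (cong₂ _++_ (edge-map f a b) (cong₂ _++_ (edge-map f b c) (edge-map f c a)))
      (sym (trans (map-++ pair (edge a b) (edge b c ++ edge c a)) (cong (mapArr f (edge a b) ++_) (map-++ pair (edge b c) (edge c a))))))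
    (concatMap-arrows-map f ts)) (sym (map-++ pair (cellArrows (a , b , c)) (concatMap cellArrows ts)))
  where pair = λ (a , b) → (f a , f b)

treeArrows-map : ∀ {X Y : Set} (f : X → Y) t → treeArrows (mapTree f t) ≡ mapArr f (treeArrows t)
treeArrows-map f t = trans (cong (concatMap cellArrows) (cells-map f t)) (concatMap-arrows-map f (cells t))

treeArrows-node : ∀ {X : Set} (z : X) l r → treeArrows (node z l r) ≡ cellArrows (just z , top l , top r) ++ treeArrows l ++ treeArrows r
treeArrows-node z l r = cong (cellArrows (just z , top l , top r) ++_) (concatMap-++ cellArrows (cells l) (cells r))

treeArrows-treeRA : ∀ t → treeArrows (treeRA t) ≡ arrA t
treeArrows-treeRA single = refl
treeArrows-treeRA (ext true t) = trans (treeArrows-node nothing (mapTree just (treeRA t)) leaf)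
  (trans (cong₂ (λ a b → cellArrows (just nothing , a , nothing) ++ b) (trans (top-map just (treeRA t)) (cong (Maybe.map just) (top-treeRA t)))
    (trans (++-identityʳ _) (trans (treeArrows-map just (treeRA t)) (cong (mapArr just) (treeArrows-treeRA t))))) refl)
treeArrows-treeRA (ext false t) = trans (treeArrows-node nothing leaf (mapTree just (treeRA t)))
  (cong₂ (λ a b → cellArrows (just nothing , nothing , a) ++ b) (trans (top-map just (treeRA t)) (cong (Maybe.map just) (top-treeRA t)))
    (trans (treeArrows-map just (treeRA t)) (cong (mapArr just) (treeArrows-treeRA t))))
treeArrows-treeRA (tri t u) = trans (treeArrows-node nothing (mapTree f (treeRA t)) (mapTree g (treeRA u)))
    (trans (cong₂ (λ a b → cellArrows (just nothing , a , b) ++ treeArrows (mapTree f (treeRA t)) ++ treeArrows (mapTree g (treeRA u)))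
      (trans (top-map f (treeRA t)) (cong (Maybe.map f) (top-treeRA t))) (trans (top-map g (treeRA u)) (cong (Maybe.map g) (top-treeRA u))))
    (cong (λ L → (nothing , f (root t)) ∷ (f (root t) , g (root u)) ∷ (g (root u) , nothing) ∷ L)
      (cong₂ _++_ (trans (treeArrows-map f (treeRA t)) (cong (mapArr f) (treeArrows-treeRA t))) (trans (treeArrows-map g (treeRA u)) (cong (mapArr g) (treeArrows-treeRA u))))))
  where
  f : VA t → VA (tri t u)
  f v = just (inj₁ v)
  g : VA u → VA (tri t u)
  g v = just (inj₂ v)

treeRA-Unique : ∀ t → Unique (names (treeRA t))
treeRA-Unique single = [] ∷ []
treeRA-Unique (ext true t) = subst (λ L → Unique (nothing ∷ L)) (sym (trans (++-identityʳ _) (names-map just (treeRA t))))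
  (Allₚ.map⁺ (All.tabulate λ _ ()) ∷ Uniqueₚ.map⁺ just-injective (treeRA-Unique t))
treeRA-Unique (ext false t) = subst (λ L → Unique (nothing ∷ L)) (sym (names-map just (treeRA t)))
  (Allₚ.map⁺ (All.tabulate λ _ ()) ∷ Uniqueₚ.map⁺ just-injective (treeRA-Unique t))
treeRA-Unique (tri t u) = subst (λ L → Unique (nothing ∷ L)) (sym (cong₂ _++_ (names-map (λ v → just (inj₁ v)) (treeRA t)) (names-map (λ v → just (inj₂ v)) (treeRA u))))
  (Allₚ.++⁺ {xs = map (λ v → just (inj₁ v)) (names (treeRA t))} (Allₚ.map⁺ {xs = names (treeRA t)} (All.tabulate λ _ ())) (Allₚ.map⁺ {xs = names (treeRA u)} (All.tabulate λ _ ())) ∷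
   Uniqueₚ.++⁺ (Uniqueₚ.map⁺ (λ { refl → refl }) (treeRA-Unique t)) (Uniqueₚ.map⁺ (λ { refl → refl }) (treeRA-Unique u)) disjoint)
  where
  disjoint : ∀ {x} → ¬ (x ∈ map (λ v → just (inj₁ v)) (names (treeRA t)) × x ∈ map (λ v → just (inj₂ v)) (names (treeRA u)))
  disjoint (p , q) with ∈-map⁻ _ p | ∈-map⁻ _ q
  ... | _ , _ , refl | _ , _ , ()

treeRA-complete : ∀ t v → v ∈ names (treeRA t)
treeRA-complete single tt = here refl
treeRA-complete (ext true t) nothing = here refl
treeRA-complete (ext true t) (just v) = there (∈-++⁺ˡ (subst (just v ∈_) (sym (names-map just (treeRA t))) (∈-map⁺ just (treeRA-complete t v))))
treeRA-complete (ext false t) nothing = here refl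
treeRA-complete (ext false t) (just v) = there (subst (just v ∈_) (sym (names-map just (treeRA t))) (∈-map⁺ just (treeRA-complete t v)))
treeRA-complete (tri t u) nothing = here refl
treeRA-complete (tri t u) (just (inj₁ v)) = there (∈-++⁺ˡ (subst (just (inj₁ v) ∈_) (sym (names-map _ (treeRA t))) (∈-map⁺ (λ v → just (inj₁ v)) (treeRA-complete t v))))
treeRA-complete (tri t u) (just (inj₂ v)) = there (∈-++⁺ʳ (names (mapTree (λ v → just (inj₁ v)) (treeRA t))) (subst (just (inj₂ v) ∈_) (sym (names-map _ (treeRA u))) (∈-map⁺ (λ v → just (inj₂ v)) (treeRA-complete u v))))

nextFin-< : ∀ {n} (i : Fin n) → suc (toℕ i) < n → toℕ (nextFin i) ≡ suc (toℕ i)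
nextFin-< {suc m} i lt = trans (Finₚ.toℕ-fromℕ< (m%n<n (suc (toℕ i)) (suc m))) (m<n⇒m%n≡m lt)

nextFin-last : ∀ {n} (i : Fin n) → suc (toℕ i) ≡ n → toℕ (nextFin i) ≡ 0
nextFin-last {suc m} i eq = trans (Finₚ.toℕ-fromℕ< (m%n<n (suc (toℕ i)) (suc m))) (trans (cong (_% suc m) eq) (n%n≡0 (suc m)))

module _ {n : ℕ} where

  headOr : List (Fin n) → Fin n → Fin n
  headOr [] e = e
  headOr (i ∷ _) e = i

  Consecutive : List (Fin n) → Fin n → Set
  Consecutive [] e = ⊤
  Consecutive (i ∷ is) e = nextFin i ≡ headOr is e × Consecutive is e

  tabulate-consecutive : ∀ {k} (f : Fin k → Fin n) j z → (∀ i → toℕ (f i) ≡ j + toℕ i) → j + k ≡ n → toℕ z ≡ 0 → Consecutive (tabulate f) z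
  tabulate-consecutive {zero} f j z eq jk z0 = tt
  tabulate-consecutive {suc zero} f j z eq jk z0 = Finₚ.toℕ-injective (trans (nextFin-last (f Fin.zero) (trans (cong suc (trans (eq Fin.zero) (+-identityʳ j))) (trans (+-comm 1 j) jk))) (sym z0)) , tt
  tabulate-consecutive {suc (suc k)} f j z eq jk z0 =
    Finₚ.toℕ-injective (trans (nextFin-< (f Fin.zero) lt) (trans (cong suc (trans (eq Fin.zero) (+-identityʳ j))) (sym (trans (eq (Fin.suc Fin.zero)) (+-comm j 1))))) ,
    tabulate-consecutive (f ∘ Fin.suc) (suc j) z (λ i → trans (eq (Fin.suc i)) (+-suc j (toℕ i))) (trans (sym (+-suc j (suc k))) jk) z0
    where
    lt : suc (toℕ (f Fin.zero)) < n
    lt = ≤-trans (s≤s (s≤s (≤-reflexive (trans (eq Fin.zero) (+-identityʳ j))))) (≤-trans (s≤s (s≤s (m≤m+n j k))) (≤-reflexive (trans (sym (trans (+-suc j (suc k)) (cong suc (+-suc j k)))) jk)))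

  allFin-consecutive : ∀ z → toℕ z ≡ 0 → Consecutive (allFin n) z
  allFin-consecutive z z0 = tabulate-consecutive id 0 z (λ _ → refl) refl z0

module _ (R : Real) where

  open Real R

  private
    m = suc (suc k)

  realBead : Fin m → Bead (RV R)
  realBead i = inj₁ i , ori i , mapTree (λ v → inj₂ (i , v)) (treeAtt (att i))

  realDrawing : Drawing (RV R)
  realDrawing = map realBead (allFin m)

  base-arrows : ∀ (x y : RV R) b (a : Maybe RA) (e : AV a → RV R) →
    cellArrows (baseCell x y b (mapTree e (treeAtt a))) ++ treeArrows (mapTree e (treeAtt a)) ≡
    let βa = if b then (x , y) else (y , x) in βa ∷ attArrows (proj₁ βa) (proj₂ βa) a e
  base-arrows x y true nothing e = refl
  base-arrows x y false nothing e = refl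
  base-arrows x y true (just t) e = cong₂ (λ r L → cellArrows (just x , just y , r) ++ L) (trans (top-map e (treeRA t)) (cong (Maybe.map e) (top-treeRA t))) (trans (treeArrows-map e (treeRA t)) (cong (mapArr e) (treeArrows-treeRA t)))
  base-arrows x y false (just t) e = cong₂ (λ r L → cellArrows (just y , just x , r) ++ L) (trans (top-map e (treeRA t)) (cong (Maybe.map e) (top-treeRA t))) (trans (treeArrows-map e (treeRA t)) (cong (mapArr e) (treeArrows-treeRA t)))

  next-head : ∀ is e → next (map realBead is) (inj₁ e) ≡ inj₁ (headOr is e)
  next-head [] e = refl
  next-head (_ ∷ _) e = refl

  path-arrows : ∀ is e → Consecutive is e → concatMap cellArrows (path (map realBead is) (inj₁ e)) ≡ concatMap (arrowsAt R) is
  path-arrows [] e _ = refl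
  path-arrows (i ∷ is) e (p , ps) = begin
    cellArrows (baseCell x y (ori i) S) ++ concatMap cellArrows (cells S ++ path (map realBead is) (inj₁ e))
      ≡⟨ cong (cellArrows (baseCell x y (ori i) S) ++_) (concatMap-++ cellArrows (cells S) (path (map realBead is) (inj₁ e))) ⟩
    cellArrows (baseCell x y (ori i) S) ++ treeArrows S ++ concatMap cellArrows (path (map realBead is) (inj₁ e))
      ≡⟨ ++-assoc (cellArrows (baseCell x y (ori i) S)) (treeArrows S) _ ⟨
    (cellArrows (baseCell x y (ori i) S) ++ treeArrows S) ++ concatMap cellArrows (path (map realBead is) (inj₁ e))
      ≡⟨ cong₂ _++_ (trans (cong (λ y → cellArrows (baseCell x y (ori i) S) ++ treeArrows S) (trans (next-head is e) (cong inj₁ (sym p)))) (base-arrows x (inj₁ (nextFin i)) (ori i) (att i) (λ v → inj₂ (i , v)))) (path-arrows is e ps) ⟩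
    arrowsAt R i ++ concatMap (arrowsAt R) is ∎
    where
    x = inj₁ i
    y = next (map realBead is) (inj₁ e)
    S = mapTree (λ v → inj₂ (i , v)) (treeAtt (att i))

  realArrows : arrows realDrawing ≡ arr (quiverOf R)
  realArrows = path-arrows (allFin m) Fin.zero (allFin-consecutive Fin.zero refl)

  block : RV R → Fin m
  block (inj₁ i) = i
  block (inj₂ (i , _)) = i

  att-Unique : ∀ a → Unique (names (treeAtt a))
  att-Unique nothing = []
  att-Unique (just t) = treeRA-Unique t

  att-complete : ∀ a (v : AV a) → v ∈ names (treeAtt a)
  att-complete (just t) v = treeRA-complete t v

  beadTree : Fin m → List (RV R)
  beadTree i = names (mapTree (λ v → inj₂ (i , v)) (treeAtt (att i)))

  beadTree≡ : ∀ i → beadTree i ≡ map (λ v → inj₂ (i , v)) (names (treeAtt (att i)))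
  beadTree≡ i = names-map (λ v → inj₂ (i , v)) (treeAtt (att i))

  beadTree-block : ∀ i {x} → x ∈ beadTree i → block x ≡ i
  beadTree-block i x∈ with ∈-map⁻ _ (subst (_ ∈_) (beadTree≡ i) x∈)
  ... | _ , _ , refl = refl

  labels-block : ∀ is {x} → x ∈ labels (map realBead is) → block x ∈ is
  labels-block (i ∷ is) (here refl) = here refl
  labels-block (i ∷ is) (there x∈) with ∈-++⁻ (beadTree i) x∈
  ... | inj₁ p = here (beadTree-block i p)
  ... | inj₂ p = there (labels-block is p)

  inj₂-injective : ∀ i {v w : AV (att i)} → _≡_ {A = RV R} (inj₂ (i , v)) (inj₂ (i , w)) → v ≡ w
  inj₂-injective i refl = refl

  labels-Unique : ∀ is → Unique is → Unique (labels (map realBead is))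
  labels-Unique [] _ = []
  labels-Unique (i ∷ is) u@(_ ∷ us) =
    Allₚ.++⁺ (All.tabulate λ { x∈ refl → contradiction-tree x∈ }) (All.tabulate λ { x∈ refl → i∉ (labels-block is x∈) }) ∷
    Uniqueₚ.++⁺ (subst Unique (sym (beadTree≡ i)) (Uniqueₚ.map⁺ (inj₂-injective i) (att-Unique (att i)))) (labels-Unique is us)
      (λ (p , q) → i∉ (subst (_∈ is) (beadTree-block i p) (labels-block is q)))
    where
    i∉ = head∉tail u
    contradiction-tree : inj₁ i ∉ beadTree i
    contradiction-tree x∈ with ∈-map⁻ _ (subst (_ ∈_) (beadTree≡ i) x∈)
    ... | _ , _ , ()

  labels-complete : ∀ is {i} → i ∈ is → (inj₁ i ∈ labels (map realBead is)) × (∀ v → inj₂ (i , v) ∈ labels (map realBead is))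
  labels-complete (i ∷ is) (here refl) = here refl , λ v → there (∈-++⁺ˡ (subst (_ ∈_) (sym (beadTree≡ i)) (∈-map⁺ _ (att-complete (att i) v))))
  labels-complete (j ∷ is) (there i∈) = let p , q = labels-complete is i∈ in there (∈-++⁺ʳ (beadTree j) p) , λ v → there (∈-++⁺ʳ (beadTree j) (q v))

  realDrawing-complete : ∀ x → x ∈ labels realDrawing
  realDrawing-complete (inj₁ i) = proj₁ (labels-complete (allFin m) (∈-allFin i))
  realDrawing-complete (inj₂ (i , v)) = proj₂ (labels-complete (allFin m) (∈-allFin i)) v

  realDrawing-valid : Valid realDrawing
  realDrawing-valid = labels-Unique (allFin m) (Uniqueₚ.allFin⁺ m) , mixed (ori i₀) refl (ori j₀) refl
    where
    i₀ = proj₁ nonOr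
    j₀ = proj₁ (proj₂ nonOr)
    occurs : ∀ i → ori i ∈ orientations realDrawing
    occurs i = subst (ori i ∈_) (map-∘ (allFin m)) (∈-map⁺ ori (∈-allFin i))
    mixed : ∀ b → ori i₀ ≡ b → ∀ c → ori j₀ ≡ c → Mixed realDrawing
    mixed true e true e' = contradiction (trans e (sym e')) (proj₂ (proj₂ nonOr))
    mixed true e false e' = subst (_∈ orientations realDrawing) e (occurs i₀) , subst (_∈ orientations realDrawing) e' (occurs j₀)
    mixed false e true e' = subst (_∈ orientations realDrawing) e' (occurs j₀) , subst (_∈ orientations realDrawing) e (occurs i₀)
    mixed false e false e' = contradiction (trans e (sym e')) (proj₂ (proj₂ nonOr))

  realWord : Word
  realWord = shape realDrawing

  letter : Fin m → Letter
  letter i = ori i , treeShape (treeAtt (att i))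

  realWord≡ : realWord ≡ map letter (allFin m)
  realWord≡ = trans (sym (map-∘ (allFin m))) (map-cong (λ i → cong (ori i ,_) (treeShape-map (λ v → inj₂ (i , v)) (treeAtt (att i)))) (allFin m))

  sumAt-map : ∀ b f is → sumAt b f (map letter is) ≡ foldr _+_ 0 (map (λ i → pick b (ori i) (f (treeShape (treeAtt (att i))))) is)
  sumAt-map b f [] = refl
  sumAt-map b f (i ∷ is) = cong (pick b (ori i) (f (treeShape (treeAtt (att i)))) +_) (sumAt-map b f is)

  -- `suc` accounts for the 3-cycle by which the tree hangs on its base arrow. A node with a single
  -- inner child adds one leaf, for its arrow in no 3-cycle; a root without children supplies the
  -- two leaves of the attaching 3-cycle.
  leavesRA : ∀ t → leaves (treeRA t) ≡ nonTriA t + 2 * suc (trisA t)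
  leaves-map : ∀ {X Y : Set} (f : X → Y) t → leaves (mapTree f t) ≡ leaves t
  leaves-map f leaf = refl
  leaves-map f (node z l r) = cong₂ _+_ (leaves-map f l) (leaves-map f r)
  leavesRA single = refl
  leavesRA (ext true t) = trans (cong (_+ 1) (trans (leaves-map just (treeRA t)) (leavesRA t))) (+-comm _ 1)
  leavesRA (ext false t) = cong suc (trans (leaves-map just (treeRA t)) (leavesRA t))
  leavesRA (tri t u) = trans (cong₂ _+_ (trans (leaves-map _ (treeRA t)) (leavesRA t)) (trans (leaves-map _ (treeRA u)) (leavesRA u)))
    (ring (nonTriA t) (trisA t) (nonTriA u) (trisA u))
    where
    ring : ∀ a b c d → (a + 2 * suc b) + (c + 2 * suc d) ≡ (a + c) + 2 * suc (suc (b + d))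
    ring = ℕ-Ring.solve-∀

  cherries-nodeˡ : ∀ {X : Set} (z : X) l r {x} → top l ≡ just x → cherries (node z l r) ≡ cherries l + cherries r
  cherries-nodeˡ z (node _ _ _) r _ = refl
  cherries-nodeʳ : ∀ {X : Set} (z : X) l r {x} → top r ≡ just x → cherries (node z l r) ≡ cherries l + cherries r
  cherries-nodeʳ z leaf (node _ _ _) _ = refl
  cherries-nodeʳ z (node _ _ _) (node _ _ _) _ = refl

  cherries-map : ∀ {X Y : Set} (f : X → Y) t → cherries (mapTree f t) ≡ cherries t
  cherries-map f leaf = refl
  cherries-map f (node _ leaf leaf) = refl
  cherries-map f (node _ leaf r@(node _ _ _)) = cherries-map f r
  cherries-map f (node _ l@(node _ _ _) r) = cong₂ _+_ (cherries-map f l) (cherries-map f r)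

  -- A nonempty tree has one cherry more than nodes with two inner children; the 3-cycle on the base
  -- arrow makes up the difference.
  cherriesRA : ∀ t → cherries (treeRA t) ≡ suc (trisA t)
  cherriesRA single = refl
  cherriesRA (ext true t) = trans (cherries-nodeˡ nothing (mapTree just (treeRA t)) leaf (trans (top-map just (treeRA t)) (cong (Maybe.map just) (top-treeRA t))))
    (trans (+-identityʳ _) (trans (cherries-map just (treeRA t)) (cherriesRA t)))
  cherriesRA (ext false t) = trans (cherries-nodeʳ nothing leaf (mapTree just (treeRA t)) (trans (top-map just (treeRA t)) (cong (Maybe.map just) (top-treeRA t))))
    (trans (cherries-map just (treeRA t)) (cherriesRA t))
  cherriesRA (tri t u) = trans (cherries-nodeˡ nothing (mapTree _ (treeRA t)) (mapTree _ (treeRA u)) (trans (top-map _ (treeRA t)) (cong (Maybe.map _) (top-treeRA t))))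
    (trans (cong₂ _+_ (trans (cherries-map _ (treeRA t)) (cherriesRA t)) (trans (cherries-map _ (treeRA u)) (cherriesRA u))) (cong suc (+-suc (trisA t) (trisA u))))

  leaves-att : ∀ a → leaves (treeShape (treeAtt a)) ≡ proj₁ (contrib R a) + 2 * proj₂ (contrib R a)
  leaves-att nothing = refl
  leaves-att (just t) = trans (leaves-map _ (treeRA t)) (leavesRA t)

  cherries-att : ∀ a → cherries (treeShape (treeAtt a)) ≡ proj₂ (contrib R a)
  cherries-att nothing = refl
  cherries-att (just t) = trans (cherries-map _ (treeRA t)) (cherriesRA t)

  pick-linear : ∀ b c m n → pick b c (m + 2 * n) ≡ pick b c m + 2 * pick b c n
  pick-linear true true m n = refl
  pick-linear true false m n = refl
  pick-linear false true m n = refl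
  pick-linear false false m n = refl

  sumAt-cherries : ∀ b → sumAt b cherries realWord ≡ sumOver R b proj₂
  sumAt-cherries b = trans (cong (sumAt b cherries) realWord≡) (trans (sumAt-map b cherries (allFin m))
    (cong (foldr _+_ 0) (map-cong (λ i → cong (pick b (ori i)) (cherries-att (att i))) (allFin m))))

  sumAt-leaves : ∀ b → sumAt b leaves realWord ≡ sumOver R b proj₁ + 2 * sumOver R b proj₂
  sumAt-leaves b = trans (cong (sumAt b leaves) realWord≡) (trans (sumAt-map b leaves (allFin m)) (go (allFin m)))
    where
    go : ∀ is → foldr _+_ 0 (map (λ i → pick b (ori i) (leaves (treeShape (treeAtt (att i))))) is) ≡
      foldr _+_ 0 (map (λ i → pick b (ori i) (proj₁ (contrib R (att i)))) is) + 2 * foldr _+_ 0 (map (λ i → pick b (ori i) (proj₂ (contrib R (att i)))) is)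
    go [] = refl
    go (i ∷ is) = trans (cong₂ _+_ (trans (cong (pick b (ori i)) (leaves-att (att i))) (pick-linear b (ori i) (proj₁ (contrib R (att i))) (proj₂ (contrib R (att i))))) (go is))
      (ring (pick b (ori i) (proj₁ (contrib R (att i)))) (pick b (ori i) (proj₂ (contrib R (att i)))) _ _)
      where
      ring : ∀ a b c d → (a + 2 * b) + (c + 2 * d) ≡ (a + c) + 2 * (b + d)
      ring = ℕ-Ring.solve-∀

  realWord-letters : realWord ≡ map (λ i → ori i , treeShape (treeAtt (att i))) (allFin m)
  realWord-letters = realWord≡

realIso⇒dihedral : ∀ R R' → RealIso R R' → realWord R' ∈ dihedral (realWord R)
realIso⇒dihedral R R' (f , p) = arrows-rigid (realDrawing R) (realDrawing R') (realDrawing-valid R) (realDrawing-complete R) (realDrawing-valid R') (realDrawing-complete R') f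
  (subst₂ (λ L M → mapArr (Inverse.to f) L ↭ M) (sym (realArrows R)) (sym (realArrows R')) p)

dihedral⇒realIso : ∀ R R' → realWord R' ∈ dihedral (realWord R) → RealIso R R'
dihedral⇒realIso R R' w∈ with dihedral⇒relabelling (realDrawing R) (realDrawing R') (proj₁ (realDrawing-valid R)) (realDrawing-complete R) (proj₁ (realDrawing-valid R')) (realDrawing-complete R') w∈
... | f , D' , ts , eq = f , subst₂ (λ L M → mapArr (Inverse.to f) L ↭ M) (realArrows R) (realArrows R')
  (↭-trans (Permₚ.map⁺ _ (concatMap-↭ {X = ⊤} cellArrows (↭-sym ts))) (↭-reflexive (trans (sym (arrows-map (Inverse.to f) D')) (cong arrows eq))))

nodeRA : Maybe RA → Maybe RA → RA
nodeRA nothing nothing = single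
nodeRA (just t) nothing = ext true t
nodeRA nothing (just t) = ext false t
nodeRA (just t) (just u) = tri t u

shapeRA : Shape → Maybe RA
shapeRA leaf = nothing
shapeRA (node _ l r) = just (nodeRA (shapeRA l) (shapeRA r))

treeShape-shapeRA : ∀ s → treeShape (treeAtt (shapeRA s)) ≡ s
treeShape-shapeRA leaf = refl
treeShape-shapeRA (node tt l r) = trans (node-shape (shapeRA l) (shapeRA r)) (cong₂ (node tt) (treeShape-shapeRA l) (treeShape-shapeRA r))
  where
  node-shape : ∀ a b → treeShape (treeRA (nodeRA a b)) ≡ node tt (treeShape (treeAtt a)) (treeShape (treeAtt b))
  node-shape nothing nothing = refl
  node-shape (just t) nothing = cong (λ s → node tt s leaf) (treeShape-map just (treeRA t))
  node-shape nothing (just t) = cong (node tt leaf) (treeShape-map just (treeRA t))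
  node-shape (just t) (just u) = cong₂ (node tt) (treeShape-map _ (treeRA t)) (treeShape-map _ (treeRA u))

wordReal : ∀ w → true ∈ map proj₁ w → false ∈ map proj₁ w → Σ Real λ R → realWord R ≡ w
wordReal [] () _
wordReal ((true , _) ∷ []) _ (here ())
wordReal ((true , _) ∷ []) _ (there ())
wordReal ((false , _) ∷ []) (here ()) _
wordReal ((false , _) ∷ []) (there ()) _
wordReal w@(x ∷ y ∷ zs) t∈ f∈ = R , trans (realWord-letters R) (trans (map-cong (λ i → cong (proj₁ (lookup w i) ,_) (treeShape-shapeRA (proj₂ (lookup w i)))) (allFin (length w)))
    (trans (map-tabulate id (lookup w)) (tabulate-lookup w)))
  where
  at-index : ∀ {b} (w : Word) → b ∈ map proj₁ w → ∃ λ i → proj₁ (lookup w i) ≡ b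
  at-index (_ ∷ w) (here refl) = Fin.zero , refl
  at-index (_ ∷ w) (there b∈) = let i , e = at-index w b∈ in Fin.suc i , e
  R : Real
  R = record
    { k = length zs
    ; ori = λ i → proj₁ (lookup w i)
    ; nonOr = proj₁ (at-index w t∈) , proj₁ (at-index w f∈) , λ e → true≢false (trans (sym (proj₂ (at-index w t∈))) (trans e (proj₂ (at-index w f∈))))
    ; att = λ i → shapeRA (proj₂ (lookup w i))
    }
    where
    true≢false : true ≢ false
    true≢false ()

leaves⇒∈ : ∀ b w → 1 ≤ sumAt b leaves w → b ∈ map proj₁ w
leaves⇒∈ true ((true , _) ∷ w) _ = here refl
leaves⇒∈ true ((false , _) ∷ w) 1≤ = there (leaves⇒∈ true w 1≤)
leaves⇒∈ false ((true , _) ∷ w) 1≤ = there (leaves⇒∈ false w 1≤)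
leaves⇒∈ false ((false , _) ∷ w) _ = here refl

-- Mutation classes

mutEntry-neg : ∀ a b → mutEntry (ℤ.- a) (ℤ.- b) ≡ ℤ.- mutEntry a b
mutEntry-neg (ℤ.+ zero) (ℤ.+ zero) = refl
mutEntry-neg (ℤ.+ zero) (ℤ.+ suc b) = refl
mutEntry-neg (ℤ.+ zero) ℤ.-[1+ b ] = refl
mutEntry-neg (ℤ.+ suc a) (ℤ.+ zero) = refl
mutEntry-neg (ℤ.+ suc a) (ℤ.+ suc b) = refl
mutEntry-neg (ℤ.+ suc a) ℤ.-[1+ b ] = refl
mutEntry-neg ℤ.-[1+ a ] (ℤ.+ zero) = refl
mutEntry-neg ℤ.-[1+ a ] (ℤ.+ suc b) = refl
mutEntry-neg ℤ.-[1+ a ] ℤ.-[1+ b ] = refl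

module _ {n : ℕ} where

  private
    Vert = Fin n

  μ-involutive : ∀ (v : Vert) (B : Mat n) x y → μ v (μ v B) x y ≡ B x y
  μ-involutive v B x y = cases (x Fin.≟ v) (y Fin.≟ v)
    where
    cases : Dec (x ≡ v) → Dec (y ≡ v) → μ v (μ v B) x y ≡ B x y
    cases (yes refl) _ = trans (μ-≡ˡ {v = v} {B = μ v B} {y = y}) (trans (cong ℤ.-_ (μ-≡ˡ {v = v} {B = B} {y = y})) (ℤₚ.neg-involutive (B x y)))
    cases (no _) (yes refl) = trans (μ-≡ʳ {v = v} {B = μ v B} {x = x}) (trans (cong ℤ.-_ (μ-≡ʳ {v = v} {B = B} {x = x})) (ℤₚ.neg-involutive (B x y)))
    cases (no x≢) (no y≢) = trans (μ-≢ {B = μ v B} x≢ y≢) (trans (cong₂ _⊞_ (μ-≢ {B = B} x≢ y≢)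
      (trans (cong₂ mutEntry (μ-≡ʳ {v = v} {B = B} {x = x}) (μ-≡ˡ {v = v} {B = B} {y = y})) (mutEntry-neg (B x v) (B v y))))
      (ring (B x y) (mutEntry (B x v) (B v y))))
      where
      ring : ∀ a b → (a ⊞ b) ⊞ ℤ.- b ≡ a
      ring = ℤ-Ring.solve-∀

  MutEq-sym : ∀ {B B' : Mat n} → MutEq B B' → MutEq B' B
  MutEq-sym = reverse⋆ step
    where
    step : ∀ {B B' : Mat n} → MutStep B B' ⊎ MatIso B B' → MutStep B' B ⊎ MatIso B' B
    step {B} {B'} (inj₁ (v , eq)) = inj₁ (v , λ x y → sym (trans (μ-cong v {B'} {μ v B} eq x y) (μ-involutive v B x y)))
    step {B} {B'} (inj₂ (σ , eq)) = inj₂ (↔-sym σ , λ x y → sym (trans (eq (σ ⟨$⟩ˡ x) (σ ⟨$⟩ˡ y)) (cong₂ B (inverseʳ σ) (inverseʳ σ))))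

  ≗⇒MutEq : ∀ {B B' : Mat n} → (∀ x y → B' x y ≡ B x y) → MutEq B B'
  ≗⇒MutEq eq = inj₂ (↔-id _ , eq) ◅ ε

  leavesAt-rot : ∀ c d (D : Drawing Vert) → leavesAt c (rot d D) ≡ leavesAt c D
  leavesAt-rot c d D = trans (cong (sumAt c leaves) (map-rot {X = ⊤} _ d D)) (sumAt-rot c leaves d (shape D))

  -- B is the matrix of a triangulation with r and s marked points on the two boundary circles.
  record Drawn (r s : ℕ) (B : Mat n) : Set where
    constructor drawn
    field
      drawing : Drawing Vert
      valid : Valid drawing
      complete : Complete drawing
      matrix : ∀ x y → B x y ≡ ⟦ drawing ⟧ x y
      leavesᶠ : leavesAt false drawing ≡ r
      leavesᵗ : leavesAt true drawing ≡ s

  drawn-mutate : ∀ {r s B B'} → Drawn r s B → MutStep B B' → Drawn r s B'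
  drawn-mutate {B = B} {B'} (drawn D val comp mat lᶠ lᵗ) (v , eq) with flip-exists D (proj₂ val) (comp v)
  ... | d , D' , fl = drawn D' (valid-flip fl vR) (λ x → ∈-resp-↭ (↭-trans (labels-↭ (↭-sym (rot-↭ d D))) (flip-labels fl)) (comp x))
      (λ x y → trans (eq x y) (trans (μ-cong v {B} {form (triangles (rot d D))} (λ a b → trans (mat a b) (sym (form-rot d D a b))) x y) (sym (flip⇒μ (flip-form fl (proj₁ vR) (proj₂ vR)) x y))))
      (trans (sym (flip-leaves fl false)) (trans (leavesAt-rot false d D) lᶠ)) (trans (sym (flip-leaves fl true)) (trans (leavesAt-rot true d D) lᵗ))
    where vR = valid-rot d val

  drawn-relabel : ∀ {r s B B'} → Drawn r s B → MatIso B B' → Drawn r s B'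
  drawn-relabel {B = B} {B'} (drawn D val comp mat lᶠ lᵗ) (σ , eq) = drawn (mapDrawing f D) (valid-map f inj val) (complete-map (↔-sym σ) D comp)
      (λ x y → trans (eq x y) (trans (mat (σ ⟨$⟩ʳ x) (σ ⟨$⟩ʳ y)) (trans (sym (form-map inj D (σ ⟨$⟩ʳ x) (σ ⟨$⟩ʳ y))) (cong₂ (⟦ mapDrawing f D ⟧) (inverseˡ σ) (inverseˡ σ)))))
      (trans (cong (sumAt false leaves) (shape-map f D)) lᶠ) (trans (cong (sumAt true leaves) (shape-map f D)) lᵗ)
    where
    f : Vert → Vert
    f = σ ⟨$⟩ˡ_
    inj : ∀ {x y} → f x ≡ f y → x ≡ y
    inj = to-injective (↔-sym σ)

  drawn-MutEq : ∀ {r s B B'} → Drawn r s B → MutEq B B' → Drawn r s B'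
  drawn-MutEq dr ε = dr
  drawn-MutEq dr (inj₁ st ◅ rest) = drawn-MutEq (drawn-mutate dr st) rest
  drawn-MutEq dr (inj₂ is ◅ rest) = drawn-MutEq (drawn-relabel dr is) rest

  matIso⇒dihedral : ∀ (D E : Drawing Vert) → Valid D → Complete D → Valid E → Complete E → MatIso (⟦ D ⟧) (⟦ E ⟧) → shape E ∈ dihedral (shape D)
  matIso⇒dihedral D E vD cD vE cE (σ , eq) = subst (λ w → shape E ∈ dihedral w) (shape-map f D)
      (≋⇒dihedral (rigid (mapDrawing f D) E (valid-map f inj vD) vE (complete-map (↔-sym σ) D cD) cE same))
    where
    f : Vert → Vert
    f = σ ⟨$⟩ˡ_
    inj : ∀ {x y} → f x ≡ f y → x ≡ y
    inj = to-injective (↔-sym σ)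
    same : ∀ x y → ⟦ mapDrawing f D ⟧ x y ≡ ⟦ E ⟧ x y
    same x y = sym (trans (eq x y) (trans (sym (form-map inj D (σ ⟨$⟩ʳ x) (σ ⟨$⟩ʳ y))) (cong₂ (⟦ mapDrawing f D ⟧) (inverseˡ σ) (inverseˡ σ))))

  dihedral⇒matIso : ∀ (D E : Drawing Vert) → Valid D → Complete D → Valid E → Complete E → shape E ∈ dihedral (shape D) → MatIso (⟦ D ⟧) (⟦ E ⟧)
  dihedral⇒matIso D E vD cD vE cE w∈ with dihedral⇒relabelling D E (proj₁ vD) cD (proj₁ vE) cE w∈
  ... | f , D' , ts , refl = ↔-sym f , λ x y → trans (cong₂ (⟦ mapDrawing (Inverse.to f) D' ⟧) (sym (Inverse.strictlyInverseˡ f x)) (sym (Inverse.strictlyInverseˡ f y)))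
    (trans (form-map (to-injective f) D' (Inverse.from f x) (Inverse.from f y)) (form-↭ ts (Inverse.from f x) (Inverse.from f y)))

  Reach : Drawing Vert → Drawing Vert → Set
  Reach D E = MutEq (⟦ D ⟧) (⟦ E ⟧)

  reach-flip : ∀ {v D D'} → Flip v D D' → Valid D → Reach D D'
  reach-flip {v} fl (u , m) = inj₁ (v , flip⇒μ (flip-form fl u m)) ◅ ε

  reach-rot : ∀ d D → Reach D (rot d D)
  reach-rot d D = ≗⇒MutEq (form-rot d D)

  -- A flip of the part bs behind a prefix: rotate bs to the front, flip there with the prefix as
  -- context, and rotate back.
  reach-context : ∀ {v} as {bs cs} → (∀ ds → Flip v (bs ++ ds) (cs ++ ds)) → Valid (as ++ bs) → Reach (as ++ bs) (as ++ cs) × Valid (as ++ cs) ×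
    (labels (as ++ bs) ↭ labels (as ++ cs)) × (∀ c → leavesAt c (as ++ bs) ≡ leavesAt c (as ++ cs))
  reach-context {v} as {bs} {cs} fl val =
    (subst (Reach (as ++ bs)) (rot-++ as bs) (reach-rot (length as) (as ++ bs)) ◅◅ reach-flip (fl as) val′) ◅◅ subst (Reach (cs ++ as)) (rot-++ cs as) (reach-rot (length cs) (cs ++ as)) ,
    subst Valid (rot-++ cs as) (valid-rot (length cs) (valid-flip (fl as) val′)) ,
    ↭-trans (labels-↭ (Permₚ.++-comm as bs)) (↭-trans (flip-labels (fl as)) (labels-↭ (Permₚ.++-comm cs as))) ,
    λ c → trans (swap-leaves c as bs) (trans (flip-leaves (fl as) c) (swap-leaves c cs as))
    where
    val′ : Valid (bs ++ as)
    val′ = subst Valid (rot-++ as bs) (valid-rot (length as) val)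
    swap-leaves : ∀ c (D E : Drawing Vert) → leavesAt c (D ++ E) ≡ leavesAt c (E ++ D)
    swap-leaves c D E = trans (sym (leavesAt-rot c (length D) (D ++ E))) (cong (leavesAt c) (rot-++ D E))

  Sorted : Drawing Vert → Set
  Sorted D = ∃ λ t → ∃ λ f → orientations D ≡ replicate t true ++ replicate f false

  Simplified : Drawing Vert → Drawing Vert → Set
  Simplified D E = Reach D E × Valid E × (labels D ↭ labels E) × (∀ c → leavesAt c D ≡ leavesAt c E)

  simplified-trans : ∀ {D E F} → Simplified D E → Simplified E F → Simplified D F
  simplified-trans (p , _ , q , r) (p' , v' , q' , r') = p ◅◅ p' , v' , ↭-trans q q' , λ c → trans (r c) (r' c)

  -- Each split moves the root of a tree onto the cycle, so the number of tree nodes drops until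
  -- none is left.
  bare-out : ∀ D → Acc _<_ (nodes D) → Valid D → ∃ λ E → Simplified D E × All Bare E
  bare-out D (acc rs) val with find-node D
  ... | inj₁ bare = D , (ε , val , ↭-refl , λ _ → refl) , bare
  ... | inj₂ (d , x , b , z , l , r , E , eq) with node≡join b z l r
  ... | t , t' , j = let F , s , bare = bare-out A' (rs smaller) vA' in F , simplified-trans first s , bare
    where
    A = (x , b , join b z t t') ∷ E
    A' = (x , b , t) ∷ (z , b , t') ∷ E
    A≡ : rot d D ≡ A
    A≡ = trans eq (cong (λ s → (x , b , s) ∷ E) j)
    vA : Valid A
    vA = subst Valid A≡ (valid-rot d val)
    flA : Flip z A A'
    flA = split x b t t' E
    vA' : Valid A'
    vA' = valid-flip flA vA
    smaller : nodes A' < nodes D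
    smaller = <-≤-trans (nodes-split x b z t t' E) (≤-reflexive (trans (cong nodes (sym A≡)) (nodes-↭ (rot-↭ d D))))
    first : Simplified D A'
    first = subst (Reach D) A≡ (reach-rot d D) ◅◅ reach-flip flA vA , vA' ,
      ↭-trans (labels-↭ (↭-sym (↭-trans (↭-reflexive (sym A≡)) (rot-↭ d D)))) (flip-labels flA) ,
      λ c → trans (sym (leavesAt-rot c d D)) (trans (cong (leavesAt c) A≡) (flip-leaves flA c))

  -- Insertion sort: an anti-clockwise arrow is carried past the clockwise ones. Each exchange is a
  -- `swap` flip; the orientations move while the names of the vertices stay in place.
  insert : ∀ as x bs → All Bare bs → Sorted bs → Valid (as ++ (x , false , leaf) ∷ bs) →
    ∃ λ cs → Simplified (as ++ (x , false , leaf) ∷ bs) (as ++ cs) × All Bare cs × Sorted cs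
  insert as x [] _ _ val = _ , (ε , val , ↭-refl , λ _ → refl) , refl ∷ [] , 0 , 1 , refl
  insert as x ((v , false , leaf) ∷ bs) bare (t , f , eq) val = _ , (ε , val , ↭-refl , λ _ → refl) , refl ∷ bare , 0 , suc f , all-false t eq
    where
    all-false : ∀ t → false ∷ orientations bs ≡ replicate t true ++ replicate f false → false ∷ false ∷ orientations bs ≡ false ∷ replicate f false
    all-false zero e = cong (false ∷_) e
    all-false (suc t) ()
  insert as x ((v , true , leaf) ∷ bs) (refl ∷ bare) (t , f , eq) val =
    let cs , s , bareC , sortedC = insert (as ++ [ x , true , leaf ]) v bs bare (tail-sorted t eq) (subst Valid (assoc ((v , false , leaf) ∷ bs)) (proj₁ (proj₂ swapped)))
    in (x , true , leaf) ∷ cs , simplified-trans swapped (subst₂ Simplified (sym (assoc ((v , false , leaf) ∷ bs))) (sym (assoc cs)) s) , refl ∷ bareC , cons-sorted sortedC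
    where
    assoc : ∀ es → as ++ (x , true , leaf) ∷ es ≡ (as ++ [ x , true , leaf ]) ++ es
    assoc es = sym (++-assoc as [ x , true , leaf ] es)
    swapped : Simplified (as ++ (x , false , leaf) ∷ (v , true , leaf) ∷ bs) (as ++ (x , true , leaf) ∷ (v , false , leaf) ∷ bs)
    swapped = reach-context {v} as (λ ds → swap x false leaf leaf (bs ++ ds)) val
    tail-sorted : ∀ t → true ∷ orientations bs ≡ replicate t true ++ replicate f false → Sorted bs
    tail-sorted zero e = contradiction e (λ e → no-true f e)
      where
      no-true : ∀ f → true ∷ orientations bs ≢ replicate f false
      no-true zero ()
      no-true (suc f) ()
    tail-sorted (suc t) e = t , f , ∷-injectiveʳ e
    cons-sorted : ∀ {cs} → Sorted cs → Sorted ((x , true , leaf) ∷ cs)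
    cons-sorted (t , f , e) = suc t , f , cong (true ∷_) e
  insert as x ((v , true , node _ _ _) ∷ bs) (() ∷ _)
  insert as x ((v , false , node _ _ _) ∷ bs) (() ∷ _)

  sort : ∀ as bs → All Bare bs → Valid (as ++ bs) → ∃ λ cs → Simplified (as ++ bs) (as ++ cs) × All Bare cs × Sorted cs
  sort as [] _ val = [] , (ε , val , ↭-refl , λ _ → refl) , [] , 0 , 0 , refl
  sort as ((x , b , leaf) ∷ bs) (refl ∷ bare) val with sort (as ++ [ x , b , leaf ]) bs bare (subst Valid (sym (++-assoc as [ x , b , leaf ] bs)) val)
  ... | cs , s , bareC , sortedC = place b refl
    where
    s′ : Simplified (as ++ (x , b , leaf) ∷ bs) (as ++ (x , b , leaf) ∷ cs)
    s′ = subst₂ Simplified (++-assoc as [ x , b , leaf ] bs) (++-assoc as [ x , b , leaf ] cs) s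
    place : ∀ c → b ≡ c → ∃ λ cs → Simplified (as ++ (x , b , leaf) ∷ bs) (as ++ cs) × All Bare cs × Sorted cs
    place true refl = (x , true , leaf) ∷ cs , s′ , refl ∷ bareC , (let t , f , e = sortedC in suc t , f , cong (true ∷_) e)
    place false refl = let es , s″ , bareE , sortedE = insert as x cs bareC sortedC (proj₁ (proj₂ s′)) in es , simplified-trans s′ s″ , bareE , sortedE

  bare-shape : ∀ (D : Drawing Vert) → All Bare D → shape D ≡ map (λ b → b , leaf) (orientations D)
  bare-shape [] _ = refl
  bare-shape ((x , b , leaf) ∷ D) (refl ∷ bare) = cong ((b , leaf) ∷_) (bare-shape D bare)

  canonical : ℕ → ℕ → Word
  canonical s r = map (λ b → b , leaf) (replicate s true ++ replicate r false)

  canonical-leaves : ∀ t f → sumAt true leaves (canonical t f) ≡ t × sumAt false leaves (canonical t f) ≡ f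
  canonical-leaves zero zero = refl , refl
  canonical-leaves zero (suc f) = let a , b = canonical-leaves zero f in a , cong suc b
  canonical-leaves (suc t) f = let a , b = canonical-leaves t f in cong suc a , b

  normalise : ∀ D → Valid D → Complete D → ∃ λ E → MutEq (⟦ D ⟧) (⟦ E ⟧) × Valid E × Complete E × shape E ≡ canonical (leavesAt true D) (leavesAt false D)
  normalise D val comp with bare-out D (<-wellFounded (nodes D)) val
  ... | B , s , bareB with sort [] B bareB (proj₁ (proj₂ s))
  ... | E , s' , bareE , t , f , e = E , proj₁ total , proj₁ (proj₂ total) , (λ x → ∈-resp-↭ (proj₁ (proj₂ (proj₂ total))) (comp x)) ,
      trans shapeE (cong₂ canonical (trans (sym (proj₁ (canonical-leaves t f))) (trans (cong (sumAt true leaves) (sym shapeE)) (sym (proj₂ (proj₂ (proj₂ total)) true))))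
                                    (trans (sym (proj₂ (canonical-leaves t f))) (trans (cong (sumAt false leaves) (sym shapeE)) (sym (proj₂ (proj₂ (proj₂ total)) false)))))
    where
    total : Simplified D E
    total = simplified-trans s s'
    shapeE : shape E ≡ canonical t f
    shapeE = trans (bare-shape E bareE) (cong (map (λ b → b , leaf)) e)

  -- Both triangulations reduce to bare cycles with the same sorted word, and mutations can be
  -- undone.
  drawn-connected : ∀ {r s B B'} → Drawn r s B → Drawn r s B' → MutEq B B'
  drawn-connected (drawn D v c mat lᶠ lᵗ) (drawn D' v' c' mat' lᶠ' lᵗ') with normalise D v c | normalise D' v' c'
  ... | E , p , vE , cE , sE | E' , p' , vE' , cE' , sE' = ≗⇒MutEq (λ x y → sym (mat x y)) ◅◅ p ◅◅
      (inj₂ (dihedral⇒matIso E E' vE cE vE' cE' (subst (_∈ dihedral (shape E)) (trans sE (trans (cong₂ canonical (trans lᵗ (sym lᵗ')) (trans lᶠ (sym lᶠ'))) (sym sE'))) (self∈dihedral (shape E)))) ◅ ε) ◅◅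
      MutEq-sym p' ◅◅ ≗⇒MutEq mat'

-- The non-oriented cycle as a drawing

isYes-true : ∀ {P : Set} (d : Dec P) → P → ⌊ d ⌋ ≡ true
isYes-true d p = trans (isYes≗does d) (dec-true d p)

isYes-false : ∀ {P : Set} (d : Dec P) → ¬ P → ⌊ d ⌋ ≡ false
isYes-false d ¬p = trans (isYes≗does d) (dec-false d ¬p)

module _ (r s : ℕ) (1≤r : 1 ≤ r) (1≤s : 1 ≤ s) where

  private
    n = r + s
    Vert = Fin n

    orient : Vert → Bool
    orient e = ⌊ toℕ e ℕ.<? r ⌋

    cycleBead : Vert → Bead Vert
    cycleBead e = e , orient e , leaf

    cycle : Drawing Vert
    cycle = map cycleBead (allFin n)

    labels-cycle : ∀ es → labels (map cycleBead es) ≡ es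
    labels-cycle [] = refl
    labels-cycle (e ∷ es) = cong (e ∷_) (labels-cycle es)

    orientations-cycle : ∀ e → orient e ∈ orientations cycle
    orientations-cycle e = subst (orient e ∈_) (map-∘ (allFin n)) (∈-map⁺ orient (∈-allFin e))

    0<n : 0 < n
    0<n = ≤-trans 1≤r (m≤m+n r s)

    r<n : r < n
    r<n = <-≤-trans (m<m+n r 1≤s) ≤-refl

    cycle-valid : Valid cycle
    cycle-valid = subst Unique (sym (labels-cycle (allFin n))) (Uniqueₚ.allFin⁺ n) ,
      subst (_∈ orientations cycle) (isYes-true (toℕ (Fin.fromℕ< 0<n) ℕ.<? r) (subst (_< r) (sym (Finₚ.toℕ-fromℕ< 0<n)) 1≤r)) (orientations-cycle (Fin.fromℕ< 0<n)) ,
      subst (_∈ orientations cycle) (isYes-false (toℕ (Fin.fromℕ< r<n) ℕ.<? r) (λ lt → <-irrefl (Finₚ.toℕ-fromℕ< r<n) lt)) (orientations-cycle (Fin.fromℕ< r<n))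

    cycle-complete : Complete cycle
    cycle-complete v = subst (v ∈_) (sym (labels-cycle (allFin n))) (∈-allFin v)

    edgeForm : List Vert → Mat n
    edgeForm [] i j = ℤ.+ 0
    edgeForm (e ∷ es) i j = cellForm (baseCell e (nextFin e) (orient e) leaf) i j ⊞ edgeForm es i j

    next-cycle : ∀ es z → next (map cycleBead es) z ≡ headOr es z
    next-cycle [] z = refl
    next-cycle (_ ∷ _) z = refl

    path-cycle : ∀ es z → Consecutive es z → ∀ i j → form (path (map cycleBead es) z) i j ≡ edgeForm es i j
    path-cycle [] z _ i j = refl
    path-cycle (e ∷ es) z (p , ps) i j = cong₂ _⊞_ (cong (λ y → cellForm (baseCell e y (orient e) leaf) i j) (trans (next-cycle es z) (sym p))) (path-cycle es z ps i j)

    countB-acc : ∀ a bs → countB a bs ≡ a + countB 0 bs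
    countB-acc a [] = sym (+-identityʳ a)
    countB-acc a (true ∷ bs) = trans (countB-acc (suc a) bs) (trans (sym (+-suc a (countB 0 bs))) (cong (a +_) (sym (countB-acc 1 bs))))
    countB-acc a (false ∷ bs) = countB-acc a bs

    bit : Bool → ℤ
    bit b = if b then ℤ.+ 1 else ℤ.+ 0

    countB-∷ : ∀ b bs → ℤ.+ countB 0 (b ∷ bs) ≡ bit b ⊞ ℤ.+ countB 0 bs
    countB-∷ true bs = cong ℤ.+_ (countB-acc 1 bs)
    countB-∷ false bs = refl

    bit-∧ : ∀ a b → bit (a ∧ b) ≡ bit a ⊠ bit b
    bit-∧ true true = refl
    bit-∧ true false = refl
    bit-∧ false b = refl

    hit : Vert → Vert → Vert × Vert → Bool
    hit i j (a , b) = ⌊ (a Fin.≟ i) ×-dec (b Fin.≟ j) ⌋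

    hit-bit : ∀ i j a b → bit (hit i j (a , b)) ≡ indicator (just a) i ⊠ indicator (just b) j
    hit-bit i j a b = trans (cong bit (isYes≗does ((a Fin.≟ i) ×-dec (b Fin.≟ j)))) (bit-∧ (does (a Fin.≟ i)) (does (b Fin.≟ j)))

    edge-entry : ∀ e i j → bit (hit i j (cycleEdge r s e)) ⊟ bit (hit j i (cycleEdge r s e)) ≡ cellForm (baseCell e (nextFin e) (orient e) leaf) i j
    edge-entry e i j = go (orient e)
      where
      side : ∀ a b → bit (hit i j (a , b)) ⊟ bit (hit j i (a , b)) ≡ cellForm (just a , just b , nothing) i j
      side a b = trans (cong₂ _⊟_ (hit-bit i j a b) (hit-bit j i a b))
        (ring (indicator (just a) i) (indicator (just b) j) (indicator (just a) j) (indicator (just b) i))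
        where
        ring : ∀ p q p' q' → p ⊠ q ⊟ p' ⊠ q' ≡ (p ⊠ q ⊟ q' ⊠ p') ⊞ ((q' ⊠ ℤ.+ 0 ⊟ ℤ.+ 0 ⊠ q) ⊞ (ℤ.+ 0 ⊠ p' ⊟ p ⊠ ℤ.+ 0))
        ring = ℤ-Ring.solve-∀
      go : ∀ b → (let ab = if b then (e , nextFin e) else (nextFin e , e) in bit (hit i j ab) ⊟ bit (hit j i ab)) ≡ cellForm (baseCell e (nextFin e) b leaf) i j
      go true = side e (nextFin e)
      go false = side (nextFin e) e

    cycleMat≡ : ∀ i j → cycleMat r s i j ≡ ⟦ cycle ⟧ i j
    cycleMat≡ i j = trans (go (allFin n)) (sym (trans (cong (λ ts → form ts i j) (triangles-path cycle z₀)) (trans (cong (λ z → form (path cycle z) i j) (trans (next-cycle (allFin n) z₀) (head-allFin n z₀ (Finₚ.toℕ-fromℕ< 0<n))))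
        (path-cycle (allFin n) z₀ (allFin-consecutive z₀ (Finₚ.toℕ-fromℕ< 0<n)) i j))))
      where
      z₀ = Fin.fromℕ< 0<n
      head-allFin : ∀ m (z : Fin m) → toℕ z ≡ 0 → headOr (allFin m) z ≡ z
      head-allFin (suc m) z z0 = Finₚ.toℕ-injective (sym z0)
      go : ∀ es → ℤ.+ countB 0 (map (λ e → hit i j (cycleEdge r s e)) es) ⊟ ℤ.+ countB 0 (map (λ e → hit j i (cycleEdge r s e)) es) ≡ edgeForm es i j
      go [] = refl
      go (e ∷ es) = trans (cong₂ _⊟_ (countB-∷ (hit i j (cycleEdge r s e)) _) (countB-∷ (hit j i (cycleEdge r s e)) _))
        (trans (ring (bit (hit i j (cycleEdge r s e))) _ (bit (hit j i (cycleEdge r s e))) _) (cong₂ _⊞_ (edge-entry e i j) (go es)))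
        where
        ring : ∀ a b c d → (a ⊞ b) ⊟ (c ⊞ d) ≡ (a ⊟ c) ⊞ (b ⊟ d)
        ring = ℤ-Ring.solve-∀

    true-count : ∀ {k} (f : Fin k → Vert) j → (∀ i → toℕ (f i) ≡ j + toℕ i) → sumAt true leaves (shape (map cycleBead (tabulate f))) ≡ (r ∸ j) ℕ.⊓ k
    true-count {zero} f j eq = sym (⊓-zeroʳ (r ∸ j))
    true-count {suc k} f j eq = first (toℕ (f Fin.zero) ℕ.<? r)
      where
      j≡ : toℕ (f Fin.zero) ≡ j
      j≡ = trans (eq Fin.zero) (+-identityʳ j)
      rest : sumAt true leaves (shape (map cycleBead (tabulate (f ∘ Fin.suc)))) ≡ (r ∸ suc j) ℕ.⊓ k
      rest = true-count (f ∘ Fin.suc) (suc j) (λ i → trans (eq (Fin.suc i)) (+-suc j (toℕ i)))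
      first : (d : Dec (toℕ (f Fin.zero) < r)) → pick true ⌊ d ⌋ 1 + sumAt true leaves (shape (map cycleBead (tabulate (f ∘ Fin.suc)))) ≡ (r ∸ j) ℕ.⊓ suc k
      first (yes lt) = trans (cong suc rest) (cong (ℕ._⊓ suc k) (sym (+-∸-assoc 1 (subst (_< r) j≡ lt))))
      first (no ge) = trans rest (trans (cong (ℕ._⊓ k) (m≤n⇒m∸n≡0 (m≤n⇒m≤1+n r≤j))) (cong (ℕ._⊓ suc k) (sym (m≤n⇒m∸n≡0 r≤j))))
        where
        r≤j : r ≤ j
        r≤j = subst (r ≤_) j≡ (≮⇒≥ ge)

    total-count : ∀ es → leavesAt false (map cycleBead es) + leavesAt true (map cycleBead es) ≡ length es
    total-count [] = refl
    total-count (e ∷ es) = trans (sumAll-∷ leaves (orient e) leaf (shape (map cycleBead es))) (cong suc (total-count es))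

    cycle-true : leavesAt true cycle ≡ r
    cycle-true = trans (true-count id 0 (λ _ → refl)) (m≤n⇒m⊓n≡m (m≤m+n r s))

    cycle-false : leavesAt false cycle ≡ s
    cycle-false = +-cancelʳ-≡ r (leavesAt false cycle) s (trans (cong (leavesAt false cycle +_) (sym cycle-true)) (trans (total-count (allFin n)) (trans (length-tabulate id) (+-comm r s))))

  -- The first r arrows of `cycleMat r s` are drawn clockwise, whereas r is to count the
  -- anti-clockwise leaves; hence the cycle is read backwards.
  cycleMat-drawn : Drawn r s (cycleMat r s)
  cycleMat-drawn = drawn (reflect cycle) (valid-reflect {D = cycle} cycle-valid) (λ v → ∈-resp-↭ (↭-sym (labels-reflect cycle)) (cycle-complete v))
    (λ i j → trans (cycleMat≡ i j) (sym (form-↭ (triangles-reflect cycle) i j)))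
    (trans (cong (sumAt false leaves) (shape-reflect cycle)) (trans (sumAt-mirror false leaves (shape cycle)) cycle-true))
    (trans (cong (sumAt true leaves) (shape-reflect cycle)) (trans (sumAt-mirror true leaves (shape cycle)) cycle-false))

  -- A binary tree has one leaf more than nodes, and the cycle vertex of the bead makes up for it:
  -- the annulus has as many diagonals as boundary segments.
  wordSize≡ : ∀ w → wordSize w ≡ sumAll leaves w
  wordSize≡ [] = refl
  wordSize≡ ((b , t) ∷ w) = trans (cong₂ _+_ (nodes+1 t) (wordSize≡ w)) (sym (sumAll-∷ leaves b t w))
    where
    nodes+1 : ∀ t → suc (shapeNodes t) ≡ leaves t
    nodes+1 leaf = refl
    nodes+1 (node _ l r') = trans (cong suc (sym (+-suc (shapeNodes l) (shapeNodes r')))) (cong₂ _+_ (nodes+1 l) (nodes+1 r'))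

  wordDrawing : ∀ w → sumAt false leaves w ≡ r → sumAt true leaves w ≡ s → Σ (Drawing Vert) λ D → Valid D × Complete D × shape D ≡ w
  wordDrawing w er es with wordReal w (leaves⇒∈ true w (subst (1 ≤_) (sym es) 1≤s)) (leaves⇒∈ false w (subst (1 ≤_) (sym er) 1≤r))
  ... | R , refl with list-bijection (labels (realDrawing R)) (allFin n) (proj₁ (realDrawing-valid R)) (realDrawing-complete R) (Uniqueₚ.allFin⁺ n) ∈-allFin
          (trans (length-labels (realDrawing R)) (trans (wordSize≡ w) (trans (cong₂ _+_ er es) (sym (length-tabulate {n = n} id)))))
  ... | f , _ = mapDrawing (Inverse.to f) (realDrawing R) , valid-map (Inverse.to f) (to-injective f) {D = realDrawing R} (realDrawing-valid R) , complete-map f (realDrawing R) (realDrawing-complete R) , shape-map (Inverse.to f) (realDrawing R)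

-- From classes of words to classes of quivers

module _ {A : Set} {P : A → Set} {_≈_ : A → A → Set} (X : List Word) (orb : Word → List Word) (Codes : A → Word → Set)
  (realise : ∀ {w} → w ∈ X → ∃ λ a → P a × Codes a w) (encode : ∀ {a} → P a → ∃ λ w → w ∈ X × Codes a w)
  (sound : ∀ {a b w v} → Codes a w → Codes b v → w ∈ X → v ∈ X → a ≈ b → v ∈ orb w)
  (complete : ∀ {a b w v} → Codes a w → Codes b v → v ∈ orb w → a ≈ b) where

  private
    realiseAll : ∀ {L} → All (_∈ X) L → ∃ λ M → All P M × Pointwise Codes M L
    realiseAll [] = [] , [] , []
    realiseAll (w∈ ∷ ∈X) = let a , pa , c = realise w∈ ; M , pM , cs = realiseAll ∈X in a ∷ M , pa ∷ pM , c ∷ cs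

    apart-from : ∀ {a w M L} → Codes a w → w ∈ X → Pointwise Codes M L → All (_∈ X) L → All (_∉ orb w) L → All (λ b → ¬ (a ≈ b)) M
    apart-from c w∈ [] [] [] = []
    apart-from c w∈ (c′ ∷ cs) (v∈ ∷ ∈X) (v∉ ∷ ∉s) = (λ a≈b → v∉ (sound c c′ w∈ v∈ a≈b)) ∷ apart-from c w∈ cs ∈X ∉s

    apart : ∀ {M L} → Pointwise Codes M L → All (_∈ X) L → AllPairs (λ w v → v ∉ orb w) L → AllPairs (λ a b → ¬ (a ≈ b)) M
    apart [] [] [] = []
    apart (c ∷ cs) (w∈ ∷ ∈X) (∉s ∷ rest) = apart-from c w∈ cs ∈X ∉s ∷ apart cs ∈X rest

    covered : ∀ {a w M L} → Codes a w → Pointwise Codes M L → Any (_∈ orb w) L → Any (a ≈_) M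
    covered c (c′ ∷ _) (here w∈) = here (complete c c′ w∈)
    covered c (_ ∷ cs) (there any) = there (covered c cs any)

  -- Representatives of the word classes are realised one by one. `Codes` is a relation and not a
  -- function, because a matrix determines its word only up to rotation and reflection.
  encodedClasses : ∀ {q} → (Σ (List Word) λ L → All (_∈ X) L × AllPairs (λ w v → v ∉ orb w) L × (∀ {w} → w ∈ X → Any (_∈ orb w) L) × fromℕ (length L) ≡ q) →
    NumClasses P _≈_ q
  encodedClasses (L , ∈X , pairs , cover , count) with realiseAll ∈X
  ... | M , pM , cs = M , pM , apart cs ∈X pairs , (λ a pa → let w , w∈ , c = encode pa in covered c cs (cover w∈)) , trans (cong fromℕ (Pointwise-length cs)) count

module _ (p q : ℕ → Bool) (r s : ℕ) where

  private
    X = admissibleWords p q r s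

  rotation-classes : 1 ≤ r → RotationClasses.Classes X
  rotation-classes 1≤r = RotationClasses.classes X (admissibleWords-Unique p q r s) (λ {x} {y} → rotation-closed p q r s 1≤r {x} {y})

  -- A reflection exchanges the leaf counts and the cherry counts of the two sides. If either
  -- exchange is incompatible with the prescribed data, no admissible word reflects to an admissible
  -- one, and the dihedral classes are rotation classes.
  mirror-excluded : r ≢ s ⊎ (∀ n m → p n ∧ q m ≡ true → p m ∧ q n ≢ true) → ∀ {w v} → w ∈ X → v ∈ X → v ∈ dihedral w → v ∈ rots w
  mirror-excluded distinct {w} {v} w∈ v∈ v∈orb with dihedral⇒ {w} v∈orb
  ... | d , inj₁ refl = rot∈rots d w
  ... | d , inj₂ refl = ⊥-elim ([ (λ r≢s → r≢s (trans (sym (proj₁ lv)) (trans (swapped false leaves) (proj₂ lw)))) ,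
      (λ excl → excl (sumAt false cherries w) (sumAt true cherries w) cw (trans (sym (cong₂ (λ a b → p a ∧ q b) (swapped false cherries) (swapped true cherries))) cv)) ]′ distinct)
    where
    lw = proj₁ (admissibleWords-sound p q r s w∈)
    cw = proj₂ (admissibleWords-sound p q r s w∈)
    lv = proj₁ (admissibleWords-sound p q r s v∈)
    cv = proj₂ (admissibleWords-sound p q r s v∈)
    swapped : ∀ b (f : Shape → ℕ) → sumAt b f v ≡ sumAt (not b) f w
    swapped b f = trans (sumAt-rot b f d (mirror w)) (sumAt-mirror b f w)

∧-true : ∀ {a b} → a ∧ b ≡ true → a ≡ true × b ≡ true
∧-true {true} {true} _ = refl , refl

equals⇒≡ : ∀ {c n} → equals c n ≡ true → n ≡ c
equals⇒≡ {c} {n} e = ≡ᵇ⇒≡ n c (subst Bool.T (sym e) tt)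

equals-refl : ∀ c → equals c c ≡ true
equals-refl c = T⇒true (≡⇒≡ᵇ c c refl)
  where
  T⇒true : ∀ {b} → Bool.T b → b ≡ true
  T⇒true {true} _ = refl

module _ (r₁ r₂ s₁ s₂ : ℕ) (1≤r : 1 ≤ r₁ + 2 * r₂) (1≤s : 1 ≤ s₁ + 2 * s₂) where

  private
    r = r₁ + 2 * r₂
    s = s₁ + 2 * s₂
    X = admissibleWords (equals r₂) (equals s₂) r s

    P : Real → Set
    P R = params R ≡ (r₁ , r₂ , s₁ , s₂)

    Codes : Real → Word → Set
    Codes R w = realWord R ≡ w

    realise : ∀ {w} → w ∈ X → ∃ λ R → P R × Codes R w
    realise {w} w∈ with admissibleWords-sound (equals r₂) (equals s₂) r s w∈
    ... | (er , es) , adm with wordReal w (leaves⇒∈ true w (subst (1 ≤_) (sym es) 1≤s)) (leaves⇒∈ false w (subst (1 ≤_) (sym er) 1≤r))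
    ... | R , refl = R , cong₂ _,_ (first false er c₂) (cong₂ _,_ c₂ (cong₂ _,_ (first true es d₂) d₂)) , refl
      where
      c₂ : sumOver R false proj₂ ≡ r₂
      c₂ = trans (sym (sumAt-cherries R false)) (equals⇒≡ (proj₁ (∧-true adm)))
      d₂ : sumOver R true proj₂ ≡ s₂
      d₂ = trans (sym (sumAt-cherries R true)) (equals⇒≡ (proj₂ (∧-true {equals r₂ (sumAt false cherries (realWord R))} adm)))
      first : ∀ b {a c} → sumAt b leaves (realWord R) ≡ a + 2 * c → sumOver R b proj₂ ≡ c → sumOver R b proj₁ ≡ a
      first b {a} {c} e refl = +-cancelʳ-≡ (2 * c) (sumOver R b proj₁) a (trans (sym (sumAt-leaves R b)) e)

    encode : ∀ {R} → P R → ∃ λ w → w ∈ X × Codes R w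
    encode {R} refl = realWord R , admissibleWords-complete (equals r₂) (equals s₂) r s 1≤r
      ((sumAt-leaves R false , sumAt-leaves R true) , cong₂ _∧_ (trans (cong (equals r₂) (sumAt-cherries R false)) (equals-refl r₂)) (trans (cong (equals s₂) (sumAt-cherries R true)) (equals-refl s₂))) , refl

  asymmetric-classes : r₁ ≢ s₁ ⊎ r₂ ≢ s₂ → NumClasses P RealIso (formulaGen r₁ r₂ s₁ s₂)
  asymmetric-classes distinct = encodedClasses X rots Codes realise (λ {R} → encode {R})
    (λ { {R} {R'} refl refl w∈ v∈ iso → mirror-excluded (equals r₂) (equals s₂) r s (exclude distinct) w∈ v∈ (realIso⇒dihedral R R' iso) })
    (λ { {R} {R'} refl refl v∈ → dihedral⇒realIso R R' (∈-++⁺ˡ v∈) })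
    (let L , ∈X , pairs , cover , count = rotation-classes (equals r₂) (equals s₂) r s 1≤r in
     L , ∈X , pairs , (λ {w} → cover {w}) , trans count (trans (∑-rotationWeight (equals r₂) (equals s₂) r s) (rotationTotal≡formulaGen r₁ r₂ s₁ s₂ 1≤r 1≤s)))
    where
    exclude : r₁ ≢ s₁ ⊎ r₂ ≢ s₂ → r ≢ s ⊎ (∀ n m → equals r₂ n ∧ equals s₂ m ≡ true → equals r₂ m ∧ equals s₂ n ≢ true)
    exclude (inj₂ r₂≢s₂) = inj₂ λ n m e e' → r₂≢s₂ (trans (sym (equals⇒≡ {r₂} {n} (proj₁ (∧-true e)))) (equals⇒≡ {s₂} {n} (proj₂ (∧-true {equals r₂ m} e'))))
    -- If r₂ = s₂, the leaf counts r and s inherit the difference of r₁ and s₁; otherwise the cherry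
    -- counts already separate the sides.
    exclude (inj₁ r₁≢s₁) = decide (r₂ ℕ.≟ s₂)
      where
      decide : Dec (r₂ ≡ s₂) → r ≢ s ⊎ (∀ n m → equals r₂ n ∧ equals s₂ m ≡ true → equals r₂ m ∧ equals s₂ n ≢ true)
      decide (yes refl) = inj₁ λ r≡s → r₁≢s₁ (+-cancelʳ-≡ (2 * r₂) r₁ s₁ r≡s)
      decide (no r₂≢s₂) = exclude (inj₂ r₂≢s₂)

  symmetric-classes : r₁ ≡ s₁ → r₂ ≡ s₂ → NumClasses P RealIso (formulaSym r₁ r₂)
  symmetric-classes refl refl = encodedClasses X dihedral Codes realise (λ {R} → encode {R})
    (λ { {R} {R'} refl refl w∈ v∈ iso → realIso⇒dihedral R R' iso })
    (λ { {R} {R'} refl refl v∈ → dihedral⇒realIso R R' v∈ })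
    (let L , ∈X , pairs , cover , count = DihedralClasses.classes X (admissibleWords-Unique (equals r₂) (equals r₂) r r) (λ {x} {y} → dihedral-closed (equals r₂) r 1≤r {x} {y}) in
     L , ∈X , pairs , (λ {w} → cover {w}) , trans count (trans (∑-dihedralWeight (equals r₂) r 1≤r) (dihedralTotal≡formulaSym r₁ r₂ 1≤r)))

module _ (r s : ℕ) (1≤r : 1 ≤ r) (1≤s : 1 ≤ s) where

  private
    X = admissibleWords always always r s

    P : Mat (r + s) → Set
    P = MutEq (cycleMat r s)

    Codes : Mat (r + s) → Word → Set
    Codes B w = Σ (Drawing (Fin (r + s))) λ D → Valid D × Complete D × (∀ x y → B x y ≡ ⟦ D ⟧ x y) × shape D ≡ w

    realise : ∀ {w} → w ∈ X → ∃ λ B → P B × Codes B w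
    realise {w} w∈ with admissibleWords-sound always always r s w∈
    ... | (er , es) , _ with wordDrawing r s 1≤r 1≤s w er es
    ... | D , vD , cD , refl = ⟦ D ⟧ , drawn-connected (cycleMat-drawn r s 1≤r 1≤s) (drawn D vD cD (λ _ _ → refl) er es) , D , vD , cD , (λ _ _ → refl) , refl

    encode : ∀ {B} → P B → ∃ λ w → w ∈ X × Codes B w
    encode eq with drawn-MutEq (cycleMat-drawn r s 1≤r 1≤s) eq
    ... | drawn D vD cD mat er es = shape D , admissibleWords-complete always always r s 1≤r ((er , es) , refl) , D , vD , cD , mat , refl

    sound : ∀ {B B' w v} → Codes B w → Codes B' v → MatIso B B' → v ∈ dihedral w
    sound (D , vD , cD , mat , refl) (D' , vD' , cD' , mat' , refl) (σ , eq) =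
      matIso⇒dihedral D D' vD cD vD' cD' (σ , λ x y → trans (sym (mat' x y)) (trans (eq x y) (mat (σ ⟨$⟩ʳ x) (σ ⟨$⟩ʳ y))))

    complete : ∀ {B B' w v} → Codes B w → Codes B' v → v ∈ dihedral w → MatIso B B'
    complete (D , vD , cD , mat , refl) (D' , vD' , cD' , mat' , refl) v∈ =
      let σ , eq = dihedral⇒matIso D D' vD cD vD' cD' v∈ in σ , λ x y → trans (mat' x y) (trans (eq x y) (sym (mat (σ ⟨$⟩ʳ x) (σ ⟨$⟩ʳ y))))

  mutation-classes-≢ : r ≢ s → NumClasses P MatIso (aTildeNeq r s)
  mutation-classes-≢ r≢s = encodedClasses X rots Codes realise encode
    (λ c c' w∈ v∈ iso → mirror-excluded always always r s (inj₁ r≢s) w∈ v∈ (sound c c' iso)) (λ c c' v∈ → complete c c' (∈-++⁺ˡ v∈))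
    (let L , ∈X , pairs , cover , count = rotation-classes always always r s 1≤r in
     L , ∈X , pairs , (λ {w} → cover {w}) , trans count (trans (∑-rotationWeight always always r s) (rotationTotal≡aTilde r s 1≤r 1≤s)))

  mutation-classes-≡ : r ≡ s → NumClasses P MatIso (aTildeEq r)
  mutation-classes-≡ refl = encodedClasses X dihedral Codes realise encode (λ c c' w∈ v∈ iso → sound c c' iso) complete
    (let L , ∈X , pairs , cover , count = DihedralClasses.classes X (admissibleWords-Unique always always r r) (λ {x} {y} → dihedral-closed always r 1≤r {x} {y}) in
     L , ∈X , pairs , (λ {w} → cover {w}) , trans count (trans (∑-dihedralWeight always r 1≤r) (dihedralTotal≡aTilde r 1≤r)))

mainTheorem1 :
    (∀ (r₁ r₂ s₁ s₂ : ℕ) → r₁ + 2 * r₂ ≥ 1 → s₁ + 2 * s₂ ≥ 1 →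
      ((r₁ ≢ s₁ ⊎ r₂ ≢ s₂) →
        NumClasses (λ R → params R ≡ (r₁ , r₂ , s₁ , s₂)) RealIso (formulaGen r₁ r₂ s₁ s₂))
      × ((r₁ ≡ s₁ × r₂ ≡ s₂) →
        NumClasses (λ R → params R ≡ (r₁ , r₂ , s₁ , s₂)) RealIso (formulaSym r₁ r₂)))
    × (∀ (r s : ℕ) → r ≥ 1 → s ≥ 1 →
      (r ≢ s → NumClasses (MutEq (cycleMat r s)) MatIso (aTildeNeq r s))
      × (r ≡ s → NumClasses (MutEq (cycleMat r s)) MatIso (aTildeEq r)))
mainTheorem1 =
  (λ r₁ r₂ s₁ s₂ 1≤r 1≤s → asymmetric-classes r₁ r₂ s₁ s₂ 1≤r 1≤s , λ (e₁ , e₂) → symmetric-classes r₁ r₂ s₁ s₂ 1≤r 1≤s e₁ e₂) ,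
  (λ r s 1≤r 1≤s → mutation-classes-≢ r s 1≤r 1≤s , mutation-classes-≡ r s 1≤r 1≤s)
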